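{- There is a constant $c>0$ such that, for $n$ a sufficiently large even integer, a uniformly random ordered matching $M$ on $n$ vertices with $\chi_{<}(M)=2$ asymptotically almost surely satisfies $$r_{<}(K_3,M)\ \ge\ c\,\frac{n^{4/3}}{(\log n)^{1/3}}.$$ That is, if $M$ is chosen uniformly at random from the set of all ordered matchings on vertex set $[n]$ without isolated vertices and with interval chromatic number $2$, then the probability that the displayed inequality holds tends to $1$ as $n\to\infty$ through even integers.
   Context: An ordered graph is a (finite, simple) graph together with a linear order on its vertex set; the vertex set of an ordered graph on $n$ vertices is identified with $[n]=\{1,\dots,n\}$ with its natural order. An ordered graph $G$ on $[N]$ contains an ordered copy of an ordered graph $H$ on $[m]$ if there is a map $\phi:[m]\to[N]$ with $\phi(i)<\phi(j)$ whenever $1\le i<j\le m$, and $\phi(i)\phi(j)\in E(G)$ whenever $ij\in E(H)$. For ordered graphs $H_1,H_2$, the ordered Ramsey number $r_{<}(H_1,H_2)$ is the least integer $N$ such that every coloring of the edges of the naturally ordered complete graph on $[N]$ with colors $1,2$ contains an ordered copy of $H_i$ in color $i$ for some $i\in\{1,2\}$. $K_3$ denotes the (ordered) triangle. The interval chromatic number $\chi_{<}(G)$ of an ordered graph $G$ is the minimum number of consecutive intervals that partition its vertex set such that no interval contains an edge of $G$. All matchings are assumed to have no isolated vertices, so an ordered matching on $n$ vertices is a perfect matching on $[n]$. Writing $n=2m$, the ordered matchings on $[2m]$ with interval chromatic number $2$ are exactly the matchings $M_\pi=\{\{i,m+\pi(i)\}:1\le i\le m\}$ for permutations $\pi$ of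 $[m]$, and $\pi\mapsto M_\pi$ is a bijection; thus the uniform distribution corresponds to a uniformly random $\pi$. Logarithms are to base $2$. -}

module Defs where

open import Data.Bool.Base using (Bool; true; false; T)
open import Data.Bool.Properties using (T?)
open import Data.Fin.Base using (Fin; zero; suc; _<_; _≤_; finToFun; funToFin)
open import Data.Fin.Patterns using (0F; 1F)
import Data.Fin.Properties as Fin
open import Data.Integer.Base using (+_; ∣_∣)
open import Data.List.Base as List
  using (List; []; _∷_; length; filter; cartesianProductWith; allFin)
open import Data.List.Membership.Propositional using (_∈_)
open import Data.List.Membership.Propositional.Properties
  using (∈-cartesianProductWith⁺; ∈-allFin; ∈-lookup)
open import Data.List.Properties using (length-tabulate)
open import Data.List.Relation.Binary.Sublist.Propositional
  using (_⊆_; []; _∷_; _∷ʳ_; ⊆-trans; minimum)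
open import Data.List.Relation.Binary.Sublist.Propositional.Properties
  using (All-resp-⊆)
open import Data.List.Relation.Unary.All as All using (All; []; _∷_)
open import Data.List.Relation.Unary.AllPairs using (AllPairs; []; _∷_)
import Data.List.Relation.Unary.AllPairs.Properties as AllPairs
open import Data.List.Relation.Unary.Any using (here; there)
open import Data.List.Relation.Unary.Unique.Propositional using (Unique)
import Data.List.Relation.Unary.Unique.Propositional.Properties as Unique
open import Data.Nat.Base as ℕ using (ℕ; zero; suc; _+_; _*_; _^_; z≤n; s≤s)
import Data.Nat.Properties as ℕ
open import Data.Product
  using (Σ-syntax; ∃; ∃!; ∃-syntax; _×_; _,_; proj₁; proj₂)
open import Data.Rational.Base as ℚ using (ℚ; 0ℚ; ↥_; ↧ₙ_)
open import Data.Sum.Base as Sum using (_⊎_; inj₁; inj₂)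
open import Data.Vec.Base as Vec using (Vec; []; _∷_; lookup)
open import Function.Base using (_∘_; id)
open import Function.Definitions using (StrictlySurjective)
open import Relation.Binary.Definitions using (tri<; tri≈; tri>)
open import Relation.Binary.PropositionalEquality
  using (_≡_; _≢_; refl; sym; trans; cong; subst; subst₂; _≗_)
open import Relation.Nullary
  using (Dec; yes; no; does; ¬_; ¬?; contradiction)
open import Relation.Nullary.Decidable
  using (map′; _×-dec_; _→-dec_; _⊎-dec_)
open import Relation.Unary using (Decidable)

private
  variable
    A B : Set
    m n N : ℕ

-- One element of A for every pair i < j in Fin n.  In v ∷ t, the vector v
-- holds the entries of the pairs formed by vertex 0 and each later vertex,
-- and t the entries of the pairs of nonzero vertices.
infixr 5 _∷_
data Triangle (A : Set) : ℕ → Set where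
  []  : Triangle A 0
  _∷_ : Vec A n → Triangle A n → Triangle A (suc n)

mapEntries : (A → B) → Triangle A n → Triangle B n
mapEntries f []      = []
mapEntries f (v ∷ t) = Vec.map f v ∷ mapEntries f t

-- A simple graph on Fin n with the natural order of the vertices: an
-- arbitrary set of pairs i < j.  Each graph has exactly one representation.
OrderedGraph : ℕ → Set
OrderedGraph = Triangle Bool

adj : OrderedGraph n → Fin n → Fin n → Bool
adj (v ∷ G) zero    zero    = false
adj (v ∷ G) zero    (suc j) = lookup v j
adj (v ∷ G) (suc i) zero    = lookup v i
adj (v ∷ G) (suc i) (suc j) = adj G i j

Edge : OrderedGraph n → Fin n → Fin n → Set
Edge G i j = T (adj G i j)

complete : ∀ n → OrderedGraph n
complete zero    = []
complete (suc n) = Vec.replicate n true ∷ complete n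

K₃ : OrderedGraph 3
K₃ = complete 3

-- 0F and 1F are the first and the second colour.
Colouring : ℕ → Set
Colouring = Triangle (Fin 2)

colourClass : Colouring n → Fin 2 → OrderedGraph n
colourClass κ c = mapEntries (λ d → does (d Fin.≟ c)) κ

Contains : OrderedGraph N → OrderedGraph m → Set
Contains {N} {m} G H = Σ[ φ ∈ (Fin m → Fin N) ]
  (∀ i j → i < j → φ i < φ j) × (∀ i j → Edge H i j → Edge G (φ i) (φ j))

Arrows : OrderedGraph m → OrderedGraph n → ℕ → Set
Arrows H₁ H₂ N = ∀ (κ : Colouring N) →
  Contains (colourClass κ 0F) H₁ ⊎ Contains (colourClass κ 1F) H₂

IsMatching : OrderedGraph n → Set
IsMatching G = ∀ i → ∃! _≡_ (Edge G i)

-- The k consecutive intervals are the fibres of a monotone surjection.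
IntervalColourable : OrderedGraph n → ℕ → Set
IntervalColourable {n} G k = Σ[ f ∈ (Fin n → Fin k) ]
  (∀ i j → i ≤ j → f i ≤ f j) ×
  StrictlySurjective _≡_ f ×
  (∀ i j → Edge G i j → f i ≢ f j)

vectors : List A → ∀ n → List (Vec A n)
vectors xs zero    = [] ∷ []
vectors xs (suc n) = cartesianProductWith _∷_ xs (vectors xs n)

triangles : List A → ∀ n → List (Triangle A n)
triangles xs zero    = [] ∷ []
triangles xs (suc n) = cartesianProductWith _∷_ (vectors xs n) (triangles xs n)

module _ {xs : List A} where

  ∈-vectors : (∀ x → x ∈ xs) → (v : Vec A n) → v ∈ vectors xs n
  ∈-vectors all []      = here refl
  ∈-vectors all (x ∷ v) = ∈-cartesianProductWith⁺ _∷_ (all x) (∈-vectors all v)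

  ∈-triangles : (∀ x → x ∈ xs) → (t : Triangle A n) → t ∈ triangles xs n
  ∈-triangles all []      = here refl
  ∈-triangles all (v ∷ t) =
    ∈-cartesianProductWith⁺ _∷_ (∈-vectors all v) (∈-triangles all t)

  vectors-unique : Unique xs → ∀ n → Unique (vectors xs n)
  vectors-unique xs! zero    = [] ∷ []
  vectors-unique xs! (suc n) = Unique.cartesianProductWith⁺ _∷_
    (λ { refl → refl , refl }) xs! (vectors-unique xs! n)

  triangles-unique : Unique xs → ∀ n → Unique (triangles xs n)
  triangles-unique xs! zero    = [] ∷ []
  triangles-unique xs! (suc n) = Unique.cartesianProductWith⁺ _∷_
    (λ { refl → refl , refl }) (vectors-unique xs! n) (triangles-unique xs! n)

orderedGraphs : ∀ n → List (OrderedGraph n)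
orderedGraphs = triangles (false ∷ true ∷ [])

∈-orderedGraphs : (G : OrderedGraph n) → G ∈ orderedGraphs n
∈-orderedGraphs = ∈-triangles λ { false → here refl ; true → there (here refl) }

orderedGraphs-unique : ∀ n → Unique (orderedGraphs n)
orderedGraphs-unique = triangles-unique (((λ ()) ∷ []) ∷ [] ∷ [])

∃Fun? : {P : (Fin m → Fin n) → Set} → (∀ {f g} → f ≗ g → P f → P g) →
        Decidable P → Dec (∃ P)
∃Fun? resp P? = map′
  (λ (k , p) → finToFun k , p)
  (λ (f , p) → funToFin f , resp (sym ∘ Fin.finToFun-funToFin f) p)
  (Fin.any? (P? ∘ finToFun))

edge? : (G : OrderedGraph n) → ∀ i j → Dec (Edge G i j)
edge? G i j = T? (adj G i j)

contains? : (G : OrderedGraph N) (H : OrderedGraph m) → Dec (Contains G H)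
contains? G H = ∃Fun?
  (λ f≗g (mono , hom) →
    (λ i j i<j → subst₂ _<_ (f≗g i) (f≗g j) (mono i j i<j)) ,
    (λ i j e → subst₂ (Edge G) (f≗g i) (f≗g j) (hom i j e)))
  (λ φ →
    Fin.all? (λ i → Fin.all? λ j → (i Fin.<? j) →-dec (φ i Fin.<? φ j)) ×-dec
    Fin.all? (λ i → Fin.all? λ j → edge? H i j →-dec edge? G (φ i) (φ j)))

arrows? : (H₁ : OrderedGraph m) (H₂ : OrderedGraph n) → Decidable (Arrows H₁ H₂)
arrows? H₁ H₂ N = map′
  (λ all κ → All.lookup all (∈-triangles ∈-allFin κ))
  (λ arr → All.universal arr (triangles (allFin 2) N))
  (All.all? (λ κ → contains? (colourClass κ 0F) H₁ ⊎-dec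
                   contains? (colourClass κ 1F) H₂) _)

isMatching? : Decidable (IsMatching {n})
isMatching? G = Fin.all? λ i → Fin.any? λ j → edge? G i j ×-dec
  map′ (λ u {k} → u k) (λ u k → u {k})
       (Fin.all? λ k → edge? G i k →-dec (j Fin.≟ k))

intervalColourable? : (G : OrderedGraph n) → Decidable (IntervalColourable G)
intervalColourable? G k = ∃Fun?
  (λ f≗g (mono , surj , proper) →
    (λ i j i≤j → subst₂ _≤_ (f≗g i) (f≗g j) (mono i j i≤j)) ,
    (λ c → let i , fi≡c = surj c in i , trans (sym (f≗g i)) fi≡c) ,
    (λ i j e gi≡gj →
      proper i j e (trans (f≗g i) (trans gi≡gj (sym (f≗g j))))))
  (λ f →
    Fin.all? (λ i → Fin.all? λ j → (i Fin.≤? j) →-dec (f i Fin.≤? f j)) ×-dec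
    Fin.all? (λ c → Fin.any? λ i → f i Fin.≟ c) ×-dec
    Fin.all? (λ i → Fin.all? λ j → edge? G i j →-dec ¬? (f i Fin.≟ f j)))

edge-sym : (G : OrderedGraph n) → ∀ i j → Edge G i j → Edge G j i
edge-sym (v ∷ G) zero    (suc j) e = e
edge-sym (v ∷ G) (suc i) zero    e = e
edge-sym (v ∷ G) (suc i) (suc j) e = edge-sym G i j e

edge-irrefl : (G : OrderedGraph n) → ∀ i → ¬ Edge G i i
edge-irrefl (v ∷ G) (suc i) e = edge-irrefl G i e

coloured : (κ : Colouring n) → ∀ i j → i < j →
           Edge (colourClass κ 0F) i j ⊎ Edge (colourClass κ 1F) i j
coloured (v ∷ κ) zero    (suc j) _         = go v j
  where
  go : (v : Vec (Fin 2) n) (j : Fin n) →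
       T (lookup (Vec.map (λ d → does (d Fin.≟ 0F)) v) j) ⊎
       T (lookup (Vec.map (λ d → does (d Fin.≟ 1F)) v) j)
  go (0F ∷ v) zero    = inj₁ _
  go (1F ∷ v) zero    = inj₂ _
  go (_  ∷ v) (suc j) = go v j
coloured (v ∷ κ) (suc i) (suc j) (s≤s i<j) = coloured κ i j i<j

ramseyBound : ℕ → ℕ → ℕ
ramseyBound zero    b       = 0
ramseyBound (suc a) zero    = 0
ramseyBound (suc a) (suc b) = suc (ramseyBound a (suc b) + ramseyBound (suc a) b)

module _ {V : Set} where

  split : {P Q : V → Set} (xs : List V) → All (λ x → P x ⊎ Q x) xs →
          ∃[ ps ] ∃[ qs ] ps ⊆ xs × qs ⊆ xs × All P ps × All Q qs ×
            length xs ≡ length ps + length qs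
  split []       []       = [] , [] , [] , [] , [] , [] , refl
  split (x ∷ xs) (d ∷ ds) with split xs ds | d
  ... | ps , qs , ps⊆ , qs⊆ , P-ps , Q-qs , eq | inj₁ p =
    x ∷ ps , qs , refl ∷ ps⊆ , x ∷ʳ qs⊆ , p ∷ P-ps , Q-qs , cong suc eq
  ... | ps , qs , ps⊆ , qs⊆ , P-ps , Q-qs , eq | inj₂ q =
    ps , x ∷ qs , x ∷ʳ ps⊆ , refl ∷ qs⊆ , P-ps , q ∷ Q-qs ,
    trans (cong suc eq) (sym (ℕ.+-suc (length ps) (length qs)))

  allPairs-⊆ : {R : V → V → Set} {xs ys : List V} →
               xs ⊆ ys → AllPairs R ys → AllPairs R xs
  allPairs-⊆ []            []       = []
  allPairs-⊆ (y ∷ʳ xs⊆ys) (_ ∷ rs) = allPairs-⊆ xs⊆ys rs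
  allPairs-⊆ (refl ∷ xs⊆ys) (r ∷ rs) =
    All-resp-⊆ xs⊆ys r ∷ allPairs-⊆ xs⊆ys rs

  allPairs-lookup : {R : V → V → Set} {xs : List V} → AllPairs R xs →
    ∀ {i j} → i < j → R (List.lookup xs i) (List.lookup xs j)
  allPairs-lookup (r ∷ rs) {zero}  {suc j} _         =
    All.lookup r (∈-lookup j)
  allPairs-lookup (r ∷ rs) {suc i} {suc j} (s≤s i<j) = allPairs-lookup rs i<j

  Homogeneous : (V → V → Set) → ℕ → List V → Set
  Homogeneous R a xs = ∃[ ys ] ys ⊆ xs × length ys ≡ a × AllPairs R ys

  weaken : ∀ {R a xs ys} → xs ⊆ ys → Homogeneous R a xs → Homogeneous R a ys
  weaken xs⊆ys (zs , zs⊆xs , rest) = zs , ⊆-trans zs⊆xs xs⊆ys , rest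

  extend : ∀ {R a x xs ys} → ys ⊆ xs → All (R x) ys →
           Homogeneous R a ys → Homogeneous R (suc a) (x ∷ xs)
  extend ys⊆xs r (zs , zs⊆ys , eq , rs) =
    _ ∷ zs , refl ∷ ⊆-trans zs⊆ys ys⊆xs , cong suc eq ,
    All-resp-⊆ zs⊆ys r ∷ rs

  ramsey : {P Q : V → V → Set} → ∀ a b xs → ramseyBound a b ℕ.≤ length xs →
           AllPairs (λ x y → P x y ⊎ Q x y) xs →
           Homogeneous P a xs ⊎ Homogeneous Q b xs
  ramsey zero    b       xs _ _ = inj₁ ([] , minimum xs , refl , [])
  ramsey (suc a) zero    xs _ _ = inj₂ ([] , minimum xs , refl , [])
  ramsey (suc a) (suc b) (x ∷ xs) (s≤s N≤) (d ∷ ds)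
    with ps , qs , ps⊆ , qs⊆ , P-ps , Q-qs , eq ← split xs d
    with ramseyBound a (suc b) ℕ.≤? length ps | ramseyBound (suc a) b ℕ.≤? length qs
  ... | yes ≤ps | _ =
    Sum.map (extend ps⊆ P-ps) (weaken (x ∷ʳ ps⊆))
            (ramsey a (suc b) ps ≤ps (allPairs-⊆ ps⊆ ds))
  ... | no _ | yes ≤qs =
    Sum.map (weaken (x ∷ʳ qs⊆)) (extend qs⊆ Q-qs)
            (ramsey (suc a) b qs ≤qs (allPairs-⊆ qs⊆ ds))
  ... | no ≰ps | no ≰qs = contradiction (subst (_ ℕ.≤_) eq N≤)
    (ℕ.<⇒≱ (ℕ.+-mono-< (ℕ.≰⇒> ≰ps) (ℕ.≰⇒> ≰qs)))

homogeneous⇒contains : (G : OrderedGraph N) (H : OrderedGraph m) {xs : List (Fin N)} →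
  Homogeneous (λ i j → i < j × Edge G i j) m xs → Contains G H
homogeneous⇒contains G H (ys , _ , refl , rs) =
  List.lookup ys , (λ i j i<j → proj₁ (allPairs-lookup rs i<j)) , hom
  where
  hom : ∀ i j → Edge H i j → Edge G (List.lookup ys i) (List.lookup ys j)
  hom i j e with Fin.<-cmp i j
  ... | tri< i<j _ _  = proj₂ (allPairs-lookup rs i<j)
  ... | tri≈ _ refl _ = contradiction e (edge-irrefl H i)
  ... | tri> _ _ j<i  = edge-sym G _ _ (proj₂ (allPairs-lookup rs j<i))

arrows-ramseyBound : (H₁ : OrderedGraph m) (H₂ : OrderedGraph n) →
                     Arrows H₁ H₂ (ramseyBound m n)
arrows-ramseyBound {m} {n} H₁ H₂ κ =
  Sum.map (homogeneous⇒contains (colourClass κ 0F) H₁)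
          (homogeneous⇒contains (colourClass κ 1F) H₂)
    (ramsey m n (allFin _)
      (ℕ.≤-reflexive (sym (length-tabulate id)))
      (AllPairs.tabulate⁺-< λ {i} {j} i<j →
        Sum.map (i<j ,_) (i<j ,_) (coloured κ i j i<j)))

intervalColourable-id : (G : OrderedGraph n) → IntervalColourable G n
intervalColourable-id G = id , (λ _ _ i≤j → i≤j) , (λ c → c , refl) ,
  λ { i _ e refl → edge-irrefl G i e }

least : {P : ℕ → Set} → Decidable P → ∀ b → P b →
        Σ[ k ∈ ℕ ] P k × (∀ j → P j → k ℕ.≤ j)
least P? zero    p = zero , p , λ _ _ → z≤n
least P? (suc b) p with P? zero
... | yes p₀ = zero , p₀ , λ _ _ → z≤n
... | no ¬p₀ with k , pₖ , min ← least (P? ∘ suc) b p = suc k , pₖ , λ where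
  zero    p₀ → contradiction p₀ ¬p₀
  (suc j) pⱼ → s≤s (min j pⱼ)

r< : OrderedGraph m → OrderedGraph n → ℕ
r< H₁ H₂ = proj₁ (least (arrows? H₁ H₂) _ (arrows-ramseyBound H₁ H₂))

χ< : OrderedGraph n → ℕ
χ< G = proj₁ (least (intervalColourable? G) _ (intervalColourable-id G))

-- The list contains each such matching exactly once.
matchingsWithχ<≡2 : ∀ n → List (OrderedGraph n)
matchingsWithχ<≡2 n =
  filter (λ G → isMatching? G ×-dec (χ< G ℕ.≟ 2)) (orderedGraphs n)

-- The junk value for a zero denominator only arises from an empty sample space.
ratio : ℕ → ℕ → ℚ
ratio a zero    = 0ℚ
ratio a (suc b) = + a ℚ./ suc b

-- The probability of P under the uniform distribution on a repetition-free list.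
probability : {P : A → Set} → List A → Decidable P → ℚ
probability xs P? = ratio (length (filter P? xs)) (length xs)

-- For c = p / q > 0 and n ≥ 2, this is r ≥ c n^(4/3) / (log₂ n)^(1/3).  Cubing
-- and clearing denominators turns that inequality into
-- p³ n⁴ ≤ q³ r³ log₂ n; then apply x ↦ 2 ^ x to both sides.
LowerBound : ℚ → ℕ → ℕ → Set
LowerBound c n r = 2 ^ (∣ ↥ c ∣ ^ 3 * n ^ 4) ℕ.≤ n ^ (↧ₙ c ^ 3 * r ^ 3)

lowerBound? : ∀ c n → Decidable (LowerBound c n)
lowerBound? c n r = _ ℕ.≤? _

{-# OPTIONS --safe #-}
module Submission where

-- With b = 2^(128 f), T = f b² and k = 4096 f b, let R be a triangle-free graph on [T] in which any two
-- k-sets X < Y span at least 128 f k edges.  Replace every vertex of R by an interval of μ h vertices and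
-- give a pair of vertices the first colour if it joins adjacent intervals.  There is no triangle in that
-- colour.  A copy of M_π in the second colour maps either half of [2m] monotonically to [T]; cut the half
-- into Q = 4 T cells of h consecutive vertices, record the image of the first vertex of each cell and
-- whether the cell is mapped to a single point.  These O(T) bits determine a set of (190 T + 16) m
-- positions that π avoids: at most T cells are not constant, and T + T = k μ constant cells on either side
-- contain k-sets for each of μ × μ pairs of residues.  By a switching argument a random π avoids the set
-- with probability at most 2^(-19 T), and a union bound over 2^(18 T) descriptions remains.
--
-- R is built vertex by vertex.  The back neighbourhood of a new vertex is an independent set, found by
-- scanning the earlier vertices t and taking t with probability x t, which starts at p = 1/b and is
-- multiplied by 1 + x u whenever a neighbour u of t is skipped.  These weights are martingales until a
-- neighbour is taken, so products of (1 + x) and of (1 - x / 2) over the relevant vertex sets are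
-- nearly supermartingales; they control degrees, codegrees and the number of edges to each k-set, and the
-- method of conditional expectations makes the choice deterministic.

-- The order n^(4/3) / (log n)^(1/3) is a balance. `R` has density at least 1 / (32 b) between its
-- k-sets, so in the mean a random permutation meets a forbidden set of order m / b times. Avoidance
-- is rarer than 2^(-O(T)), where T = f b², once m is of order f b³. Then N = T μ h is of order m b,
-- and f is of order log m. The reason why k-sets arise in every embedding: a half has at least 4 T
-- h vertices and an interval only μ h, so a half meets at least 4 T / μ = 2 k intervals.
--
-- These sizes make k of order sqrt(T log T), the least possible order of the independence number of
-- a triangle-free graph on T vertices. At density p = 1 / b a pair has about p² T = f common
-- neighbours, so triangles outnumber edges and cannot be deleted afterwards: each back
-- neighbourhood has to be independent when it is chosen. The price is that weights may grow by
-- 2^(O(f)) and not just by a constant. High powers of 1 + x in the potentials keep this growth in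
-- check, and codegree bounds keep the errors of the near-supermartingales small.

-- Products, Bernoulli inequalities and one-step estimates over the rationals.

module RationalArithmetic where
  open import Data.Nat.Base as ℕ using (ℕ; zero; suc)
  import Data.Nat.Properties as ℕ
  open import Data.Rational.Base
  open import Data.Rational.Properties
  open import Data.Rational.Solver
  open import Data.Sum.Base using (inj₁; inj₂)
  open import Relation.Binary.PropositionalEquality
  open import Relation.Nullary using (yes; no)
  open +-*-Solver using (solve; _:=_; _:+_; _:*_; _:-_; :-_; con)

  2ℚ 3ℚ : ℚ
  2ℚ = 1ℚ + 1ℚ
  3ℚ = 1ℚ + 2ℚ

  0≤1 : 0ℚ ≤ 1ℚ
  0≤1 = nonNegative⁻¹ 1ℚ

  0≤½ : 0ℚ ≤ ½
  0≤½ = nonNegative⁻¹ ½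

  0≤+ : ∀ {a b} → 0ℚ ≤ a → 0ℚ ≤ b → 0ℚ ≤ a + b
  0≤+ {a} {b} p q = subst (_≤ a + b) (+-identityˡ 0ℚ) (+-mono-≤ p q)

  *-monoʳ : ∀ {r a b} → 0ℚ ≤ r → a ≤ b → r * a ≤ r * b
  *-monoʳ {r} p q = *-monoˡ-≤-nonNeg r {{nonNegative p}} q

  *-monoˡ : ∀ {r a b} → 0ℚ ≤ r → a ≤ b → a * r ≤ b * r
  *-monoˡ {r} p q = *-monoʳ-≤-nonNeg r {{nonNegative p}} q

  0≤* : ∀ {a b} → 0ℚ ≤ a → 0ℚ ≤ b → 0ℚ ≤ a * b
  0≤* {a} {b} p q = subst (_≤ a * b) (*-zeroʳ a) (*-monoʳ p q)

  *-mono : ∀ {a b c d} → 0ℚ ≤ c → 0ℚ ≤ b → a ≤ b → c ≤ d → a * c ≤ b * d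
  *-mono 0≤c 0≤b a≤b c≤d = ≤-trans (*-monoˡ 0≤c a≤b) (*-monoʳ 0≤b c≤d)

  -- Polynomial inequalities are reduced to this throughout: `d` is a certificate built from
  -- non-negative factors, and the ring solver checks the identity.
  by-difference : ∀ {a b} d → 0ℚ ≤ d → a + d ≡ b → a ≤ b
  by-difference {a} {b} d 0≤d eq = subst₂ _≤_ (+-identityʳ a) eq (+-mono-≤ (≤-refl {a}) 0≤d)

  0≤- : ∀ {a b} → a ≤ b → 0ℚ ≤ b - a
  0≤- {a} {b} p = subst (_≤ b - a) (+-inverseʳ a) (+-mono-≤ p (≤-refl {x = - a}))

  infixr 8 _^_
  _^_ : ℚ → ℕ → ℚ
  a ^ zero  = 1ℚ
  a ^ suc n = a * a ^ n

  ∏ ∑ : ℕ → (ℕ → ℚ) → ℚ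
  ∏ zero    f = 1ℚ
  ∏ (suc n) f = ∏ n f * f n
  ∑ zero    f = 0ℚ
  ∑ (suc n) f = ∑ n f + f n

  ∏-cong : ∀ {f g : ℕ → ℚ} n → (∀ i → i ℕ.< n → f i ≡ g i) → ∏ n f ≡ ∏ n g
  ∏-cong zero    eq = refl
  ∏-cong (suc n) eq = cong₂ _*_ (∏-cong n (λ i p → eq i (ℕ.m<n⇒m<1+n p))) (eq n ℕ.≤-refl)

  ∑-cong : ∀ {f g : ℕ → ℚ} n → (∀ i → i ℕ.< n → f i ≡ g i) → ∑ n f ≡ ∑ n g
  ∑-cong zero    eq = refl
  ∑-cong (suc n) eq = cong₂ _+_ (∑-cong n (λ i p → eq i (ℕ.m<n⇒m<1+n p))) (eq n ℕ.≤-refl)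

  ∏-nonneg : ∀ {f : ℕ → ℚ} n → (∀ i → i ℕ.< n → 0ℚ ≤ f i) → 0ℚ ≤ ∏ n f
  ∏-nonneg zero    p = 0≤1
  ∏-nonneg (suc n) p = 0≤* (∏-nonneg n (λ i q → p i (ℕ.m<n⇒m<1+n q))) (p n ℕ.≤-refl)

  ∑-nonneg : ∀ {f : ℕ → ℚ} n → (∀ i → i ℕ.< n → 0ℚ ≤ f i) → 0ℚ ≤ ∑ n f
  ∑-nonneg zero    p = ≤-refl
  ∑-nonneg (suc n) p = 0≤+ (∑-nonneg n (λ i q → p i (ℕ.m<n⇒m<1+n q))) (p n ℕ.≤-refl)

  ∏-mono : ∀ {f g : ℕ → ℚ} n → (∀ i → i ℕ.< n → 0ℚ ≤ f i) → (∀ i → i ℕ.< n → f i ≤ g i) →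
           ∏ n f ≤ ∏ n g
  ∏-mono zero    p q = ≤-refl
  ∏-mono (suc n) p q = *-mono (p n ℕ.≤-refl)
    (∏-nonneg n λ i l → ≤-trans (p i (ℕ.m<n⇒m<1+n l)) (q i (ℕ.m<n⇒m<1+n l)))
    (∏-mono n (λ i l → p i (ℕ.m<n⇒m<1+n l)) (λ i l → q i (ℕ.m<n⇒m<1+n l))) (q n ℕ.≤-refl)

  ∑-mono : ∀ {f g : ℕ → ℚ} n → (∀ i → i ℕ.< n → f i ≤ g i) → ∑ n f ≤ ∑ n g
  ∑-mono zero    q = ≤-refl
  ∑-mono (suc n) q = +-mono-≤ (∑-mono n (λ i l → q i (ℕ.m<n⇒m<1+n l))) (q n ℕ.≤-refl)

  ∏-* : ∀ (f g : ℕ → ℚ) n → ∏ n (λ i → f i * g i) ≡ ∏ n f * ∏ n g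
  ∏-* f g zero    = sym (*-identityˡ 1ℚ)
  ∏-* f g (suc n) = trans (cong (_* (f n * g n)) (∏-* f g n))
    (solve 4 (λ a b c d → (a :* b) :* (c :* d) := (a :* c) :* (b :* d)) refl (∏ n f) (∏ n g) (f n) (g n))

  ∑-+ : ∀ (f g : ℕ → ℚ) n → ∑ n (λ i → f i + g i) ≡ ∑ n f + ∑ n g
  ∑-+ f g zero    = sym (+-identityˡ 0ℚ)
  ∑-+ f g (suc n) = trans (cong (_+ (f n + g n)) (∑-+ f g n))
    (solve 4 (λ a b c d → (a :+ b) :+ (c :+ d) := (a :+ c) :+ (b :+ d)) refl (∑ n f) (∑ n g) (f n) (g n))

  ∑-*ˡ : ∀ r (f : ℕ → ℚ) n → ∑ n (λ i → r * f i) ≡ r * ∑ n f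
  ∑-*ˡ r f zero    = sym (*-zeroʳ r)
  ∑-*ˡ r f (suc n) = trans (cong (_+ r * f n) (∑-*ˡ r f n)) (sym (*-distribˡ-+ r (∑ n f) (f n)))

  ∏-one : ∀ n → ∏ n (λ _ → 1ℚ) ≡ 1ℚ
  ∏-one zero    = refl
  ∏-one (suc n) = trans (*-identityʳ _) (∏-one n)

  ∏-^ : ∀ (f : ℕ → ℚ) s n → ∏ n (λ i → f i ^ s) ≡ ∏ n f ^ s
  ∏-^ f zero    n = ∏-one n
  ∏-^ f (suc s) n = trans (∏-* f (λ i → f i ^ s) n) (cong (∏ n f *_) (∏-^ f s n))

  ∏-single : ∀ {f : ℕ → ℚ} n t → t ℕ.< n → (∀ i → i ≢ t → f i ≡ 1ℚ) → ∏ n f ≡ f t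
  ∏-single {f} (suc n) t t<n e with t ℕ.≟ n
  ... | yes refl = trans (cong (_* f t) (trans (∏-cong n (λ i l → e i (ℕ.<⇒≢ l))) (∏-one n))) (*-identityˡ _)
  ... | no t≢n   = trans (cong₂ _*_ (∏-single n t (ℕ.≤∧≢⇒< (ℕ.s≤s⁻¹ t<n) t≢n) e) (e n (λ q → t≢n (sym q))))
                         (*-identityʳ _)

  ^-nonneg : ∀ {a} n → 0ℚ ≤ a → 0ℚ ≤ a ^ n
  ^-nonneg zero    p = 0≤1
  ^-nonneg (suc n) p = 0≤* p (^-nonneg n p)

  ^-mono : ∀ {a b} n → 0ℚ ≤ a → a ≤ b → a ^ n ≤ b ^ n
  ^-mono zero    p q = ≤-refl
  ^-mono (suc n) p q = *-mono (^-nonneg n p) (≤-trans p q) q (^-mono n p q)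

  ^-* : ∀ a b n → (a * b) ^ n ≡ a ^ n * b ^ n
  ^-* a b zero    = sym (*-identityˡ 1ℚ)
  ^-* a b (suc n) = trans (cong (a * b *_) (^-* a b n))
    (solve 4 (λ a b c d → (a :* b) :* (c :* d) := (a :* c) :* (b :* d)) refl a b (a ^ n) (b ^ n))

  ^-one : ∀ n → 1ℚ ^ n ≡ 1ℚ
  ^-one zero    = refl
  ^-one (suc n) = trans (*-identityˡ _) (^-one n)

  1≤^ : ∀ {a} n → 1ℚ ≤ a → 1ℚ ≤ a ^ n
  1≤^ {a} n p = subst (_≤ a ^ n) (^-one n) (^-mono n 0≤1 p)

  ^≤1 : ∀ {a} n → 0ℚ ≤ a → a ≤ 1ℚ → a ^ n ≤ 1ℚ
  ^≤1 {a} n 0≤a p = subst (a ^ n ≤_) (^-one n) (^-mono n 0≤a p)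

  ι : ℕ → ℚ
  ι zero    = 0ℚ
  ι (suc n) = 1ℚ + ι n

  0≤ι : ∀ n → 0ℚ ≤ ι n
  0≤ι zero    = ≤-refl
  0≤ι (suc n) = 0≤+ 0≤1 (0≤ι n)

  1≤ι-suc : ∀ n → 1ℚ ≤ ι (suc n)
  1≤ι-suc n = by-difference (ι n) (0≤ι n) refl

  1+∑≤∏ : ∀ {f : ℕ → ℚ} n → (∀ i → i ℕ.< n → 0ℚ ≤ f i) → 1ℚ + ∑ n f ≤ ∏ n (λ i → 1ℚ + f i)
  1+∑≤∏ zero    p = ≤-reflexive (+-identityʳ 1ℚ)
  1+∑≤∏ {f} (suc n) p =
    ≤-trans (by-difference (∑ n f * f n) (0≤* s≥0 fn)
              (solve 2 (λ s a → con 1ℚ :+ (s :+ a) :+ s :* a := (con 1ℚ :+ s) :* (con 1ℚ :+ a)) refl (∑ n f) (f n)))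
            (*-monoˡ (0≤+ 0≤1 fn) (1+∑≤∏ n p′))
    where
    p′ = λ i l → p i (ℕ.m<n⇒m<1+n l)
    fn = p n ℕ.≤-refl
    s≥0 = ∑-nonneg n p′

  1-∑≤∏ : ∀ {f : ℕ → ℚ} n → (∀ i → i ℕ.< n → 0ℚ ≤ f i) → (∀ i → i ℕ.< n → f i ≤ 1ℚ) →
          1ℚ - ∑ n f ≤ ∏ n (λ i → 1ℚ - f i)
  1-∑≤∏ zero    p q = ≤-refl
  1-∑≤∏ {f} (suc n) p q =
    ≤-trans (by-difference (∑ n f * f n) (0≤* s≥0 (p n ℕ.≤-refl))
              (solve 2 (λ s a → con 1ℚ :- (s :+ a) :+ s :* a := (con 1ℚ :- s) :* (con 1ℚ :- a)) refl (∑ n f) (f n)))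
            (*-monoˡ (0≤- (q n ℕ.≤-refl)) (1-∑≤∏ n p′ (λ i l → q i (ℕ.m<n⇒m<1+n l))))
    where
    p′ = λ i l → p i (ℕ.m<n⇒m<1+n l)
    s≥0 = ∑-nonneg n p′

  ∏-≤1 : ∀ {f : ℕ → ℚ} n → (∀ i → i ℕ.< n → 0ℚ ≤ f i) → (∀ i → i ℕ.< n → f i ≤ 1ℚ) → ∏ n f ≤ 1ℚ
  ∏-≤1 {f} n p q = subst (∏ n f ≤_) (∏-one n) (∏-mono n p q)

  1≤∏ : ∀ {f : ℕ → ℚ} n → (∀ i → i ℕ.< n → 1ℚ ≤ f i) → 1ℚ ≤ ∏ n f
  1≤∏ {f} n p = subst (_≤ ∏ n f) (∏-one n) (∏-mono n (λ _ _ → 0≤1) p)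

  1-a≤1 : ∀ {a} → 0ℚ ≤ a → 1ℚ - a ≤ 1ℚ
  1-a≤1 {a} p = by-difference a p (solve 1 (λ a → con 1ℚ :- a :+ a := con 1ℚ) refl a)

  -- Replaces division: since (1 + a) (1 - a) ≤ 1, a lower bound on either product gives an upper
  -- bound on the other.
  ∏[1+f]*∏[1-f]≤1 : ∀ {f : ℕ → ℚ} n → (∀ i → i ℕ.< n → 0ℚ ≤ f i) → (∀ i → i ℕ.< n → f i ≤ 1ℚ) →
    ∏ n (λ i → 1ℚ + f i) * ∏ n (λ i → 1ℚ - f i) ≤ 1ℚ
  ∏[1+f]*∏[1-f]≤1 {f} n p q = subst (_≤ 1ℚ) (∏-* (λ i → 1ℚ + f i) (λ i → 1ℚ - f i) n)
    (∏-≤1 n (λ i l → 0≤* (0≤+ 0≤1 (p i l)) (0≤- (q i l)))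
      (λ i l → by-difference (f i * f i) (0≤* (p i l) (p i l))
        (solve 1 (λ a → (con 1ℚ :+ a) :* (con 1ℚ :- a) :+ a :* a := con 1ℚ) refl (f i))))

  ∏[1+f]*[1-∑]≤1 : ∀ {f : ℕ → ℚ} n → (∀ i → i ℕ.< n → 0ℚ ≤ f i) → (∀ i → i ℕ.< n → f i ≤ 1ℚ) →
    ∏ n (λ i → 1ℚ + f i) * (1ℚ - ∑ n f) ≤ 1ℚ
  ∏[1+f]*[1-∑]≤1 n p q = ≤-trans
    (*-monoʳ (∏-nonneg n (λ i l → 0≤+ 0≤1 (p i l))) (1-∑≤∏ n p q)) (∏[1+f]*∏[1-f]≤1 n p q)

  ∏[1-f]*[1+∑]≤1 : ∀ {f : ℕ → ℚ} n → (∀ i → i ℕ.< n → 0ℚ ≤ f i) → (∀ i → i ℕ.< n → f i ≤ 1ℚ) →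
    ∏ n (λ i → 1ℚ - f i) * (1ℚ + ∑ n f) ≤ 1ℚ
  ∏[1-f]*[1+∑]≤1 {f} n p q = ≤-trans
    (*-monoʳ (∏-nonneg n (λ i l → 0≤- (q i l))) (1+∑≤∏ n p))
    (subst (_≤ 1ℚ) (*-comm (∏ n (λ i → 1ℚ + f i)) _) (∏[1+f]*∏[1-f]≤1 n p q))

  1+nx≤^ : ∀ {x} n → 0ℚ ≤ x → 1ℚ + ι n * x ≤ (1ℚ + x) ^ n
  1+nx≤^ {x} zero    p = ≤-reflexive (trans (cong (1ℚ +_) (*-zeroˡ x)) (+-identityʳ 1ℚ))
  1+nx≤^ {x} (suc n) p = ≤-trans
    (by-difference (x * (ι n * x)) (0≤* p (0≤* (0≤ι n) p))
      (solve 2 (λ k x → con 1ℚ :+ (con 1ℚ :+ k) :* x :+ x :* (k :* x) := (con 1ℚ :+ x) :* (con 1ℚ :+ k :* x)) refl (ι n) x))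
    (*-monoʳ (0≤+ 0≤1 p) (1+nx≤^ n p))

  1-nx≤^ : ∀ {x} n → 0ℚ ≤ x → x ≤ 1ℚ → 1ℚ - ι n * x ≤ (1ℚ - x) ^ n
  1-nx≤^ {x} zero    p q = ≤-reflexive (solve 1 (λ x → con 1ℚ :- con 0ℚ :* x := con 1ℚ) refl x)
  1-nx≤^ {x} (suc n) p q = ≤-trans
    (by-difference (x * (ι n * x)) (0≤* p (0≤* (0≤ι n) p))
      (solve 2 (λ k x → con 1ℚ :- (con 1ℚ :+ k) :* x :+ x :* (k :* x) := (con 1ℚ :- x) :* (con 1ℚ :- k :* x)) refl (ι n) x))
    (*-monoʳ (0≤- q) (1-nx≤^ n p q))

  D≤2 : ∀ {D y} → 0ℚ ≤ D → y ≤ ½ → D * (1ℚ - y) ≤ 1ℚ → D ≤ 2ℚ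
  D≤2 {D} {y} 0≤D y≤½ h = by-difference (2ℚ * ((1ℚ - D * (1ℚ - y)) + D * (½ - y)))
    (0≤* (nonNegative⁻¹ 2ℚ) (0≤+ (0≤- h) (0≤* 0≤D (0≤- y≤½))))
    (solve 2 (λ D y → D :+ con 2ℚ :* ((con 1ℚ :- D :* (con 1ℚ :- y)) :+ D :* (con ½ :- y)) := con 2ℚ) refl D y)

  -- Taking the current vertex collapses the product `A` over its later neighbours to 1; skipping it
  -- multiplies `A` by `D`, about 1 + x a. The mean changes by about x (1 - A + a A), and this is at
  -- most x a² A because A ≥ 1 + a.
  algebra-upper : ∀ {x a A D} → 0ℚ ≤ x → x ≤ 1ℚ → 0ℚ ≤ a → 1ℚ + a ≤ A → x * a ≤ ½ → 0ℚ ≤ D →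
    D * (1ℚ - x * a) ≤ 1ℚ → x + (1ℚ - x) * (A * D) ≤ (1ℚ + 3ℚ * (x * (a * a))) * A
  algebra-upper {x} {a} {A} {D} 0≤x x≤1 0≤a A≥ xa≤½ 0≤D h =
    ≤-trans (+-mono-≤ (≤-refl {x}) (*-monoʳ (0≤- x≤1) (*-monoʳ 0≤A D≤)))
      (by-difference _ diff≥0
        (solve 3 (λ x a A →
           x :+ (con 1ℚ :- x) :* (A :* (con 1ℚ :+ x :* a :+ con 2ℚ :* ((x :* a) :* (x :* a))))
           :+ (x :* ((A :- (con 1ℚ :+ a)) :* (con 1ℚ :- a :+ a :* a) :+ a :* a :* a)
               :+ A :* (con 2ℚ :* (x :* (a :* a))) :* (con 1ℚ :- x)
               :+ x :* (A :* (x :* a :+ con 2ℚ :* ((x :* a) :* (x :* a)))))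
           := (con 1ℚ :+ con 3ℚ :* (x :* (a :* a))) :* A) refl x a A))
    where
    0≤A : 0ℚ ≤ A
    0≤A = ≤-trans (0≤+ 0≤1 0≤a) A≥
    0≤xa : 0ℚ ≤ x * a
    0≤xa = 0≤* 0≤x 0≤a
    D≤ : D ≤ 1ℚ + x * a + 2ℚ * ((x * a) * (x * a))
    D≤ = by-difference ((1ℚ - D * (1ℚ - x * a)) + x * a * (1ℚ - D * (1ℚ - x * a)) + (x * a) * (x * a) * (2ℚ - D))
      (0≤+ (0≤+ (0≤- h) (0≤* 0≤xa (0≤- h))) (0≤* (0≤* 0≤xa 0≤xa) (0≤- (D≤2 0≤D xa≤½ h))))
      (solve 2 (λ D y → D :+ ((con 1ℚ :- D :* (con 1ℚ :- y)) :+ y :* (con 1ℚ :- D :* (con 1ℚ :- y)) :+ y :* y :* (con 2ℚ :- D))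
         := con 1ℚ :+ y :+ con 2ℚ :* (y :* y)) refl D (x * a))
    -- Only `x * a` is known to be small; `a` itself may exceed 1.
    1-a+a²≥0 : 0ℚ ≤ 1ℚ - a + a * a
    1-a+a²≥0 with ≤-total a 1ℚ
    ... | inj₁ a≤1 = 0≤+ (0≤- a≤1) (0≤* 0≤a 0≤a)
    ... | inj₂ 1≤a = subst (0ℚ ≤_) (solve 1 (λ a → con 1ℚ :+ a :* (a :- con 1ℚ) := con 1ℚ :- a :+ a :* a) refl a)
                       (0≤+ 0≤1 (0≤* 0≤a (0≤- 1≤a)))
    diff≥0 : 0ℚ ≤ x * ((A - (1ℚ + a)) * (1ℚ - a + a * a) + a * a * a) + A * (2ℚ * (x * (a * a))) * (1ℚ - x)
                  + x * (A * (x * a + 2ℚ * ((x * a) * (x * a))))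
    diff≥0 = 0≤+ (0≤+ (0≤* 0≤x (0≤+ (0≤* (0≤- A≥) 1-a+a²≥0) (0≤* (0≤* 0≤a 0≤a) 0≤a)))
                      (0≤* (0≤* 0≤A (0≤* (nonNegative⁻¹ 2ℚ) (0≤* 0≤x (0≤* 0≤a 0≤a)))) (0≤- x≤1)))
                 (0≤* 0≤x (0≤* 0≤A (0≤+ 0≤xa (0≤* (nonNegative⁻¹ 2ℚ) (0≤* 0≤xa 0≤xa)))))

  -- The case in which the current vertex itself lies in the counted set: its factor becomes 2 with
  -- probability `x` and 1 otherwise, and the mean 1 + x is what was reserved for it.
  algebra-upper′ : ∀ {x a A D} → 0ℚ ≤ x → x ≤ 1ℚ → 0ℚ ≤ a → 1ℚ + a ≤ A → x * a ≤ ½ → 0ℚ ≤ D →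
    D * (1ℚ - x * a) ≤ 1ℚ → x * 2ℚ + (1ℚ - x) * (A * D) ≤ (1ℚ + 3ℚ * (x * (a * a))) * ((1ℚ + x) * A)
  algebra-upper′ {x} {a} {A} {D} 0≤x x≤1 0≤a A≥ xa≤½ 0≤D h =
    subst₂ _≤_
      (solve 3 (λ x A D → x :+ (con 1ℚ :- x) :* (A :* D) :+ x :* con 1ℚ := x :* con 2ℚ :+ (con 1ℚ :- x) :* (A :* D)) refl x A D)
      (solve 3 (λ x e A → e :* A :+ x :* (e :* A) := e :* ((con 1ℚ :+ x) :* A)) refl x (1ℚ + 3ℚ * (x * (a * a))) A)
      (+-mono-≤ (algebra-upper 0≤x x≤1 0≤a A≥ xa≤½ 0≤D h)
        (*-monoʳ 0≤x (≤-trans 1≤A (by-difference _ (0≤* e≥0 (≤-trans 0≤1 1≤A))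
           (solve 2 (λ e A → A :+ e :* A := (con 1ℚ :+ e) :* A) refl (3ℚ * (x * (a * a))) A)))))
    where
    1≤A : 1ℚ ≤ A
    1≤A = ≤-trans (by-difference a 0≤a refl) A≥
    e≥0 : 0ℚ ≤ 3ℚ * (x * (a * a))
    e≥0 = 0≤* (nonNegative⁻¹ 3ℚ) (0≤* 0≤x (0≤* 0≤a 0≤a))

  -- The same cancellation for factors below 1: skipping makes `P` smaller, taking raises it to 1.
  -- `G` bounds 1 / P, so that the error can be stated relative to `P`.
  algebra-lower : ∀ {x J P G D} → 0ℚ ≤ x → x ≤ 1ℚ → 0ℚ ≤ J → 0ℚ ≤ P → 1ℚ - J ≤ P → 1ℚ ≤ P * G →
    1ℚ - x * J ≤ D → D * (1ℚ + x * J) ≤ 1ℚ →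
    x + (1ℚ - x) * (P * D) ≤ (1ℚ + (x * (J * J) * G + x * x * J + x * x * (J * J))) * P
  algebra-lower {x} {J} {P} {G} {D} 0≤x x≤1 0≤J 0≤P P≥ PG≥1 D≥ h =
    ≤-trans (+-mono-≤ (≤-refl {x}) (*-monoʳ (0≤- x≤1) (*-monoʳ 0≤P D≤)))
      (by-difference _ diff≥0
        (solve 4 (λ x J P G →
           x :+ (con 1ℚ :- x) :* (P :* (con 1ℚ :- x :* J :+ x :* J :* (x :* J)))
           :+ (x :* ((P :- (con 1ℚ :- J)) :* (con 1ℚ :+ J) :+ J :* J :* (P :* G :- con 1ℚ))
               :+ x :* x :* x :* (J :* J) :* P)
           := (con 1ℚ :+ (x :* (J :* J) :* G :+ x :* x :* J :+ x :* x :* (J :* J))) :* P) refl x J P G))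
    where
    0≤xJ : 0ℚ ≤ x * J
    0≤xJ = 0≤* 0≤x 0≤J
    D≤ : D ≤ 1ℚ - x * J + x * J * (x * J)
    D≤ = by-difference ((1ℚ - D * (1ℚ + x * J)) + x * J * (D - (1ℚ - x * J)))
      (0≤+ (0≤- h) (0≤* 0≤xJ (0≤- D≥)))
      (solve 2 (λ D y → D :+ ((con 1ℚ :- D :* (con 1ℚ :+ y)) :+ y :* (D :- (con 1ℚ :- y))) := con 1ℚ :- y :+ y :* y) refl D (x * J))
    diff≥0 : 0ℚ ≤ x * ((P - (1ℚ - J)) * (1ℚ + J) + J * J * (P * G - 1ℚ)) + x * x * x * (J * J) * P
    diff≥0 = 0≤+ (0≤* 0≤x (0≤+ (0≤* (0≤- P≥) (0≤+ 0≤1 0≤J)) (0≤* (0≤* 0≤J 0≤J) (0≤- PG≥1))))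
                 (0≤* (0≤* (0≤* (0≤* 0≤x 0≤x) 0≤x) (0≤* 0≤J 0≤J)) 0≤P)

  -- Here the current vertex is counted too: a factor ½ with probability `x` has mean 1 - x / 2.
  -- Doubling the error absorbs the cross terms.
  algebra-lower′ : ∀ {x e P Q} → 0ℚ ≤ x → x ≤ 1ℚ → 0ℚ ≤ e → 0ℚ ≤ P → P ≤ 1ℚ →
    x + (1ℚ - x) * Q ≤ (1ℚ + e) * P → x * ½ + (1ℚ - x) * Q ≤ (1ℚ + 2ℚ * e) * ((1ℚ - ½ * x) * P)
  algebra-lower′ {x} {e} {P} {Q} 0≤x x≤1 0≤e 0≤P P≤1 h =
    by-difference (((1ℚ + e) * P - (x + (1ℚ - x) * Q)) + ½ * x * (1ℚ - P) + e * P * (1ℚ - x))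
      (0≤+ (0≤+ (0≤- h) (0≤* (0≤* 0≤½ 0≤x) (0≤- P≤1))) (0≤* (0≤* 0≤e 0≤P) (0≤- x≤1)))
      (solve 4 (λ x e P Q → x :* con ½ :+ (con 1ℚ :- x) :* Q
          :+ (((con 1ℚ :+ e) :* P :- (x :+ (con 1ℚ :- x) :* Q)) :+ con ½ :* x :* (con 1ℚ :- P) :+ e :* P :* (con 1ℚ :- x))
          := (con 1ℚ :+ con 2ℚ :* e) :* ((con 1ℚ :- con ½ :* x) :* P)) refl x e P Q)

-- The take-or-skip process and multiplicative potentials.

module Process where
  open RationalArithmetic
  open import Data.Bool.Base using (Bool; true; false; if_then_else_)
  open import Data.Nat.Base as ℕ using (ℕ; zero; suc; _<ᵇ_; _≡ᵇ_)
  import Data.Nat.Properties as ℕ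
  open import Data.Rational.Base
  open import Data.Rational.Properties
  open import Data.Rational.Solver
  open import Data.Empty using (⊥-elim)
  open import Relation.Binary.PropositionalEquality
  open import Relation.Binary.Definitions using (tri<; tri≈; tri>)
  open import Relation.Nullary using (yes; no)
  open +-*-Solver using (solve; _:=_; _:*_; con)
  open import Data.Bool.Properties using (T-≡)
  open import Function.Bundles using (Equivalence)

  <ᵇ-true : ∀ {m n} → m ℕ.< n → (m <ᵇ n) ≡ true
  <ᵇ-true p = Equivalence.to T-≡ (ℕ.<⇒<ᵇ p)

  <ᵇ-true⁻ : ∀ {m n} → (m <ᵇ n) ≡ true → m ℕ.< n
  <ᵇ-true⁻ {m} {n} p = ℕ.<ᵇ⇒< m n (Equivalence.from T-≡ p)

  <ᵇ-false : ∀ {m n} → n ℕ.≤ m → (m <ᵇ n) ≡ false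
  <ᵇ-false {m} {n} p with m <ᵇ n in eq
  ... | false = refl
  ... | true  = ⊥-elim (ℕ.<⇒≱ (<ᵇ-true⁻ {m} {n} eq) p)

  ≡ᵇ-refl : ∀ m → (m ≡ᵇ m) ≡ true
  ≡ᵇ-refl m = Equivalence.to T-≡ (ℕ.≡⇒≡ᵇ m m refl)

  ≡ᵇ-true⁻ : ∀ {m n} → (m ≡ᵇ n) ≡ true → m ≡ n
  ≡ᵇ-true⁻ {m} {n} p = ℕ.≡ᵇ⇒≡ m n (Equivalence.from T-≡ p)

  ≡ᵇ-false : ∀ {m n} → m ≢ n → (m ≡ᵇ n) ≡ false
  ≡ᵇ-false {m} {n} p with m ≡ᵇ n in eq
  ... | false = refl
  ... | true  = ⊥-elim (p (≡ᵇ-true⁻ {m} {n} eq))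

  <ᵇ-suc : ∀ {w t} → w ≢ t → (w <ᵇ suc t) ≡ (w <ᵇ t)
  <ᵇ-suc {w} {t} w≢t with ℕ.<-cmp w t
  ... | tri< l _ _ = trans (<ᵇ-true (ℕ.m<n⇒m<1+n l)) (sym (<ᵇ-true l))
  ... | tri≈ _ e _ = ⊥-elim (w≢t e)
  ... | tri> _ _ g = trans (<ᵇ-false g) (sym (<ᵇ-false (ℕ.<⇒≤ g)))

  -- x holds the current weights, c the choices made so far; back w u says that u < w are adjacent.
  record State : Set where
    constructor state
    field
      x : ℕ → ℚ
      c : ℕ → Bool
  open State

  module Steps (back : ℕ → ℕ → Bool)
               (back-< : ∀ {w u} → back w u ≡ true → u ℕ.< w) where

    -- The compensation that would keep the mean of a weight exactly is 1 / (1 - x). The factor 1 +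
    -- x is slightly smaller, avoids division, and leaves a supermartingale.
    take skip : ℕ → State → State
    take t s = state (λ w → if back w t then 0ℚ else x s w)
                     (λ w → if w ≡ᵇ t then true else c s w)
    skip t s = state (λ w → if back w t then x s w * (1ℚ + x s t) else x s w)
                     (λ w → if w ≡ᵇ t then false else c s w)

    back-refl : ∀ t → back t t ≡ false
    back-refl t with back t t in eq
    ... | false = refl
    ... | true  = ⊥-elim (ℕ.<-irrefl refl (back-< eq))

    affected : (ℕ → Bool) → ℕ → State → ℕ → ℚ
    affected Z t s w = if Z w then (if back w t then x s w else 0ℚ) else 0ℚ

    -- `future` is the mean factor reserved for a vertex that is still undecided, `past` the factor
    -- it keeps afterwards. Since `future 0ℚ` is 1, an undecided vertex with a chosen neighbour
    -- drops out of the product.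
    module Potential (past : ℚ → Bool → ℚ) (future : ℚ → ℚ) (future-0 : future 0ℚ ≡ 1ℚ)
                     (m : ℕ) (Z : ℕ → Bool) where

      value : ℕ → State → ℕ → ℚ
      value t s w = if w <ᵇ t then past (x s w) (c s w) else future (x s w)

      factor : ℕ → State → ℕ → ℚ
      factor t s w = if Z w then value t s w else 1ℚ

      potential : ℕ → State → ℚ
      potential t s = ∏ m (factor t s)

      module _ (t : ℕ) (t<m : t ℕ.< m) (s : State) where

        unaffected : ℕ → ℚ
        unaffected w = if w ≡ᵇ t then 1ℚ else (if Z w then (if back w t then 1ℚ else value t s w) else 1ℚ)

        own : ℚ → ℕ → ℚ
        own o w = if w ≡ᵇ t then (if Z t then o else 1ℚ) else 1ℚ

        U : ℚ
        U = ∏ m unaffected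

        ∏-own : ∀ o → ∏ m (own o) ≡ (if Z t then o else 1ℚ)
        ∏-own o = trans (∏-single m t t<m off) on
          where
          off : ∀ i → i ≢ t → own o i ≡ 1ℚ
          off i i≢t rewrite ≡ᵇ-false i≢t = refl
          on : own o t ≡ (if Z t then o else 1ℚ)
          on rewrite ≡ᵇ-refl t = refl

        1*1*1 : 1ℚ ≡ 1ℚ * (1ℚ * 1ℚ)
        1*1*1 = refl

        o*1*1 : ∀ o → o ≡ o * (1ℚ * 1ℚ)
        o*1*1 = solve 1 (λ o → o := o :* (con 1ℚ :* con 1ℚ)) refl

        1*a*1 : ∀ o → o ≡ 1ℚ * (o * 1ℚ)
        1*a*1 = solve 1 (λ o → o := con 1ℚ :* (o :* con 1ℚ)) refl

        1*1*a : ∀ o → o ≡ 1ℚ * (1ℚ * o)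
        1*1*a = solve 1 (λ o → o := con 1ℚ :* (con 1ℚ :* o)) refl

        -- Between `t` and `suc t` only two kinds of factors move: that of `t` itself and those of
        -- its neighbours above `t`, which by `back-<` are undecided before and after the step.
        -- Everything else is the common factor `U`.
        decompose : potential t s ≡ (if Z t then future (x s t) else 1ℚ) * (U * ∏ m (λ w → future (affected Z t s w)))
        decompose = trans (∏-cong m λ w _ → pointwise w)
          (trans (∏-* (own o) _ m) (cong₂ _*_ (∏-own o) (∏-* unaffected _ m)))
          where
          o = future (x s t)
          pointwise : ∀ w → factor t s w ≡ own o w * (unaffected w * future (affected Z t s w))
          pointwise w with w ℕ.≟ t
          ... | yes refl rewrite ≡ᵇ-refl t | back-refl t | <ᵇ-false (ℕ.≤-refl {t}) with Z t
          ...   | true  rewrite future-0 = o*1*1 _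
          ...   | false rewrite future-0 = 1*1*1
          pointwise w | no w≢t rewrite ≡ᵇ-false w≢t with Z w
          ...   | false rewrite future-0 = 1*1*1
          ...   | true with back w t in eq
          ...     | false rewrite future-0 = 1*a*1 _
          ...     | true rewrite <ᵇ-false (ℕ.<⇒≤ (back-< eq)) = 1*1*a _

        decompose-take : potential (suc t) (take t s) ≡ (if Z t then past (x s t) true else 1ℚ) * U
        decompose-take = trans (∏-cong m λ w _ → pointwise w)
          (trans (∏-* (own o) _ m) (cong (_* U) (∏-own o)))
          where
          o = past (x s t) true
          pointwise : ∀ w → factor (suc t) (take t s) w ≡ own o w * unaffected w
          pointwise w with w ℕ.≟ t
          ... | yes refl rewrite ≡ᵇ-refl t | back-refl t | <ᵇ-true (ℕ.n<1+n t) with Z t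
          ...   | true  = sym (*-identityʳ _)
          ...   | false = refl
          pointwise w | no w≢t rewrite ≡ᵇ-false w≢t | <ᵇ-suc w≢t with Z w
          ...   | false = refl
          ...   | true with back w t in eq
          ...     | false = sym (*-identityˡ _)
          ...     | true rewrite <ᵇ-false (ℕ.<⇒≤ (back-< eq)) | future-0 = refl

        decompose-skip : potential (suc t) (skip t s) ≡ (if Z t then past (x s t) false else 1ℚ) *
                         (U * ∏ m (λ w → future (affected Z t s w * (1ℚ + x s t))))
        decompose-skip = trans (∏-cong m λ w _ → pointwise w)
          (trans (∏-* (own o) _ m) (cong₂ _*_ (∏-own o) (∏-* unaffected _ m)))
          where
          o = past (x s t) false
          0* : future (0ℚ * (1ℚ + x s t)) ≡ 1ℚ
          0* = trans (cong future (*-zeroˡ (1ℚ + x s t))) future-0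
          pointwise : ∀ w → factor (suc t) (skip t s) w ≡ own o w * (unaffected w * future (affected Z t s w * (1ℚ + x s t)))
          pointwise w with w ℕ.≟ t
          ... | yes refl rewrite ≡ᵇ-refl t | back-refl t | <ᵇ-true (ℕ.n<1+n t) with Z t
          ...   | true  rewrite 0* = o*1*1 _
          ...   | false rewrite 0* = 1*1*1
          pointwise w | no w≢t rewrite ≡ᵇ-false w≢t | <ᵇ-suc w≢t with Z w
          ...   | false rewrite 0* = 1*1*1
          ...   | true with back w t in eq
          ...     | false rewrite 0* = 1*a*1 _
          ...     | true rewrite <ᵇ-false (ℕ.<⇒≤ (back-< eq)) = 1*1*a _

-- The expected change of a potential in one step.

module ExpectedStep where
  open RationalArithmetic
  open Process
  open import Data.Bool.Base using (Bool; true; false; if_then_else_; _∧_)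
  open import Data.Nat.Base as ℕ using (ℕ; zero; suc; _<ᵇ_; _≡ᵇ_)
  import Data.Nat.Properties as ℕ
  open import Data.Rational.Base
  open import Data.Rational.Properties
  open import Data.Rational.Solver
  open import Relation.Binary.PropositionalEquality hiding (J)
  open +-*-Solver using (solve; _:=_; _:+_; _:*_; _:-_; :-_; con)
  open State

  count : ℕ → (ℕ → Bool) → ℕ
  count zero    f = 0
  count (suc n) f = if f n then suc (count n f) else count n f

  ∑≤count : ∀ {f : ℕ → ℚ} {z} (P : ℕ → Bool) n → 0ℚ ≤ z →
    (∀ i → i ℕ.< n → P i ≡ true → f i ≤ z) → (∀ i → P i ≡ false → f i ≤ 0ℚ) → ∑ n f ≤ ι (count n P) * z
  ∑≤count {z = z} P zero 0≤z p q = ≤-reflexive (sym (*-zeroˡ z))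
  ∑≤count {f} {z} P (suc n) 0≤z p q with P n in eq
  ... | true  = ≤-trans (+-mono-≤ (∑≤count P n 0≤z (λ i l → p i (ℕ.m<n⇒m<1+n l)) q) (p n ℕ.≤-refl eq))
    (≤-reflexive (solve 2 (λ c z → c :* z :+ z := (con 1ℚ :+ c) :* z) refl (ι (count n P)) z))
  ... | false = subst (_ ≤_) (+-identityʳ _) (+-mono-≤ (∑≤count P n 0≤z (λ i l → p i (ℕ.m<n⇒m<1+n l)) q) (q n eq))

  -- Lets an error term that is linear in the number of hits be absorbed into the quadratic one.
  ι≤ι*ι : ∀ n → ι n ≤ ι n * ι n
  ι≤ι*ι zero    = ≤-reflexive (sym (*-zeroˡ 0ℚ))
  ι≤ι*ι (suc n) = subst (_≤ ι (suc n) * ι (suc n)) (*-identityˡ _) (*-monoˡ (0≤ι (suc n)) (1≤ι-suc n))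

  module Expectation (back : ℕ → ℕ → Bool) (back-< : ∀ {w u} → back w u ≡ true → u ℕ.< w) (m : ℕ)
      (x̄ G Sq : ℚ) (x̄≤1 : x̄ ≤ 1ℚ) (1≤G : 1ℚ ≤ G) (1≤Sq : 1ℚ ≤ Sq) where

    open Steps back back-< public

    -- A common majorant for the second order errors of both kinds of potentials, so that the same
    -- slack serves them all: `Sq` bounds the exponents of the upper potentials, `G` the reciprocals
    -- of the lower ones.
    K : ℚ
    K = 3ℚ * (x̄ * (x̄ * x̄) * (Sq * Sq) * G)

    hits : (ℕ → Bool) → ℕ → ℕ
    hits Z t = count m (λ w → Z w ∧ back w t)

    error : (ℕ → Bool) → ℕ → ℚ
    error Z t = K * (ι (hits Z t) * ι (hits Z t))

    record Bounded (t : ℕ) (s : State) : Set where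
      field
        x≥0     : ∀ w → 0ℚ ≤ x s w
        x≤x̄     : ∀ w → x s w ≤ x̄
        ∏≤G     : ∏ m (λ w → 1ℚ + affected (λ _ → true) t s w) ≤ G

    Super : (ℕ → State → ℚ) → ℚ → ℕ → State → Set
    Super V e t s = x s t * V (suc t) (take t s) + (1ℚ - x s t) * V (suc t) (skip t s) ≤ (1ℚ + e) * V t s

    module _ {t : ℕ} (t<m : t ℕ.< m) {s : State} (B : Bounded t s) (Z : ℕ → Bool) where
      open Bounded B

      0≤x̄ : 0ℚ ≤ x̄
      0≤x̄ = ≤-trans (x≥0 t) (x≤x̄ t)

      0≤G : 0ℚ ≤ G
      0≤G = ≤-trans 0≤1 1≤G

      0≤Sq : 0ℚ ≤ Sq
      0≤Sq = ≤-trans 0≤1 1≤Sq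

      xₜ≤1 : x s t ≤ 1ℚ
      xₜ≤1 = ≤-trans (x≤x̄ t) x̄≤1

      aff : ℕ → ℚ
      aff = affected Z t s

      h : ℚ
      h = ι (hits Z t)

      0≤h : 0ℚ ≤ h
      0≤h = 0≤ι (hits Z t)

      aff≥0 : ∀ w → 0ℚ ≤ aff w
      aff≥0 w with Z w
      ... | false = ≤-refl
      ... | true with back w t
      ...   | true  = x≥0 w
      ...   | false = ≤-refl

      aff≤x̄ : ∀ w → aff w ≤ x̄
      aff≤x̄ w with Z w
      ... | false = 0≤x̄
      ... | true with back w t
      ...   | true  = x≤x̄ w
      ...   | false = 0≤x̄

      aff≤1 : ∀ w → aff w ≤ 1ℚ
      aff≤1 w = ≤-trans (aff≤x̄ w) x̄≤1

      aff-off : ∀ w → Z w ∧ back w t ≡ false → aff w ≤ 0ℚ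
      aff-off w with Z w
      ... | false = λ _ → ≤-refl
      ... | true with back w t
      ...   | true  = λ ()
      ...   | false = λ _ → ≤-refl

      Σaff : ℚ
      Σaff = ∑ m aff

      Σaff≥0 : 0ℚ ≤ Σaff
      Σaff≥0 = ∑-nonneg m (λ w _ → aff≥0 w)

      Σaff≤ : Σaff ≤ h * x̄
      Σaff≤ = ∑≤count (λ w → Z w ∧ back w t) m 0≤x̄ (λ w _ _ → aff≤x̄ w) aff-off

      xaff≤1 : ∀ w → x s t * aff w ≤ 1ℚ
      xaff≤1 w = subst (x s t * aff w ≤_) (*-identityˡ 1ℚ) (*-mono (aff≥0 w) 0≤1 xₜ≤1 (aff≤1 w))

      0≤1-x : 0ℚ ≤ 1ℚ - x s t
      0≤1-x = 0≤- xₜ≤1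

      -- The factor 2 per chosen vertex counts choices. The power `σ` of 1 + y stays after the
      -- decision: if the set is the back neighbourhood of some w, these factors record how far the
      -- weight of w has grown. The one extra power held beforehand is the mean x · 2 + (1 - x) of
      -- the counting factor.
      module Upper (σ : ℕ) (σ≤ : ι (suc σ) ≤ Sq) (half : x̄ * (Sq * (h * x̄)) ≤ ½) where
        open Potential (λ y b → (1ℚ + y) ^ σ * (if b then 2ℚ else 1ℚ)) (λ y → (1ℚ + y) ^ suc σ)
                       (^-one (suc σ)) m Z

        a A₁ D₁ A D : ℚ
        a  = ι (suc σ) * Σaff
        A₁ = ∏ m (λ w → 1ℚ + aff w)
        D₁ = ∏ m (λ w → 1ℚ + x s t * aff w)
        A  = A₁ ^ suc σ
        D  = D₁ ^ suc σ

        0≤a : 0ℚ ≤ a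
        0≤a = 0≤* (0≤ι (suc σ)) Σaff≥0

        0≤A₁ : 0ℚ ≤ A₁
        0≤A₁ = ∏-nonneg m (λ w _ → 0≤+ 0≤1 (aff≥0 w))

        0≤D₁ : 0ℚ ≤ D₁
        0≤D₁ = ∏-nonneg m (λ w _ → 0≤+ 0≤1 (0≤* (x≥0 t) (aff≥0 w)))

        1+a≤A : 1ℚ + a ≤ A
        1+a≤A = ≤-trans (1+nx≤^ (suc σ) Σaff≥0)
          (^-mono (suc σ) (0≤+ 0≤1 Σaff≥0) (1+∑≤∏ m (λ w _ → aff≥0 w)))

        a≤ : a ≤ Sq * (h * x̄)
        a≤ = *-mono Σaff≥0 0≤Sq σ≤ Σaff≤

        xa≤½ : x s t * a ≤ ½
        xa≤½ = ≤-trans (*-mono 0≤a 0≤x̄ (x≤x̄ t) a≤) half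

        Σx≤1 : x s t * Σaff ≤ 1ℚ
        Σx≤1 = ≤-trans (*-monoʳ (x≥0 t)
          (subst (_≤ a) (*-identityˡ _) (*-monoˡ Σaff≥0 (1≤ι-suc σ)))) (≤-trans xa≤½ (by-difference ½ 0≤½ refl))

        D[1-xa]≤1 : D * (1ℚ - x s t * a) ≤ 1ℚ
        D[1-xa]≤1 = ≤-trans (*-monoʳ (^-nonneg (suc σ) 0≤D₁)
            (subst (λ z → 1ℚ - z ≤ (1ℚ - x s t * Σaff) ^ suc σ)
              (solve 3 (λ k x y → k :* (x :* y) := x :* (k :* y)) refl (ι (suc σ)) (x s t) Σaff)
              (1-nx≤^ (suc σ) (0≤* (x≥0 t) Σaff≥0) Σx≤1)))
          (subst (_≤ 1ℚ) (^-* D₁ _ (suc σ)) (^≤1 (suc σ)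
            (0≤* 0≤D₁ (0≤- Σx≤1))
            (subst (λ z → D₁ * (1ℚ - z) ≤ 1ℚ) (∑-*ˡ (x s t) aff m)
              (∏[1+f]*[1-∑]≤1 m (λ w _ → 0≤* (x≥0 t) (aff≥0 w)) (λ w _ → xaff≤1 w)))))

        -- 1 + y (1 + x) ≤ (1 + y) (1 + x y) separates the old product from the growth caused by
        -- skipping.
        skip≤ : ∏ m (λ w → (1ℚ + aff w * (1ℚ + x s t)) ^ suc σ) ≤ A * D
        skip≤ = subst (_≤ A * D) (sym (∏-^ (λ w → 1ℚ + aff w * (1ℚ + x s t)) (suc σ) m))
          (subst ((∏ m (λ w → 1ℚ + aff w * (1ℚ + x s t))) ^ suc σ ≤_) (^-* A₁ D₁ (suc σ))
            (^-mono (suc σ) (∏-nonneg m (λ w _ → 0≤+ 0≤1 (nn w)))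
              (subst (∏ m (λ w → 1ℚ + aff w * (1ℚ + x s t)) ≤_) (∏-* _ _ m)
                (∏-mono m (λ w _ → 0≤+ 0≤1 (nn w)) (λ w _ → by-difference (x s t * (aff w * aff w))
                  (0≤* (x≥0 t) (0≤* (aff≥0 w) (aff≥0 w)))
                  (solve 2 (λ x y → con 1ℚ :+ y :* (con 1ℚ :+ x) :+ x :* (y :* y) := (con 1ℚ :+ y) :* (con 1ℚ :+ x :* y))
                    refl (x s t) (aff w)))))))
          where
          nn : ∀ w → 0ℚ ≤ aff w * (1ℚ + x s t)
          nn w = 0≤* (aff≥0 w) (0≤+ 0≤1 (x≥0 t))

        err≤ : 3ℚ * (x s t * (a * a)) ≤ error Z t
        err≤ = subst (3ℚ * (x s t * (a * a)) ≤_)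
          (solve 4 (λ y s h g → con 3ℚ :* (y :* ((s :* (h :* y)) :* (s :* (h :* y))) :* g) :=
                                con 3ℚ :* (y :* (y :* y) :* (s :* s) :* g) :* (h :* h)) refl x̄ Sq h G)
          (*-monoʳ (nonNegative⁻¹ 3ℚ) (≤-trans
            (*-mono (0≤* 0≤a 0≤a) 0≤x̄ (x≤x̄ t) (*-mono 0≤a 0≤b a≤ a≤))
            (subst (_≤ x̄ * (b * b) * G) (*-identityʳ _) (*-monoʳ (0≤* 0≤x̄ (0≤* 0≤b 0≤b)) 1≤G))))
          where
          b = Sq * (h * x̄)
          0≤b : 0ℚ ≤ b
          0≤b = 0≤* 0≤Sq (0≤* 0≤h 0≤x̄)

        Ut : ℚ
        Ut = U t t<m s

        0≤Ut : 0ℚ ≤ Ut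
        0≤Ut = ∏-nonneg m nn
          where
          nn : ∀ w → w ℕ.< m → 0ℚ ≤ unaffected t t<m s w
          nn w _ with w ≡ᵇ t
          ... | true = 0≤1
          ... | false with Z w
          ...   | false = 0≤1
          ...   | true with back w t
          ...     | true = 0≤1
          ...     | false with w <ᵇ t
          ...       | false = ^-nonneg (suc σ) (0≤+ 0≤1 (x≥0 w))
          ...       | true with c s w
          ...         | true  = 0≤* (^-nonneg σ (0≤+ 0≤1 (x≥0 w))) (nonNegative⁻¹ 2ℚ)
          ...         | false = 0≤* (^-nonneg σ (0≤+ 0≤1 (x≥0 w))) 0≤1

        A≡ : ∏ m (λ w → (1ℚ + aff w) ^ suc σ) ≡ A
        A≡ = ∏-^ (λ w → 1ℚ + aff w) (suc σ) m

        0≤A : 0ℚ ≤ A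
        0≤A = ^-nonneg (suc σ) 0≤A₁

        raise : ∀ {L R o} → 0ℚ ≤ o → L ≤ (1ℚ + 3ℚ * (x s t * (a * a))) * R → 0ℚ ≤ R →
                o * Ut * L ≤ (1ℚ + error Z t) * (o * (Ut * R))
        raise {L} {R} {o} 0≤o L≤ 0≤R = subst (o * Ut * L ≤_)
          (solve 4 (λ o u e r → o :* u :* (e :* r) := e :* (o :* (u :* r))) refl o Ut (1ℚ + error Z t) R)
          (*-monoʳ (0≤* 0≤o 0≤Ut) (≤-trans L≤ (*-monoˡ 0≤R (+-mono-≤ (≤-refl {1ℚ}) err≤))))

        super : Super potential (error Z t) t s
        super rewrite decompose t t<m s | decompose-take t t<m s | decompose-skip t t<m s | A≡ with Z t
        ... | false = ≤-trans
          (≤-trans (+-mono-≤ (≤-refl {x s t * (1ℚ * Ut)}) (*-monoʳ 0≤1-x (*-monoʳ 0≤1 (*-monoʳ 0≤Ut skip≤))))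
            (≤-reflexive (solve 4 (λ x u a d → x :* (con 1ℚ :* u) :+ (con 1ℚ :- x) :* (con 1ℚ :* (u :* (a :* d)))
                := con 1ℚ :* u :* (x :+ (con 1ℚ :- x) :* (a :* d))) refl (x s t) Ut A D)))
          (raise 0≤1 (algebra-upper (x≥0 t) xₜ≤1 0≤a 1+a≤A xa≤½ (^-nonneg (suc σ) 0≤D₁) D[1-xa]≤1) 0≤A)
        ... | true = ≤-trans
          (≤-trans (+-mono-≤ (≤-refl {x s t * (o * 2ℚ * Ut)}) (*-monoʳ 0≤1-x (*-monoʳ (0≤* 0≤o 0≤1) (*-monoʳ 0≤Ut skip≤))))
            (≤-reflexive (solve 5 (λ x o u a d → x :* (o :* con 2ℚ :* u) :+ (con 1ℚ :- x) :* (o :* con 1ℚ :* (u :* (a :* d)))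
                := o :* u :* (x :* con 2ℚ :+ (con 1ℚ :- x) :* (a :* d))) refl (x s t) o Ut A D)))
          (subst (o * Ut * (x s t * 2ℚ + (1ℚ - x s t) * (A * D)) ≤_)
            (solve 5 (λ e o u x a → e :* (o :* (u :* ((con 1ℚ :+ x) :* a))) := e :* ((con 1ℚ :+ x) :* o :* (u :* a))) refl (1ℚ + error Z t) o Ut (x s t) A)
            (raise 0≤o (algebra-upper′ (x≥0 t) xₜ≤1 0≤a 1+a≤A xa≤½ (^-nonneg (suc σ) 0≤D₁) D[1-xa]≤1)
              (0≤* (0≤+ 0≤1 (x≥0 t)) 0≤A)))
          where
          o = (1ℚ + x s t) ^ σ
          0≤o : 0ℚ ≤ o
          0≤o = ^-nonneg σ (0≤+ 0≤1 (x≥0 t))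

      module Lower where
        open Potential (λ _ b → if b then ½ else 1ℚ) (λ y → 1ℚ - ½ * y) refl m Z

        y : ℕ → ℚ
        y w = ½ * aff w

        y≥0 : ∀ w → 0ℚ ≤ y w
        y≥0 w = 0≤* 0≤½ (aff≥0 w)

        y≤1 : ∀ w → y w ≤ 1ℚ
        y≤1 w = ≤-trans (*-monoʳ 0≤½ (aff≤1 w)) (by-difference ½ 0≤½ refl)

        xy≥0 : ∀ w → 0ℚ ≤ x s t * y w
        xy≥0 w = 0≤* (x≥0 t) (y≥0 w)

        xy≤1 : ∀ w → x s t * y w ≤ 1ℚ
        xy≤1 w = subst (x s t * y w ≤_) (*-identityˡ 1ℚ) (*-mono (y≥0 w) 0≤1 xₜ≤1 (y≤1 w))

        J P D e : ℚ
        J = ∑ m y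
        P = ∏ m (λ w → 1ℚ - y w)
        D = ∏ m (λ w → 1ℚ - x s t * y w)
        e = x s t * (J * J) * G + x s t * x s t * J + x s t * x s t * (J * J)

        0≤J : 0ℚ ≤ J
        0≤J = ∑-nonneg m (λ w _ → y≥0 w)

        J≤ : J ≤ ½ * (h * x̄)
        J≤ = subst (_≤ ½ * (h * x̄)) (sym (∑-*ˡ ½ aff m)) (*-monoʳ 0≤½ Σaff≤)

        0≤P : 0ℚ ≤ P
        0≤P = ∏-nonneg m (λ w _ → 0≤- (y≤1 w))

        P≤1 : P ≤ 1ℚ
        P≤1 = ∏-≤1 m (λ w _ → 0≤- (y≤1 w)) (λ w _ → 1-a≤1 (y≥0 w))

        affected≤ : ∀ w → aff w ≤ affected (λ _ → true) t s w
        affected≤ w with Z w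
        ... | true = ≤-refl
        ... | false with back w t
        ...   | true  = x≥0 w
        ...   | false = ≤-refl

        -- (1 - a / 2) (1 + a) ≥ 1 for 0 ≤ a ≤ 1, so the bound `G` on the product of the factors 1 +
        -- a also bounds 1 / P.
        1≤PG : 1ℚ ≤ P * G
        1≤PG = ≤-trans (1≤∏ m (λ w _ → by-difference (½ * aff w * (1ℚ - aff w))
              (0≤* (0≤* 0≤½ (aff≥0 w)) (0≤- (aff≤1 w)))
              (solve 1 (λ a → con 1ℚ :+ con ½ :* a :* (con 1ℚ :- a) := (con 1ℚ :- con ½ :* a) :* (con 1ℚ :+ a)) refl (aff w))))
          (subst (_≤ P * G) (sym (∏-* (λ w → 1ℚ - y w) (λ w → 1ℚ + aff w) m))
            (*-monoʳ 0≤P (≤-trans (∏-mono m (λ w _ → 0≤+ 0≤1 (aff≥0 w))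
              (λ w _ → +-mono-≤ (≤-refl {1ℚ}) (affected≤ w))) ∏≤G)))

        skip≤ : ∏ m (λ w → 1ℚ - ½ * (aff w * (1ℚ + x s t))) ≤ P * D
        skip≤ = subst (∏ m (λ w → 1ℚ - ½ * (aff w * (1ℚ + x s t))) ≤_) (∏-* _ _ m)
          (∏-mono m (λ w _ → subst (0ℚ ≤_)
              (solve 2 (λ a x → con ½ :* (con 1ℚ :- a) :+ con ½ :* (con 1ℚ :- x :* a) := con 1ℚ :- con ½ :* (a :* (con 1ℚ :+ x))) refl (aff w) (x s t))
              (0≤+ (0≤* 0≤½ (0≤- (aff≤1 w))) (0≤* 0≤½ (0≤- (xaff≤1 w)))))
            (λ w _ → by-difference (x s t * (y w * y w)) (0≤* (x≥0 t) (0≤* (y≥0 w) (y≥0 w)))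
              (solve 2 (λ x a → con 1ℚ :- con ½ :* (a :* (con 1ℚ :+ x)) :+ x :* ((con ½ :* a) :* (con ½ :* a))
                := (con 1ℚ :- con ½ :* a) :* (con 1ℚ :- x :* (con ½ :* a))) refl (x s t) (aff w))))

        e≥0 : 0ℚ ≤ e
        e≥0 = 0≤+ (0≤+ (0≤* (0≤* (x≥0 t) (0≤* 0≤J 0≤J)) 0≤G) (0≤* (0≤* (x≥0 t) (x≥0 t)) 0≤J))
                  (0≤* (0≤* (x≥0 t) (x≥0 t)) (0≤* 0≤J 0≤J))

        err≤ : 2ℚ * e ≤ error Z t
        err≤ = ≤-trans (*-monoʳ (nonNegative⁻¹ 2ℚ) (+-mono-≤ (+-mono-≤
                  (*-monoˡ 0≤G (*-mono (0≤* 0≤J 0≤J) 0≤x̄ (x≤x̄ t) (*-mono 0≤J 0≤z J≤ J≤)))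
                  (*-mono 0≤J (0≤* 0≤x̄ 0≤x̄) xx≤ J≤))
                  (*-mono (0≤* 0≤J 0≤J) (0≤* 0≤x̄ 0≤x̄) xx≤ (*-mono 0≤J 0≤z J≤ J≤))))
          (≤-trans (by-difference
              (x̄ * (x̄ * x̄) * (h * h - h) + x̄ * (x̄ * x̄) * (h * h) * (½ * (G - 1ℚ) + 2ℚ * (G - 1ℚ) + ½ * (1ℚ - x̄) + 1ℚ))
              (0≤+ (0≤* 0≤x³ (0≤- (ι≤ι*ι (hits Z t))))
                (0≤* (0≤* 0≤x³ (0≤* 0≤h 0≤h))
                  (0≤+ (0≤+ (0≤+ (0≤* 0≤½ (0≤- 1≤G)) (0≤* (nonNegative⁻¹ 2ℚ) (0≤- 1≤G))) (0≤* 0≤½ (0≤- x̄≤1))) 0≤1)))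
              (solve 3 (λ y h g →
                con 2ℚ :* (y :* ((con ½ :* (h :* y)) :* (con ½ :* (h :* y))) :* g :+ y :* y :* (con ½ :* (h :* y))
                   :+ y :* y :* ((con ½ :* (h :* y)) :* (con ½ :* (h :* y))))
                :+ (y :* (y :* y) :* (h :* h :- h) :+ y :* (y :* y) :* (h :* h) :*
                     (con ½ :* (g :- con 1ℚ) :+ con 2ℚ :* (g :- con 1ℚ) :+ con ½ :* (con 1ℚ :- y) :+ con 1ℚ))
                := con 3ℚ :* (y :* (y :* y) :* (h :* h) :* g)) refl x̄ h G))
            (subst (3ℚ * (x̄ * (x̄ * x̄) * (h * h) * G) ≤_)
              (solve 4 (λ y h g s → con 3ℚ :* (y :* (y :* y) :* (h :* h) :* g) :* (s :* s) := con 3ℚ :* (y :* (y :* y) :* (s :* s) :* g) :* (h :* h)) refl x̄ h G Sq)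
              (subst (_≤ 3ℚ * (x̄ * (x̄ * x̄) * (h * h) * G) * (Sq * Sq)) (*-identityʳ _)
                (*-monoʳ (0≤* (nonNegative⁻¹ 3ℚ) (0≤* (0≤* 0≤x³ (0≤* 0≤h 0≤h)) 0≤G))
                  (subst (_≤ Sq * Sq) (*-identityˡ 1ℚ) (*-mono 0≤1 0≤Sq 1≤Sq 1≤Sq))))))
          where
          0≤x³ : 0ℚ ≤ x̄ * (x̄ * x̄)
          0≤x³ = 0≤* 0≤x̄ (0≤* 0≤x̄ 0≤x̄)
          0≤z : 0ℚ ≤ ½ * (h * x̄)
          0≤z = 0≤* 0≤½ (0≤* 0≤h 0≤x̄)
          xx≤ : x s t * x s t ≤ x̄ * x̄
          xx≤ = *-mono (x≥0 t) 0≤x̄ (x≤x̄ t) (x≤x̄ t)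

        Ut : ℚ
        Ut = U t t<m s


        core : x s t + (1ℚ - x s t) * (P * D) ≤ (1ℚ + e) * P
        core = algebra-lower (x≥0 t) xₜ≤1 0≤J 0≤P (1-∑≤∏ m (λ w _ → y≥0 w) (λ w _ → y≤1 w)) 1≤PG
          (subst (λ z → 1ℚ - z ≤ D) (∑-*ˡ (x s t) y m) (1-∑≤∏ m (λ w _ → xy≥0 w) (λ w _ → xy≤1 w)))
          (subst (λ z → D * (1ℚ + z) ≤ 1ℚ) (∑-*ˡ (x s t) y m) (∏[1-f]*[1+∑]≤1 m (λ w _ → xy≥0 w) (λ w _ → xy≤1 w)))

        0≤Ut : 0ℚ ≤ Ut
        0≤Ut = ∏-nonneg m nn
          where
          nn : ∀ w → w ℕ.< m → 0ℚ ≤ unaffected t t<m s w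
          nn w _ with w ≡ᵇ t
          ... | true = 0≤1
          ... | false with Z w
          ...   | false = 0≤1
          ...   | true with back w t
          ...     | true = 0≤1
          ...     | false with w <ᵇ t
          ...       | false = 0≤- (≤-trans (*-monoʳ 0≤½ (≤-trans (x≤x̄ w) x̄≤1)) (by-difference ½ 0≤½ refl))
          ...       | true with c s w
          ...         | true  = 0≤½
          ...         | false = 0≤1

        raise : ∀ {L R ε} → ε ≤ error Z t → L ≤ (1ℚ + ε) * R → 0ℚ ≤ R → Ut * L ≤ (1ℚ + error Z t) * (Ut * R)
        raise {L} {R} ε≤ L≤ 0≤R = subst (Ut * L ≤_)
          (solve 3 (λ u e r → u :* (e :* r) := e :* (u :* r)) refl Ut (1ℚ + error Z t) R)
          (*-monoʳ 0≤Ut (≤-trans L≤ (*-monoˡ 0≤R (+-mono-≤ (≤-refl {1ℚ}) ε≤))))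

        super : Super potential (error Z t) t s
        super rewrite decompose t t<m s | decompose-take t t<m s | decompose-skip t t<m s with Z t
        ... | false = ≤-trans
          (≤-trans (+-mono-≤ (≤-refl {x s t * (1ℚ * Ut)}) (*-monoʳ 0≤1-x (*-monoʳ 0≤1 (*-monoʳ 0≤Ut skip≤))))
            (≤-reflexive (solve 4 (λ x u a d → x :* (con 1ℚ :* u) :+ (con 1ℚ :- x) :* (con 1ℚ :* (u :* (a :* d)))
                := u :* (x :+ (con 1ℚ :- x) :* (a :* d))) refl (x s t) Ut P D)))
          (subst (Ut * (x s t + (1ℚ - x s t) * (P * D)) ≤_)
            (solve 3 (λ e u p → e :* (u :* p) := e :* (con 1ℚ :* (u :* p))) refl (1ℚ + error Z t) Ut P)
            (raise {ε = e} (≤-trans (by-difference e e≥0 (solve 1 (λ e → e :+ e := con 2ℚ :* e) refl e)) err≤) core 0≤P))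
        ... | true = ≤-trans
          (≤-trans (+-mono-≤ (≤-refl {x s t * (½ * Ut)}) (*-monoʳ 0≤1-x (*-monoʳ 0≤1 (*-monoʳ 0≤Ut skip≤))))
            (≤-reflexive (solve 4 (λ x u a d → x :* (con ½ :* u) :+ (con 1ℚ :- x) :* (con 1ℚ :* (u :* (a :* d)))
                := u :* (x :* con ½ :+ (con 1ℚ :- x) :* (a :* d))) refl (x s t) Ut P D)))
          (subst (Ut * (x s t * ½ + (1ℚ - x s t) * (P * D)) ≤_)
            (solve 4 (λ e u x p → e :* (u :* ((con 1ℚ :- con ½ :* x) :* p)) := e :* ((con 1ℚ :- con ½ :* x) :* (u :* p))) refl (1ℚ + error Z t) Ut (x s t) P)
            (raise {ε = 2ℚ * e} err≤ (algebra-lower′ (x≥0 t) xₜ≤1 e≥0 0≤P P≤1 core)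
              (0≤* (0≤- (≤-trans (*-monoʳ 0≤½ xₜ≤1) (by-difference ½ 0≤½ refl))) 0≤P)))

-- Estimates that do not increase in the mean, and the invariants of the process.

module Descents where
  open RationalArithmetic
  open Process
  open ExpectedStep
  open import Data.Bool.Base using (Bool; true; false; if_then_else_)
  open import Data.Nat.Base as ℕ using (ℕ; zero; suc; _<ᵇ_; _≡ᵇ_)
  import Data.Nat.Properties as ℕ
  open import Data.List.Base using (List; []; _∷_)
  open import Data.List.Relation.Unary.All as All using (All; []; _∷_)
  open import Data.Rational.Base
  open import Data.Rational.Properties
  open import Data.Rational.Solver
  open import Data.Empty using (⊥-elim)
  open import Data.Sum.Base using (inj₁; inj₂)
  open import Relation.Binary.PropositionalEquality hiding (J)
  open import Relation.Nullary using (yes; no; ¬_)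
  open +-*-Solver using (solve; _:=_; _:+_; _:*_; _:-_; :-_; con)
  open State

  <⇒≱ : ∀ {a b} → a < b → ¬ b ≤ a
  <⇒≱ p q = <-irrefl refl (<-≤-trans p q)

  ^-mono-< : ∀ {a b} n → 0ℚ ≤ a → a < b → a ^ suc n < b ^ suc n
  ^-mono-< {a} {b} n 0≤a a<b = ≤-<-trans (*-monoʳ 0≤a (^-mono n 0≤a (<⇒≤ a<b)))
    (*-monoˡ-<-pos (b ^ n) {{positive (0<^ n)}} a<b)
    where
    0<b : 0ℚ < b
    0<b = ≤-<-trans 0≤a a<b
    0<^ : ∀ n → 0ℚ < b ^ n
    0<^ zero    = positive⁻¹ 1ℚ
    0<^ (suc n) = subst (_< b * b ^ n) (*-zeroʳ b) (*-monoʳ-<-pos b {{positive 0<b}} (0<^ n))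

  ^-cancel-≤ : ∀ {a b} n → 0ℚ ≤ b → a ^ suc n ≤ b ^ suc n → a ≤ b
  ^-cancel-≤ {a} {b} n 0≤b h with a ≤? b
  ... | yes p = p
  ... | no ¬p = ⊥-elim (<⇒≱ (^-mono-< n 0≤b (≰⇒> ¬p)) h)

  ^-+ : ∀ a m n → a ^ (m ℕ.+ n) ≡ a ^ m * a ^ n
  ^-+ a zero    n = sym (*-identityˡ _)
  ^-+ a (suc m) n = trans (cong (a *_) (^-+ a m n)) (sym (*-assoc a (a ^ m) (a ^ n)))

  ^-^ : ∀ a m n → a ^ (m ℕ.* n) ≡ (a ^ n) ^ m
  ^-^ a zero    n = refl
  ^-^ a (suc m) n = trans (^-+ a n (m ℕ.* n)) (cong (a ^ n *_) (^-^ a m n))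

  ½^*2^ : ∀ n → ½ ^ n * 2ℚ ^ n ≡ 1ℚ
  ½^*2^ n = trans (sym (^-* ½ 2ℚ n)) (^-one n)

  2^-cancel-≤ : ∀ m n → 2ℚ ^ m ≤ 2ℚ ^ n → m ℕ.≤ n
  2^-cancel-≤ zero    n       h = ℕ.z≤n
  2^-cancel-≤ (suc m) zero    h = ⊥-elim (<⇒≱ (<-≤-trans
    (toWitnessTrue) (subst (_≤ 2ℚ * 2ℚ ^ m) (*-identityʳ 2ℚ) (*-monoʳ (nonNegative⁻¹ 2ℚ) (1≤^ m (by-difference 1ℚ 0≤1 refl))))) h)
    where
    toWitnessTrue : 1ℚ < 2ℚ
    toWitnessTrue = subst (_< 2ℚ) (+-identityˡ 1ℚ) (+-monoˡ-< 1ℚ (positive⁻¹ 1ℚ))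
  2^-cancel-≤ (suc m) (suc n) h = ℕ.s≤s (2^-cancel-≤ m n (*-cancelˡ-≤-pos 2ℚ h))

  ∏-drop : ∀ {f : ℕ → ℚ} {t} m → t ℕ.≤ m → (∀ i → 1ℚ ≤ f i) → ∏ t f ≤ ∏ m f
  ∏-drop {f} {t} m t≤m 1≤f with ℕ.m≤n⇒m<n∨m≡n t≤m
  ... | inj₂ refl = ≤-refl
  ∏-drop {f} {t} (suc m) t≤m 1≤f | inj₁ t<m = ≤-trans (∏-drop m (ℕ.s≤s⁻¹ t<m) 1≤f)
    (subst (_≤ ∏ m f * f m) (*-identityʳ _) (*-monoʳ (∏-nonneg m (λ i _ → ≤-trans 0≤1 (1≤f i))) (1≤f m)))

  ∏-count : ∀ (P : ℕ → Bool) a n → ∏ n (λ i → if P i then a else 1ℚ) ≡ a ^ count n P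
  ∏-count P a zero    = refl
  ∏-count P a (suc n) with P n
  ... | true  = trans (cong (_* a) (∏-count P a n)) (*-comm _ a)
  ... | false = trans (*-identityʳ _) (∏-count P a n)

  sumL : {A : Set} → (A → ℚ) → List A → ℚ
  sumL f []       = 0ℚ
  sumL f (x ∷ xs) = f x + sumL f xs

  sumL-mono : {A : Set} {f g : A → ℚ} (xs : List A) → All (λ x → f x ≤ g x) xs → sumL f xs ≤ sumL g xs
  sumL-mono []       []       = ≤-refl
  sumL-mono (x ∷ xs) (p ∷ ps) = +-mono-≤ p (sumL-mono xs ps)

  sumL-nonneg : {A : Set} {f : A → ℚ} (xs : List A) → (∀ x → 0ℚ ≤ f x) → 0ℚ ≤ sumL f xs
  sumL-nonneg []       p = ≤-refl
  sumL-nonneg (x ∷ xs) p = 0≤+ (p x) (sumL-nonneg xs p)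

  sumL-*ˡ : {A : Set} (r : ℚ) (f : A → ℚ) (xs : List A) → sumL (λ x → r * f x) xs ≡ r * sumL f xs
  sumL-*ˡ r f []       = sym (*-zeroʳ r)
  sumL-*ˡ r f (x ∷ xs) = trans (cong (r * f x +_) (sumL-*ˡ r f xs)) (sym (*-distribˡ-+ r (f x) (sumL f xs)))

  -- A spec asks for at most bound chosen vertices in set; exponent is the power of 1 + x in its potential UP.
  record Spec : Set where
    constructor spec
    field
      set      : ℕ → Bool
      exponent : ℕ
      bound    : ℕ
  open Spec

  module Descent (back : ℕ → ℕ → Bool) (back-< : ∀ {w u} → back w u ≡ true → u ℕ.< w) (m : ℕ)
      (p : ℚ) (0≤p : 0ℚ ≤ p) (e₀ : ℕ) (Sq : ℚ) (pγ≤1 : p * 2ℚ ^ e₀ ≤ 1ℚ) (1≤Sq : 1ℚ ≤ Sq) where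

    γ x̄ : ℚ
    γ = 2ℚ ^ e₀
    x̄ = p * γ

    1≤γ : 1ℚ ≤ γ
    1≤γ = 1≤^ e₀ (by-difference 1ℚ 0≤1 refl)

    open Expectation back back-< m x̄ γ Sq pγ≤1 1≤γ 1≤Sq

    -- The first argument of `V` is the number of steps still to come. It lets an estimate carry the
    -- errors of these steps in advance, so that it never increases in the mean.
    Step : (ℕ → ℕ → State → ℚ) → Set
    Step V = ∀ j t s → t ℕ.< m → Bounded t s →
      x s t * V j (suc t) (take t s) + (1ℚ - x s t) * V j (suc t) (skip t s) ≤ V (suc j) t s

    step-+ : ∀ V W → Step V → Step W → Step (λ j t s → V j t s + W j t s)
    step-+ V W hV hW j t s l b = ≤-trans (≤-reflexive
      (solve 5 (λ x v v′ w w′ → x :* (v :+ w) :+ (con 1ℚ :- x) :* (v′ :+ w′)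
        := (x :* v :+ (con 1ℚ :- x) :* v′) :+ (x :* w :+ (con 1ℚ :- x) :* w′)) refl
        (x s t) (V j (suc t) (take t s)) (V j (suc t) (skip t s)) (W j (suc t) (take t s)) (W j (suc t) (skip t s))))
      (+-mono-≤ (hV j t s l b) (hW j t s l b))

    step-* : ∀ r V → 0ℚ ≤ r → Step V → Step (λ j t s → r * V j t s)
    step-* r V 0≤r hV j t s l b = ≤-trans (≤-reflexive
      (solve 4 (λ x v v′ r → x :* (r :* v) :+ (con 1ℚ :- x) :* (r :* v′) := r :* (x :* v :+ (con 1ℚ :- x) :* v′)) refl
        (x s t) (V j (suc t) (take t s)) (V j (suc t) (skip t s)) r))
      (*-monoʳ 0≤r (hV j t s l b))

    step-0 : Step (λ _ _ _ → 0ℚ)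
    step-0 j t s _ _ = ≤-reflexive (solve 1 (λ x → x :* con 0ℚ :+ (con 1ℚ :- x) :* con 0ℚ := con 0ℚ) refl (x s t))

    step-sumL : {A : Set} (V : A → ℕ → ℕ → State → ℚ) (xs : List A) → All (λ a → Step (V a)) xs →
                Step (λ j t s → sumL (λ a → V a j t s) xs)
    step-sumL V []       []       = step-0
    step-sumL V (a ∷ xs) (q ∷ qs) = step-+ (V a) (λ j t s → sumL (λ a → V a j t s) xs) q (step-sumL V xs qs)

    step-∑ : (V : ℕ → ℕ → ℕ → State → ℚ) (n : ℕ) → (∀ u → Step (V u)) → Step (λ j t s → ∑ n (λ u → V u j t s))
    step-∑ V zero    q = step-0
    step-∑ V (suc n) q = step-+ (λ j t s → ∑ n (λ u → V u j t s)) (V n) (step-∑ V n q) (q n)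

    -- The product of the factors 1 + error over the `j` steps from `t` on. Multiplied by it, a
    -- potential that satisfies `Super` becomes a `Step`.
    slack : (ℕ → Bool) → ℕ → ℕ → ℚ
    slack Z zero    t = 1ℚ
    slack Z (suc j) t = slack Z j (suc t) * (1ℚ + error Z t)

    0≤K : 0ℚ ≤ K
    0≤K = 0≤* (nonNegative⁻¹ 3ℚ) (0≤* (0≤* (0≤* 0≤x̄′ (0≤* 0≤x̄′ 0≤x̄′)) (0≤* 0≤Sq′ 0≤Sq′)) (≤-trans 0≤1 1≤γ))
      where
      0≤x̄′ : 0ℚ ≤ x̄
      0≤x̄′ = 0≤* 0≤p (≤-trans 0≤1 1≤γ)
      0≤Sq′ : 0ℚ ≤ Sq
      0≤Sq′ = ≤-trans 0≤1 1≤Sq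

    0≤error : ∀ Z t → 0ℚ ≤ error Z t
    0≤error Z t = 0≤* 0≤K (0≤* (0≤ι (hits Z t)) (0≤ι (hits Z t)))

    1≤slack : ∀ Z j t → 1ℚ ≤ slack Z j t
    1≤slack Z zero    t = ≤-refl
    1≤slack Z (suc j) t = subst (_≤ slack Z j (suc t) * (1ℚ + error Z t)) (*-identityʳ 1ℚ)
      (*-mono 0≤1 (≤-trans 0≤1 (1≤slack Z j (suc t))) (1≤slack Z j (suc t)) (by-difference (error Z t) (0≤error Z t) refl))

    step-slack : ∀ Z V → (∀ t s → t ℕ.< m → Bounded t s → Super V (error Z t) t s) →
                 Step (λ j t s → slack Z j t * V t s)
    step-slack Z V h j t s l b = ≤-trans (≤-reflexive
      (solve 4 (λ x v v′ r → x :* (r :* v) :+ (con 1ℚ :- x) :* (r :* v′) := r :* (x :* v :+ (con 1ℚ :- x) :* v′)) refl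
        (x s t) (V (suc t) (take t s)) (V (suc t) (skip t s)) (slack Z j (suc t))))
      (≤-trans (*-monoʳ (≤-trans 0≤1 (1≤slack Z j (suc t))) (h t s l b))
        (≤-reflexive (sym (*-assoc (slack Z j (suc t)) _ _))))

    -- An upper bound for the conditional probability that u is chosen.
    marginal : ℕ → ℕ → State → ℚ
    marginal u t s = if u <ᵇ t then (if c s u then 1ℚ else 0ℚ) else x s u

    step-marginal : ∀ u → Step (λ _ → marginal u)
    step-marginal u j t s l b with u ℕ.≟ t
    ... | yes refl rewrite ≡ᵇ-refl u | <ᵇ-true (ℕ.n<1+n u) | <ᵇ-false (ℕ.≤-refl {u}) =
      ≤-reflexive (solve 1 (λ x → x :* con 1ℚ :+ (con 1ℚ :- x) :* con 0ℚ := x) refl (x s u))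
    ... | no u≢t rewrite ≡ᵇ-false u≢t | <ᵇ-suc u≢t with u <ᵇ t in eq
    ...   | true = ≤-reflexive (solve 2 (λ x v → x :* v :+ (con 1ℚ :- x) :* v := v) refl (x s t) (if c s u then 1ℚ else 0ℚ))
    ...   | false with back u t
    ...     | false = ≤-reflexive (solve 2 (λ x v → x :* v :+ (con 1ℚ :- x) :* v := v) refl (x s t) (x s u))
    -- A neighbour of `t` stays alive with probability 1 - x and then gains the factor 1 + x, so the
    -- mean loses the proportion x².
    ...     | true  = by-difference (x s t * x s t * x s u) (0≤* (0≤* (x≥0 t) (x≥0 t)) (x≥0 u))
      (solve 2 (λ x v → x :* con 0ℚ :+ (con 1ℚ :- x) :* (v :* (con 1ℚ :+ x)) :+ x :* x :* v := v) refl (x s t) (x s u))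
      where open Bounded b

    module UP (z : Spec) = Potential (λ y b → (1ℚ + y) ^ exponent z * (if b then 2ℚ else 1ℚ))
                                     (λ y → (1ℚ + y) ^ suc (exponent z)) (^-one (suc (exponent z))) m (set z)
    module LP (Z : ℕ → Bool) = Potential (λ _ b → if b then ½ else 1ℚ) (λ y → 1ℚ - ½ * y) refl m Z

    -- `growth` relies on the weights below `t` being frozen. `conflict` and `nonzero` together
    -- force independence: a vertex with a chosen back neighbour has weight 0, a chosen vertex does
    -- not. `x≤2` is crude, but it still holds in the state right after a spec has ceased to be
    -- light.
    record Inv (t : ℕ) (s : State) : Set where
      field
        x≥0      : ∀ w → 0ℚ ≤ x s w
        growth   : ∀ w → x s w ≤ (if w <ᵇ m then p else 0ℚ) * ∏ t (λ u → if back w u then 1ℚ + x s u else 1ℚ)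
        conflict : ∀ u w → c s u ≡ true → back w u ≡ true → x s w ≡ 0ℚ
        chosen   : ∀ u → c s u ≡ true → u ℕ.< t
        nonzero  : ∀ u → c s u ≡ true → x s u ≢ 0ℚ
        x≤2      : ∀ w → x s w ≤ 2ℚ

    initial : State
    initial = state (λ w → if w <ᵇ m then p else 0ℚ) (λ _ → false)

    0≤if : ∀ w → 0ℚ ≤ (if w <ᵇ m then p else 0ℚ)
    0≤if w with w <ᵇ m
    ... | true  = 0≤p
    ... | false = ≤-refl

    1≤2 : 1ℚ ≤ 2ℚ
    1≤2 = by-difference 1ℚ 0≤1 refl

    if≤2 : ∀ w → (if w <ᵇ m then p else 0ℚ) ≤ 2ℚ
    if≤2 w with w <ᵇ m
    ... | true  = ≤-trans (subst (_≤ x̄) (*-identityʳ p) (*-monoʳ 0≤p 1≤γ)) (≤-trans pγ≤1 1≤2)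
    ... | false = nonNegative⁻¹ 2ℚ

    inv-initial : Inv 0 initial
    inv-initial = record
      { x≥0 = 0≤if ; growth = λ w → ≤-reflexive (sym (*-identityʳ _))
      ; conflict = λ _ _ () ; chosen = λ _ () ; nonzero = λ _ () ; x≤2 = if≤2 }

    module _ {t : ℕ} {s : State} (I : Inv t s) where
      open Inv I

      no-back : ∀ {u} → u ℕ.≤ t → back u t ≡ false
      no-back {u} u≤t with back u t in eq
      ... | false = refl
      ... | true  = ⊥-elim (ℕ.<⇒≱ (back-< eq) u≤t)

      grow≥1 : ∀ w → 0ℚ ≤ ∏ t (λ u → if back w u then 1ℚ + x s u else 1ℚ)
      grow≥1 w = ∏-nonneg t λ u _ → nn u
        where
        nn : ∀ u → 0ℚ ≤ (if back w u then 1ℚ + x s u else 1ℚ)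
        nn u with back w u
        ... | true  = 0≤+ 0≤1 (x≥0 u)
        ... | false = 0≤1

      grow-take : ∀ w → ∏ t (λ u → if back w u then 1ℚ + x s u else 1ℚ) ≤
                        ∏ (suc t) (λ u → if back w u then 1ℚ + x (take t s) u else 1ℚ)
      grow-take w = subst₂ _≤_ (*-identityʳ _) (cong₂ _*_ (∏-cong t old) refl)
        (*-monoʳ (grow≥1 w) new)
        where
        old : ∀ u → u ℕ.< t → (if back w u then 1ℚ + x s u else 1ℚ) ≡ (if back w u then 1ℚ + x (take t s) u else 1ℚ)
        old u u<t rewrite no-back (ℕ.<⇒≤ u<t) = refl
        new : 1ℚ ≤ (if back w t then 1ℚ + x (take t s) t else 1ℚ)
        new rewrite no-back (ℕ.≤-refl) with back w t
        ... | true  = by-difference (x s t) (x≥0 t) refl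
        ... | false = ≤-refl

      grow-skip : ∀ w → ∏ (suc t) (λ u → if back w u then 1ℚ + x (skip t s) u else 1ℚ) ≡
        ∏ t (λ u → if back w u then 1ℚ + x s u else 1ℚ) * (if back w t then 1ℚ + x s t else 1ℚ)
      grow-skip w = cong₂ _*_ (∏-cong t old) new
        where
        old : ∀ u → u ℕ.< t → (if back w u then 1ℚ + x (skip t s) u else 1ℚ) ≡ (if back w u then 1ℚ + x s u else 1ℚ)
        old u u<t rewrite no-back (ℕ.<⇒≤ u<t) = refl
        new : (if back w t then 1ℚ + x (skip t s) t else 1ℚ) ≡ (if back w t then 1ℚ + x s t else 1ℚ)
        new rewrite no-back (ℕ.≤-refl) = refl

      inv-take : x s t ≢ 0ℚ → Inv (suc t) (take t s)
      inv-take x≢0 = record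
        { x≥0 = nn ; growth = gr ; conflict = co ; chosen = ch ; nonzero = nz ; x≤2 = ub }
        where
        nn : ∀ w → 0ℚ ≤ x (take t s) w
        nn w with back w t
        ... | true  = ≤-refl
        ... | false = x≥0 w
        gr : ∀ w → x (take t s) w ≤ (if w <ᵇ m then p else 0ℚ) *
             ∏ (suc t) (λ u → if back w u then 1ℚ + x (take t s) u else 1ℚ)
        gr w = ≤-trans below (≤-trans (growth w) (*-monoʳ (0≤if w) (grow-take w)))
          where
          below : x (take t s) w ≤ x s w
          below with back w t
          ... | true  = x≥0 w
          ... | false = ≤-refl
        co : ∀ u w → c (take t s) u ≡ true → back w u ≡ true → x (take t s) w ≡ 0ℚ
        co u w cu bw with u ℕ.≟ t
        ... | yes refl rewrite bw = refl
        ... | no u≢t rewrite ≡ᵇ-false u≢t with back w t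
        ...   | true  = refl
        ...   | false = conflict u w cu bw
        ch : ∀ u → c (take t s) u ≡ true → u ℕ.< suc t
        ch u cu with u ℕ.≟ t
        ... | yes refl = ℕ.n<1+n u
        ... | no u≢t rewrite ≡ᵇ-false u≢t = ℕ.m<n⇒m<1+n (chosen u cu)
        nz : ∀ u → c (take t s) u ≡ true → x (take t s) u ≢ 0ℚ
        nz u cu with u ℕ.≟ t
        ... | yes refl rewrite no-back (ℕ.≤-refl) = x≢0
        ... | no u≢t rewrite ≡ᵇ-false u≢t | no-back (ℕ.<⇒≤ (chosen u cu)) = nonzero u cu
        ub : ∀ w → x (take t s) w ≤ 2ℚ
        ub w with back w t
        ... | true  = nonNegative⁻¹ 2ℚ
        ... | false = x≤2 w

      inv-skip : (∀ w → x s w ≤ 1ℚ) → Inv (suc t) (skip t s)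
      inv-skip x≤1 = record
        { x≥0 = nn ; growth = gr ; conflict = co ; chosen = ch ; nonzero = nz ; x≤2 = ub }
        where
        nn : ∀ w → 0ℚ ≤ x (skip t s) w
        nn w with back w t
        ... | true  = 0≤* (x≥0 w) (0≤+ 0≤1 (x≥0 t))
        ... | false = x≥0 w
        gr : ∀ w → x (skip t s) w ≤ (if w <ᵇ m then p else 0ℚ) *
             ∏ (suc t) (λ u → if back w u then 1ℚ + x (skip t s) u else 1ℚ)
        gr w rewrite grow-skip w with back w t
        ... | true  = subst (x s w * (1ℚ + x s t) ≤_) (*-assoc (if w <ᵇ m then p else 0ℚ) _ _)
                        (*-monoˡ (0≤+ 0≤1 (x≥0 t)) (growth w))
        ... | false = ≤-trans (growth w) (*-monoʳ (0≤if w) (≤-reflexive (sym (*-identityʳ _))))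
        co : ∀ u w → c (skip t s) u ≡ true → back w u ≡ true → x (skip t s) w ≡ 0ℚ
        co u w cu bw with u ≡ᵇ t
        co u w () bw | true
        ... | false with back w t
        ...   | true  = trans (cong (_* (1ℚ + x s t)) (conflict u w cu bw)) (*-zeroˡ (1ℚ + x s t))
        ...   | false = conflict u w cu bw
        ch : ∀ u → c (skip t s) u ≡ true → u ℕ.< suc t
        ch u cu with u ≡ᵇ t
        ch u () | true
        ... | false = ℕ.m<n⇒m<1+n (chosen u cu)
        nz : ∀ u → c (skip t s) u ≡ true → x (skip t s) u ≢ 0ℚ
        nz u cu with u ≡ᵇ t
        nz u () | true
        ... | false rewrite no-back (ℕ.<⇒≤ (chosen u cu)) = nonzero u cu
        ub : ∀ w → x (skip t s) w ≤ 2ℚ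
        ub w with back w t
        ... | true  = *-mono (0≤+ 0≤1 (x≥0 t)) 0≤1 (x≤1 w) (+-mono-≤ (≤-refl {1ℚ}) (x≤1 t))
        ... | false = x≤2 w

-- Derandomised choice of an independent set.

module RandomIndependentSet where
  open RationalArithmetic
  open Process
  open ExpectedStep
  open Descents
  open import Data.Bool.Base using (Bool; true; false; if_then_else_; _∧_)
  open import Data.Bool.Properties using (∧-zeroʳ)
  open import Data.Nat.Base as ℕ using (ℕ; zero; suc; _<ᵇ_; _≡ᵇ_)
  import Data.Nat.Properties as ℕ
  open import Data.List.Base using (List; []; _∷_)
  open import Data.List.Relation.Unary.All as All using (All; []; _∷_)
  open import Data.List.Membership.Propositional using (_∈_)
  open import Data.Rational.Base
  open import Data.Rational.Properties
  open import Data.Rational.Solver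
  open import Data.Empty using (⊥-elim)
  open import Data.Product using (_×_; _,_; proj₁; proj₂; Σ-syntax)
  open import Data.Sum.Base using (_⊎_; inj₁; inj₂)
  open import Relation.Binary.PropositionalEquality hiding (J)
  open import Relation.Nullary using (yes; no)
  open +-*-Solver using (solve; _:=_; _:+_; _:*_; _:-_; :-_; con)
  open State
  open Spec

  count-cong : ∀ {P Q : ℕ → Bool} n → (∀ i → i ℕ.< n → P i ≡ Q i) → count n P ≡ count n Q
  count-cong zero    e = refl
  count-cong {P} {Q} (suc n) e rewrite e n ℕ.≤-refl | count-cong {P} {Q} n (λ i l → e i (ℕ.m<n⇒m<1+n l)) = refl

  count-false : ∀ n → count n (λ _ → false) ≡ 0
  count-false zero    = refl
  count-false (suc n) = count-false n

  -- The basic move of the method of conditional expectations: one of two outcomes is at most the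
  -- mean. Taking is offered only for a non-zero weight, as `inv-take` demands.
  convex-choice : ∀ {x a b c} → 0ℚ ≤ x → x ≤ 1ℚ → x * a + (1ℚ - x) * b ≤ c → (x ≢ 0ℚ × a ≤ c) ⊎ b ≤ c
  convex-choice {x} {a} {b} {c} 0≤x x≤1 h with x ≟ 0ℚ
  ... | yes refl = inj₂ (subst (_≤ c) (solve 2 (λ a b → con 0ℚ :* a :+ (con 1ℚ :- con 0ℚ) :* b := b) refl a b) h)
  ... | no x≢0 with ≤-total a b
  ...   | inj₁ a≤b = inj₁ (x≢0 , ≤-trans (by-difference ((1ℚ - x) * (b - a)) (0≤* (0≤- x≤1) (0≤- a≤b))
            (solve 3 (λ x a b → a :+ (con 1ℚ :- x) :* (b :- a) := x :* a :+ (con 1ℚ :- x) :* b) refl x a b)) h)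
  ...   | inj₂ b≤a = inj₂ (≤-trans (by-difference (x * (a - b)) (0≤* 0≤x (0≤- b≤a))
            (solve 3 (λ x a b → b :+ x :* (a :- b) := x :* a :+ (con 1ℚ :- x) :* b) refl x a b)) h)

  module Choice (back : ℕ → ℕ → Bool) (back-< : ∀ {w u} → back w u ≡ true → u ℕ.< w) (m : ℕ)
      (p : ℚ) (0≤p : 0ℚ ≤ p) (e₀ : ℕ) (Sq : ℚ) (pγ≤1 : p * 2ℚ ^ e₀ ≤ 1ℚ) (1≤Sq : 1ℚ ≤ Sq) where

    open Descent back back-< m p 0≤p e₀ Sq pγ≤1 1≤Sq
    open Expectation back back-< m x̄ γ Sq pγ≤1 1≤γ 1≤Sq

    record Admissible (specs : List Spec) (I : ℕ → Bool) : Set where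
      field
        below       : ∀ u → I u ≡ true → u ℕ.< m
        independent : ∀ u w → I u ≡ true → I w ≡ true → back w u ≡ false
        few         : All (λ z → count m (λ w → set z w ∧ I w) ℕ.≤ bound z) specs

    module _ (specs : List Spec) (σ : ℕ)
      (has-back    : ∀ w → w ℕ.< m → spec (back w) (suc σ) (suc σ ℕ.* e₀) ∈ specs)
      (has-forward : ∀ t → t ℕ.< m → spec (λ w → back w t) (suc σ) (suc σ ℕ.* e₀) ∈ specs)
      (spec-σ      : All (λ z → ι (suc (exponent z)) ≤ Sq) specs)
      (spec-half   : All (λ z → ∀ t → x̄ * (Sq * (ι (hits (set z) t) * x̄)) ≤ ½) specs)
      (spec-error  : All (λ z → ∑ m (error (set z)) ≤ ½) specs)
      where

      W : Spec → ℕ → State → ℚ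
      W z = UP.potential z

      L : (ℕ → Bool) → ℕ → State → ℚ
      L Z = LP.potential Z

      -- Up to slack, `½ ^ bound z * W z t s` is the Markov bound for the event that more than
      -- `bound z` vertices of the set get chosen.
      Light : ℕ → State → Spec → Set
      Light t s z = ½ ^ bound z * W z t s ≤ 1ℚ

      module _ {t : ℕ} {s : State} (t≤m : t ℕ.≤ m) (I : Inv t s) where
        open Inv I

        value≥1 : ∀ z w → 1ℚ ≤ UP.value z t s w
        value≥1 z w with w <ᵇ t
        ... | false = 1≤^ (suc (exponent z)) (by-difference (x s w) (x≥0 w) refl)
        ... | true with c s w
        ...   | true  = *-mono 0≤1 (≤-trans 0≤1 e≥) e≥ 1≤2
          where e≥ = 1≤^ (exponent z) (by-difference (x s w) (x≥0 w) refl)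
        ...   | false = *-mono 0≤1 (≤-trans 0≤1 e≥) e≥ ≤-refl
          where e≥ = 1≤^ (exponent z) (by-difference (x s w) (x≥0 w) refl)

        factor≥1 : ∀ z w → 1ℚ ≤ UP.factor z t s w
        factor≥1 z w with set z w
        ... | true  = value≥1 z w
        ... | false = ≤-refl

        1≤W : ∀ z → 1ℚ ≤ W z t s
        1≤W z = 1≤∏ m (λ w _ → factor≥1 z w)

        0≤L : ∀ Z → 0ℚ ≤ L Z t s
        0≤L Z = ∏-nonneg m nn
          where
          nn : ∀ w → w ℕ.< m → 0ℚ ≤ LP.factor Z t s w
          nn w _ with Z w
          ... | false = 0≤1
          ... | true with w <ᵇ t
          ...   | false = 0≤- (*-monoʳ 0≤½ (x≤2 w))
          ...   | true with c s w
          ...     | true  = 0≤½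
          ...     | false = 0≤1

        grown : ∀ w σ g → (∏ t (λ u → if back w u then 1ℚ + x s u else 1ℚ)) ^ σ ≤ W (spec (back w) σ g) t s
        grown w σ g = subst (_≤ W z t s) (∏-^ (λ u → if back w u then 1ℚ + x s u else 1ℚ) σ t)
          (≤-trans (∏-mono t (λ u _ → ^-nonneg σ (≤-trans 0≤1 (grow≥ u))) below)
                   (∏-drop m t≤m (factor≥1 z)))
          where
          z = spec (back w) σ g
          grow≥ : ∀ u → 1ℚ ≤ (if back w u then 1ℚ + x s u else 1ℚ)
          grow≥ u with back w u
          ... | true  = by-difference (x s u) (x≥0 u) refl
          ... | false = ≤-refl
          below : ∀ u → u ℕ.< t → (if back w u then 1ℚ + x s u else 1ℚ) ^ σ ≤ UP.factor z t s u
          below u u<t rewrite <ᵇ-true u<t with back w u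
          ... | false = ≤-reflexive (^-one σ)
          ... | true with c s u
          ...   | true  = subst (_≤ (1ℚ + x s u) ^ σ * 2ℚ) (*-identityʳ _)
                            (*-monoʳ (^-nonneg σ (0≤+ 0≤1 (x≥0 u))) 1≤2)
          ...   | false = ≤-reflexive (sym (*-identityʳ _))

        forward-grown : ∀ σ g → (∏ m (λ w → 1ℚ + affected (λ _ → true) t s w)) ^ suc σ ≤ W (spec (λ w → back w t) σ g) t s
        forward-grown σ g = subst (_≤ W z t s) (∏-^ (λ w → 1ℚ + affected (λ _ → true) t s w) (suc σ) m)
          (∏-mono m (λ w _ → ^-nonneg (suc σ) (nn w)) below)
          where
          z = spec (λ w → back w t) σ g
          nn : ∀ w → 0ℚ ≤ 1ℚ + affected (λ _ → true) t s w
          nn w with back w t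
          ... | true  = 0≤+ 0≤1 (x≥0 w)
          ... | false = 0≤1
          below : ∀ w → w ℕ.< m → (1ℚ + affected (λ _ → true) t s w) ^ suc σ ≤ UP.factor z t s w
          below w _ with back w t in eq
          ... | true rewrite <ᵇ-false (ℕ.<⇒≤ (back-< eq)) = ≤-refl
          ... | false = ≤-reflexive (^-one (suc σ))

        light⇒ : ∀ z → Light t s z → W z t s ≤ 2ℚ ^ bound z
        light⇒ z h = subst₂ _≤_
          (trans (sym (*-assoc (2ℚ ^ bound z) (½ ^ bound z) (W z t s)))
            (trans (cong (_* W z t s) (trans (*-comm (2ℚ ^ bound z) (½ ^ bound z)) (½^*2^ (bound z)))) (*-identityˡ _)))
          (*-identityʳ _) (*-monoʳ (^-nonneg (bound z) (nonNegative⁻¹ 2ℚ)) h)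

        -- Lightness of `back w` bounds the growth of the weight of `w` by γ; lightness of the
        -- forward neighbourhood of `t` bounds the product over the neighbours of `t`. Both come
        -- from extracting roots, as the bounds of these specs are multiples of `e₀` and γ = 2 ^ e₀.
        bounded : t ℕ.< m → All (Light t s) specs → Bounded t s
        bounded t<m light = record { x≥0 = x≥0 ; x≤x̄ = x≤ ; ∏≤G = G≤ }
          where
          x≤ : ∀ w → x s w ≤ x̄
          x≤ w with w <ᵇ m in eq | growth w
          ... | false | g = ≤-trans g (≤-trans (≤-reflexive (*-zeroˡ (∏ t (λ u → if back w u then 1ℚ + x s u else 1ℚ)))) (0≤* 0≤p (≤-trans 0≤1 1≤γ)))
          ... | true  | g = ≤-trans g (*-monoʳ 0≤p (^-cancel-≤ σ (≤-trans 0≤1 1≤γ)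
            (≤-trans (grown w (suc σ) (suc σ ℕ.* e₀)) (subst (W (spec (back w) (suc σ) (suc σ ℕ.* e₀)) t s ≤_) (^-^ 2ℚ (suc σ) e₀)
              (light⇒ (spec (back w) (suc σ) (suc σ ℕ.* e₀)) (All.lookup light (has-back w (<ᵇ-true⁻ eq))))))))
          G≤ : ∏ m (λ w → 1ℚ + affected (λ _ → true) t s w) ≤ γ
          G≤ = ^-cancel-≤ (suc σ) (≤-trans 0≤1 1≤γ) (≤-trans (forward-grown (suc σ) (suc σ ℕ.* e₀))
            (≤-trans (light⇒ (spec (λ w → back w t) (suc σ) (suc σ ℕ.* e₀)) (All.lookup light (has-forward t t<m)))
              (subst₂ _≤_ (trans (*-identityˡ _) (sym (^-^ 2ℚ (suc σ) e₀))) refl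
                (*-monoˡ (^-nonneg (suc σ) (≤-trans 0≤1 1≤γ)) 1≤γ))))

      -- Bounds the conditional probability that some spec will cease to be light; it is at least 1
      -- when that has happened.
      dead : ℕ → ℕ → State → ℚ
      dead j t s = sumL (λ z → ½ ^ bound z * (slack (set z) j t * W z t s)) specs

      module _ {j t : ℕ} {s : State} (t≤m : t ℕ.≤ m) (I : Inv t s) where

        summand≥0 : ∀ z → 0ℚ ≤ ½ ^ bound z * (slack (set z) j t * W z t s)
        summand≥0 z = 0≤* (^-nonneg (bound z) 0≤½) (0≤* (≤-trans 0≤1 (1≤slack (set z) j t)) (≤-trans 0≤1 (1≤W t≤m I z)))

        dead≥0 : 0ℚ ≤ dead j t s
        dead≥0 = sumL-nonneg specs summand≥0

        light-or-dead : All (Light t s) specs ⊎ 1ℚ ≤ dead j t s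
        light-or-dead = go specs
          where
          go : ∀ zs → All (Light t s) zs ⊎ 1ℚ ≤ sumL (λ z → ½ ^ bound z * (slack (set z) j t * W z t s)) zs
          go [] = inj₁ []
          go (z ∷ zs) with ≤-total (½ ^ bound z * W z t s) 1ℚ
          ... | inj₂ h = inj₂ (≤-trans h (≤-trans
            (*-monoʳ (^-nonneg (bound z) 0≤½) (subst (_≤ slack (set z) j t * W z t s) (*-identityˡ _)
              (*-monoˡ (≤-trans 0≤1 (1≤W t≤m I z)) (1≤slack (set z) j t))))
            (subst (_≤ sumL (λ z → ½ ^ bound z * (slack (set z) j t * W z t s)) (z ∷ zs)) (+-identityʳ _) (+-mono-≤ (≤-refl {½ ^ bound z * (slack (set z) j t * W z t s)}) (sumL-nonneg zs summand≥0)))))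
          ... | inj₁ h with go zs
          ...   | inj₁ hs = inj₁ (h ∷ hs)
          ...   | inj₂ hs = inj₂ (≤-trans hs (subst (_≤ sumL (λ z → ½ ^ bound z * (slack (set z) j t * W z t s)) (z ∷ zs)) (+-identityˡ _) (+-mono-≤ (summand≥0 z) (≤-refl {sumL (λ z → ½ ^ bound z * (slack (set z) j t * W z t s)) zs}))))

      step-dead : Step dead
      step-dead = step-sumL (λ z j t s → ½ ^ bound z * (slack (set z) j t * W z t s)) specs
        (All.tabulate λ {z} z∈ → step-* (½ ^ bound z) (λ j t s → slack (set z) j t * W z t s) (^-nonneg (bound z) 0≤½)
          (step-slack (set z) (W z) λ t s t<m B →
            Upper.super t<m B (set z) (exponent z) (All.lookup spec-σ z∈) (All.lookup spec-half z∈ t)))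

      module _ (A : ℕ → ℚ) (A≥0 : ∀ u → 0ℚ ≤ A u)
               (targets : List (ℚ × (ℕ → Bool))) (a≥0 : All (λ a → 0ℚ ≤ proj₁ a) targets) where

        -- Estimates for the linear and the exponential part of `objective`. Every target gets its
        -- own summand `dead`, because giving up costs it ½ ^ 0 = 1.
        V₁ V₂ V : ℕ → ℕ → State → ℚ
        V₁ j t s = ∑ m (λ u → A u * marginal u t s)
        V₂ j t s = sumL (λ (a , X) → a * (slack X j t * L X t s + dead j t s)) targets
        V  j t s = V₁ j t s + V₂ j t s

        objective : (ℕ → Bool) → ℚ
        objective I = ∑ m (λ u → A u * (if I u then 1ℚ else 0ℚ))
                    + sumL (λ (a , X) → a * ½ ^ count m (λ w → X w ∧ I w)) targets

        step-V : Step V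
        step-V = step-+ V₁ V₂
          (step-∑ (λ u _ t s → A u * marginal u t s) m λ u → step-* (A u) (λ _ → marginal u) (A≥0 u) (step-marginal u))
          (step-sumL (λ (a , X) j t s → a * (slack X j t * L X t s + dead j t s)) targets
            (All.map (λ { {a , X} 0≤a → step-* a (λ j t s → slack X j t * L X t s + dead j t s) 0≤a
              (step-+ (λ j t s → slack X j t * L X t s) dead
                (step-slack X (L X) λ t s t<m B → Lower.super t<m B X) step-dead) }) a≥0))

        descend : ∀ j t s → j ℕ.+ t ≡ m → Inv t s → Σ[ I ∈ (ℕ → Bool) ] Admissible specs I × objective I ≤ V j t s
        descend-case : ∀ j t s → j ℕ.+ t ≡ m → Inv t s → t ℕ.≤ m → All (Light t s) specs ⊎ 1ℚ ≤ dead j t s →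
                       Σ[ I ∈ (ℕ → Bool) ] Admissible specs I × objective I ≤ V j t s

        descend j t s j+t≡m I = descend-case j t s j+t≡m I t≤m (light-or-dead {j} t≤m I)
          where
          t≤m : t ℕ.≤ m
          t≤m = subst (t ℕ.≤_) j+t≡m (ℕ.m≤n+m t j)

        -- Some estimate has failed: stop with the empty set, which satisfies all specs. `dead` pays
        -- for the targets, and the linear part of the objective is 0.
        descend-case j t s j+t≡m I t≤m (inj₂ 1≤dead) = (λ _ → false) , record
            { below = λ _ () ; independent = λ _ _ ()
            ; few = All.universal (λ z → subst (ℕ._≤ bound z) (sym (none (set z))) ℕ.z≤n) specs } ,
          +-mono-≤ (∑-mono m (λ u _ → *-monoʳ (A≥0 u) (marg≥0 u)))
            (sumL-mono targets (All.map (λ { {a , X} 0≤a → *-monoʳ 0≤a (subst (λ n → ½ ^ n ≤ slack X j t * L X t s + dead j t s) (sym (none X))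
              (subst (_≤ slack X j t * L X t s + dead j t s) (+-identityˡ 1ℚ)
                (+-mono-≤ (0≤* (≤-trans 0≤1 (1≤slack X j t)) (0≤L t≤m I X)) 1≤dead))) }) a≥0))
          where
          none : ∀ X → count m (λ w → X w ∧ false) ≡ 0
          none X = trans (count-cong m (λ i _ → ∧-zeroʳ (X i))) (count-false m)
          marg≥0 : ∀ u → 0ℚ ≤ marginal u t s
          marg≥0 u with u <ᵇ t
          ... | false = Inv.x≥0 I u
          ... | true with c s u
          ...   | true  = 0≤1
          ...   | false = ≤-refl
        -- All vertices are decided. The potential of a spec is now at least 2 to the number of
        -- chosen vertices in its set, so lightness is the required bound.
        descend-case zero t s refl I t≤m (inj₁ light) = c s , record
            { below = Inv.chosen I ; independent = indep ; few = All.map (λ {z} → few z) light } ,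
          +-mono-≤ (∑-mono m (λ u u<m → *-monoʳ (A≥0 u) (≤-reflexive (marg u u<m))))
            (sumL-mono targets (All.map (λ { {a , X} 0≤a → *-monoʳ 0≤a
              (subst (_≤ 1ℚ * L X t s + dead 0 t s) (trans (+-identityʳ _) (trans (*-identityˡ _) (final X)))
                (+-mono-≤ (≤-refl {1ℚ * L X t s}) (dead≥0 {0} t≤m I))) }) a≥0))
          where
          indep : ∀ u w → c s u ≡ true → c s w ≡ true → back w u ≡ false
          indep u w cu cw with back w u in eq
          ... | false = refl
          ... | true  = ⊥-elim (Inv.nonzero I w cw (Inv.conflict I u w cu eq))
          marg : ∀ u → u ℕ.< m → (if c s u then 1ℚ else 0ℚ) ≡ marginal u m s
          marg u u<m rewrite <ᵇ-true u<m = refl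
          final : ∀ X → L X m s ≡ ½ ^ count m (λ w → X w ∧ c s w)
          final X = trans (∏-cong m eq) (∏-count (λ w → X w ∧ c s w) ½ m)
            where
            eq : ∀ w → w ℕ.< m → LP.factor X m s w ≡ (if X w ∧ c s w then ½ else 1ℚ)
            eq w w<m rewrite <ᵇ-true w<m with X w
            ... | true  = refl
            ... | false = refl
          few : ∀ z → Light m s z → count m (λ w → set z w ∧ c s w) ℕ.≤ bound z
          few z h = 2^-cancel-≤ _ (bound z) (≤-trans (subst (_≤ W z m s) (∏-count (λ w → set z w ∧ c s w) 2ℚ m)
            (∏-mono m (λ w _ → nn w) below)) (light⇒ t≤m I z h))
            where
            nn : ∀ w → 0ℚ ≤ (if set z w ∧ c s w then 2ℚ else 1ℚ)
            nn w with set z w ∧ c s w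
            ... | true  = nonNegative⁻¹ 2ℚ
            ... | false = 0≤1
            below : ∀ w → w ℕ.< m → (if set z w ∧ c s w then 2ℚ else 1ℚ) ≤ UP.factor z m s w
            below w w<m rewrite <ᵇ-true w<m with set z w
            ... | false = ≤-refl
            ... | true = subst (_≤ (1ℚ + x s w) ^ exponent z * (if c s w then 2ℚ else 1ℚ)) (*-identityˡ _)
              (*-monoˡ nn′ (1≤^ (exponent z) (by-difference (x s w) (Inv.x≥0 I w) refl)))
              where
              nn′ : 0ℚ ≤ (if c s w then 2ℚ else 1ℚ)
              nn′ with c s w
              ... | true  = nonNegative⁻¹ 2ℚ
              ... | false = 0≤1
        descend-case (suc j) t s j+t≡m I t≤m (inj₁ light) =
          branch (convex-choice (Inv.x≥0 I t) (≤-trans (Bounded.x≤x̄ B t) pγ≤1) (step-V j t s t<m B))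
          where
          t<m : t ℕ.< m
          t<m = subst (t ℕ.<_) j+t≡m (ℕ.s≤s (ℕ.m≤n+m t j))
          B : Bounded t s
          B = bounded t≤m I t<m light
          Goal : ℚ → Set
          Goal v = Σ[ I ∈ (ℕ → Bool) ] Admissible specs I × objective I ≤ v
          weaken : ∀ {v w} → v ≤ w → Goal v → Goal w
          weaken v≤w (R , adm , le) = R , adm , ≤-trans le v≤w
          branch : (x s t ≢ 0ℚ × V j (suc t) (take t s) ≤ V (suc j) t s) ⊎ V j (suc t) (skip t s) ≤ V (suc j) t s →
                   Goal (V (suc j) t s)
          branch (inj₁ (x≢0 , h)) = weaken h (descend j (suc t) (take t s) (trans (ℕ.+-suc j t) j+t≡m) (inv-take I x≢0))
          branch (inj₂ h) = weaken h (descend j (suc t) (skip t s) (trans (ℕ.+-suc j t) j+t≡m)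
                                       (inv-skip I (λ w → ≤-trans (Bounded.x≤x̄ B w) pγ≤1)))

        errors : (ℕ → Bool) → ℕ → ℕ → ℚ
        errors Z zero    t = 0ℚ
        errors Z (suc j) t = errors Z j (suc t) + error Z t

        errors-∑ : ∀ Z j t → errors Z j t + ∑ t (error Z) ≡ ∑ (j ℕ.+ t) (error Z)
        errors-∑ Z zero    t = +-identityˡ _
        errors-∑ Z (suc j) t = trans
          (solve 3 (λ a b c → a :+ b :+ c := a :+ (c :+ b)) refl (errors Z j (suc t)) (error Z t) (∑ t (error Z)))
          (trans (errors-∑ Z j (suc t)) (cong (λ n → ∑ n (error Z)) (ℕ.+-suc j t)))

        -- This is ∏ (1 + e) ≤ 1 / (1 - ∑ e) without division; a total error of at most ½ then gives
        -- slack at most 2.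
        slack*[1-errors]≤1 : ∀ Z j t → slack Z j t * (1ℚ - errors Z j t) ≤ 1ℚ
        slack*[1-errors]≤1 Z zero    t = ≤-refl
        slack*[1-errors]≤1 Z (suc j) t = ≤-trans (by-difference
            (slack Z j (suc t) * (error Z t * (errors Z j (suc t) + error Z t)))
            (0≤* (≤-trans 0≤1 (1≤slack Z j (suc t))) (0≤* (0≤error Z t) (0≤+ (errors≥0 j (suc t)) (0≤error Z t))))
            (solve 3 (λ s e r → s :* (con 1ℚ :+ e) :* (con 1ℚ :- (r :+ e)) :+ s :* (e :* (r :+ e)) := s :* (con 1ℚ :- r)) refl
              (slack Z j (suc t)) (error Z t) (errors Z j (suc t))))
          (slack*[1-errors]≤1 Z j (suc t))
          where
          errors≥0 : ∀ j t → 0ℚ ≤ errors Z j t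
          errors≥0 zero    t = ≤-refl
          errors≥0 (suc j) t = 0≤+ (errors≥0 j (suc t)) (0≤error Z t)

        slack≤2 : ∀ Z → ∑ m (error Z) ≤ ½ → slack Z m 0 ≤ 2ℚ
        slack≤2 Z h = D≤2 {y = errors Z m 0} (≤-trans 0≤1 (1≤slack Z m 0)) (subst (_≤ ½)
          (sym (trans (sym (+-identityʳ (errors Z m 0))) (trans (errors-∑ Z m 0) (cong (λ n → ∑ n (error Z)) (ℕ.+-identityʳ m))))) h)
          (slack*[1-errors]≤1 Z m 0)

        W-initial : ∀ z → W z 0 initial ≡ ((1ℚ + p) ^ suc (exponent z)) ^ count m (set z)
        W-initial z = trans (∏-cong m eq) (∏-count (set z) ((1ℚ + p) ^ suc (exponent z)) m)
          where
          eq : ∀ w → w ℕ.< m → UP.factor z 0 initial w ≡ (if set z w then (1ℚ + p) ^ suc (exponent z) else 1ℚ)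
          eq w w<m rewrite <ᵇ-true w<m = refl

        L-initial : ∀ X → L X 0 initial ≡ (1ℚ - ½ * p) ^ count m X
        L-initial X = trans (∏-cong m eq) (∏-count X (1ℚ - ½ * p) m)
          where
          eq : ∀ w → w ℕ.< m → LP.factor X 0 initial w ≡ (if X w then 1ℚ - ½ * p else 1ℚ)
          eq w w<m rewrite <ᵇ-true w<m = refl

        -- `ρ` bounds the mean factor by which a target shrinks: slack times the moment (1 - p / 2)
        -- ^ k of a k-set, plus the failure probabilities of all specs. The objective is a weighted
        -- sum, so a single set serves all targets in the aggregate.
        choose : ∀ (k : ℕ) (ρ : ℚ) →
          All (λ a → count m (proj₂ a) ≡ k × ∑ m (error (proj₂ a)) ≤ ½) targets →
          2ℚ * (1ℚ - ½ * p) ^ k + sumL (λ z → ½ ^ bound z * (2ℚ * ((1ℚ + p) ^ suc (exponent z)) ^ count m (set z))) specs ≤ ρ →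
          Σ[ I ∈ (ℕ → Bool) ] Admissible specs I × objective I ≤ p * ∑ m A + ρ * sumL proj₁ targets
        choose k ρ good hρ with I , adm , le ← descend m 0 initial (ℕ.+-identityʳ m) inv-initial =
          I , adm , ≤-trans le (+-mono-≤
            (subst (V₁ m 0 initial ≤_) (∑-*ˡ p A m) (∑-mono m λ u u<m → ≤-reflexive (marg u u<m)))
            (subst (V₂ m 0 initial ≤_) (sumL-*ˡ ρ proj₁ targets)
              (sumL-mono targets (All.zipWith (λ { {a , X} (0≤a , size , err) →
                subst (a * (slack X m 0 * L X 0 initial + dead m 0 initial) ≤_) (*-comm a ρ) (*-monoʳ 0≤a (≤-trans (+-mono-≤
                  (subst (λ l → slack X m 0 * l ≤ 2ℚ * (1ℚ - ½ * p) ^ k) (sym (trans (L-initial X) (cong ((1ℚ - ½ * p) ^_) size)))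
                    (*-monoˡ (^-nonneg k (0≤- ½p≤1)) (slack≤2 X err)))
                  (sumL-mono specs (All.map (λ {z} e → *-monoʳ (^-nonneg (bound z) 0≤½)
                    (subst (λ w → slack (set z) m 0 * w ≤ 2ℚ * ((1ℚ + p) ^ suc (exponent z)) ^ count m (set z)) (sym (W-initial z))
                      (*-monoˡ (^-nonneg (count m (set z)) (^-nonneg (suc (exponent z)) (0≤+ 0≤1 0≤p))) (slack≤2 (set z) e)))) spec-error)))
                  hρ)) }) (a≥0 , good)))))
          where
          marg : ∀ u → u ℕ.< m → A u * marginal u 0 initial ≡ p * A u
          marg u u<m rewrite <ᵇ-true u<m = *-comm (A u) p
          ½p≤1 : ½ * p ≤ 1ℚ
          ½p≤1 = ≤-trans (*-monoʳ 0≤½ (≤-trans (subst (_≤ x̄) (*-identityʳ p) (*-monoʳ 0≤p 1≤γ)) pγ≤1)) (by-difference ½ 0≤½ refl)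

-- Finite sums, counting, and a second moment bound from codegrees.

module Sums where
  open ExpectedStep using (count)
  open Process using (≡ᵇ-refl; ≡ᵇ-true⁻)
  open import Data.Bool.Base using (Bool; true; false; if_then_else_; _∧_)
  open import Data.Nat.Base
  open import Data.Nat.Properties
  open import Data.Nat.Tactic.RingSolver using (solve-∀)
  open import Relation.Binary.PropositionalEquality hiding ([_])
  open import Data.Empty using (⊥-elim)
  open import Relation.Nullary using (yes; no)

  sum< : ℕ → (ℕ → ℕ) → ℕ
  sum< zero    f = 0
  sum< (suc n) f = sum< n f + f n

  𝟙[_] : Bool → ℕ
  𝟙[ b ] = if b then 1 else 0

  []≤1 : ∀ b → 𝟙[ b ] ≤ 1
  []≤1 true  = ≤-refl
  []≤1 false = z≤n

  sum<-cong : ∀ {f g : ℕ → ℕ} n → (∀ i → i < n → f i ≡ g i) → sum< n f ≡ sum< n g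
  sum<-cong zero    e = refl
  sum<-cong (suc n) e = cong₂ _+_ (sum<-cong n (λ i l → e i (m<n⇒m<1+n l))) (e n ≤-refl)

  sum<-mono : ∀ {f g : ℕ → ℕ} n → (∀ i → i < n → f i ≤ g i) → sum< n f ≤ sum< n g
  sum<-mono zero    e = z≤n
  sum<-mono (suc n) e = +-mono-≤ (sum<-mono n (λ i l → e i (m<n⇒m<1+n l))) (e n ≤-refl)

  sum<-+ : ∀ f g n → sum< n (λ i → f i + g i) ≡ sum< n f + sum< n g
  sum<-+ f g zero    = refl
  sum<-+ f g (suc n) = trans (cong (_+ (f n + g n)) (sum<-+ f g n)) (lemma (sum< n f) (sum< n g) (f n) (g n))
    where
    lemma : ∀ a b c d → (a + b) + (c + d) ≡ (a + c) + (b + d)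
    lemma = solve-∀

  sum<-*ˡ : ∀ r f n → sum< n (λ i → r * f i) ≡ r * sum< n f
  sum<-*ˡ r f zero    = sym (*-zeroʳ r)
  sum<-*ˡ r f (suc n) = trans (cong (_+ r * f n) (sum<-*ˡ r f n)) (sym (*-distribˡ-+ r (sum< n f) (f n)))

  sum<-*ʳ : ∀ r f n → sum< n (λ i → f i * r) ≡ sum< n f * r
  sum<-*ʳ r f n = trans (sum<-cong n (λ i _ → *-comm (f i) r)) (trans (sum<-*ˡ r f n) (*-comm r (sum< n f)))

  sum<-const : ∀ r n → sum< n (λ _ → r) ≡ n * r
  sum<-const r zero    = refl
  sum<-const r (suc n) = trans (cong (_+ r) (sum<-const r n)) (+-comm (n * r) r)

  sum<-zero : ∀ n → sum< n (λ _ → 0) ≡ 0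
  sum<-zero n = trans (sum<-const 0 n) (*-zeroʳ n)

  sum<-swap : ∀ (f : ℕ → ℕ → ℕ) m n → sum< m (λ i → sum< n (f i)) ≡ sum< n (λ j → sum< m (λ i → f i j))
  sum<-swap f zero    n = sym (sum<-zero n)
  sum<-swap f (suc m) n = trans (cong (_+ sum< n (f m)) (sum<-swap f m n)) (sym (sum<-+ (λ j → sum< m (λ i → f i j)) (f m) n))

  sum<-split : ∀ f m n → sum< (m + n) f ≡ sum< m f + sum< n (λ i → f (m + i))
  sum<-split f m zero    rewrite +-identityʳ m = sym (+-identityʳ _)
  sum<-split f m (suc n) rewrite +-suc m n = trans (cong (_+ f (m + n)) (sum<-split f m n)) (+-assoc (sum< m f) _ _)

  sum<-grid : ∀ f m n → sum< (m * n) f ≡ sum< m (λ i → sum< n (λ j → f (i * n + j)))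
  sum<-grid f zero    n = refl
  sum<-grid f (suc m) n = trans (cong (λ l → sum< l f) (+-comm n (m * n)))
    (trans (sum<-split f (m * n) n) (cong (_+ sum< n (λ j → f (m * n + j))) (sum<-grid f m n)))

  sum<-extend : ∀ f {m n} → m ≤ n → sum< m f ≤ sum< n f
  sum<-extend f {m} {n} m≤n rewrite sym (m+[n∸m]≡n m≤n) | sum<-split f m (n ∸ m) = m≤m+n _ _

  count≡sum : ∀ P n → count n P ≡ sum< n (λ i → 𝟙[ P i ])
  count≡sum P zero    = refl
  count≡sum P (suc n) with P n
  ... | true  = trans (cong suc (count≡sum P n)) (+-comm 1 _)
  ... | false = trans (count≡sum P n) (sym (+-identityʳ _))

  [∧] : ∀ a b → 𝟙[ a ∧ b ] ≡ 𝟙[ a ] * 𝟙[ b ]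
  [∧] true  b = sym (+-identityʳ _)
  [∧] false b = refl

  count-mono : ∀ {P Q : ℕ → Bool} n → (∀ i → i < n → P i ≡ true → Q i ≡ true) → count n P ≤ count n Q
  count-mono zero    h = z≤n
  count-mono {P} {Q} (suc n) h with P n in eq
  ... | false = ≤-trans (count-mono {P} {Q} n (λ i l → h i (m<n⇒m<1+n l))) step
    where
    step : count n Q ≤ count (suc n) Q
    step with Q n
    ... | true  = n≤1+n _
    ... | false = ≤-refl
  ... | true rewrite h n ≤-refl eq = s≤s (count-mono {P} {Q} n (λ i l → h i (m<n⇒m<1+n l)))

  count≤ : ∀ P n → count n P ≤ n
  count≤ P zero    = z≤n
  count≤ P (suc n) with P n
  ... | true  = s≤s (count≤ P n)
  ... | false = m≤n⇒m≤1+n (count≤ P n)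

  -- The second moment of the hits counts pairs with a common back neighbour.
  second-moment : ∀ (R : ℕ → ℕ → Bool) (Z : ℕ → Bool) m Δ κ →
    (∀ w → w < m → count m (R w) ≤ Δ) →
    (∀ w w′ → w < m → w′ < m → w ≢ w′ → count m (λ t → R w t ∧ R w′ t) ≤ κ) →
    sum< m (λ t → count m (λ w → Z w ∧ R w t) * count m (λ w → Z w ∧ R w t))
      ≤ count m Z * (Δ + count m Z * κ)
  second-moment R Z m Δ κ deg codeg = begin
    sum< m (λ t → h t * h t)
      ≡⟨ sum<-cong m (λ t _ → square t) ⟩
    sum< m (λ t → sum< m (λ w → sum< m (λ w′ → z w * r w t * (z w′ * r w′ t))))
      ≡⟨ sum<-swap (λ t w → sum< m (λ w′ → z w * r w t * (z w′ * r w′ t))) m m ⟩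
    sum< m (λ w → sum< m (λ t → sum< m (λ w′ → z w * r w t * (z w′ * r w′ t))))
      ≡⟨ sum<-cong m (λ w _ → sum<-swap (λ t w′ → z w * r w t * (z w′ * r w′ t)) m m) ⟩
    sum< m (λ w → sum< m (λ w′ → sum< m (λ t → z w * r w t * (z w′ * r w′ t))))
      ≤⟨ sum<-mono m (λ w w<m → row w w<m) ⟩
    sum< m (λ w → z w * (Δ + count m Z * κ))
      ≡⟨ trans (sum<-*ʳ _ z m) (cong (_* (Δ + count m Z * κ)) (sym (count≡sum Z m))) ⟩
    count m Z * (Δ + count m Z * κ) ∎
    where
    open ≤-Reasoning
    z : ℕ → ℕ
    z w = 𝟙[ Z w ]
    r : ℕ → ℕ → ℕ
    r w t = 𝟙[ R w t ]
    h : ℕ → ℕ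
    h t = count m (λ w → Z w ∧ R w t)
    h≡ : ∀ t → h t ≡ sum< m (λ w → z w * r w t)
    h≡ t = trans (count≡sum _ m) (sum<-cong m (λ w _ → [∧] (Z w) (R w t)))
    square : ∀ t → h t * h t ≡ sum< m (λ w → sum< m (λ w′ → z w * r w t * (z w′ * r w′ t)))
    square t = trans (cong₂ _*_ (h≡ t) (h≡ t))
      (trans (sym (sum<-*ʳ (sum< m (λ w → z w * r w t)) (λ w → z w * r w t) m))
        (sum<-cong m (λ w _ → sym (sum<-*ˡ (z w * r w t) (λ w′ → z w′ * r w′ t) m))))
    rearrange : ∀ a b c d → a * b * (c * d) ≡ a * c * (b * d)
    rearrange = solve-∀
    pair : ∀ w w′ → sum< m (λ t → z w * r w t * (z w′ * r w′ t)) ≡ z w * z w′ * count m (λ t → R w t ∧ R w′ t)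
    pair w w′ = trans (sum<-cong m (λ t _ → trans (rearrange (z w) (r w t) (z w′) (r w′ t)) (cong (z w * z w′ *_) (sym ([∧] (R w t) (R w′ t))))))
      (trans (sum<-*ˡ (z w * z w′) (λ t → 𝟙[ R w t ∧ R w′ t ]) m) (cong (z w * z w′ *_) (sym (count≡sum _ m))))
    cell : ∀ w → w < m → ∀ w′ → w′ < m →
           sum< m (λ t → z w * r w t * (z w′ * r w′ t)) ≤ z w * (𝟙[ w ≡ᵇ w′ ] * Δ + z w′ * κ)
    cell w w<m w′ w′<m = ≤-trans (≤-reflexive (trans (pair w w′) (*-assoc (z w) (z w′) _)))
      (*-monoʳ-≤ (z w) bnd)
      where
      bnd : z w′ * count m (λ t → R w t ∧ R w′ t) ≤ 𝟙[ w ≡ᵇ w′ ] * Δ + z w′ * κ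
      bnd with w ≟ w′
      ... | no w≢w′ = ≤-trans (*-monoʳ-≤ (z w′) (codeg w w′ w<m w′<m w≢w′)) (m≤n+m _ _)
      ... | yes refl rewrite ≡ᵇ-refl w = ≤-trans (*-mono-≤ ([]≤1 (Z w)) (≤-trans
            (count-mono m (λ t _ → fst (R w t))) (deg w w<m))) (m≤m+n _ _)
        where
        fst : ∀ a → a ∧ a ≡ true → a ≡ true
        fst true _ = refl
    off : ∀ k n → n ≤ k → sum< n (λ w′ → 𝟙[ k ≡ᵇ w′ ]) ≡ 0
    off k zero    _ = refl
    off k (suc n) l with k ≡ᵇ n in e
    ... | false = trans (+-identityʳ _) (off k n (<⇒≤ l))
    ... | true  = ⊥-elim (<-irrefl (sym (≡ᵇ-true⁻ {k} e)) l)
    diagonal : ∀ w n → sum< n (λ w′ → 𝟙[ w ≡ᵇ w′ ]) ≤ 1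
    diagonal w zero    = z≤n
    diagonal w (suc n) with w ≡ᵇ n in eq
    ... | false = subst (_≤ 1) (sym (+-identityʳ _)) (diagonal w n)
    ... | true rewrite ≡ᵇ-true⁻ {w} eq | off n n ≤-refl = ≤-refl
    row : ∀ w → w < m → sum< m (λ w′ → sum< m (λ t → z w * r w t * (z w′ * r w′ t))) ≤ z w * (Δ + count m Z * κ)
    row w w<m = begin
      sum< m (λ w′ → sum< m (λ t → z w * r w t * (z w′ * r w′ t)))
        ≤⟨ sum<-mono m (cell w w<m) ⟩
      sum< m (λ w′ → z w * (𝟙[ w ≡ᵇ w′ ] * Δ + z w′ * κ))
        ≡⟨ trans (sum<-*ˡ (z w) _ m) (cong (z w *_) (sum<-+ (λ w′ → 𝟙[ w ≡ᵇ w′ ] * Δ) (λ w′ → z w′ * κ) m)) ⟩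
      z w * (sum< m (λ w′ → 𝟙[ w ≡ᵇ w′ ] * Δ) + sum< m (λ w′ → z w′ * κ))
        ≡⟨ cong (z w *_) (cong₂ _+_ (sum<-*ʳ Δ (λ w′ → 𝟙[ w ≡ᵇ w′ ]) m) (trans (sum<-*ʳ κ z m) (cong (_* κ) (sym (count≡sum Z m))))) ⟩
      z w * (sum< m (λ w′ → 𝟙[ w ≡ᵇ w′ ]) * Δ + count m Z * κ)
        ≤⟨ *-monoʳ-≤ (z w) (+-monoˡ-≤ _ (≤-trans (*-monoˡ-≤ Δ (diagonal w m)) (≤-reflexive (*-identityˡ Δ)))) ⟩
      z w * (Δ + count m Z * κ) ∎

-- Transfer between natural and rational sums, and blocks of consecutive vertices.

module Ranges where
  open RationalArithmetic
  open Process
  open ExpectedStep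
  open Descents
  open RandomIndependentSet
  open Sums
  open import Data.Bool.Base using (Bool; true; false; _∧_; not)
  open import Data.Bool.Properties using (∧-zeroʳ)
  open import Data.Nat.Base as ℕ using (ℕ; zero; suc; _<ᵇ_; _≡ᵇ_; _∸_)
  import Data.Nat.Properties as ℕ
  open import Data.List.Base using (List; []; _∷_; _++_)
  open import Data.List.Relation.Unary.All as All using (All; []; _∷_)
  open import Data.List.Relation.Unary.Any using (here; there)
  open import Data.List.Membership.Propositional using (_∈_)
  open import Data.Rational.Base
  open import Data.Rational.Properties
  open import Data.Rational.Solver
  open import Data.Sum.Base using (inj₁; inj₂)
  open import Relation.Binary.PropositionalEquality hiding (J; [_])
  open import Relation.Nullary using (yes; no)
  open +-*-Solver using (solve; _:=_; _:+_; _:*_; con)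
  open Spec

  ι-+ : ∀ m n → ι (m ℕ.+ n) ≡ ι m + ι n
  ι-+ zero    n = sym (+-identityˡ _)
  ι-+ (suc m) n = trans (cong (1ℚ +_) (ι-+ m n)) (sym (+-assoc 1ℚ (ι m) (ι n)))

  ι-* : ∀ m n → ι (m ℕ.* n) ≡ ι m * ι n
  ι-* zero    n = sym (*-zeroˡ (ι n))
  ι-* (suc m) n = trans (ι-+ n (m ℕ.* n)) (trans (cong (ι n +_) (ι-* m n))
    (solve 2 (λ a b → b :+ a :* b := (con 1ℚ :+ a) :* b) refl (ι m) (ι n)))

  ι-mono : ∀ {m n} → m ℕ.≤ n → ι m ≤ ι n
  ι-mono {n = n} ℕ.z≤n = 0≤ι n
  ι-mono (ℕ.s≤s m≤n) = +-mono-≤ (≤-refl {1ℚ}) (ι-mono m≤n)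

  ∑-ι : ∀ f n → ∑ n (λ i → ι (f i)) ≡ ι (sum< n f)
  ∑-ι f zero    = refl
  ∑-ι f (suc n) = trans (cong (_+ ι (f n)) (∑-ι f n)) (sym (ι-+ (sum< n f) (f n)))

  ∑-const : ∀ r n → ∑ n (λ _ → r) ≡ ι n * r
  ∑-const r zero    = sym (*-zeroˡ r)
  ∑-const r (suc n) = trans (cong (_+ r) (∑-const r n)) (solve 2 (λ a r → a :* r :+ r := (con 1ℚ :+ a) :* r) refl (ι n) r)

  ∑-truncate : ∀ {f : ℕ → ℚ} {m} n → m ℕ.≤ n → (∀ i → m ℕ.≤ i → f i ≡ 0ℚ) → ∑ n f ≡ ∑ m f
  ∑-truncate {f} {m} n m≤n z with ℕ.m≤n⇒m<n∨m≡n m≤n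
  ... | inj₂ refl = refl
  ∑-truncate {f} {m} (suc n) m≤n z | inj₁ m<n = trans (cong₂ _+_ (∑-truncate n (ℕ.s≤s⁻¹ m<n) z) (z n (ℕ.s≤s⁻¹ m<n))) (+-identityʳ _)

  term≤∑ : ∀ {f : ℕ → ℚ} n i → i ℕ.< n → (∀ j → 0ℚ ≤ f j) → f i ≤ ∑ n f
  term≤∑ {f} (suc n) i i<n p with i ℕ.≟ n
  ... | yes refl = subst (_≤ ∑ n f + f n) (+-identityˡ _) (+-mono-≤ (∑-nonneg n (λ j _ → p j)) (≤-refl {f n}))
  ... | no i≢n   = subst (_≤ ∑ n f + f n) (+-identityʳ _) (+-mono-≤ (term≤∑ n i (ℕ.≤∧≢⇒< (ℕ.s≤s⁻¹ i<n) i≢n) p) (p n))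

  ∑-extend : ∀ {f : ℕ → ℚ} {m} n → m ℕ.≤ n → (∀ j → 0ℚ ≤ f j) → ∑ m f ≤ ∑ n f
  ∑-extend {f} {m} n m≤n p with ℕ.m≤n⇒m<n∨m≡n m≤n
  ... | inj₂ refl = ≤-refl
  ∑-extend {f} {m} (suc n) m≤n p | inj₁ m<n = subst (_≤ ∑ n f + f n) (+-identityʳ _) (+-mono-≤ (∑-extend n (ℕ.s≤s⁻¹ m<n) p) (p n))

  sum<-extend-zero : ∀ {f : ℕ → ℕ} m d → (∀ i → m ℕ.≤ i → f i ≡ 0) → sum< (m ℕ.+ d) f ≡ sum< m f
  sum<-extend-zero {f} m d z = trans (sum<-split f m d)
    (trans (cong (sum< m f ℕ.+_) (trans (sum<-cong d (λ i _ → z (m ℕ.+ i) (ℕ.m≤m+n m i))) (sum<-zero d))) (ℕ.+-identityʳ _))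

  rangeL : {A : Set} → (ℕ → A) → ℕ → List A
  rangeL f zero    = []
  rangeL f (suc n) = f n ∷ rangeL f n

  ∈-rangeL : {A : Set} (f : ℕ → A) {n i : ℕ} → i ℕ.< n → f i ∈ rangeL f n
  ∈-rangeL f {suc n} {i} i<n with i ℕ.≟ n
  ... | yes refl = here refl
  ... | no i≢n   = there (∈-rangeL f (ℕ.≤∧≢⇒< (ℕ.s≤s⁻¹ i<n) i≢n))

  all-rangeL : {A : Set} {P : A → Set} (f : ℕ → A) (n : ℕ) → (∀ i → i ℕ.< n → P (f i)) → All P (rangeL f n)
  all-rangeL f zero    h = []
  all-rangeL f (suc n) h = h n ℕ.≤-refl ∷ all-rangeL f n (λ i l → h i (ℕ.m<n⇒m<1+n l))

  sumL-rangeL : {A : Set} (g : A → ℚ) (f : ℕ → A) (n : ℕ) → sumL g (rangeL f n) ≡ ∑ n (λ i → g (f i))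
  sumL-rangeL g f zero    = refl
  sumL-rangeL g f (suc n) = trans (cong (g (f n) +_) (sumL-rangeL g f n)) (+-comm (g (f n)) _)

  sumL-++ : {A : Set} (g : A → ℚ) (xs ys : List A) → sumL g (xs ++ ys) ≡ sumL g xs + sumL g ys
  sumL-++ g []       ys = sym (+-identityˡ _)
  sumL-++ g (x ∷ xs) ys = trans (cong (g x +_) (sumL-++ g xs ys)) (sym (+-assoc (g x) _ _))

  term≤sumL : {A : Set} (g : A → ℚ) {xs : List A} {x : A} → (∀ x → 0ℚ ≤ g x) → x ∈ xs → g x ≤ sumL g xs
  term≤sumL g {y ∷ xs} p (here refl) = subst (_≤ g y + sumL g xs) (+-identityʳ _) (+-mono-≤ (≤-refl {g y}) (sumL-nonneg xs p))
  term≤sumL g {y ∷ xs} p (there q)   = subst (_≤ g y + sumL g xs) (+-identityˡ _) (+-mono-≤ (p y) (term≤sumL g p q))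

  -- The degree of a new vertex is controlled on intervals of length `k` separately, because the
  -- total error is only shown to be small for sets of at most `k` vertices.
  module Blocks (k : ℕ) where
    block : ℕ → ℕ → Bool
    block i w = not (w <ᵇ i ℕ.* k) ∧ (w <ᵇ i ℕ.* k ℕ.+ k)

    block-total : ∀ i (P : ℕ → Bool) n → count n (λ w → block i w ∧ P w) ℕ.≤ sum< k (λ j → 𝟙[ P (i ℕ.* k ℕ.+ j) ])
    block-total′ : ∀ i (P : ℕ → Bool) n → (∀ w → n ℕ.≤ w → P w ≡ false) →
                   sum< k (λ j → 𝟙[ P (i ℕ.* k ℕ.+ j) ]) ℕ.≤ count n (λ w → block i w ∧ P w)

    module _ (i : ℕ) (P : ℕ → Bool) (n : ℕ) where
      a = i ℕ.* k
      g : ℕ → ℕ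
      g w = 𝟙[ block i w ∧ P w ]
      low : ∀ w → w ℕ.< a → g w ≡ 0
      low w w<a rewrite <ᵇ-true w<a = refl
      high : ∀ w → a ℕ.+ k ℕ.≤ w → g w ≡ 0
      high w h rewrite <ᵇ-false h | ∧-zeroʳ (not (w <ᵇ i ℕ.* k)) = refl
      mid : ∀ j → j ℕ.< k → g (a ℕ.+ j) ≡ 𝟙[ P (a ℕ.+ j) ]
      mid j j<k rewrite <ᵇ-false (ℕ.m≤m+n a j) | <ᵇ-true (ℕ.+-monoʳ-< a j<k) = refl
      whole : sum< (a ℕ.+ k ℕ.+ n) g ≡ sum< k (λ j → 𝟙[ P (a ℕ.+ j) ])
      whole = trans (sum<-extend-zero (a ℕ.+ k) n high) (trans (sum<-split g a k)
        (cong₂ ℕ._+_ (trans (sum<-cong a low) (sum<-zero a)) (sum<-cong k mid)))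

    block-total i P n = subst₂ ℕ._≤_ (sym (count≡sum _ n)) (whole i P n) (sum<-extend (g i P n) (ℕ.m≤n+m n (i ℕ.* k ℕ.+ k)))
    block-total′ i P n z = ℕ.≤-reflexive (trans (sym (whole i P n)) (trans (cong (λ l → sum< l (g i P n)) (ℕ.+-comm _ n))
      (trans (sum<-extend-zero n (i ℕ.* k ℕ.+ k) (λ w n≤w → cong 𝟙[_] (trans (cong (block i w ∧_) (z w n≤w)) (∧-zeroʳ _))))
        (sym (count≡sum _ n)))))

    count-block≤ : ∀ i n → count n (block i) ℕ.≤ k
    count-block≤ i n = ℕ.≤-trans (ℕ.≤-reflexive (count-cong n (λ w _ → sym (∧true (block i w)))))
      (ℕ.≤-trans (block-total i (λ _ → true) n) (ℕ.≤-reflexive (trans (sum<-const 1 k) (ℕ.*-identityʳ k))))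
      where
      ∧true : ∀ b → b ∧ true ≡ b
      ∧true true  = refl
      ∧true false = refl

    count-blocks : ∀ (I : ℕ → Bool) n nb c → n ℕ.≤ nb ℕ.* k → (∀ w → n ℕ.≤ w → I w ≡ false) →
      (∀ i → i ℕ.< nb → count n (λ w → block i w ∧ I w) ℕ.≤ c) → count n I ℕ.≤ nb ℕ.* c
    count-blocks I n nb c n≤ z h = ℕ.≤-trans (ℕ.≤-reflexive (count≡sum I n))
      (ℕ.≤-trans (sum<-extend (λ w → 𝟙[ I w ]) n≤) (ℕ.≤-trans (ℕ.≤-reflexive (sum<-grid (λ w → 𝟙[ I w ]) nb k))
        (ℕ.≤-trans (sum<-mono nb (λ i l → ℕ.≤-trans (block-total′ i I n z) (h i l))) (ℕ.≤-reflexive (sum<-const c nb)))))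

-- Vertex-by-vertex construction of the triangle-free graph.

module SequentialGraph where
  open RationalArithmetic
  open Process
  open ExpectedStep
  open Descents
  open RandomIndependentSet
  open Sums
  open Ranges
  open import Data.Bool.Base using (Bool; true; false; if_then_else_; _∧_)
  open import Data.Bool.Properties using (∧-comm)
  open import Data.Nat.Base as ℕ using (ℕ; zero; suc; _<ᵇ_; _≡ᵇ_; _∸_)
  import Data.Nat.Properties as ℕ
  open import Data.List.Base using (List; []; _∷_; _++_)
  open import Data.List.Relation.Unary.All as All using (All; []; _∷_)
  import Data.List.Relation.Unary.All.Properties as All
  open import Data.List.Membership.Propositional using (_∈_)
  open import Data.List.Membership.Propositional.Properties using (∈-++⁺ˡ; ∈-++⁺ʳ)
  open import Data.Rational.Base
  open import Data.Rational.Properties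
  open import Data.Rational.Solver
  open import Data.Empty using (⊥-elim)
  open import Data.Product using (_×_; _,_; proj₁; proj₂; Σ-syntax; ∃-syntax)
  open import Relation.Binary.PropositionalEquality hiding (J; [_])
  open import Relation.Nullary using (yes; no)
  open +-*-Solver using (solve; _:=_; _:+_; _:*_; con)
  open Spec

  degree : (ℕ → ℕ → Bool) → ℕ → ℕ → ℕ
  degree back v u = count v (λ w → back w u)

  edges : (ℕ → ℕ → Bool) → ℕ → (ℕ → Bool) → (ℕ → Bool) → ℕ
  edges back v X Y = sum< v (λ w → if Y w then count w (λ u → X u ∧ back w u) else 0)

  insert : ℕ → (ℕ → Bool) → (ℕ → ℕ → Bool) → ℕ → ℕ → Bool
  insert v I back w u = if w ≡ᵇ v then I u else back w u

  insert-new : ∀ v I back u → insert v I back v u ≡ I u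
  insert-new v I back u rewrite ≡ᵇ-refl v = refl

  insert-old : ∀ {w} v I back u → w ≢ v → insert v I back w u ≡ back w u
  insert-old v I back u w≢v rewrite ≡ᵇ-false w≢v = refl

  ∸-suc : ∀ {m n} → m ℕ.< n → n ∸ m ≡ suc (n ∸ suc m)
  ∸-suc {zero}  {suc n} _         = refl
  ∸-suc {suc m} {suc n} (ℕ.s≤s l) = ∸-suc l

  record TriangleFree (back : ℕ → ℕ → Bool) : Set where
    field
      back-<   : ∀ {w u} → back w u ≡ true → u ℕ.< w
      triangle : ∀ w u u′ → back w u ≡ true → back w u′ ≡ true → back u′ u ≡ false

  Pair : Set
  Pair = (ℕ → Bool) × (ℕ → Bool)

  -- `half` and `small-error` keep the errors of the process of second order, `ρ≥` is the
  -- requirement of `choose`, and `start` is the union bound over forward degrees and all pairs.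
  module Sequential
    (p ρ Sq : ℚ) (e₀ σ k Δ T nb g E₀ : ℕ)
    (0≤p : 0ℚ ≤ p) (0≤ρ : 0ℚ ≤ ρ) (pγ≤1 : p * 2ℚ ^ e₀ ≤ 1ℚ) (1≤Sq : 1ℚ ≤ Sq) (Sq≥ : ι (suc (suc σ)) ≤ Sq)
    (half : p * 2ℚ ^ e₀ * (Sq * (ι Δ * (p * 2ℚ ^ e₀))) ≤ ½)
    (small-error : 3ℚ * (p * 2ℚ ^ e₀ * (p * 2ℚ ^ e₀ * (p * 2ℚ ^ e₀)) * (Sq * Sq) * 2ℚ ^ e₀)
                   * ι (k ℕ.* (Δ ℕ.+ k ℕ.* (suc σ ℕ.* e₀))) ≤ ½)
    (Δ≤k : Δ ℕ.≤ k) (T≤ : T ℕ.≤ nb ℕ.* k) (nb*g≤Δ : nb ℕ.* g ℕ.≤ Δ)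
    (ρ≥ : 2ℚ * (1ℚ - ½ * p) ^ k
          + ((ι T * (½ ^ (suc σ ℕ.* e₀) * (2ℚ * ((1ℚ + p) ^ suc (suc σ)) ^ Δ))
            + ι T * (½ ^ (suc σ ℕ.* e₀) * (2ℚ * ((1ℚ + p) ^ suc (suc σ)) ^ Δ)))
            + ι nb * (½ ^ g * (2ℚ * ((1ℚ + p) ^ 1) ^ k))) ≤ ρ)
    (𝒬 : List Pair)
    (good : All (λ q → count T (proj₂ q) ≡ k × (∀ v → v ℕ.< T → proj₂ q v ≡ true → count v (proj₁ q) ≡ k)) 𝒬)
    (start : ½ ^ Δ * (ι T * (1ℚ + p) ^ T) + sumL (λ _ → 2ℚ ^ E₀ * ρ ^ k) 𝒬 < 1ℚ)
    where

    open Blocks k using (block; count-block≤; count-blocks)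

    κ : ℕ
    κ = suc σ ℕ.* e₀

    1≤1+p : 1ℚ ≤ 1ℚ + p
    1≤1+p = by-difference p 0≤p refl

    0≤2 : 0ℚ ≤ 2ℚ
    0≤2 = nonNegative⁻¹ 2ℚ

    degree-term : (ℕ → ℕ → Bool) → ℕ → ℕ → ℚ
    degree-term back v u = ½ ^ Δ * (2ℚ ^ degree back v u * (1ℚ + p) ^ (T ∸ v))

    pair-term : (ℕ → ℕ → Bool) → ℕ → Pair → ℚ
    pair-term back v (X , Y) = 2ℚ ^ E₀ * (½ ^ edges back v X Y * ρ ^ (k ∸ count v Y))

    -- A pessimistic estimator for the number of failures: at the end a forward degree above `Δ`, or
    -- a pair with fewer than `E₀` edges, would make a summand exceed 1. Each vertex still to come
    -- is accounted for by a factor 1 + p, and by a factor `ρ` if it lies in `Y`.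
    Φ : (ℕ → ℕ → Bool) → ℕ → ℚ
    Φ back v = ∑ T (degree-term back v) + sumL (pair-term back v) 𝒬

    record Env (v : ℕ) (back : ℕ → ℕ → Bool) : Set where
      field
        free   : TriangleFree back
        top    : ∀ {w u} → back w u ≡ true → w ℕ.< v
        deg    : ∀ w → count v (back w) ℕ.≤ Δ
        codeg  : ∀ w w′ → w ≢ w′ → count v (λ u → back w u ∧ back w′ u) ℕ.≤ κ
        Φ<1    : Φ back v < 1ℚ
      open TriangleFree free public

    0≤degree-term : ∀ back v u → 0ℚ ≤ degree-term back v u
    0≤degree-term back v u = 0≤* (^-nonneg Δ 0≤½) (0≤* (^-nonneg (degree back v u) 0≤2) (^-nonneg (T ∸ v) (≤-trans 0≤1 1≤1+p)))

    0≤pair-term : ∀ back v q → 0ℚ ≤ pair-term back v q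
    0≤pair-term back v (X , Y) = 0≤* (^-nonneg E₀ 0≤2) (0≤* (^-nonneg (edges back v X Y) 0≤½) (^-nonneg (k ∸ count v Y) 0≤ρ))

    cancel-half : ∀ a b c → 0ℚ ≤ c → 1ℚ ≤ c → ½ ^ a * (2ℚ ^ b * c) < 1ℚ → b ℕ.≤ a
    cancel-half a b c 0≤c 1≤c h = 2^-cancel-≤ b a (≤-trans
      (subst (_≤ 2ℚ ^ b * c) (*-identityʳ (2ℚ ^ b)) (*-monoʳ (^-nonneg b 0≤2) 1≤c))
      (subst₂ _≤_
        (trans (sym (*-assoc (2ℚ ^ a) (½ ^ a) (2ℚ ^ b * c))) (trans (cong (_* (2ℚ ^ b * c)) (trans (*-comm (2ℚ ^ a) (½ ^ a)) (½^*2^ a))) (*-identityˡ (2ℚ ^ b * c))))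
        (*-identityʳ (2ℚ ^ a))
        (*-monoʳ (^-nonneg a 0≤2) (<⇒≤ h))))

    module _ {v : ℕ} {back : ℕ → ℕ → Bool} (E : Env v back) (v<T : v ℕ.< T) where
      open Env E

      forward : ∀ t → degree back v t ℕ.≤ Δ
      forward t with t ℕ.<? T
      ... | yes t<T = cancel-half Δ (degree back v t) ((1ℚ + p) ^ (T ∸ v)) (^-nonneg (T ∸ v) (≤-trans 0≤1 1≤1+p)) (1≤^ (T ∸ v) 1≤1+p)
        (≤-<-trans (≤-trans (term≤∑ T t t<T (0≤degree-term back v))
          (subst (_≤ Φ back v) (+-identityʳ (∑ T (degree-term back v))) (+-mono-≤ (≤-refl {∑ T (degree-term back v)}) (sumL-nonneg 𝒬 (0≤pair-term back v))))) Φ<1)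
      ... | no t≮T = subst (ℕ._≤ Δ) (sym (trans (count-cong v none) (count-false v))) ℕ.z≤n
        where
        none : ∀ w → w ℕ.< v → back w t ≡ false
        none w w<v with back w t in eq
        ... | false = refl
        ... | true  = ⊥-elim (t≮T (ℕ.<-trans (back-< eq) (ℕ.<-trans w<v v<T)))

      open Choice back back-< v p 0≤p e₀ Sq pγ≤1 1≤Sq using (Admissible; choose)
      open Descent back back-< v p 0≤p e₀ Sq pγ≤1 1≤Sq using (x̄; γ; 1≤γ; 0≤K)
      open Expectation back back-< v x̄ γ Sq pγ≤1 1≤γ 1≤Sq using (hits; error; K)

      back-spec forward-spec block-spec : ℕ → Spec
      back-spec w    = spec (back w) (suc σ) κ
      forward-spec t = spec (λ w → back w t) (suc σ) κ
      block-spec i   = spec (block i) 0 g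

      specs₁ specs₂ specs₃ specs : List Spec
      specs₁ = rangeL back-spec v
      specs₂ = rangeL forward-spec v
      specs₃ = rangeL block-spec nb
      specs = (specs₁ ++ specs₂) ++ specs₃

      all-specs : ∀ {P : Spec → Set} → (∀ w → w ℕ.< v → P (back-spec w)) → (∀ t → t ℕ.< v → P (forward-spec t)) →
                  (∀ i → i ℕ.< nb → P (block-spec i)) → All P specs
      all-specs h₁ h₂ h₃ = All.++⁺ (All.++⁺ (all-rangeL back-spec v h₁) (all-rangeL forward-spec v h₂)) (all-rangeL block-spec nb h₃)

      hits≤Δ : ∀ Z t → hits Z t ℕ.≤ Δ
      hits≤Δ Z t = ℕ.≤-trans (count-mono v (λ w _ → snd (Z w) (back w t))) (forward t)
        where
        snd : ∀ a b → a ∧ b ≡ true → b ≡ true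
        snd true b e = e

      0≤x̄₀ : 0ℚ ≤ x̄
      0≤x̄₀ = 0≤* 0≤p (≤-trans 0≤1 1≤γ)

      half′ : ∀ Z t → x̄ * (Sq * (ι (hits Z t) * x̄)) ≤ ½
      half′ Z t = ≤-trans (*-monoʳ 0≤x̄₀ (*-monoʳ (≤-trans 0≤1 1≤Sq) (*-monoˡ 0≤x̄₀ (ι-mono (hits≤Δ Z t))))) half

      error′ : ∀ Z → count v Z ℕ.≤ k → ∑ v (error Z) ≤ ½
      error′ Z Z≤k = ≤-trans (≤-reflexive (trans (∑-*ˡ K (λ t → ι (hits Z t) * ι (hits Z t)) v)
          (cong (K *_) (trans (∑-cong v (λ t _ → sym (ι-* (hits Z t) (hits Z t)))) (∑-ι (λ t → hits Z t ℕ.* hits Z t) v)))))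
        (≤-trans (*-monoʳ 0≤K (ι-mono (ℕ.≤-trans
          (second-moment back Z v Δ κ (λ w _ → deg w) (λ w w′ _ _ w≢w′ → codeg w w′ w≢w′))
          (ℕ.*-mono-≤ Z≤k (ℕ.+-monoʳ-≤ Δ (ℕ.*-monoˡ-≤ κ Z≤k)))))) small-error)

      size₁ : ∀ w → count v (back w) ℕ.≤ k
      size₁ w = ℕ.≤-trans (deg w) Δ≤k

      -- `A` and `coefficient` are terms of `Φ` after the step without the factor that depends on
      -- the new neighbourhood I. That factor is 1 + [u ∈ I] for degrees and ½ ^ |X ∩ I| for pairs
      -- with `v` in `Y`, which explains the two parts of the objective of `choose`.
      A : ℕ → ℚ
      A u = ½ ^ Δ * (2ℚ ^ degree back v u * (1ℚ + p) ^ (T ∸ suc v))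

      A≥0 : ∀ u → 0ℚ ≤ A u
      A≥0 u = 0≤* (^-nonneg Δ 0≤½) (0≤* (^-nonneg (degree back v u) 0≤2) (^-nonneg (T ∸ suc v) (≤-trans 0≤1 1≤1+p)))

      coefficient : Pair → ℚ
      coefficient (X , Y) = 2ℚ ^ E₀ * (½ ^ edges back v X Y * ρ ^ (k ∸ suc (count v Y)))

      coefficient≥0 : ∀ q → 0ℚ ≤ coefficient q
      coefficient≥0 (X , Y) = 0≤* (^-nonneg E₀ 0≤2) (0≤* (^-nonneg (edges back v X Y) 0≤½) (^-nonneg (k ∸ suc (count v Y)) 0≤ρ))

      targets : List Pair → List (ℚ × (ℕ → Bool))
      targets []            = []
      targets ((X , Y) ∷ q) = if Y v then (coefficient (X , Y) , X) ∷ targets q else targets q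

      Good : Pair → Set
      Good q = count T (proj₂ q) ≡ k × (∀ v → v ℕ.< T → proj₂ q v ≡ true → count v (proj₁ q) ≡ k)

      targets-all : ∀ {P : ℚ × (ℕ → Bool) → Set} q → All Good q → (∀ X Y → Good (X , Y) → Y v ≡ true → P (coefficient (X , Y) , X)) →
                    All P (targets q)
      targets-all []            []       h = []
      targets-all ((X , Y) ∷ q) (g ∷ gs) h with Y v in eq
      ... | true  = h X Y g eq ∷ targets-all q gs h
      ... | false = targets-all q gs h

      chosen : Σ[ I ∈ (ℕ → Bool) ] Admissible specs I ×
               ∑ v (λ u → A u * (if I u then 1ℚ else 0ℚ)) + sumL (λ a → proj₁ a * ½ ^ count v (λ w → proj₂ a w ∧ I w)) (targets 𝒬)
                 ≤ p * ∑ v A + ρ * sumL proj₁ (targets 𝒬)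
      chosen = choose specs σ
        (λ w w<v → ∈-++⁺ˡ (∈-++⁺ˡ (∈-rangeL back-spec w<v)))
        (λ t t<v → ∈-++⁺ˡ (∈-++⁺ʳ specs₁ (∈-rangeL forward-spec t<v)))
        (all-specs (λ _ _ → Sq≥) (λ _ _ → Sq≥) (λ _ _ → subst (_≤ Sq) (sym (+-identityʳ 1ℚ)) 1≤Sq))
        (all-specs (λ w _ → half′ (back w)) (λ t _ → half′ (λ w → back w t)) (λ i _ → half′ (block i)))
        (all-specs (λ w _ → error′ (back w) (size₁ w)) (λ t _ → error′ (λ w → back w t) (ℕ.≤-trans (forward t) Δ≤k))
                   (λ i _ → error′ (block i) (count-block≤ i v)))
        A A≥0 (targets 𝒬) (targets-all 𝒬 good (λ X Y _ _ → coefficient≥0 (X , Y))) k ρ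
        (targets-all 𝒬 good (λ X Y (_ , h) Yv → h v v<T Yv , error′ X (ℕ.≤-reflexive (h v v<T Yv))))
        (≤-trans (+-mono-≤ (≤-refl {2ℚ * (1ℚ - ½ * p) ^ k}) sums) ρ≥)
        where
        cost : Spec → ℚ
        cost z = ½ ^ bound z * (2ℚ * ((1ℚ + p) ^ suc (exponent z)) ^ count v (set z))
        τ : ℕ → ℕ → ℕ → ℚ
        τ b e n = ½ ^ b * (2ℚ * ((1ℚ + p) ^ suc e) ^ n)
        0≤τ : ∀ b e n → 0ℚ ≤ τ b e n
        0≤τ b e n = 0≤* (^-nonneg b 0≤½) (0≤* 0≤2 (^-nonneg n (^-nonneg (suc e) (≤-trans 0≤1 1≤1+p))))
        τ-mono : ∀ b e {n n′} → n ℕ.≤ n′ → τ b e n ≤ τ b e n′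
        τ-mono b e {n} {n′} n≤n′ = *-monoʳ (^-nonneg b 0≤½) (*-monoʳ 0≤2 (pow-mono n≤n′))
          where
          a = (1ℚ + p) ^ suc e
          1≤a : 1ℚ ≤ a
          1≤a = 1≤^ (suc e) 1≤1+p
          pow-mono : ∀ {n n′} → n ℕ.≤ n′ → a ^ n ≤ a ^ n′
          pow-mono {n′ = n′} ℕ.z≤n = 1≤^ n′ 1≤a
          pow-mono (ℕ.s≤s l) = *-monoʳ (≤-trans 0≤1 1≤a) (pow-mono l)
        part : ∀ (f : ℕ → Spec) n N c → n ℕ.≤ N → 0ℚ ≤ c → (∀ i → cost (f i) ≤ c) → sumL cost (rangeL f n) ≤ ι N * c
        part f n N c n≤N 0≤c h = ≤-trans (≤-reflexive (sumL-rangeL cost f n))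
          (≤-trans (∑-mono n (λ i _ → h i)) (≤-trans (≤-reflexive (∑-const c n)) (*-monoˡ 0≤c (ι-mono n≤N))))
        sums : sumL cost specs ≤ (ι T * τ κ (suc σ) Δ + ι T * τ κ (suc σ) Δ) + ι nb * τ g 0 k
        sums = ≤-trans (≤-reflexive (trans (sumL-++ cost (specs₁ ++ specs₂) specs₃) (cong (_+ sumL cost specs₃) (sumL-++ cost specs₁ specs₂))))
          (+-mono-≤ (+-mono-≤
            (part back-spec v T (τ κ (suc σ) Δ) (ℕ.<⇒≤ v<T) (0≤τ κ (suc σ) Δ) (λ w → τ-mono κ (suc σ) (deg w)))
            (part forward-spec v T (τ κ (suc σ) Δ) (ℕ.<⇒≤ v<T) (0≤τ κ (suc σ) Δ) (λ t → τ-mono κ (suc σ) (forward t))))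
            (part block-spec nb nb (τ g 0 k) ℕ.≤-refl (0≤τ g 0 k) (λ i → τ-mono g 0 (count-block≤ i v))))

      module Next (I : ℕ → Bool) (admissible : Admissible specs I)
        (objective≤ : ∑ v (λ u → A u * (if I u then 1ℚ else 0ℚ)) + sumL (λ a → proj₁ a * ½ ^ count v (λ w → proj₂ a w ∧ I w)) (targets 𝒬)
                 ≤ p * ∑ v A + ρ * sumL proj₁ (targets 𝒬)) where

        open Admissible admissible

        I-above : ∀ w → v ℕ.≤ w → I w ≡ false
        I-above w v≤w with I w in eq
        ... | false = refl
        ... | true  = ⊥-elim (ℕ.<⇒≱ (below w eq) v≤w)

        back-above : ∀ w u → v ℕ.≤ u → back w u ≡ false
        back-above w u v≤u with back w u in eq
        ... | false = refl
        ... | true  = ⊥-elim (ℕ.<-irrefl refl (ℕ.<-≤-trans (ℕ.<-trans (back-< eq) (top eq)) v≤u))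

        back-top : ∀ w u → v ℕ.≤ w → back w u ≡ false
        back-top w u v≤w with back w u in eq
        ... | false = refl
        ... | true  = ⊥-elim (ℕ.<⇒≱ (top eq) v≤w)

        next : ℕ → ℕ → Bool
        next = insert v I back

        count-suc : ∀ (f : ℕ → Bool) → f v ≡ false → count (suc v) f ≡ count v f
        count-suc f e rewrite e = refl

        count-suc-true : ∀ (f : ℕ → Bool) → f v ≡ true → count (suc v) f ≡ suc (count v f)
        count-suc-true f e rewrite e = refl

        next-< : ∀ {w u} → next w u ≡ true → u ℕ.< w
        next-< {w} {u} e with w ℕ.≟ v
        ... | yes refl = below u (trans (sym (insert-new w I back u)) e)
        ... | no w≢v   = back-< (trans (sym (insert-old v I back u w≢v)) e)

        next-top : ∀ {w u} → next w u ≡ true → w ℕ.< suc v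
        next-top {w} {u} e with w ℕ.≟ v
        ... | yes refl = ℕ.n<1+n w
        ... | no w≢v   = ℕ.m<n⇒m<1+n (top (trans (sym (insert-old v I back u w≢v)) e))

        next-triangle : ∀ w u u′ → next w u ≡ true → next w u′ ≡ true → next u′ u ≡ false
        next-triangle w u u′ e e′ with w ℕ.≟ v
        ... | yes refl = trans (insert-old w I back u (ℕ.<⇒≢ (below u′ Iu′))) (independent u u′ (trans (sym (insert-new w I back u)) e) Iu′)
          where
          Iu′ : I u′ ≡ true
          Iu′ = trans (sym (insert-new w I back u′)) e′
        ... | no w≢v = trans (insert-old v I back u (ℕ.<⇒≢ (ℕ.<-trans (back-< b′) (top b′))))
                             (triangle w u u′ (trans (sym (insert-old v I back u w≢v)) e) b′)
          where
          b′ : back w u′ ≡ true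
          b′ = trans (sym (insert-old v I back u′ w≢v)) e′

        next-deg : ∀ w → count (suc v) (next w) ℕ.≤ Δ
        next-deg w with w ℕ.≟ v
        ... | yes refl = subst (ℕ._≤ Δ) (sym (trans (count-cong (suc v) (λ u _ → insert-new v I back u)) (count-suc I (I-above v ℕ.≤-refl))))
          (ℕ.≤-trans (count-blocks I v nb g (ℕ.≤-trans (ℕ.<⇒≤ v<T) T≤) I-above
            (λ i i<nb → All.lookup few (∈-++⁺ʳ (specs₁ ++ specs₂) (∈-rangeL block-spec i<nb)))) nb*g≤Δ)
        ... | no w≢v = subst (ℕ._≤ Δ) (sym (trans (count-cong (suc v) (λ u _ → insert-old v I back u w≢v)) (count-suc (back w) (back-above w v ℕ.≤-refl)))) (deg w)

        -- The specs on back neighbourhoods, introduced to control the weights, also bound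
        -- codegrees: the common back neighbours of `v` and `w` are the chosen vertices in `back w`.
        new-codeg : ∀ w → w ≢ v → count (suc v) (λ u → I u ∧ back w u) ℕ.≤ κ
        new-codeg w w≢v = subst (ℕ._≤ κ) (sym (trans (count-suc (λ u → I u ∧ back w u) (cong (_∧ back w v) (I-above v ℕ.≤-refl)))
            (count-cong v (λ u _ → ∧-comm (I u) (back w u))))) bnd
          where
          bnd : count v (λ u → back w u ∧ I u) ℕ.≤ κ
          bnd with w ℕ.<? v
          ... | yes w<v = All.lookup few (∈-++⁺ˡ (∈-++⁺ˡ (∈-rangeL back-spec w<v)))
          ... | no w≮v  = subst (ℕ._≤ κ) (sym (trans (count-cong v (λ u _ → cong (_∧ I u) (back-top w u (ℕ.≮⇒≥ w≮v)))) (count-false v))) ℕ.z≤n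

        next-codeg : ∀ w w′ → w ≢ w′ → count (suc v) (λ u → next w u ∧ next w′ u) ℕ.≤ κ
        next-codeg w w′ w≢w′ with w ℕ.≟ v | w′ ℕ.≟ v
        ... | yes refl | yes refl = ⊥-elim (w≢w′ refl)
        ... | yes refl | no w′≢v = subst (ℕ._≤ κ) (count-cong (suc v) (λ u _ → sym (cong₂ _∧_ (insert-new v I back u) (insert-old v I back u w′≢v)))) (new-codeg w′ w′≢v)
        ... | no w≢v | yes refl = subst (ℕ._≤ κ) (count-cong (suc v) (λ u _ → trans (∧-comm (I u) (back w u)) (sym (cong₂ _∧_ (insert-old v I back u w≢v) (insert-new v I back u))))) (new-codeg w w≢v)
        ... | no w≢v | no w′≢v = subst (ℕ._≤ κ) (sym (trans (count-cong (suc v) (λ u _ → cong₂ _∧_ (insert-old v I back u w≢v) (insert-old v I back u w′≢v)))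
            (count-suc (λ u → back w u ∧ back w′ u) (cong (_∧ back w′ v) (back-above w v ℕ.≤-refl))))) (codeg w w′ w≢w′)

        T∸v : T ∸ v ≡ suc (T ∸ suc v)
        T∸v = ∸-suc v<T

        ind : ℕ → ℚ
        ind u = if I u then 1ℚ else 0ℚ

        degree-next : ∀ u → 2ℚ ^ degree next (suc v) u ≡ 2ℚ ^ degree back v u * (1ℚ + ind u)
        degree-next u = helper (I u) refl
          where
          old : count v (λ w → next w u) ≡ degree back v u
          old = count-cong v (λ w w<v → insert-old v I back u (ℕ.<⇒≢ w<v))
          helper : ∀ b → I u ≡ b → 2ℚ ^ degree next (suc v) u ≡ 2ℚ ^ degree back v u * (1ℚ + ind u)
          f : ℕ → Bool
          f w = next w u
          d : ℚ
          d = 2ℚ ^ degree back v u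
          helper true  e = trans (cong (2ℚ ^_) (trans (count-suc-true f (trans (insert-new v I back u) e)) (cong suc old)))
            (trans (*-comm 2ℚ d) (cong (λ b → d * (1ℚ + (if b then 1ℚ else 0ℚ))) (sym e)))
          helper false e = trans (cong (2ℚ ^_) (trans (count-suc f (trans (insert-new v I back u) e)) old))
            (trans (sym (*-identityʳ d)) (cong (λ b → d * (1ℚ + (if b then 1ℚ else 0ℚ))) (sym e)))

        degree-term-next : ∀ u → degree-term next (suc v) u ≡ A u + A u * ind u
        degree-term-next u = trans (cong (λ z → ½ ^ Δ * (z * (1ℚ + p) ^ (T ∸ suc v))) (degree-next u))
          (solve 4 (λ h d i q → h :* (d :* (con 1ℚ :+ i) :* q) := h :* (d :* q) :+ h :* (d :* q) :* i) refl
            (½ ^ Δ) (2ℚ ^ degree back v u) (ind u) ((1ℚ + p) ^ (T ∸ suc v)))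

        degree-term-old : ∀ u → degree-term back v u ≡ A u + p * A u
        degree-term-old u = trans (cong (λ n → ½ ^ Δ * (2ℚ ^ degree back v u * (1ℚ + p) ^ n)) T∸v)
          (solve 4 (λ h d p q → h :* (d :* ((con 1ℚ :+ p) :* q)) := h :* (d :* q) :+ p :* (h :* (d :* q))) refl
            (½ ^ Δ) (2ℚ ^ degree back v u) p ((1ℚ + p) ^ (T ∸ suc v)))

        gain : Pair → ℕ
        gain (X , Y) = count v (λ u → X u ∧ I u)

        edges-next : ∀ X Y → edges next (suc v) X Y ≡ edges back v X Y ℕ.+ (if Y v then gain (X , Y) else 0)
        edges-next X Y = cong₂ ℕ._+_
          (sum<-cong v (λ w w<v → cong (λ n → if Y w then n else 0) (count-cong w (λ u _ → cong (X u ∧_) (insert-old v I back u (ℕ.<⇒≢ w<v))))))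
          (cong (λ n → if Y v then n else 0) (count-cong v (λ u _ → cong (X u ∧_) (insert-new v I back u))))

        pair-off : ∀ X Y → Y v ≡ false → pair-term next (suc v) (X , Y) ≡ pair-term back v (X , Y)
        pair-off X Y e = cong₂ (λ a b → 2ℚ ^ E₀ * (½ ^ a * ρ ^ (k ∸ b)))
          (trans (edges-next X Y) (trans (cong (λ b → edges back v X Y ℕ.+ (if b then gain (X , Y) else 0)) e) (ℕ.+-identityʳ (edges back v X Y))))
          (count-suc Y e)

        pair-on : ∀ X Y → Y v ≡ true → pair-term next (suc v) (X , Y) ≡ coefficient (X , Y) * ½ ^ gain (X , Y)
        pair-on X Y e = trans (cong₂ (λ a b → 2ℚ ^ E₀ * (a * ρ ^ (k ∸ b)))
          (trans (cong (½ ^_) (trans (edges-next X Y) (cong (λ b → edges back v X Y ℕ.+ (if b then gain (X , Y) else 0)) e)))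
            (^-+ ½ (edges back v X Y) (gain (X , Y))))
          (count-suc-true Y e))
          (solve 4 (λ a b c d → a :* (b :* c :* d) := a :* (b :* d) :* c) refl
            (2ℚ ^ E₀) (½ ^ edges back v X Y) (½ ^ gain (X , Y)) (ρ ^ (k ∸ suc (count v Y))))

        pair-old : ∀ X Y → Good (X , Y) → Y v ≡ true → pair-term back v (X , Y) ≡ ρ * coefficient (X , Y)
        pair-old X Y (size , _) e = trans (cong (λ n → 2ℚ ^ E₀ * (½ ^ edges back v X Y * ρ ^ n)) (∸-suc lt))
          (solve 4 (λ a b c d → a :* (b :* (c :* d)) := c :* (a :* (b :* d))) refl
            (2ℚ ^ E₀) (½ ^ edges back v X Y) ρ (ρ ^ (k ∸ suc (count v Y))))
          where
          count-le : ∀ (f : ℕ → Bool) {m n} → m ℕ.≤ n → count m f ℕ.≤ count n f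
          count-le f {m} {n} l = subst₂ ℕ._≤_ (sym (count≡sum f m)) (sym (count≡sum f n)) (sum<-extend (λ i → 𝟙[ f i ]) l)
          lt : count v Y ℕ.< k
          lt = subst₂ ℕ._≤_ (count-suc-true Y e) size (count-le Y v<T)

        objective-term : ℚ × (ℕ → Bool) → ℚ
        objective-term a = proj₁ a * ½ ^ count v (λ w → proj₂ a w ∧ I w)

        -- `r` collects the terms of the pairs with `v` not in `Y`, which the new vertex leaves
        -- unchanged.
        pairs : ∀ q → All Good q → Σ[ r ∈ ℚ ]
          (sumL (pair-term next (suc v)) q ≡ sumL objective-term (targets q) + r) ×
          (sumL (pair-term back v) q ≡ ρ * sumL proj₁ (targets q) + r)
        pairs [] [] = 0ℚ , refl , solve 1 (λ r → con 0ℚ := r :* con 0ℚ :+ con 0ℚ) refl ρ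
        pairs ((X , Y) ∷ q) (g ∷ gs) = helper (Y v) refl (pairs q gs)
          where
          tail′ : ∀ b → Y v ≡ b → targets ((X , Y) ∷ q) ≡ (if b then (coefficient (X , Y) , X) ∷ targets q else targets q)
          tail′ b e = cong (λ b → if b then (coefficient (X , Y) , X) ∷ targets q else targets q) e
          Result : ℚ → Set
          Result r = (sumL (pair-term next (suc v)) ((X , Y) ∷ q) ≡ sumL objective-term (targets ((X , Y) ∷ q)) + r) ×
                     (sumL (pair-term back v) ((X , Y) ∷ q) ≡ ρ * sumL proj₁ (targets ((X , Y) ∷ q)) + r)
          helper : ∀ b → Y v ≡ b → Σ[ r ∈ ℚ ]
            (sumL (pair-term next (suc v)) q ≡ sumL objective-term (targets q) + r) ×
            (sumL (pair-term back v) q ≡ ρ * sumL proj₁ (targets q) + r) → ∃[ r ] Result r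
          helper true e (r , e₁ , e₂) = r ,
            trans (cong₂ _+_ (pair-on X Y e) e₁) (trans (sym (+-assoc (objective-term (coefficient (X , Y) , X)) (sumL objective-term (targets q)) r))
              (cong (λ l → sumL objective-term l + r) (sym (tail′ true e)))) ,
            trans (cong₂ _+_ (pair-old X Y g e) e₂) (trans
              (solve 4 (λ ρ c s r → ρ :* c :+ (ρ :* s :+ r) := ρ :* (c :+ s) :+ r) refl ρ (coefficient (X , Y)) (sumL proj₁ (targets q)) r)
              (cong (λ l → ρ * sumL proj₁ l + r) (sym (tail′ true e))))
          helper false e (r , e₁ , e₂) = pair-term back v (X , Y) + r ,
            trans (cong₂ _+_ (pair-off X Y e) e₁) (trans
              (solve 3 (λ a s r → a :+ (s :+ r) := s :+ (a :+ r)) refl (pair-term back v (X , Y)) (sumL objective-term (targets q)) r)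
              (cong (λ l → sumL objective-term l + (pair-term back v (X , Y) + r)) (sym (tail′ false e)))) ,
            trans (cong (pair-term back v (X , Y) +_) e₂) (trans
              (solve 3 (λ a s r → a :+ (s :+ r) := s :+ (a :+ r)) refl (pair-term back v (X , Y)) (ρ * sumL proj₁ (targets q)) r)
              (cong (λ l → ρ * sumL proj₁ l + (pair-term back v (X , Y) + r)) (sym (tail′ false e))))

        -- The bound in `objective≤` is at most what the old terms release when one factor 1 + p per
        -- degree and one factor `ρ` per affected pair are spent.
        Φ-next : Φ next (suc v) ≤ Φ back v
        Φ-next = subst₂ _≤_ (sym new) (sym old) ineq
          where
          r : ℚ
          r = proj₁ (pairs 𝒬 good)
          new : Φ next (suc v) ≡ (∑ T A + ∑ v (λ u → A u * ind u)) + (sumL objective-term (targets 𝒬) + r)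
          new = cong₂ _+_ (trans (∑-cong T (λ u _ → degree-term-next u)) (trans (∑-+ A (λ u → A u * ind u) T)
              (cong (∑ T A +_) (∑-truncate T (ℕ.<⇒≤ v<T) (λ u v≤u → trans (cong (λ b → A u * (if b then 1ℚ else 0ℚ)) (I-above u v≤u)) (*-zeroʳ (A u)))))))
            (proj₁ (proj₂ (pairs 𝒬 good)))
          old : Φ back v ≡ (∑ T A + p * ∑ T A) + (ρ * sumL proj₁ (targets 𝒬) + r)
          old = cong₂ _+_ (trans (∑-cong T (λ u _ → degree-term-old u)) (trans (∑-+ A (λ u → p * A u) T) (cong (∑ T A +_) (∑-*ˡ p A T))))
            (proj₂ (proj₂ (pairs 𝒬 good)))
          ineq : (∑ T A + ∑ v (λ u → A u * ind u)) + (sumL objective-term (targets 𝒬) + r)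
                 ≤ (∑ T A + p * ∑ T A) + (ρ * sumL proj₁ (targets 𝒬) + r)
          ineq = subst₂ _≤_
            (solve 4 (λ a b c r → a :+ r :+ (b :+ c) := (a :+ b) :+ (c :+ r)) refl (∑ T A) (∑ v (λ u → A u * ind u)) (sumL objective-term (targets 𝒬)) r)
            (solve 4 (λ a b c r → a :+ r :+ (b :+ c) := (a :+ b) :+ (c :+ r)) refl (∑ T A) (p * ∑ T A) (ρ * sumL proj₁ (targets 𝒬)) r)
            (+-mono-≤ (≤-refl {∑ T A + r}) (≤-trans objective≤
              (+-mono-≤ (*-monoʳ 0≤p (∑-extend T (ℕ.<⇒≤ v<T) A≥0)) (≤-refl {ρ * sumL proj₁ (targets 𝒬)}))))

        env-next : Env (suc v) next
        env-next = record { free = record { back-< = next-< ; triangle = next-triangle } ; top = next-top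
                          ; deg = next-deg ; codeg = next-codeg ; Φ<1 = ≤-<-trans Φ-next Φ<1 }

      extend-env : Σ[ back ∈ (ℕ → ℕ → Bool) ] Env (suc v) back
      extend-env = Next.next I adm le , Next.env-next I adm le
        where
        I = proj₁ chosen
        adm = proj₁ (proj₂ chosen)
        le = proj₂ (proj₂ chosen)

    env-start : Env 0 (λ _ _ → false)
    env-start = record { free = record { back-< = λ () ; triangle = λ _ _ _ () } ; top = λ () ; deg = λ _ → ℕ.z≤n
                       ; codeg = λ _ _ _ → ℕ.z≤n ; Φ<1 = subst (_< 1ℚ) (sym eq) start }
      where
      eq : Φ (λ _ _ → false) 0 ≡ ½ ^ Δ * (ι T * (1ℚ + p) ^ T) + sumL (λ _ → 2ℚ ^ E₀ * ρ ^ k) 𝒬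
      eq = cong₂ _+_ (trans (∑-const (½ ^ Δ * (1ℚ * (1ℚ + p) ^ T)) T)
          (solve 3 (λ t h q → t :* (h :* (con 1ℚ :* q)) := h :* (t :* q)) refl (ι T) (½ ^ Δ) ((1ℚ + p) ^ T)))
        (go 𝒬)
        where
        go : ∀ q → sumL (pair-term (λ _ _ → false) 0) q ≡ sumL (λ _ → 2ℚ ^ E₀ * ρ ^ k) q
        go []      = refl
        go (_ ∷ q) = cong₂ _+_ (cong (2ℚ ^ E₀ *_) (*-identityˡ (ρ ^ k))) (go q)

    build : ∀ v → v ℕ.≤ T → Σ[ back ∈ (ℕ → ℕ → Bool) ] Env v back
    build zero    _   = (λ _ _ → false) , env-start
    build (suc v) v<T = extend-env (proj₂ (build v (ℕ.<⇒≤ v<T))) v<T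

    graph : Σ[ back ∈ (ℕ → ℕ → Bool) ] TriangleFree back × All (λ q → E₀ ℕ.≤ edges back T (proj₁ q) (proj₂ q)) 𝒬
    graph = let back , E = build T ℕ.≤-refl in back , Env.free E , All.tabulate (λ q∈ → enough back E q∈)
      where
      enough : ∀ back → Env T back → ∀ {q} → q ∈ 𝒬 → E₀ ℕ.≤ edges back T (proj₁ q) (proj₂ q)
      enough back E {X , Y} q∈ = cancel-half e E₀ 1ℚ 0≤1 ≤-refl (≤-<-trans (≤-trans (≤-reflexive eq)
          (≤-trans (term≤sumL (pair-term back T) (0≤pair-term back T) q∈)
            (subst (_≤ Φ back T) (+-identityˡ (sumL (pair-term back T) 𝒬)) (+-mono-≤ (∑-nonneg T (λ u _ → 0≤degree-term back T u)) (≤-refl {sumL (pair-term back T) 𝒬})))))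
          (Env.Φ<1 E))
        where
        e = edges back T X Y
        done : k ∸ count T Y ≡ 0
        done = trans (cong (k ∸_) (proj₁ (All.lookup good q∈))) (ℕ.n∸n≡0 k)
        eq : ½ ^ e * (2ℚ ^ E₀ * 1ℚ) ≡ pair-term back T (X , Y)
        eq = trans (solve 2 (λ a b → a :* (b :* con 1ℚ) := b :* (a :* con 1ℚ)) refl (½ ^ e) (2ℚ ^ E₀))
          (cong (λ n → 2ℚ ^ E₀ * (½ ^ e * ρ ^ n)) (sym done))

-- Enumeration of all separated pairs of k-sets.

module SubsetPairs where
  open Process using (≡ᵇ-refl; ≡ᵇ-false)
  open ExpectedStep using (count)
  open Sums
  open SequentialGraph using (Pair; edges)
  open import Data.Bool.Base using (Bool; true; false; if_then_else_; _∧_; _∨_)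
  open import Data.Nat.Base
  open import Data.Nat.Properties
  open import Data.List.Base using (List; []; _∷_; _++_; length; map; cartesianProduct)
  open import Data.List.Properties using (length-++; length-map)
  open import Data.List.Relation.Unary.All as All using (All; []; _∷_)
  import Data.List.Relation.Unary.All.Properties as All
  open import Data.List.Relation.Unary.Any using (here)
  open import Data.List.Membership.Propositional using (_∈_)
  open import Data.List.Membership.Propositional.Properties using (∈-++⁺ˡ; ∈-++⁺ʳ; ∈-map⁺; ∈-cartesianProduct⁺; ∈-cartesianProduct⁻)
  open import Data.Empty using (⊥-elim)
  open import Data.Product using (_×_; _,_; proj₁; proj₂; ∃-syntax)
  open import Relation.Binary.PropositionalEquality hiding ([_])
  open import Relation.Nullary using (yes; no)

  adjoin : ℕ → (ℕ → Bool) → ℕ → Bool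
  adjoin a P w = (w ≡ᵇ a) ∨ P w

  subsets : ℕ → ℕ → ℕ → List (ℕ → Bool)
  subsets lo n       zero    = (λ _ → false) ∷ []
  subsets lo zero    (suc k) = []
  subsets lo (suc n) (suc k) = map (adjoin (lo + n)) (subsets lo n k) ++ subsets lo n (suc k)

  length-subsets : ∀ lo n k → length (subsets lo n k) ≤ n ^ k
  length-subsets lo n       zero    = ≤-refl
  length-subsets lo zero    (suc k) = z≤n
  length-subsets lo (suc n) (suc k) = begin
    length (map (adjoin (lo + n)) (subsets lo n k) ++ subsets lo n (suc k))
      ≡⟨ trans (length-++ (map (adjoin (lo + n)) (subsets lo n k))) (cong (_+ length (subsets lo n (suc k))) (length-map (adjoin (lo + n)) (subsets lo n k))) ⟩
    length (subsets lo n k) + length (subsets lo n (suc k))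
      ≤⟨ +-mono-≤ (length-subsets lo n k) (length-subsets lo n (suc k)) ⟩
    n ^ k + n * n ^ k
      ≤⟨ *-monoʳ-≤ (suc n) (^-monoˡ-≤ k (n≤1+n n)) ⟩
    suc n ^ suc k ∎
    where open ≤-Reasoning

  Within : ℕ → ℕ → (ℕ → Bool) → Set
  Within lo hi P = ∀ w → P w ≡ true → lo ≤ w × w < hi

  within-false : ∀ {lo hi P} → Within lo hi P → P hi ≡ false
  within-false {hi = hi} {P} h with P hi in eq
  ... | false = refl
  ... | true  = ⊥-elim (<-irrefl refl (proj₂ (h hi eq)))

  sum-adjoin : ∀ a P (g : ℕ → ℕ) N → P a ≡ false → a < N →
    sum< N (λ w → if adjoin a P w then g w else 0) ≡ sum< N (λ w → if P w then g w else 0) + g a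
  sum-adjoin a P g N Pa a<N = trans (sum<-cong N (λ w _ → pointwise w)) (trans (sum<-+ (λ w → if P w then g w else 0) (λ w → if w ≡ᵇ a then g w else 0) N) (cong (sum< N (λ w → if P w then g w else 0) +_) (single N a<N)))
    where
    pointwise : ∀ w → (if adjoin a P w then g w else 0) ≡ (if P w then g w else 0) + (if w ≡ᵇ a then g w else 0)
    pointwise w with w ≟ a
    ... | yes refl rewrite ≡ᵇ-refl w | Pa = refl
    ... | no w≢a rewrite ≡ᵇ-false w≢a = sym (+-identityʳ _)
    below : ∀ N → N ≤ a → sum< N (λ w → if w ≡ᵇ a then g w else 0) ≡ 0
    below zero    _ = refl
    below (suc N) l rewrite ≡ᵇ-false (<⇒≢ l) | below N (<⇒≤ l) = refl
    single : ∀ N → a < N → sum< N (λ w → if w ≡ᵇ a then g w else 0) ≡ g a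
    single (suc N) a<N with N ≟ a
    ... | yes refl rewrite ≡ᵇ-refl N | below N ≤-refl = refl
    ... | no N≢a rewrite ≡ᵇ-false N≢a = trans (+-identityʳ _) (single N (≤∧≢⇒< (s≤s⁻¹ a<N) (λ e → N≢a (sym e))))

  Sized : ℕ → ℕ → ℕ → (ℕ → Bool) → Set
  Sized lo n k P = Within lo (lo + n) P × (∀ N → lo + n ≤ N → count N P ≡ k)

  subsets-sized : ∀ lo n k → All (Sized lo n k) (subsets lo n k)
  subsets-sized lo n zero = ((λ _ ()) , λ N _ → zeros N) ∷ []
    where
    zeros : ∀ N → count N (λ _ → false) ≡ 0
    zeros zero    = refl
    zeros (suc N) = zeros N
  subsets-sized lo zero    (suc k) = []
  subsets-sized lo (suc n) (suc k) = All.++⁺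
    (All.map⁺ (All.map add (subsets-sized lo n k)))
    (All.map keep (subsets-sized lo n (suc k)))
    where
    lo+n<  : lo + n < lo + suc n
    lo+n< = +-monoʳ-< lo (n<1+n n)
    add : ∀ {P} → Sized lo n k P → Sized lo (suc n) (suc k) (adjoin (lo + n) P)
    add {P} (within , size) = within′ , size′
      where
      within′ : Within lo (lo + suc n) (adjoin (lo + n) P)
      within′ w e with w ≟ lo + n
      ... | yes refl = m≤m+n lo n , lo+n<
      ... | no w≢ rewrite ≡ᵇ-false w≢ = proj₁ (within w e) , <-trans (proj₂ (within w e)) lo+n<
      size′ : ∀ N → lo + suc n ≤ N → count N (adjoin (lo + n) P) ≡ suc k
      size′ N l = trans (count≡sum (adjoin (lo + n) P) N) (trans
        (sum-adjoin (lo + n) P (λ _ → 1) N (within-false within) (<-≤-trans lo+n< l))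
        (trans (cong (_+ 1) (trans (sym (count≡sum P N)) (size N (≤-trans (<⇒≤ lo+n<) l)))) (+-comm k 1)))
    keep : ∀ {P} → Sized lo n (suc k) P → Sized lo (suc n) (suc k) P
    keep (within , size) = (λ w e → proj₁ (within w e) , <-trans (proj₂ (within w e)) lo+n<) ,
                           λ N l → size N (≤-trans (<⇒≤ lo+n<) l)

  Increasing : ℕ → (ℕ → ℕ) → Set
  Increasing k f = ∀ i j → i < j → j < k → f i < f j

  -- Says that `f` enumerates `P` in the form in which this is used: sums over `P` become sums over
  -- indices.
  Lists : (ℕ → Bool) → ℕ → ℕ → (ℕ → ℕ) → Set
  Lists P hi k f = ∀ (g : ℕ → ℕ) N → hi ≤ N → sum< N (λ w → if P w then g w else 0) ≡ sum< k (λ j → g (f j))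

  subsets-complete : ∀ lo n k f → Increasing k f → (∀ j → j < k → lo ≤ f j × f j < lo + n) →
                     ∃[ P ] P ∈ subsets lo n k × Lists P (lo + n) k f
  subsets-complete lo n       zero    f inc bnd = (λ _ → false) , here refl , λ g N _ → sum<-zero N
  subsets-complete lo zero    (suc k) f inc bnd =
    ⊥-elim (<⇒≱ (proj₂ (bnd k ≤-refl)) (subst (_≤ f k) (sym (+-identityʳ lo)) (proj₁ (bnd k ≤-refl))))
  subsets-complete lo (suc n) (suc k) f inc bnd with f k ≟ lo + n
  ... | yes fk≡ =
    let P , P∈ , lists = subsets-complete lo n k f (λ i j i<j j<k → inc i j i<j (m<n⇒m<1+n j<k))
          (λ j j<k → proj₁ (bnd j (m<n⇒m<1+n j<k)) , subst (f j <_) fk≡ (inc j k j<k ≤-refl))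
    in adjoin (lo + n) P , ∈-++⁺ˡ (∈-map⁺ (adjoin (lo + n)) P∈) , λ g N l →
         trans (sum-adjoin (lo + n) P g N (within-false (proj₁ (All.lookup (subsets-sized lo n k) P∈)))
                 (<-≤-trans (+-monoʳ-< lo (n<1+n n)) l))
               (cong₂ _+_ (lists g N (≤-trans (+-monoʳ-≤ lo (n≤1+n n)) l)) (cong g (sym fk≡)))
  ... | no fk≢ =
    let P , P∈ , lists = subsets-complete lo n (suc k) f inc (λ j j≤k → proj₁ (bnd j j≤k) , below j j≤k)
    in P , ∈-++⁺ʳ (map (adjoin (lo + n)) (subsets lo n k)) P∈ , λ g N l → lists g N (≤-trans (+-monoʳ-≤ lo (n≤1+n n)) l)
    where
    top : f k < lo + n
    top = ≤∧≢⇒< (s≤s⁻¹ (subst (f k <_) (+-suc lo n) (proj₂ (bnd k ≤-refl)))) fk≢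
    below : ∀ j → j < suc k → f j < lo + n
    below j j≤k with j ≟ k
    ... | yes refl = top
    ... | no j≢k   = <-trans (inc j k (≤∧≢⇒< (s≤s⁻¹ j≤k) j≢k) ≤-refl) top

  length-cartesianProduct : {A B : Set} (xs : List A) (ys : List B) → length (cartesianProduct xs ys) ≡ length xs * length ys
  length-cartesianProduct []       ys = refl
  length-cartesianProduct (x ∷ xs) ys = trans (length-++ (map (x ,_) ys))
    (cong₂ _+_ (length-map (x ,_) ys) (length-cartesianProduct xs ys))

  module _ (T k : ℕ) where

    split-pairs : ℕ → List Pair
    split-pairs s = cartesianProduct (subsets 0 s k) (subsets s (T ∸ s) k)

    -- A pair may be listed for several cuts `s`. The repetitions weaken the union bound by a factor
    -- of at most `T`.
    pairs-below : ℕ → List Pair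
    pairs-below zero    = []
    pairs-below (suc n) = split-pairs n ++ pairs-below n

    length-pairs : ∀ n → n ≤ T → length (pairs-below n) ≤ n * (T ^ k * T ^ k)
    length-pairs zero    _   = z≤n
    length-pairs (suc n) n<T = ≤-trans (≤-reflexive (length-++ (split-pairs n))) (+-mono-≤
      (≤-trans (≤-reflexive (length-cartesianProduct (subsets 0 n k) (subsets n (T ∸ n) k)))
        (*-mono-≤ (≤-trans (length-subsets 0 n k) (^-monoˡ-≤ k (<⇒≤ n<T)))
                  (≤-trans (length-subsets n (T ∸ n) k) (^-monoˡ-≤ k (m∸n≤m T n)))))
      (length-pairs n (<⇒≤ n<T)))

    Separated : Pair → Set
    Separated (X , Y) = count T Y ≡ k × (∀ v → v < T → Y v ≡ true → count v X ≡ k)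

    pairs-separated : ∀ n → n ≤ T → All Separated (pairs-below n)
    pairs-separated zero    _   = []
    pairs-separated (suc n) n<T = All.++⁺ (All.tabulate sep) (pairs-separated n (<⇒≤ n<T))
      where
      sep : ∀ {q} → q ∈ split-pairs n → Separated q
      sep {X , Y} q∈ =
        let X∈ , Y∈ = ∈-cartesianProduct⁻ (subsets 0 n k) (subsets n (T ∸ n) k) q∈
            _ , sizeX = All.lookup (subsets-sized 0 n k) X∈
            withinY , sizeY = All.lookup (subsets-sized n (T ∸ n) k) Y∈
        in sizeY T (≤-reflexive (m+[n∸m]≡n (<⇒≤ n<T))) , λ v _ Yv → sizeX v (proj₁ (withinY v Yv))

    ∈-pairs-below : ∀ {s n q} → s < n → q ∈ split-pairs s → q ∈ pairs-below n
    ∈-pairs-below {s} {suc n} s<n q∈ with s ≟ n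
    ... | yes refl = ∈-++⁺ˡ q∈
    ... | no s≢n   = ∈-++⁺ʳ (split-pairs n) (∈-pairs-below (≤∧≢⇒< (s≤s⁻¹ s<n) s≢n) q∈)

    pairs-complete : ∀ k′ → k ≡ suc k′ → (X Y : ℕ → ℕ) → Increasing k X → Increasing k Y → (∀ i j → i < k → j < k → X i < Y j) →
      (∀ j → j < k → Y j < T) → ∃[ P ] ∃[ Q ] (P , Q) ∈ pairs-below T ×
      (∀ back → edges back T P Q ≡ sum< k (λ j → sum< k (λ i → 𝟙[ back (Y j) (X i) ])))
    pairs-complete k′ refl X Y incX incY X<Y Y<T =
      let P , P∈ , listsP = subsets-complete 0 s k X incX (λ i i<k → z≤n , s≤s (X≤ i i<k))
          Q , Q∈ , listsQ = subsets-complete s (T ∸ s) k Y incY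
             (λ j j<k → s≤Y j j<k , subst (Y j <_) (sym (m+[n∸m]≡n (<⇒≤ s<T))) (Y<T j j<k))
      in P , Q , ∈-pairs-below s<T (∈-cartesianProduct⁺ P∈ Q∈) , λ back →
         trans (listsQ (λ w → count w (λ u → P u ∧ back w u)) T (≤-reflexive (m+[n∸m]≡n (<⇒≤ s<T))))
           (sum<-cong k (λ j j<k → trans (count≡sum (λ u → P u ∧ back (Y j) u) (Y j))
             (trans (sum<-cong (Y j) (λ u _ → ∧-if (P u) (back (Y j) u))) (listsP (λ u → 𝟙[ back (Y j) u ]) (Y j) (s≤Y j j<k)))))
      where
      s : ℕ
      -- The cut comes right after the largest element of the lower set.
      s = suc (X k′)
      s≤Y : ∀ j → j < k → s ≤ Y j
      s≤Y j j<k = X<Y k′ j ≤-refl j<k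
      s<T : s < T
      s<T = ≤-<-trans (s≤Y 0 z<s) (Y<T 0 z<s)
      ∧-if : ∀ a b → 𝟙[ a ∧ b ] ≡ (if a then 𝟙[ b ] else 0)
      ∧-if true  b = refl
      ∧-if false b = refl
      X≤ : ∀ i → i < suc k′ → X i ≤ X k′
      X≤ i i<k with i ≟ k′
      ... | yes refl = ≤-refl
      ... | no i≢k   = <⇒≤ (incX i k′ (≤∧≢⇒< (s≤s⁻¹ i<k) i≢k) ≤-refl)

-- Numerical constants, and the dense triangle-free graph.

module DenseGraph where
  open RationalArithmetic
  open ExpectedStep
  open Descents
  open Sums
  open Ranges
  open SequentialGraph
  open SubsetPairs
  open import Data.Bool.Base using (Bool)
  open import Data.Nat.Base as ℕ using (ℕ; zero; suc; _<ᵇ_; _≡ᵇ_; _∸_)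
  import Data.Nat.Properties as ℕ
  open import Data.List.Base using (List; []; _∷_; length)
  open import Data.List.Relation.Unary.All as All using (All; []; _∷_)
  open import Data.Rational.Base
  open import Data.Rational.Properties
  open import Data.Rational.Solver
  open import Data.Product using (_×_; _,_; proj₁; proj₂; Σ-syntax)
  open import Relation.Binary.PropositionalEquality hiding (J; [_])
  open import Relation.Nullary.Decidable using (toWitness)
  open import Data.Unit using (tt)
  open +-*-Solver using (solve; _:=_; _:+_; _:*_; _:-_; :-_; con)

  0≤2ℚ : 0ℚ ≤ 2ℚ
  0≤2ℚ = nonNegative⁻¹ 2ℚ

  1≤2ℚ : 1ℚ ≤ 2ℚ
  1≤2ℚ = by-difference 1ℚ 0≤1 refl

  ^-expand : ∀ {a m n} → 1ℚ ≤ a → m ℕ.≤ n → a ^ m ≤ a ^ n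
  ^-expand {n = n} 1≤a ℕ.z≤n     = 1≤^ n 1≤a
  ^-expand {a} 1≤a (ℕ.s≤s l) = *-monoʳ (≤-trans 0≤1 1≤a) (^-expand 1≤a l)

  ½^-shrink : ∀ {m n} → m ℕ.≤ n → ½ ^ n ≤ ½ ^ m
  ½^-shrink {n = n} ℕ.z≤n = ^≤1 n 0≤½ (by-difference ½ 0≤½ refl)
  ½^-shrink (ℕ.s≤s l)     = *-monoʳ 0≤½ (½^-shrink l)

  ½^*2^≤ : ∀ a c d → c ℕ.+ d ℕ.≤ a → ½ ^ a * 2ℚ ^ c ≤ ½ ^ d
  ½^*2^≤ a c d c+d≤a = ≤-trans (*-monoˡ (^-nonneg c 0≤2ℚ) (½^-shrink c+d≤a))
    (≤-reflexive (trans (cong (_* 2ℚ ^ c) (^-+ ½ c d)) (trans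
      (solve 3 (λ a b c → a :* b :* c := a :* c :* b) refl (½ ^ c) (½ ^ d) (2ℚ ^ c))
      (trans (cong (_* ½ ^ d) (½^*2^ c)) (*-identityˡ (½ ^ d))))))

  ι-2^ : ∀ n → ι (2 ℕ.^ n) ≡ 2ℚ ^ n
  ι-2^ zero    = refl
  ι-2^ (suc n) = trans (ι-* 2 (2 ℕ.^ n)) (cong (2ℚ *_) (ι-2^ n))

  -- Both exponential bounds come from Bernoulli's inequality and (1 - x)(1 + x) ≤ 1.
  [1-x]^*[1+x]^≤1 : ∀ {x} n → 0ℚ ≤ x → x ≤ 1ℚ → (1ℚ - x) ^ n * (1ℚ + x) ^ n ≤ 1ℚ
  [1-x]^*[1+x]^≤1 {x} n 0≤x x≤1 = subst (_≤ 1ℚ) (^-* (1ℚ - x) (1ℚ + x) n)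
    (^≤1 n (0≤* (0≤- x≤1) (0≤+ 0≤1 0≤x)) (by-difference (x * x) (0≤* 0≤x 0≤x)
      (solve 1 (λ a → (con 1ℚ :- a) :* (con 1ℚ :+ a) :+ a :* a := con 1ℚ) refl x)))

  ½^≤1 : ∀ n → ½ ^ n ≤ 1ℚ
  ½^≤1 n = ^≤1 n 0≤½ (by-difference ½ 0≤½ refl)

  [1-½^j]^2^j≤½ : ∀ j → (1ℚ - ½ ^ j) ^ (2 ℕ.^ j) ≤ ½
  [1-½^j]^2^j≤½ j = subst₂ _≤_
    (solve 1 (λ a → con ½ :* (a :* con 2ℚ) := a) refl ((1ℚ - ½ ^ j) ^ (2 ℕ.^ j))) (*-identityʳ ½)
    (*-monoʳ 0≤½ (≤-trans (*-monoʳ (^-nonneg (2 ℕ.^ j) (0≤- (½^≤1 j)))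
      (subst (_≤ (1ℚ + ½ ^ j) ^ (2 ℕ.^ j)) (cong (1ℚ +_) (trans (cong (_* ½ ^ j) (ι-2^ j)) (trans (*-comm (2ℚ ^ j) (½ ^ j)) (½^*2^ j))))
        (1+nx≤^ (2 ℕ.^ j) (^-nonneg j 0≤½))))
      ([1-x]^*[1+x]^≤1 (2 ℕ.^ j) (^-nonneg j 0≤½) (½^≤1 j))))

  [1+½^1+j]^2^j≤2 : ∀ j → (1ℚ + ½ ^ suc j) ^ (2 ℕ.^ j) ≤ 2ℚ
  [1+½^1+j]^2^j≤2 j = subst₂ _≤_
    (solve 1 (λ a → con 2ℚ :* (con ½ :* a) := a) refl ((1ℚ + ½ ^ suc j) ^ (2 ℕ.^ j))) (*-identityʳ 2ℚ)
    (*-monoʳ 0≤2ℚ (≤-trans (*-monoˡ (^-nonneg (2 ℕ.^ j) (0≤+ 0≤1 (^-nonneg (suc j) 0≤½)))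
      (subst (_≤ (1ℚ - ½ ^ suc j) ^ (2 ℕ.^ j)) (cong (λ z → 1ℚ - z) (trans (cong (_* ½ ^ suc j) (ι-2^ j))
          (trans (solve 2 (λ a b → a :* (con ½ :* b) := con ½ :* (b :* a)) refl (2ℚ ^ j) (½ ^ j)) (cong (½ *_) (½^*2^ j)))))
        (1-nx≤^ (2 ℕ.^ j) (^-nonneg (suc j) 0≤½) (½^≤1 (suc j)))))
      ([1-x]^*[1+x]^≤1 (2 ℕ.^ j) (^-nonneg (suc j) 0≤½) (½^≤1 (suc j)))))

  [1+½^j]^2^j≤4 : ∀ j → 1 ℕ.≤ j → (1ℚ + ½ ^ j) ^ (2 ℕ.^ j) ≤ 2ℚ ^ 2
  [1+½^j]^2^j≤4 (suc j) _ = subst (_≤ 2ℚ ^ 2) (sym (^-^ (1ℚ + ½ ^ suc j) 2 (2 ℕ.^ j)))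
    (^-mono 2 (^-nonneg (2 ℕ.^ j) (0≤+ 0≤1 (^-nonneg (suc j) 0≤½))) ([1+½^1+j]^2^j≤2 j))

  n≤2^n : ∀ n → n ℕ.≤ 2 ℕ.^ n
  n≤2^n zero    = ℕ.z≤n
  n≤2^n (suc n) = ℕ.≤-trans (ℕ.+-mono-≤ (ℕ.m^n>0 2 n) (n≤2^n n)) (ℕ.≤-reflexive (cong (2 ℕ.^ n ℕ.+_) (sym (ℕ.+-identityʳ (2 ℕ.^ n)))))

  sumL-const : {A : Set} (c : ℚ) (xs : List A) → sumL (λ _ → c) xs ≡ ι (length xs) * c
  sumL-const c []       = sym (*-zeroˡ c)
  sumL-const c (x ∷ xs) = trans (cong (c +_) (sumL-const c xs)) (solve 2 (λ l c → c :+ l :* c := (con 1ℚ :+ l) :* c) refl (ι (length xs)) c)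

  -- In terms of the density p = 1 / b, `Δ` is 4 p T and `E₀` is p k² / 32.
  module Scale (f : ℕ) where
    b T k Δ E₀ : ℕ
    b  = 2 ℕ.^ (f ℕ.* 128)
    T  = f ℕ.* b ℕ.* b
    k  = f ℕ.* 4096 ℕ.* b
    Δ  = f ℕ.* 4 ℕ.* b
    E₀ = k ℕ.* (f ℕ.* 128)

  module Instance (f : ℕ) (16≤f : 16 ℕ.≤ f) where
    open Scale f

    nb : ℕ
    nb = 2 ℕ.^ (f ℕ.* 128 ∸ 12)

    p ρ : ℚ
    p = ½ ^ (f ℕ.* 128)
    ρ = ½ ^ (f ℕ.* 1024)

    -- All quantities are powers of 2^f up to moderate factors. As `f` is at least 16, a numeral up
    -- to 2^16 is absorbed into `P 1`, and the estimates reduce to comparing the arguments of `H`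
    -- and `P`.
    H P : ℕ → ℚ
    H c = ½ ^ (f ℕ.* c)
    P c = 2ℚ ^ (f ℕ.* c)

    0≤H : ∀ c → 0ℚ ≤ H c
    0≤H c = ^-nonneg (f ℕ.* c) 0≤½

    0≤P : ∀ c → 0ℚ ≤ P c
    0≤P c = ^-nonneg (f ℕ.* c) 0≤2ℚ

    1≤f : 1 ℕ.≤ f
    1≤f = ℕ.≤-trans (ℕ.s≤s ℕ.z≤n) 16≤f

    ≤f : ∀ {m n} → m ℕ.≤ n → m ℕ.≤ f ℕ.* n
    ≤f {m} {n} m≤n = ℕ.≤-trans m≤n (ℕ.≤-trans (ℕ.≤-reflexive (sym (ℕ.*-identityˡ n))) (ℕ.*-monoˡ-≤ n 1≤f))

    H*P≤H : ∀ a c d → c ℕ.+ d ℕ.≤ a → H a * P c ≤ H d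
    H*P≤H a c d h = ½^*2^≤ (f ℕ.* a) (f ℕ.* c) (f ℕ.* d)
      (ℕ.≤-trans (ℕ.≤-reflexive (sym (ℕ.*-distribˡ-+ f c d))) (ℕ.*-monoʳ-≤ f h))

    P*P : ∀ a c → P a * P c ≡ P (a ℕ.+ c)
    P*P a c = trans (sym (^-+ 2ℚ (f ℕ.* a) (f ℕ.* c))) (cong (2ℚ ^_) (sym (ℕ.*-distribˡ-+ f a c)))

    H*H : ∀ a c → H a * H c ≡ H (a ℕ.+ c)
    H*H a c = trans (sym (^-+ ½ (f ℕ.* a) (f ℕ.* c))) (cong (½ ^_) (sym (ℕ.*-distribˡ-+ f a c)))

    ι≤P : ∀ n c → n ℕ.≤ 2 ℕ.^ (16 ℕ.* c) → ι n ≤ P c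
    ι≤P n c h = ≤-trans (ι-mono h) (≤-trans (≤-reflexive (ι-2^ (16 ℕ.* c))) (^-expand 1≤2ℚ (ℕ.*-monoˡ-≤ c 16≤f)))

    ιf≤P : ι f ≤ P 1
    ιf≤P = ≤-trans (ι-mono (n≤2^n f)) (≤-reflexive (trans (ι-2^ f) (cong (2ℚ ^_) (sym (ℕ.*-identityʳ f)))))

    ιb : ι b ≡ P 128
    ιb = ι-2^ (f ℕ.* 128)

    ιf*≤P : ∀ n c → n ℕ.≤ 2 ℕ.^ (16 ℕ.* c) → ι (f ℕ.* n) ≤ P (1 ℕ.+ c)
    ιf*≤P n c h = subst₂ _≤_ (sym (ι-* f n)) (P*P 1 c) (*-mono (0≤ι n) (0≤P 1) ιf≤P (ι≤P n c h))

    ιf*n*b≤P : ∀ n c → n ℕ.≤ 2 ℕ.^ (16 ℕ.* c) → ι (f ℕ.* n ℕ.* b) ≤ P (1 ℕ.+ c ℕ.+ 128)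
    ιf*n*b≤P n c h = subst₂ _≤_ (sym (trans (ι-* (f ℕ.* n) b) (cong (ι (f ℕ.* n) *_) ιb))) (P*P (1 ℕ.+ c) 128)
      (*-monoˡ (0≤P 128) (ιf*≤P n c h))

    ιT≤P : ι T ≤ P 257
    ιT≤P = subst₂ _≤_ (sym (trans (ι-* (f ℕ.* b) b) (cong₂ _*_ (trans (ι-* f b) (cong (ι f *_) ιb)) ιb)))
      (trans (cong (_* P 128) (P*P 1 128)) (P*P 129 128))
      (*-monoˡ (0≤P 128) (*-monoˡ (0≤P 128) ιf≤P))

    12≤ : 12 ℕ.≤ f ℕ.* 128
    12≤ = ≤f (ℕ.≤ᵇ⇒≤ 12 128 tt)

    b≡ : b ≡ 4096 ℕ.* nb
    b≡ = trans (cong (2 ℕ.^_) (sym (ℕ.m+[n∸m]≡n 12≤))) (ℕ.^-distribˡ-+-* 2 12 (f ℕ.* 128 ∸ 12))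

    nb*k≡T : nb ℕ.* k ≡ T
    nb*k≡T = trans (lemma f nb b) (cong (λ n → f ℕ.* n ℕ.* b) (sym b≡))
      where
      lemma : ∀ f n b → n ℕ.* (f ℕ.* 4096 ℕ.* b) ≡ f ℕ.* (4096 ℕ.* n) ℕ.* b
      lemma f n b = trans (sym (ℕ.*-assoc n (f ℕ.* 4096) b)) (cong (ℕ._* b) (trans (ℕ.*-comm n (f ℕ.* 4096)) (ℕ.*-assoc f 4096 n)))

    nb*g≡Δ : nb ℕ.* (f ℕ.* 16384) ≡ Δ
    nb*g≡Δ = trans (lemma f nb) (cong (f ℕ.* 4 ℕ.*_) (sym b≡))
      where
      lemma : ∀ f n → n ℕ.* (f ℕ.* 16384) ≡ f ℕ.* 4 ℕ.* (4096 ℕ.* n)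
      lemma f n = trans (ℕ.*-comm n (f ℕ.* 16384)) (trans (cong (ℕ._* n) (sym (ℕ.*-assoc f 4 4096))) (ℕ.*-assoc (f ℕ.* 4) 4096 n))

    0≤p : 0ℚ ≤ p
    0≤p = 0≤H 128

    [1+p]^≤ : ∀ n → (1ℚ + p) ^ (n ℕ.* b) ≤ 2ℚ ^ (n ℕ.* 2)
    [1+p]^≤ n = subst₂ _≤_ (sym (^-^ (1ℚ + p) n b)) (sym (^-^ 2ℚ n 2))
      (^-mono n (^-nonneg b (0≤+ 0≤1 0≤p)) ([1+½^j]^2^j≤4 (f ℕ.* 128) (≤f (ℕ.s≤s ℕ.z≤n))))

    -- Weights may grow from `H 128` to `H 104`. The allowance has to exceed the initial potential
    -- of a neighbourhood: 129 powers of 1 + p over `Δ` vertices make at most `P 1032`, while the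
    -- bound 128 · e₀ corresponds to `P 3072`. The large exponent widens this gap until it beats the
    -- union bound and ρ = `H 1024`.
    e₀ : ℕ
    e₀ = f ℕ.* 24

    x̄≤ : p * 2ℚ ^ e₀ ≤ H 104
    x̄≤ = H*P≤H 128 24 104 ℕ.≤-refl

    0≤x̄ : 0ℚ ≤ p * 2ℚ ^ e₀
    0≤x̄ = 0≤* 0≤p (0≤P 24)

    H≤½ : ∀ c → 1 ℕ.≤ c → H c ≤ ½
    H≤½ c h = ≤-trans (½^-shrink {1} (≤f h)) (≤-reflexive (*-identityʳ ½))

    small : ∀ {n} → n ℕ.≤ 4096 → n ℕ.≤ 2 ℕ.^ (16 ℕ.* 1)
    small h = ℕ.≤-trans h (ℕ.≤ᵇ⇒≤ 4096 (2 ℕ.^ 16) tt)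

    Sq≤ : ι 129 ≤ P 1
    Sq≤ = ι≤P 129 1 (small (ℕ.≤ᵇ⇒≤ 129 4096 tt))

    ιΔ≤ : ι Δ ≤ P 130
    ιΔ≤ = ιf*n*b≤P 4 1 (small (ℕ.≤ᵇ⇒≤ 4 4096 tt))

    ιk≤ : ι k ≤ P 130
    ιk≤ = ιf*n*b≤P 4096 1 (small ℕ.≤-refl)

    H*P≤½ : ∀ a c → suc c ℕ.≤ a → H a * P c ≤ ½
    H*P≤½ a c h = ≤-trans (H*P≤H a c 1 (ℕ.≤-trans (ℕ.≤-reflexive (ℕ.+-comm c 1)) h)) (H≤½ 1 ℕ.≤-refl)

    half : p * 2ℚ ^ e₀ * (ι 129 * (ι Δ * (p * 2ℚ ^ e₀))) ≤ ½
    half = ≤-trans (*-mono (0≤* (0≤ι 129) (0≤* (0≤ι Δ) 0≤x̄)) (0≤H 104) x̄≤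
        (*-mono (0≤* (0≤ι Δ) 0≤x̄) (0≤P 1) Sq≤ (*-mono 0≤x̄ (0≤P 130) ιΔ≤ x̄≤)))
      (≤-trans (≤-reflexive (trans
        (solve 3 (λ h a c → h :* (a :* (c :* h)) := h :* h :* (a :* c)) refl (H 104) (P 1) (P 130))
        (cong₂ _*_ (H*H 104 104) (P*P 1 130))))
      (H*P≤½ 208 131 (ℕ.≤ᵇ⇒≤ 132 208 tt)))

    κ≡ : 128 ℕ.* e₀ ≡ f ℕ.* 3072
    κ≡ = trans (ℕ.*-comm 128 e₀) (ℕ.*-assoc f 24 128)

    2≤P1 : 2ℚ ≤ P 1
    2≤P1 = ≤-trans (≤-reflexive (sym (*-identityʳ 2ℚ))) (^-expand {2ℚ} {1} 1≤2ℚ (≤f (ℕ.≤-refl {1})))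

    3≤P1 : 3ℚ ≤ P 1
    3≤P1 = ≤-trans (by-difference 1ℚ 0≤1 refl) (^-expand {2ℚ} {2} 1≤2ℚ (ℕ.≤-trans (ℕ.≤-trans (ℕ.≤ᵇ⇒≤ 2 16 tt) 16≤f) (ℕ.≤-reflexive (sym (ℕ.*-identityʳ f)))))

    -- The cube of the maximal weight gives `H 312`; the second moment k (Δ + k κ), γ and the
    -- numerals give `P 290`. With `Δ` as codegree bound the second moment would be of order b³ up
    -- to powers of f, too much for `H 312`.
    small-error : 3ℚ * (p * 2ℚ ^ e₀ * (p * 2ℚ ^ e₀ * (p * 2ℚ ^ e₀)) * (ι 129 * ι 129) * 2ℚ ^ e₀)
                  * ι (k ℕ.* (Δ ℕ.+ k ℕ.* (128 ℕ.* e₀))) ≤ ½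
    small-error = ≤-trans (*-mono (0≤ι (k ℕ.* (Δ ℕ.+ k ℕ.* (128 ℕ.* e₀)))) 0≤K′ K≤ N≤)
      (≤-trans (≤-reflexive (trans
        (solve 5 (λ t h q w v → t :* (h :* (h :* h) :* (t :* t) :* q) :* (w :* v) := (h :* h :* h) :* (t :* (t :* t) :* q :* (w :* v))) refl
           (P 1) (H 104) (P 24) (P 130) (P 133))
        (cong₂ _*_ (trans (cong (_* H 104) (H*H 104 104)) (H*H 208 104))
          (trans (cong₂ _*_ (trans (cong (λ z → P 1 * z * P 24) (P*P 1 1)) (trans (cong (_* P 24) (P*P 1 2)) (P*P 3 24))) (P*P 130 133)) (P*P 27 263)))))
      (H*P≤½ 312 290 (ℕ.≤ᵇ⇒≤ 291 312 tt)))
      where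
      0≤K′ : 0ℚ ≤ P 1 * (H 104 * (H 104 * H 104) * (P 1 * P 1) * P 24)
      0≤K′ = 0≤* (0≤P 1) (0≤* (0≤* (0≤* (0≤H 104) (0≤* (0≤H 104) (0≤H 104))) (0≤* (0≤P 1) (0≤P 1))) (0≤P 24))
      K≤ : 3ℚ * (p * 2ℚ ^ e₀ * (p * 2ℚ ^ e₀ * (p * 2ℚ ^ e₀)) * (ι 129 * ι 129) * 2ℚ ^ e₀)
           ≤ P 1 * (H 104 * (H 104 * H 104) * (P 1 * P 1) * P 24)
      K≤ = *-mono (0≤* (0≤* (0≤* 0≤x̄ (0≤* 0≤x̄ 0≤x̄)) (0≤* (0≤ι 129) (0≤ι 129))) (0≤P 24)) (0≤P 1) 3≤P1
        (*-monoˡ (0≤P 24) (*-mono (0≤* (0≤ι 129) (0≤ι 129)) (0≤* (0≤H 104) (0≤* (0≤H 104) (0≤H 104)))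
          (*-mono (0≤* 0≤x̄ 0≤x̄) (0≤H 104) x̄≤ (*-mono 0≤x̄ (0≤H 104) x̄≤ x̄≤))
          (*-mono (0≤ι 129) (0≤P 1) Sq≤ Sq≤)))
      N≤ : ι (k ℕ.* (Δ ℕ.+ k ℕ.* (128 ℕ.* e₀))) ≤ P 130 * P 133
      N≤ = subst (_≤ P 130 * P 133) (sym (trans (ι-* k _) (cong (ι k *_) (trans (ι-+ Δ _) (cong (ι Δ +_)
             (trans (ι-* k _) (cong (λ n → ι k * ι n) κ≡)))))))
        (*-mono (0≤+ (0≤ι Δ) (0≤* (0≤ι k) (0≤ι (f ℕ.* 3072)))) (0≤P 130) ιk≤
          (≤-trans (+-mono-≤ (≤-trans ιΔ≤ (^-expand 1≤2ℚ (ℕ.*-monoʳ-≤ f (ℕ.≤ᵇ⇒≤ 130 132 tt))))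
              (≤-trans (*-mono (0≤ι (f ℕ.* 3072)) (0≤P 130) ιk≤ (ιf*≤P 3072 1 (small (ℕ.≤ᵇ⇒≤ 3072 4096 tt)))) (≤-reflexive (P*P 130 2))))
            (≤-trans (≤-reflexive (solve 1 (λ a → a :+ a := con 2ℚ :* a) refl (P 132)))
              (≤-trans (*-monoˡ (0≤P 132) 2≤P1) (≤-reflexive (P*P 1 132))))))

    quarter : ℚ
    quarter = ½ * ½

    H1025≤ : H 1025 ≤ quarter * ρ
    H1025≤ = subst (_≤ quarter * ρ) (H*H 1 1024) (*-monoˡ (0≤H 1024)
      (≤-trans (½^-shrink {2} (ℕ.≤-trans (ℕ.≤-trans (ℕ.≤ᵇ⇒≤ 2 16 tt) 16≤f) (ℕ.≤-reflexive (sym (ℕ.*-identityʳ f))))) ≤-refl))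

    -- `k` is 2048 f · 2 b, and (1 - 1 / (2 b)) ^ (2 b) ≤ ½ yields `H 2048`, well below ρ.
    term₁ : 2ℚ * (1ℚ - ½ * p) ^ k ≤ H 1025
    term₁ = ≤-trans (*-mono (^-nonneg k (0≤- (½^≤1 (suc (f ℕ.* 128))))) (0≤P 1) 2≤P1 pow)
      (≤-trans (≤-reflexive (*-comm (P 1) (H 2048))) (H*P≤H 2048 1 1025 (ℕ.≤ᵇ⇒≤ 1026 2048 tt)))
      where
      k≡ : k ≡ (f ℕ.* 2048) ℕ.* 2 ℕ.^ suc (f ℕ.* 128)
      k≡ = trans (cong (ℕ._* b) (sym (ℕ.*-assoc f 2048 2))) (ℕ.*-assoc (f ℕ.* 2048) 2 b)
      pow : (1ℚ - ½ * p) ^ k ≤ H 2048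
      pow = subst (_≤ H 2048) (sym (trans (cong ((1ℚ - ½ * p) ^_) k≡) (^-^ (1ℚ - ½ * p) (f ℕ.* 2048) (2 ℕ.^ suc (f ℕ.* 128)))))
        (^-mono (f ℕ.* 2048) (^-nonneg (2 ℕ.^ suc (f ℕ.* 128)) (0≤- (½^≤1 (suc (f ℕ.* 128))))) ([1-½^j]^2^j≤½ (suc (f ℕ.* 128))))

    term₂ : ι T * (½ ^ (128 ℕ.* e₀) * (2ℚ * ((1ℚ + p) ^ 129) ^ Δ)) ≤ H 1025
    term₂ = ≤-trans (*-mono (0≤* (^-nonneg (128 ℕ.* e₀) 0≤½) (0≤* 0≤2ℚ 0≤pow)) (0≤P 257) ιT≤P
        (*-mono (0≤* 0≤2ℚ 0≤pow) (0≤H 3072) (≤-reflexive (cong (½ ^_) κ≡)) (*-mono 0≤pow (0≤P 1) 2≤P1 pow)))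
      (≤-trans (≤-reflexive (trans
        (solve 4 (λ t h a c → t :* (h :* (a :* c)) := h :* (t :* (a :* c))) refl (P 257) (H 3072) (P 1) (P 1032))
        (cong (H 3072 *_) (trans (cong (P 257 *_) (P*P 1 1032)) (P*P 257 1033)))))
      (H*P≤H 3072 1290 1025 (ℕ.≤ᵇ⇒≤ 2315 3072 tt)))
      where
      0≤pow : 0ℚ ≤ ((1ℚ + p) ^ 129) ^ Δ
      0≤pow = ^-nonneg Δ (^-nonneg 129 (0≤+ 0≤1 0≤p))
      expo : Δ ℕ.* 129 ≡ f ℕ.* 516 ℕ.* b
      expo = trans (ℕ.*-assoc (f ℕ.* 4) b 129) (trans (cong (f ℕ.* 4 ℕ.*_) (ℕ.*-comm b 129))
        (trans (sym (ℕ.*-assoc (f ℕ.* 4) 129 b)) (cong (ℕ._* b) (ℕ.*-assoc f 4 129))))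
      pow : ((1ℚ + p) ^ 129) ^ Δ ≤ P 1032
      pow = subst₂ _≤_ (trans (cong ((1ℚ + p) ^_) (sym expo)) (^-^ (1ℚ + p) Δ 129)) (cong (2ℚ ^_) (ℕ.*-assoc f 516 2)) ([1+p]^≤ (f ℕ.* 516))

    -- A block has mean p k = 4096 f and bound 16384 f, four times as much; (1 + p) ^ k ≤ `P 8192`
    -- leaves `H 8192` for the union over the blocks and for ρ.
    term₃ : ι nb * (½ ^ (f ℕ.* 16384) * (2ℚ * ((1ℚ + p) ^ 1) ^ k)) ≤ H 1025
    term₃ = ≤-trans (*-mono (0≤* (0≤H 16384) (0≤* 0≤2ℚ 0≤pow)) (0≤P 128) nb≤
        (*-monoʳ (0≤H 16384) (*-mono 0≤pow (0≤P 1) 2≤P1 pow)))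
      (≤-trans (≤-reflexive (trans
        (solve 4 (λ t h a c → t :* (h :* (a :* c)) := h :* (t :* (a :* c))) refl (P 128) (H 16384) (P 1) (P 8192))
        (cong (H 16384 *_) (trans (cong (P 128 *_) (P*P 1 8192)) (P*P 128 8193)))))
      (H*P≤H 16384 8321 1025 (ℕ.≤ᵇ⇒≤ 9346 16384 tt)))
      where
      0≤pow : 0ℚ ≤ ((1ℚ + p) ^ 1) ^ k
      0≤pow = ^-nonneg k (^-nonneg 1 (0≤+ 0≤1 0≤p))
      nb≤ : ι nb ≤ P 128
      nb≤ = ≤-trans (≤-reflexive (ι-2^ (f ℕ.* 128 ∸ 12))) (^-expand 1≤2ℚ (ℕ.m∸n≤m (f ℕ.* 128) 12))
      pow : ((1ℚ + p) ^ 1) ^ k ≤ P 8192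
      pow = subst₂ _≤_ (cong (_^ k) (sym (*-identityʳ (1ℚ + p)))) (cong (2ℚ ^_) (ℕ.*-assoc f 4096 2)) ([1+p]^≤ (f ℕ.* 4096))

    ρ≥ : 2ℚ * (1ℚ - ½ * p) ^ k
          + ((ι T * (½ ^ (128 ℕ.* e₀) * (2ℚ * ((1ℚ + p) ^ 129) ^ Δ))
            + ι T * (½ ^ (128 ℕ.* e₀) * (2ℚ * ((1ℚ + p) ^ 129) ^ Δ)))
            + ι nb * (½ ^ (f ℕ.* 16384) * (2ℚ * ((1ℚ + p) ^ 1) ^ k))) ≤ ρ
    ρ≥ = ≤-trans (+-mono-≤ (≤-trans term₁ H1025≤) (+-mono-≤ (+-mono-≤ (≤-trans term₂ H1025≤) (≤-trans term₂ H1025≤)) (≤-trans term₃ H1025≤)))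
      (≤-reflexive (solve 1 (λ r → con quarter :* r :+ ((con quarter :* r :+ con quarter :* r) :+ con quarter :* r) := r) refl ρ))

    𝒬 : List Pair
    𝒬 = pairs-below T k T

    1≤b : 1 ℕ.≤ b
    1≤b = ℕ.m^n>0 2 (f ℕ.* 128)

    -- With n = f b, `Δ` is 4 n, the growth (1 + p) ^ T is at most 2^(2 n), and `T` is at most 2^n.
    start₁ : ½ ^ Δ * (ι T * (1ℚ + p) ^ T) ≤ quarter
    start₁ = ≤-trans (*-monoʳ (^-nonneg Δ 0≤½) (*-mono (^-nonneg T (0≤+ 0≤1 0≤p)) (^-nonneg n 0≤2ℚ)
        (≤-trans ιT≤P (^-expand 1≤2ℚ (ℕ.*-monoʳ-≤ f 257≤b))) ([1+p]^≤ n)))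
      (≤-trans (≤-reflexive (cong₂ _*_ (cong (½ ^_) Δ≡) (sym (^-+ 2ℚ n (n ℕ.* 2)))))
      (≤-trans (½^*2^≤ (n ℕ.* 4) (n ℕ.+ n ℕ.* 2) 2 bound) ≤-refl))
      where
      n : ℕ
      n = f ℕ.* b
      2≤n : 2 ℕ.≤ n
      2≤n = ℕ.*-mono-≤ (ℕ.≤-trans (ℕ.≤ᵇ⇒≤ 2 16 tt) 16≤f) 1≤b
      257≤b : 257 ℕ.≤ b
      257≤b = ℕ.≤-trans (ℕ.≤ᵇ⇒≤ 257 (2 ℕ.^ 128) tt) (ℕ.^-monoʳ-≤ 2 (≤f (ℕ.≤-refl {128})))
      Δ≡ : Δ ≡ n ℕ.* 4
      Δ≡ = trans (ℕ.*-assoc f 4 b) (trans (cong (f ℕ.*_) (ℕ.*-comm 4 b)) (sym (ℕ.*-assoc f b 4)))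
      bound : n ℕ.+ n ℕ.* 2 ℕ.+ 2 ℕ.≤ n ℕ.* 4
      bound = ℕ.≤-trans (ℕ.+-monoʳ-≤ (n ℕ.+ n ℕ.* 2) 2≤n) (ℕ.≤-reflexive (lemma n))
        where
        lemma : ∀ n → n ℕ.+ n ℕ.* 2 ℕ.+ n ≡ n ℕ.* 4
        lemma n = trans (cong (ℕ._+ n) (sym (ℕ.*-suc n 2))) (trans (ℕ.+-comm (n ℕ.* 3) n) (sym (ℕ.*-suc n 3)))

    1≤k : 1 ℕ.≤ k
    1≤k = ℕ.*-mono-≤ (≤f (ℕ.≤ᵇ⇒≤ 1 4096 tt)) 1≤b

    -- This fixes ρ. In units of f k the union over T^(2 k + 1) pairs costs at most 3 · 257, `E₀`
    -- costs 128 and the factor ¼ at most 2, in total 901 of the available 1024.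
    start₂ : sumL (λ _ → 2ℚ ^ E₀ * ρ ^ k) 𝒬 ≤ quarter
    start₂ = ≤-trans (≤-reflexive (sumL-const (2ℚ ^ E₀ * ρ ^ k) 𝒬))
      (≤-trans (*-monoˡ (0≤* (^-nonneg E₀ 0≤2ℚ) (^-nonneg k (0≤H 1024))) (≤-trans (ι-mono (length-pairs T k T ℕ.≤-refl)) number≤))
      (≤-trans (≤-reflexive (trans
        (cong (λ z → 2ℚ ^ n257 * (2ℚ ^ (k ℕ.* n257) * 2ℚ ^ (k ℕ.* n257)) * (2ℚ ^ E₀ * z)) (sym (^-^ ½ k (f ℕ.* 1024))))
        (trans (solve 4 (λ a c e r → a :* (c :* c) :* (e :* r) := r :* (a :* (c :* c) :* e)) refl (2ℚ ^ n257) (2ℚ ^ (k ℕ.* n257)) (2ℚ ^ E₀) (½ ^ (k ℕ.* (f ℕ.* 1024))))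
          (cong (½ ^ (k ℕ.* (f ℕ.* 1024)) *_) (sym (trans (^-+ 2ℚ (n257 ℕ.+ (k ℕ.* n257 ℕ.+ k ℕ.* n257)) E₀) (cong (_* 2ℚ ^ E₀)
            (trans (^-+ 2ℚ n257 (k ℕ.* n257 ℕ.+ k ℕ.* n257)) (cong (2ℚ ^ n257 *_) (^-+ 2ℚ (k ℕ.* n257) (k ℕ.* n257)))))))))))
      (≤-trans (½^*2^≤ (k ℕ.* (f ℕ.* 1024)) (n257 ℕ.+ (k ℕ.* n257 ℕ.+ k ℕ.* n257) ℕ.+ E₀) 2 bound) ≤-refl)))
      where
      n257 : ℕ
      n257 = f ℕ.* 257
      number≤ : ι (T ℕ.* (T ℕ.^ k ℕ.* T ℕ.^ k)) ≤ 2ℚ ^ n257 * (2ℚ ^ (k ℕ.* n257) * 2ℚ ^ (k ℕ.* n257))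
      number≤ = subst (_≤ 2ℚ ^ n257 * (2ℚ ^ (k ℕ.* n257) * 2ℚ ^ (k ℕ.* n257))) (sym (trans (ι-* T _) (cong (ι T *_) (ι-* (T ℕ.^ k) (T ℕ.^ k)))))
        (*-mono (0≤* (0≤ι (T ℕ.^ k)) (0≤ι (T ℕ.^ k))) (0≤P 257) ιT≤P (*-mono (0≤ι (T ℕ.^ k)) (^-nonneg (k ℕ.* n257) 0≤2ℚ) pow pow))
        where
        ι-^ : ∀ a n → ι (a ℕ.^ n) ≡ ι a ^ n
        ι-^ a zero    = refl
        ι-^ a (suc n) = trans (ι-* a (a ℕ.^ n)) (cong (ι a *_) (ι-^ a n))
        pow : ι (T ℕ.^ k) ≤ 2ℚ ^ (k ℕ.* n257)
        pow = subst₂ _≤_ (sym (ι-^ T k)) (sym (^-^ 2ℚ k n257)) (^-mono k (0≤ι T) ιT≤P)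
      bound : n257 ℕ.+ (k ℕ.* n257 ℕ.+ k ℕ.* n257) ℕ.+ E₀ ℕ.+ 2 ℕ.≤ k ℕ.* (f ℕ.* 1024)
      bound = ℕ.≤-trans (ℕ.+-mono-≤ (ℕ.+-monoˡ-≤ E₀ (ℕ.+-monoˡ-≤ (k ℕ.* n257 ℕ.+ k ℕ.* n257)
          (ℕ.≤-trans (ℕ.≤-reflexive (sym (ℕ.*-identityˡ n257))) (ℕ.*-monoˡ-≤ n257 1≤k))))
          (ℕ.≤-trans (≤f (ℕ.≤-refl {2})) (ℕ.≤-trans (ℕ.≤-reflexive (sym (ℕ.*-identityˡ (f ℕ.* 2)))) (ℕ.*-monoˡ-≤ (f ℕ.* 2) 1≤k))))
        (ℕ.≤-trans (ℕ.≤-reflexive (trans (cong (ℕ._+ k ℕ.* (f ℕ.* 2)) (cong (ℕ._+ E₀) (trans (cong (k ℕ.* n257 ℕ.+_) (sym (ℕ.*-distribˡ-+ k n257 n257))) (sym (ℕ.*-distribˡ-+ k n257 (n257 ℕ.+ n257))))))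
            (trans (cong (ℕ._+ k ℕ.* (f ℕ.* 2)) (sym (ℕ.*-distribˡ-+ k (n257 ℕ.+ (n257 ℕ.+ n257)) (f ℕ.* 128))))
              (trans (sym (ℕ.*-distribˡ-+ k (n257 ℕ.+ (n257 ℕ.+ n257) ℕ.+ f ℕ.* 128) (f ℕ.* 2)))
                (cong (k ℕ.*_) (trans (cong (λ z → n257 ℕ.+ z ℕ.+ f ℕ.* 128 ℕ.+ f ℕ.* 2) (sym (ℕ.*-distribˡ-+ f 257 257)))
                  (trans (cong (λ z → z ℕ.+ f ℕ.* 128 ℕ.+ f ℕ.* 2) (sym (ℕ.*-distribˡ-+ f 257 514)))
                    (trans (cong (ℕ._+ f ℕ.* 2) (sym (ℕ.*-distribˡ-+ f 771 128))) (sym (ℕ.*-distribˡ-+ f 899 2)))))))))) 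
          (ℕ.*-monoʳ-≤ k (ℕ.*-monoʳ-≤ f (ℕ.≤ᵇ⇒≤ 901 1024 tt))))

    start : ½ ^ Δ * (ι T * (1ℚ + p) ^ T) + sumL (λ _ → 2ℚ ^ E₀ * ρ ^ k) 𝒬 < 1ℚ
    start = ≤-<-trans (+-mono-≤ start₁ start₂) (toWitness {a? = quarter + quarter <? 1ℚ} tt)

    graph-family : Σ[ back ∈ (ℕ → ℕ → Bool) ] TriangleFree back × All (λ q → E₀ ℕ.≤ edges back T (proj₁ q) (proj₂ q)) 𝒬
    graph-family = Sequential.graph p ρ (ι 129) e₀ 127 k Δ T nb (f ℕ.* 16384) E₀ 0≤p (0≤H 1024)
      (≤-trans x̄≤ (½^≤1 (f ℕ.* 104))) (1≤ι-suc 128) ≤-refl half small-error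
      (ℕ.*-monoˡ-≤ b (ℕ.*-monoʳ-≤ f (ℕ.≤ᵇ⇒≤ 4 4096 tt))) (ℕ.≤-reflexive (sym nb*k≡T)) (ℕ.≤-reflexive nb*g≡Δ)
      ρ≥ 𝒬 (pairs-separated T k T ℕ.≤-refl) start

  Dense : ℕ → (ℕ → ℕ → Bool) → Set
  Dense f back = ∀ X Y → Increasing k X → Increasing k Y → (∀ i j → i ℕ.< k → j ℕ.< k → X i ℕ.< Y j) →
    (∀ j → j ℕ.< k → Y j ℕ.< T) → E₀ ℕ.≤ sum< k (λ j → sum< k (λ i → 𝟙[ back (Y j) (X i) ]))
    where open Scale f

  dense-triangle-free : ∀ f → 16 ℕ.≤ f → Σ[ back ∈ (ℕ → ℕ → Bool) ] TriangleFree back × Dense f back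
  dense-triangle-free f 16≤f = back , proj₁ (proj₂ graph-family) , λ X Y incX incY X<Y Y<T →
    let P , Q , ∈ , eq = pairs-complete T k (ℕ.pred k) (sym (ℕ.suc-pred k {{ℕ.>-nonZero 1≤k}})) X Y incX incY X<Y Y<T
    in subst (E₀ ℕ.≤_) (eq back) (All.lookup (proj₂ (proj₂ graph-family)) ∈)
    where
    open Scale f
    open Instance f 16≤f
    back : ℕ → ℕ → Bool
    back = proj₁ graph-family

-- A switching bound for permutations that avoid a large set of positions.

module Switching where
  open Process using (≡ᵇ-refl; ≡ᵇ-true⁻; ≡ᵇ-false)
  open ExpectedStep using (count)
  open Sums
  open import Data.Bool.Base using (Bool; true; false; if_then_else_; _∧_; not)
  open import Data.Nat.Base
  open import Data.Nat.Properties
  open import Data.Nat.Tactic.RingSolver using (solve-∀)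
  open import Data.List.Base using (List; []; _∷_; _++_; length)
  open import Data.List.Relation.Unary.All as All using (All; []; _∷_)
  open import Data.List.Relation.Unary.Any using (here; there)
  open import Data.List.Relation.Unary.AllPairs using ([]; _∷_)
  open import Data.List.Relation.Unary.Unique.Propositional using (Unique)
  open import Data.List.Membership.Propositional using (_∈_)
  open import Data.List.Membership.Propositional.Properties using (∈-++⁺ˡ; ∈-++⁺ʳ; ∈-++⁻; ∈-∃++)
  open import Data.Empty using (⊥-elim)
  open import Data.Product using (_×_; _,_; proj₁; proj₂)
  open import Data.Sum.Base using (inj₁; inj₂)
  open import Relation.Binary.PropositionalEquality hiding ([_])
  open import Relation.Nullary using (yes; no)

  sumList : {A : Set} → (A → ℕ) → List A → ℕ
  sumList F []       = 0
  sumList F (x ∷ xs) = F x + sumList F xs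

  sumList-++ : {A : Set} (F : A → ℕ) (xs ys : List A) → sumList F (xs ++ ys) ≡ sumList F xs + sumList F ys
  sumList-++ F []       ys = refl
  sumList-++ F (x ∷ xs) ys = trans (cong (F x +_) (sumList-++ F xs ys)) (sym (+-assoc (F x) _ _))

  sumList-mono : {A : Set} {F G : A → ℕ} (xs : List A) → (∀ {x} → x ∈ xs → F x ≤ G x) → sumList F xs ≤ sumList G xs
  sumList-mono []       h = z≤n
  sumList-mono (x ∷ xs) h = +-mono-≤ (h (here refl)) (sumList-mono xs (λ x∈ → h (there x∈)))

  sumList-+ : {A : Set} (F G : A → ℕ) (xs : List A) → sumList (λ x → F x + G x) xs ≡ sumList F xs + sumList G xs
  sumList-+ F G []       = refl
  sumList-+ F G (x ∷ xs) = trans (cong (F x + G x +_) (sumList-+ F G xs)) (lemma (F x) (G x) (sumList F xs) (sumList G xs))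
    where
    lemma : ∀ a b c d → a + b + (c + d) ≡ a + c + (b + d)
    lemma = solve-∀

  sumList-*ʳ : {A : Set} (r : ℕ) (F : A → ℕ) (xs : List A) → sumList (λ x → F x * r) xs ≡ sumList F xs * r
  sumList-*ʳ r F []       = refl
  sumList-*ʳ r F (x ∷ xs) = trans (cong (F x * r +_) (sumList-*ʳ r F xs)) (sym (*-distribʳ-+ r (F x) (sumList F xs)))

  sumList-sum< : {A : Set} (F : A → ℕ → ℕ) (xs : List A) (n : ℕ) →
    sumList (λ x → sum< n (F x)) xs ≡ sum< n (λ i → sumList (λ x → F x i) xs)
  sumList-sum< F []       n = sym (sum<-zero n)
  sumList-sum< F (x ∷ xs) n = trans (cong (sum< n (F x) +_) (sumList-sum< F xs n)) (sym (sum<-+ (F x) (λ i → sumList (λ x → F x i) xs) n))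

  sumList-injection : {A B : Set} (F : B → ℕ) (f : A → B) (xs : List A) (ys : List B) → Unique xs →
    (∀ {x} → x ∈ xs → f x ∈ ys) → (∀ {x x′} → x ∈ xs → x′ ∈ xs → f x ≡ f x′ → x ≡ x′) →
    sumList (λ x → F (f x)) xs ≤ sumList F ys
  sumList-injection F f []       ys _         into inj = z≤n
  sumList-injection F f (x ∷ xs) ys (x∉ ∷ u) into inj with ∈-∃++ (into (here refl))
  ... | as , bs , refl = begin
    F (f x) + sumList (λ x → F (f x)) xs ≤⟨ +-monoʳ-≤ (F (f x)) (sumList-injection F f xs (as ++ bs) u into′ (λ p q → inj (there p) (there q))) ⟩
    F (f x) + sumList F (as ++ bs)       ≡⟨ cong (F (f x) +_) (sumList-++ F as bs) ⟩
    F (f x) + (sumList F as + sumList F bs) ≡⟨ lemma (F (f x)) (sumList F as) (sumList F bs) ⟩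
    sumList F as + (F (f x) + sumList F bs) ≡⟨ sym (sumList-++ F as (f x ∷ bs)) ⟩
    sumList F (as ++ f x ∷ bs) ∎
    where
    open ≤-Reasoning
    lemma : ∀ a b c → a + (b + c) ≡ b + (a + c)
    lemma = solve-∀
    into′ : ∀ {x′} → x′ ∈ xs → f x′ ∈ as ++ bs
    into′ {x′} x′∈ with ∈-++⁻ as (into (there x′∈))
    ... | inj₁ p = ∈-++⁺ˡ p
    ... | inj₂ (there p) = ∈-++⁺ʳ as p
    ... | inj₂ (here e) = ⊥-elim (All.lookup x∉ x′∈ (inj (here refl) (there x′∈) (sym e)))

  indicator-sum : ∀ a n → a < n → sum< n (λ i → 𝟙[ i ≡ᵇ a ]) ≡ 1
  indicator-sum a (suc n) a<n with n ≟ a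
  ... | yes refl rewrite ≡ᵇ-refl n = cong (_+ 1) (none n ≤-refl)
    where
    none : ∀ k → k ≤ n → sum< k (λ i → 𝟙[ i ≡ᵇ n ]) ≡ 0
    none zero    _ = refl
    none (suc k) l rewrite ≡ᵇ-false (<⇒≢ l) = trans (+-identityʳ _) (none k (<⇒≤ l))
  ... | no n≢a rewrite ≡ᵇ-false n≢a = trans (+-identityʳ _) (indicator-sum a n (≤∧≢⇒< (s≤s⁻¹ a<n) (λ e → n≢a (sym e))))

  -- Permutations of the first `m` numbers: by finiteness injectivity suffices, and `surjective`
  -- recovers the rest.
  BoundedInjective : ℕ → (ℕ → ℕ) → Set
  BoundedInjective m τ = (∀ i → i < m → τ i < m) × (∀ i j → i < m → j < m → τ i ≡ τ j → i ≡ j)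

  module _ {m : ℕ} {τ : ℕ → ℕ} (bi : BoundedInjective m τ) where

    preimages≤1 : ∀ j n → n ≤ m → sum< n (λ i → 𝟙[ τ i ≡ᵇ j ]) ≤ 1
    preimages≤1 j zero    _   = z≤n
    preimages≤1 j (suc n) n<m with τ n ≡ᵇ j in eq
    ... | false = ≤-trans (≤-reflexive (+-identityʳ _)) (preimages≤1 j n (<⇒≤ n<m))
    ... | true  = ≤-reflexive (cong (_+ 1) (none n ≤-refl))
      where
      none : ∀ k → k ≤ n → sum< k (λ i → 𝟙[ τ i ≡ᵇ j ]) ≡ 0
      none zero    _ = refl
      none (suc k) l with τ k ≡ᵇ j in e
      ... | false = trans (+-identityʳ _) (none k (<⇒≤ l))
      ... | true  = ⊥-elim (<⇒≢ l (proj₂ bi k n (<-trans l n<m) n<m (trans (≡ᵇ-true⁻ e) (sym (≡ᵇ-true⁻ {τ n} eq)))))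

    sum-injective≤ : ∀ g → sum< m (λ i → g (τ i)) ≤ sum< m g
    sum-injective≤ g = begin
      sum< m (λ i → g (τ i)) ≡⟨ sum<-cong m (λ i i<m → sym (expand i i<m)) ⟩
      sum< m (λ i → sum< m (λ j → g j * 𝟙[ τ i ≡ᵇ j ])) ≡⟨ sum<-swap (λ i j → g j * 𝟙[ τ i ≡ᵇ j ]) m m ⟩
      sum< m (λ j → sum< m (λ i → g j * 𝟙[ τ i ≡ᵇ j ])) ≡⟨ sum<-cong m (λ j _ → sum<-*ˡ (g j) (λ i → 𝟙[ τ i ≡ᵇ j ]) m) ⟩
      sum< m (λ j → g j * sum< m (λ i → 𝟙[ τ i ≡ᵇ j ])) ≤⟨ sum<-mono m (λ j _ → *-monoʳ-≤ (g j) (preimages≤1 j m ≤-refl)) ⟩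
      sum< m (λ j → g j * 1) ≡⟨ sum<-cong m (λ j _ → *-identityʳ (g j)) ⟩
      sum< m g ∎
      where
      open ≤-Reasoning
      ≡ᵇ-sym : ∀ a b → (a ≡ᵇ b) ≡ (b ≡ᵇ a)
      ≡ᵇ-sym zero    zero    = refl
      ≡ᵇ-sym zero    (suc b) = refl
      ≡ᵇ-sym (suc a) zero    = refl
      ≡ᵇ-sym (suc a) (suc b) = ≡ᵇ-sym a b
      expand : ∀ i → i < m → sum< m (λ j → g j * 𝟙[ τ i ≡ᵇ j ]) ≡ g (τ i)
      expand i i<m = trans (sum<-cong m (λ j _ → pointwise j)) (trans (sum<-*ˡ (g (τ i)) (λ j → 𝟙[ j ≡ᵇ τ i ]) m)
        (trans (cong (g (τ i) *_) (indicator-sum (τ i) m (proj₁ bi i i<m))) (*-identityʳ _)))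
        where
        pointwise : ∀ j → g j * 𝟙[ τ i ≡ᵇ j ] ≡ g (τ i) * 𝟙[ j ≡ᵇ τ i ]
        pointwise j rewrite ≡ᵇ-sym (τ i) j with j ≡ᵇ τ i in eq
        ... | true  rewrite ≡ᵇ-true⁻ {j} eq = refl
        ... | false = trans (*-zeroʳ (g j)) (sym (*-zeroʳ (g (τ i))))

    -- A sum of indicators and the complementary sum add up to m on both sides.
    count-injective : ∀ (P : ℕ → Bool) → count m P ≤ sum< m (λ i → 𝟙[ P (τ i) ])
    count-injective P = +-cancelʳ-≤ (sum< m (λ i → 𝟙[ not (P i) ])) (count m P) (sum< m (λ i → 𝟙[ P (τ i) ])) (begin
      count m P + sum< m (λ i → 𝟙[ not (P i) ]) ≡⟨ cong (_+ sum< m (λ i → 𝟙[ not (P i) ])) (count≡sum P m) ⟩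
      sum< m (λ i → 𝟙[ P i ]) + sum< m (λ i → 𝟙[ not (P i) ]) ≡⟨ total P (λ i → i) ⟩
      m ≡⟨ sym (total P τ) ⟩
      sum< m (λ i → 𝟙[ P (τ i) ]) + sum< m (λ i → 𝟙[ not (P (τ i)) ]) ≤⟨ +-monoʳ-≤ _ (sum-injective≤ (λ i → 𝟙[ not (P i) ])) ⟩
      sum< m (λ i → 𝟙[ P (τ i) ]) + sum< m (λ i → 𝟙[ not (P i) ]) ∎)
      where
      open ≤-Reasoning
      one : ∀ b → 𝟙[ b ] + 𝟙[ not b ] ≡ 1
      one true  = refl
      one false = refl
      total : ∀ (P : ℕ → Bool) (h : ℕ → ℕ) → sum< m (λ i → 𝟙[ P (h i) ]) + sum< m (λ i → 𝟙[ not (P (h i)) ]) ≡ m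
      total P h = trans (sym (sum<-+ (λ i → 𝟙[ P (h i) ]) (λ i → 𝟙[ not (P (h i)) ]) m))
        (trans (sum<-cong m (λ i _ → one (P (h i)))) (trans (sum<-const 1 m) (*-identityʳ m)))

  transpose : ℕ → ℕ → ℕ → ℕ
  transpose i i′ x = if x ≡ᵇ i then i′ else (if x ≡ᵇ i′ then i else x)

  transpose-left : ∀ i i′ → transpose i i′ i ≡ i′
  transpose-left i i′ rewrite ≡ᵇ-refl i = refl

  transpose-right : ∀ i i′ → transpose i i′ i′ ≡ i
  transpose-right i i′ with i′ ≟ i
  ... | yes refl rewrite ≡ᵇ-refl i = refl
  ... | no i′≢i rewrite ≡ᵇ-false i′≢i | ≡ᵇ-refl i′ = refl

  transpose-other : ∀ {i i′ x} → x ≢ i → x ≢ i′ → transpose i i′ x ≡ x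
  transpose-other x≢i x≢i′ rewrite ≡ᵇ-false x≢i | ≡ᵇ-false x≢i′ = refl

  transpose-involutive : ∀ i i′ x → transpose i i′ (transpose i i′ x) ≡ x
  transpose-involutive i i′ x with x ≟ i | x ≟ i′
  ... | yes refl | _        = trans (cong (transpose x i′) (transpose-left x i′)) (transpose-right x i′)
  ... | no _     | yes refl = trans (cong (transpose i x) (transpose-right i x)) (transpose-left i x)
  ... | no x≢i   | no x≢i′  = trans (cong (transpose i i′) (transpose-other x≢i x≢i′)) (transpose-other x≢i x≢i′)

  transpose-< : ∀ {i i′ x m} → i < m → i′ < m → x < m → transpose i i′ x < m
  transpose-< {i} {i′} {x} i<m i′<m x<m with x ≡ᵇ i | x ≡ᵇ i′
  ... | true  | _     = i′<m
  ... | false | true  = i<m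
  ... | false | false = x<m

  -- A repetition-free list in bijection with the permutations of [m]: everything that the switching
  -- argument uses of the matchings.
  record PermutationModel (A : Set) (m : ℕ) : Set where
    field
      elements   : List A
      unique     : Unique elements
      π          : A → ℕ → ℕ
      realize    : (ℕ → ℕ) → A
      realize-∈  : ∀ τ → BoundedInjective m τ → realize τ ∈ elements
      π-realize  : ∀ τ → BoundedInjective m τ → ∀ i → i < m → π (realize τ) i ≡ τ i
      π-bi       : ∀ {G} → G ∈ elements → BoundedInjective m (π G)
      π-injective : ∀ {G G′} → G ∈ elements → G′ ∈ elements → (∀ i → i < m → π G i ≡ π G′ i) → G ≡ G′

  module Switch {A : Set} {m : ℕ} (𝓜 : PermutationModel A m) (S : ℕ → ℕ → Bool) where
    open PermutationModel 𝓜

    hit : A → ℕ → Bool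
    hit G i = S i (π G i)

    hits : A → ℕ
    hits G = count m (hit G)

    area : ℕ
    area = sum< m (λ i → count m (S i))

    level : ℕ → ℕ
    level h = sumList (λ G → 𝟙[ hits G ≡ᵇ h ]) elements

    swap : ℕ → ℕ → A → A
    swap i i′ G = realize (λ x → π G (transpose i i′ x))

    -- Neither position may be a hit. So the swap destroys no hit, creates one at `i` for certain
    -- and perhaps a second one at `i′`.
    swappable : A → ℕ → ℕ → Bool
    swappable G i i′ = S i (π G i′) ∧ (not (hit G i) ∧ not (hit G i′))

    module _ {i i′ : ℕ} (i<m : i < m) (i′<m : i′ < m) where

      swap-bi : ∀ {G} → G ∈ elements → BoundedInjective m (λ x → π G (transpose i i′ x))
      swap-bi G∈ = (λ x x<m → proj₁ (π-bi G∈) _ (transpose-< i<m i′<m x<m)) , λ x y x<m y<m e →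
        trans (sym (transpose-involutive i i′ x)) (trans (cong (transpose i i′)
          (proj₂ (π-bi G∈) _ _ (transpose-< i<m i′<m x<m) (transpose-< i<m i′<m y<m) e)) (transpose-involutive i i′ y))

      swap-π : ∀ {G} → G ∈ elements → ∀ x → x < m → π (swap i i′ G) x ≡ π G (transpose i i′ x)
      swap-π {G} G∈ = π-realize (λ x → π G (transpose i i′ x)) (swap-bi G∈)

      swap-∈ : ∀ {G} → G ∈ elements → swap i i′ G ∈ elements
      swap-∈ {G} G∈ = realize-∈ (λ x → π G (transpose i i′ x)) (swap-bi G∈)

      swap-injective : ∀ {G G′} → G ∈ elements → G′ ∈ elements → swap i i′ G ≡ swap i i′ G′ → G ≡ G′
      swap-injective {G} {G′} G∈ G′∈ e = π-injective G∈ G′∈ λ x x<m →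
        let y = transpose i i′ x
            y<m = transpose-< i<m i′<m x<m
        in trans (cong (π G) (sym (transpose-involutive i i′ x))) (trans (sym (swap-π G∈ y y<m))
             (trans (cong (λ H → π H y) e) (trans (swap-π G′∈ y y<m) (cong (π G′) (transpose-involutive i i′ x)))))

      swap-hits : ∀ {G} → G ∈ elements → swappable G i i′ ≡ true →
        hit (swap i i′ G) i ≡ true × hits (swap i i′ G) ≡ hits G + (1 + 𝟙[ hit (swap i i′ G) i′ ])
      swap-hits {G} G∈ ok = at-i , trans (count≡sum (hit G′) m) (trans (sum<-cong m pointwise)
          (trans (sum<-+ (λ x → 𝟙[ hit G x ]) _ m) (cong₂ _+_ (sym (count≡sum (hit G) m))
            (trans (sum<-+ (λ x → 𝟙[ x ≡ᵇ i ]) _ m) (cong₂ _+_ (indicator-sum i m i<m)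
              (trans (sum<-*ˡ 𝟙[ hit G′ i′ ] (λ x → 𝟙[ x ≡ᵇ i′ ]) m)
                (trans (cong (𝟙[ hit G′ i′ ] *_) (indicator-sum i′ m i′<m)) (*-identityʳ _))))))))
        where
        G′ : A
        G′ = swap i i′ G
        split : ∀ a b c → a ∧ (not b ∧ not c) ≡ true → a ≡ true × b ≡ false × c ≡ false
        split true false false _ = refl , refl , refl
        parts : S i (π G i′) ≡ true × hit G i ≡ false × hit G i′ ≡ false
        parts = split (S i (π G i′)) (hit G i) (hit G i′) ok
        at-i : hit G′ i ≡ true
        at-i = trans (cong (S i) (trans (swap-π G∈ i i<m) (cong (π G) (transpose-left i i′)))) (proj₁ parts)
        -- For equal positions the wanted new hit would be the hit at `i` that has been excluded.
        i≢i′ : i ≢ i′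
        i≢i′ refl with trans (sym (proj₁ parts)) (proj₁ (proj₂ parts))
        ... | ()
        pointwise : ∀ x → x < m → 𝟙[ hit G′ x ] ≡ 𝟙[ hit G x ] + (𝟙[ x ≡ᵇ i ] + 𝟙[ hit G′ i′ ] * 𝟙[ x ≡ᵇ i′ ])
        pointwise x x<m with x ≟ i | x ≟ i′
        ... | yes refl | _ rewrite at-i | proj₁ (proj₂ parts) | ≡ᵇ-refl x | ≡ᵇ-false i≢i′ | *-zeroʳ 𝟙[ hit G′ i′ ] = refl
        ... | no x≢i | yes refl rewrite proj₂ (proj₂ parts) | ≡ᵇ-refl x | ≡ᵇ-false x≢i = sym (*-identityʳ _)
        ... | no x≢i | no x≢i′ rewrite ≡ᵇ-false x≢i | ≡ᵇ-false x≢i′ | *-zeroʳ 𝟙[ hit G′ i′ ] =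
          trans (cong (λ y → 𝟙[ S x y ]) (trans (swap-π G∈ x x<m) (cong (π G) (transpose-other x≢i x≢i′)))) (sym (+-identityʳ _))

    -- Since the permutation is onto, every position of `S` is (i, π i′) for some i′. At most 2 ·
    -- hits · m pairs (i, i′) have i or i′ among the hits.
    swappable-many : ∀ {G} → G ∈ elements → area ≤ sum< m (λ i → sum< m (λ i′ → 𝟙[ swappable G i i′ ])) + (hits G * m + hits G * m)
    swappable-many {G} G∈ = begin
      sum< m (λ i → count m (S i)) ≤⟨ sum<-mono m (λ i _ → count-injective (π-bi G∈) (S i)) ⟩
      sum< m (λ i → sum< m (λ i′ → 𝟙[ S i (π G i′) ]))
        ≤⟨ sum<-mono m (λ i _ → sum<-mono m (λ i′ _ → bound (S i (π G i′)) (hit G i) (hit G i′))) ⟩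
      sum< m (λ i → sum< m (λ i′ → 𝟙[ swappable G i i′ ] + (𝟙[ hit G i ] + 𝟙[ hit G i′ ])))
        ≡⟨ sum<-cong m (λ i _ → trans (sum<-+ (λ i′ → 𝟙[ swappable G i i′ ]) _ m) (cong (sum< m (λ i′ → 𝟙[ swappable G i i′ ]) +_)
             (trans (sum<-+ (λ _ → 𝟙[ hit G i ]) (λ i′ → 𝟙[ hit G i′ ]) m) (cong₂ _+_ (sum<-const 𝟙[ hit G i ] m) (sym (count≡sum (hit G) m)))))) ⟩
      sum< m (λ i → sum< m (λ i′ → 𝟙[ swappable G i i′ ]) + (m * 𝟙[ hit G i ] + hits G))
        ≡⟨ trans (sum<-+ (λ i → sum< m (λ i′ → 𝟙[ swappable G i i′ ])) _ m) (cong (sum< m (λ i → sum< m (λ i′ → 𝟙[ swappable G i i′ ])) +_)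
             (trans (sum<-+ (λ i → m * 𝟙[ hit G i ]) (λ _ → hits G) m) (cong₂ _+_
               (trans (sum<-*ˡ m (λ i → 𝟙[ hit G i ]) m) (trans (cong (m *_) (sym (count≡sum (hit G) m))) (*-comm m (hits G))))
               (trans (sum<-const (hits G) m) (*-comm m (hits G)))))) ⟩
      sum< m (λ i → sum< m (λ i′ → 𝟙[ swappable G i i′ ])) + (hits G * m + hits G * m) ∎
      where
      open ≤-Reasoning
      bound : ∀ a b c → 𝟙[ a ] ≤ 𝟙[ a ∧ (not b ∧ not c) ] + (𝟙[ b ] + 𝟙[ c ])
      bound false b     c     = z≤n
      bound true  true  c     = s≤s z≤n
      bound true  false true  = s≤s z≤n
      bound true  false false = s≤s z≤n

    raised : ℕ → A → ℕ
    raised h G = 𝟙[ hits G ≡ᵇ suc h ] + 𝟙[ hits G ≡ᵇ suc (suc h) ]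

    -- Double counting of triples (G, i, i′). For fixed i and i′ the swap is injective; its result
    -- has h + 1 or h + 2 hits, one of them at i. So a result arises from at most (h + 2) m triples.
    switching : ∀ h → level h * area ≤ level h * (h * m + h * m) + (level (suc h) + level (suc (suc h))) * (suc (suc h) * m)
    switching h = begin
      level h * area ≡⟨ sym (sumList-*ʳ area (λ G → 𝟙[ hits G ≡ᵇ h ]) elements) ⟩
      sumList (λ G → 𝟙[ hits G ≡ᵇ h ] * area) elements ≤⟨ sumList-mono elements many ⟩
      sumList (λ G → 𝟙[ hits G ≡ᵇ h ] * (h * m + h * m) + sum< m (λ i → sum< m (λ i′ → 𝟙[ hits G ≡ᵇ h ] * 𝟙[ swappable G i i′ ]))) elements
        ≡⟨ trans (sumList-+ _ _ elements) (cong₂ _+_ (sumList-*ʳ (h * m + h * m) (λ G → 𝟙[ hits G ≡ᵇ h ]) elements)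
             (trans (sumList-sum< _ elements m) (sum<-cong m (λ i _ → sumList-sum< _ elements m)))) ⟩
      level h * (h * m + h * m) + sum< m (λ i → sum< m (λ i′ → sumList (λ G → 𝟙[ hits G ≡ᵇ h ] * 𝟙[ swappable G i i′ ]) elements))
        ≤⟨ +-monoʳ-≤ (level h * (h * m + h * m)) (sum<-mono m (λ i i<m → sum<-mono m (λ i′ i′<m → ≤-trans
             (sumList-mono elements (λ G∈ → raise i<m i′<m G∈))
             (sumList-injection (λ G → raised h G * 𝟙[ hit G i ]) (swap i i′) elements elements unique (swap-∈ i<m i′<m) (swap-injective i<m i′<m))))) ⟩
      level h * (h * m + h * m) + sum< m (λ i → sum< m (λ i′ → sumList (λ G → raised h G * 𝟙[ hit G i ]) elements))
        ≡⟨ cong (level h * (h * m + h * m) +_) (trans (sum<-cong m (λ i _ → sum<-const _ m))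
             (trans (sum<-*ˡ m (λ i → sumList (λ G → raised h G * 𝟙[ hit G i ]) elements) m)
               (cong (m *_) (trans (sym (sumList-sum< (λ G i → raised h G * 𝟙[ hit G i ]) elements m)) refl)))) ⟩
      level h * (h * m + h * m) + m * sumList (λ G → sum< m (λ i → raised h G * 𝟙[ hit G i ])) elements
        ≤⟨ +-monoʳ-≤ (level h * (h * m + h * m)) (*-monoʳ-≤ m (sumList-mono elements (λ {G} _ → few G))) ⟩
      level h * (h * m + h * m) + m * sumList (λ G → raised h G * suc (suc h)) elements
        ≡⟨ cong (level h * (h * m + h * m) +_) (trans (cong (m *_) (trans (sumList-*ʳ (suc (suc h)) (raised h) elements) (cong (_* suc (suc h)) (sumList-+ _ _ elements))))
             (lemma m (level (suc h) + level (suc (suc h))) (suc (suc h)))) ⟩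
      level h * (h * m + h * m) + (level (suc h) + level (suc (suc h))) * (suc (suc h) * m) ∎
      where
      open ≤-Reasoning
      lemma : ∀ m l h → m * (l * h) ≡ l * (h * m)
      lemma = solve-∀
      many : ∀ {G} → G ∈ elements → 𝟙[ hits G ≡ᵇ h ] * area ≤
        𝟙[ hits G ≡ᵇ h ] * (h * m + h * m) + sum< m (λ i → sum< m (λ i′ → 𝟙[ hits G ≡ᵇ h ] * 𝟙[ swappable G i i′ ]))
      many {G} G∈ with hits G ≡ᵇ h in eq
      ... | false = z≤n
      ... | true  = ≤-trans (≤-reflexive (*-identityˡ area)) (≤-trans (swappable-many G∈) (≤-reflexive
        (trans (+-comm _ (hits G * m + hits G * m)) (cong₂ _+_
          (trans (cong (λ z → z * m + z * m) (≡ᵇ-true⁻ {hits G} eq)) (sym (+-identityʳ _)))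
          (sum<-cong m (λ i _ → sum<-cong m (λ i′ _ → sym (+-identityʳ _))))))))
      raise : ∀ {i i′} → i < m → i′ < m → ∀ {G} → G ∈ elements →
        𝟙[ hits G ≡ᵇ h ] * 𝟙[ swappable G i i′ ] ≤ raised h (swap i i′ G) * 𝟙[ hit (swap i i′ G) i ]
      raise {i} {i′} i<m i′<m {G} G∈ with hits G ≡ᵇ h in eq | swappable G i i′ in ok
      ... | false | _     = z≤n
      ... | true  | false = z≤n
      ... | true  | true  = *-mono-≤ {1} {raised h (swap i i′ G)} {1} up (≤-reflexive (cong 𝟙[_] (sym (proj₁ both))))
        where
        both = swap-hits i<m i′<m G∈ ok
        up : 1 ≤ raised h (swap i i′ G)
        up with hit (swap i i′ G) i′ | proj₂ both
        ... | false | e = ≤-trans (≤-reflexive (cong 𝟙[_] (sym (trans (cong (_≡ᵇ suc h) (trans e (trans (+-comm (hits G) 1) (cong suc (≡ᵇ-true⁻ {hits G} eq))))) (≡ᵇ-refl (suc h)))))) (m≤m+n _ _)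
        ... | true  | e = ≤-trans (≤-reflexive (cong 𝟙[_] (sym (trans (cong (_≡ᵇ suc (suc h)) (trans e (trans (+-comm (hits G) 2) (cong (2 +_) (≡ᵇ-true⁻ {hits G} eq))))) (≡ᵇ-refl (suc (suc h))))))) (m≤n+m _ _)
      few : ∀ G → sum< m (λ i → raised h G * 𝟙[ hit G i ]) ≤ raised h G * suc (suc h)
      few G = ≤-trans (≤-reflexive (trans (sum<-*ˡ (raised h G) (λ i → 𝟙[ hit G i ]) m) (cong (raised h G *_) (sym (count≡sum (hit G) m))))) bnd
        where
        bnd : raised h G * hits G ≤ raised h G * suc (suc h)
        bnd with hits G ≡ᵇ suc h in e₁ | hits G ≡ᵇ suc (suc h) in e₂
        ... | false | false = z≤n
        ... | true  | b     = *-monoʳ-≤ (1 + 𝟙[ b ]) (≤-trans (≤-reflexive (≡ᵇ-true⁻ {hits G} e₁)) (n≤1+n _))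
        ... | false | true  = *-monoʳ-≤ 1 (≤-reflexive (≡ᵇ-true⁻ {hits G} e₂))

    module _ (r : ℕ) (0<m : 0 < m) (large : (10 * r + 16) * m ≤ area) where

      -- The constants 10 and 16 are made for (10 h + 16) - 2 h = 8 (h + 2).
      descent : ∀ h → h ≤ r → 8 * level h ≤ level (suc h) + level (suc (suc h))
      descent h h≤r = *-cancelʳ-≤ _ _ (suc (suc h) * m) {{>-nonZero (*-mono-≤ (s≤s (z≤n {suc h})) 0<m)}}
        (+-cancelˡ-≤ (level h * (h * m + h * m)) _ _ (begin
          level h * (h * m + h * m) + 8 * level h * (suc (suc h) * m) ≡⟨ lemma (level h) h m ⟩
          level h * ((10 * h + 16) * m) ≤⟨ *-monoʳ-≤ (level h) (≤-trans (*-monoˡ-≤ m (+-monoˡ-≤ 16 (*-monoʳ-≤ 10 h≤r))) large) ⟩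
          level h * area ≤⟨ switching h ⟩
          level h * (h * m + h * m) + (level (suc h) + level (suc (suc h))) * (suc (suc h) * m) ∎))
        where
        open ≤-Reasoning
        lemma : ∀ l h m → l * (h * m + h * m) + 8 * l * (suc (suc h) * m) ≡ l * ((10 * h + 16) * m)
        lemma = solve-∀

      level≤ : ∀ h → level h ≤ length elements
      level≤ h = go elements
        where
        go : ∀ xs → sumList (λ G → 𝟙[ hits G ≡ᵇ h ]) xs ≤ length xs
        go []       = z≤n
        go (x ∷ xs) = +-mono-≤ ([]≤1 (hits x ≡ᵇ h)) (go xs)

      -- Both of the next levels are bounded by induction. The second one has a step less to go,
      -- hence an extra factor 2, and the sum 1 + 2 stays below 4 = 8 / 2.
      decay : ∀ j h → h + j ≤ r → level h * 2 ^ j ≤ length elements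
      decay zero    h l = ≤-trans (≤-reflexive (*-identityʳ _)) (level≤ h)
      decay (suc j) h l = *-cancelˡ-≤ 4 (begin
        4 * (level h * (2 * 2 ^ j)) ≡⟨ lemma (level h) (2 ^ j) ⟩
        8 * level h * 2 ^ j ≤⟨ *-monoˡ-≤ (2 ^ j) (descent h (≤-trans (m≤m+n h (suc j)) l)) ⟩
        (level (suc h) + level (suc (suc h))) * 2 ^ j ≡⟨ *-distribʳ-+ (2 ^ j) (level (suc h)) (level (suc (suc h))) ⟩
        level (suc h) * 2 ^ j + level (suc (suc h)) * 2 ^ j ≤⟨ +-mono-≤ (decay j (suc h) (≤-trans (≤-reflexive (sym (+-suc h j))) l)) second ⟩
        length elements + 2 * length elements ≤⟨ m≤n+m _ (length elements) ⟩
        length elements + (length elements + 2 * length elements) ≡⟨ lemma′ (length elements) ⟩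
        4 * length elements ∎)
        where
        open ≤-Reasoning
        lemma : ∀ a b → 4 * (a * (2 * b)) ≡ 8 * a * b
        lemma = solve-∀
        lemma′ : ∀ a → a + (a + 2 * a) ≡ 4 * a
        lemma′ = solve-∀
        second : level (suc (suc h)) * 2 ^ j ≤ 2 * length elements
        second = two j l
          where
          two : ∀ j → h + suc j ≤ r → level (suc (suc h)) * 2 ^ j ≤ 2 * length elements
          two zero    _ = ≤-trans (≤-reflexive (*-identityʳ _)) (≤-trans (level≤ (suc (suc h))) (m≤m+n _ _))
          two (suc i) l = ≤-trans (≤-reflexive (lem (level (suc (suc h))) (2 ^ i)))
            (*-monoʳ-≤ 2 (decay i (suc (suc h)) (≤-trans (≤-reflexive (sym (trans (+-suc h (suc i)) (cong suc (+-suc h i))))) l)))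
            where
            lem : ∀ a b → a * (2 * b) ≡ 2 * (a * b)
            lem = solve-∀

      avoiding-rare : level 0 * 2 ^ r ≤ length elements
      avoiding-rare = decay r 0 ≤-refl

-- Matchings of interval chromatic number 2 as permutations.

module Matchings where
  open import Defs
  open Process using (≡ᵇ-refl; ≡ᵇ-true⁻; <ᵇ-true; <ᵇ-true⁻; <ᵇ-false)
  open ExpectedStep using (count)
  open Sums
  open Switching
  open import Data.Bool.Base using (Bool; true; false; if_then_else_; _∧_; not)
  open import Data.Bool.Properties using (T-≡)
  open import Data.Fin.Base as Fin using (Fin; toℕ; fromℕ<)
  open import Data.Fin.Patterns using (0F; 1F)
  import Data.Fin.Properties as Fin
  open import Data.Nat.Base
  open import Data.Nat.Properties
  open import Data.List.Base using ([]; _∷_)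
  open import Data.List.Membership.Propositional using (_∈_)
  open import Data.List.Membership.Propositional.Properties using (∈-filter⁺; ∈-filter⁻)
  import Data.List.Relation.Unary.Unique.Propositional.Properties as Unique
  open import Data.Vec.Base as Vec using (Vec; []; _∷_; lookup)
  open import Data.Empty using (⊥-elim)
  open import Data.Product using (_×_; _,_; proj₁; proj₂; Σ-syntax; ∃-syntax)
  open import Function.Bundles using (Equivalence)
  open import Relation.Binary.PropositionalEquality hiding ([_])
  open import Relation.Binary.Definitions using (tri<; tri≈; tri>)
  open import Relation.Nullary using (yes; no; ¬_)
  open import Relation.Nullary.Decidable using (_×-dec_)

  true≢false : true ≢ false
  true≢false ()

  lookupℕ : ∀ {n} → Vec Bool n → ℕ → Bool
  lookupℕ []      _       = false
  lookupℕ (x ∷ v) zero    = x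
  lookupℕ (x ∷ v) (suc j) = lookupℕ v j

  -- Adjacency with default `false` out of range, so that vertices can be shifted and divided as
  -- plain natural numbers.
  adjℕ : ∀ {n} → OrderedGraph n → ℕ → ℕ → Bool
  adjℕ []      _       _       = false
  adjℕ (v ∷ G) zero    zero    = false
  adjℕ (v ∷ G) zero    (suc j) = lookupℕ v j
  adjℕ (v ∷ G) (suc i) zero    = lookupℕ v i
  adjℕ (v ∷ G) (suc i) (suc j) = adjℕ G i j

  lookupℕ-toℕ : ∀ {n} (v : Vec Bool n) j → lookup v j ≡ lookupℕ v (toℕ j)
  lookupℕ-toℕ (x ∷ v) Fin.zero    = refl
  lookupℕ-toℕ (x ∷ v) (Fin.suc j) = lookupℕ-toℕ v j

  adjℕ-toℕ : ∀ {n} (G : OrderedGraph n) i j → adj G i j ≡ adjℕ G (toℕ i) (toℕ j)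
  adjℕ-toℕ (v ∷ G) Fin.zero    Fin.zero    = refl
  adjℕ-toℕ (v ∷ G) Fin.zero    (Fin.suc j) = lookupℕ-toℕ v j
  adjℕ-toℕ (v ∷ G) (Fin.suc i) Fin.zero    = lookupℕ-toℕ v i
  adjℕ-toℕ (v ∷ G) (Fin.suc i) (Fin.suc j) = adjℕ-toℕ G i j

  adjℕ-sym : ∀ {n} (G : OrderedGraph n) i j → adjℕ G i j ≡ adjℕ G j i
  adjℕ-sym []      i       j       = refl
  adjℕ-sym (v ∷ G) zero    zero    = refl
  adjℕ-sym (v ∷ G) zero    (suc j) = refl
  adjℕ-sym (v ∷ G) (suc i) zero    = refl
  adjℕ-sym (v ∷ G) (suc i) (suc j) = adjℕ-sym G i j

  adjℕ-irrefl : ∀ {n} (G : OrderedGraph n) i → adjℕ G i i ≡ false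
  adjℕ-irrefl []      i       = refl
  adjℕ-irrefl (v ∷ G) zero    = refl
  adjℕ-irrefl (v ∷ G) (suc i) = adjℕ-irrefl G i

  edge⇒adjℕ : ∀ {n} (G : OrderedGraph n) i j → Edge G i j → adjℕ G (toℕ i) (toℕ j) ≡ true
  edge⇒adjℕ G i j e = trans (sym (adjℕ-toℕ G i j)) (Equivalence.to T-≡ e)

  adjℕ⇒edge : ∀ {n} (G : OrderedGraph n) i j → adjℕ G (toℕ i) (toℕ j) ≡ true → Edge G i j
  adjℕ⇒edge G i j e = Equivalence.from T-≡ (trans (adjℕ-toℕ G i j) e)

  tabulateℕ : (ℕ → Bool) → ∀ n → Vec Bool n
  tabulateℕ P zero    = []
  tabulateℕ P (suc n) = P 0 ∷ tabulateℕ (λ j → P (suc j)) n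

  graphℕ : (ℕ → ℕ → Bool) → ∀ n → OrderedGraph n
  graphℕ R zero    = []
  graphℕ R (suc n) = tabulateℕ (λ j → R 0 (suc j)) n ∷ graphℕ (λ i j → R (suc i) (suc j)) n

  lookupℕ-tabulateℕ : ∀ P n j → j < n → lookupℕ (tabulateℕ P n) j ≡ P j
  lookupℕ-tabulateℕ P (suc n) zero    _       = refl
  lookupℕ-tabulateℕ P (suc n) (suc j) (s≤s l) = lookupℕ-tabulateℕ (λ j → P (suc j)) n j l

  adjℕ-graphℕ : ∀ R n i j → i < j → j < n → adjℕ (graphℕ R n) i j ≡ R i j
  adjℕ-graphℕ R (suc n) zero    (suc j) _       (s≤s l) = lookupℕ-tabulateℕ (λ j → R 0 (suc j)) n j l
  adjℕ-graphℕ R (suc n) (suc i) (suc j) (s≤s p) (s≤s l) = adjℕ-graphℕ (λ i j → R (suc i) (suc j)) n i j p l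

  vec-ext : ∀ {n} (v w : Vec Bool n) → (∀ j → j < n → lookupℕ v j ≡ lookupℕ w j) → v ≡ w
  vec-ext []      []      h = refl
  vec-ext (x ∷ v) (y ∷ w) h = cong₂ _∷_ (h 0 z<s) (vec-ext v w (λ j l → h (suc j) (s≤s l)))

  graph-ext : ∀ {n} (G H : OrderedGraph n) → (∀ i j → i < j → j < n → adjℕ G i j ≡ adjℕ H i j) → G ≡ H
  graph-ext []      []      h = refl
  graph-ext (v ∷ G) (w ∷ H) h = cong₂ _∷_ (vec-ext v w (λ j l → h 0 (suc j) z<s (s≤s l)))
    (graph-ext G H (λ i j p l → h (suc i) (suc j) (s≤s p) (s≤s l)))

  find : ℕ → (ℕ → Bool) → ℕ
  find zero    P = 0
  find (suc n) P = if P n then n else find n P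

  find-correct : ∀ n (P : ℕ → Bool) j → j < n → P j ≡ true → find n P < n × P (find n P) ≡ true
  find-correct (suc n) P j j<n Pj with P n in eq
  ... | true  = ≤-refl , eq
  ... | false with j ≟ n
  ...   | yes refl = ⊥-elim (true≢false (trans (sym Pj) eq))
  ...   | no j≢n   = let l , e = find-correct n P j (≤∧≢⇒< (s≤s⁻¹ j<n) j≢n) Pj in m<n⇒m<1+n l , e

  count-above : ∀ (P : ℕ → Bool) n u → (∀ v → u ≤ v → v < n → P v ≡ false) → count n P ≤ u
  count-above P zero    u h = z≤n
  count-above P (suc n) u h with n <? u
  ... | yes n<u = ≤-trans (count≤ P (suc n)) n<u
  ... | no n≮u rewrite h n (≮⇒≥ n≮u) ≤-refl = count-above P n u (λ v p l → h v p (m<n⇒m<1+n l))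

  count-below : ∀ (P : ℕ → Bool) n u → u ≤ n → (∀ v → v < u → P v ≡ true) → u ≤ count n P
  count-below P n u u≤n h = subst₂ _≤_ (trans (sum<-cong u (λ v l → cong 𝟙[_] (h v l))) (trans (sum<-const 1 u) (*-identityʳ u))) (sym (count≡sum P n))
    (sum<-extend (λ v → 𝟙[ P v ]) u≤n)

  count-not : ∀ (P : ℕ → Bool) n → count n P + count n (λ i → not (P i)) ≡ n
  count-not P zero    = refl
  count-not P (suc n) with P n
  ... | true  = cong suc (count-not P n)
  ... | false = trans (+-suc (count n P) _) (cong suc (count-not P n))

  ∧-true : ∀ {a b} → a ∧ b ≡ true → a ≡ true × b ≡ true
  ∧-true {true} {true} _ = refl , refl

  bool-iff : ∀ {a b} → (a ≡ true → b ≡ true) → (b ≡ true → a ≡ true) → a ≡ b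
  bool-iff {true}  {b}     f g = sym (f refl)
  bool-iff {false} {true}  f g = g refl
  bool-iff {false} {false} f g = refl

  exists : ∀ (P : ℕ → Bool) n → 1 ≤ sum< n (λ i → 𝟙[ P i ]) → Σ[ i ∈ ℕ ] i < n × P i ≡ true
  exists P (suc n) h with P n in eq
  ... | true  = n , ≤-refl , eq
  ... | false = let i , l , e = exists P n (subst (1 ≤_) (+-identityʳ _) h) in i , m<n⇒m<1+n l , e

  surjective : ∀ {m τ} → BoundedInjective m τ → ∀ y → y < m → Σ[ i ∈ ℕ ] i < m × τ i ≡ y
  surjective {m} {τ} bi y y<m =
    let i , l , e = exists (λ i → τ i ≡ᵇ y) m (≤-trans
          (≤-reflexive (sym (trans (count≡sum (_≡ᵇ y) m) (indicator-sum y m y<m)))) (count-injective bi (_≡ᵇ y)))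
    in i , l , ≡ᵇ-true⁻ {τ i} e

  module MatchingModel (m : ℕ) (0<m : 0 < m) where

    n : ℕ
    n = m + m

    m<n : m < n
    m<n = subst (_< n) (+-identityʳ m) (+-monoʳ-< m 0<m)

    -- The permutation π with G = M_π. For `i` below `m` and a graph in the list, the search
    -- succeeds by `partner-edge`, so the default value of `find` does not interfere.
    partner : OrderedGraph n → ℕ → ℕ
    partner G i = find m (λ j → adjℕ G i (m + j))

    matchingRelation : (ℕ → ℕ) → ℕ → ℕ → Bool
    matchingRelation τ u v = (u <ᵇ m) ∧ (v ≡ᵇ m + τ u)

    matching : (ℕ → ℕ) → OrderedGraph n
    matching τ = graphℕ (matchingRelation τ) n

    matching-edge : ∀ τ u v → u < v → v < n → adjℕ (matching τ) u v ≡ true → u < m × v ≡ m + τ u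
    matching-edge τ u v u<v v<n e =
      let a , b = ∧-true (trans (sym (adjℕ-graphℕ (matchingRelation τ) n u v u<v v<n)) e)
      in <ᵇ-true⁻ a , ≡ᵇ-true⁻ {v} b

    colourable-0 : ∀ G → ¬ IntervalColourable {n} G 0
    colourable-0 G (f , _) with f (fromℕ< (≤-<-trans z≤n m<n))
    ... | ()

    module _ (τ : ℕ → ℕ) (bi : BoundedInjective m τ) where

      matching-adj : ∀ u → u < m → adjℕ (matching τ) u (m + τ u) ≡ true
      matching-adj u u<m = trans (adjℕ-graphℕ (matchingRelation τ) n u (m + τ u) (<-≤-trans u<m (m≤m+n m _)) (+-monoʳ-< m (proj₁ bi u u<m)))
        (cong₂ _∧_ (<ᵇ-true u<m) (≡ᵇ-refl (m + τ u)))

      low-edges : ∀ u v → u < m → v < n → adjℕ (matching τ) u v ≡ true → v ≡ m + τ u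
      low-edges u v u<m v<n e with <-cmp u v
      ... | tri< u<v _ _ = proj₂ (matching-edge τ u v u<v v<n e)
      ... | tri≈ _ refl _ = ⊥-elim (true≢false (trans (sym e) (adjℕ-irrefl (matching τ) u)))
      ... | tri> _ _ v<u = ⊥-elim (<⇒≱ u<m (subst (m ≤_) (sym (proj₂ (matching-edge τ v u v<u (<-≤-trans u<m (m≤m+n m m))
              (trans (adjℕ-sym (matching τ) v u) e)))) (m≤m+n m _)))

      high-edges : ∀ u v → m ≤ u → u < n → v < n → adjℕ (matching τ) u v ≡ true → v < m × u ≡ m + τ v
      high-edges u v m≤u u<n v<n e with <-cmp u v
      ... | tri< u<v _ _ = ⊥-elim (<⇒≱ (proj₁ (matching-edge τ u v u<v v<n e)) m≤u)
      ... | tri≈ _ refl _ = ⊥-elim (true≢false (trans (sym e) (adjℕ-irrefl (matching τ) u)))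
      ... | tri> _ _ v<u = matching-edge τ v u v<u u<n (trans (adjℕ-sym (matching τ) v u) e)

      matching-isMatching : IsMatching (matching τ)
      matching-isMatching i with toℕ i <? m
      ... | yes i<m = j , adjℕ⇒edge (matching τ) i j (subst (λ v → adjℕ (matching τ) (toℕ i) v ≡ true) (sym toℕj) (matching-adj (toℕ i) i<m)) ,
            λ {y} e → Fin.toℕ-injective (trans toℕj (sym (low-edges (toℕ i) (toℕ y) i<m (Fin.toℕ<n y) (edge⇒adjℕ (matching τ) i y e))))
        where
        l : m + τ (toℕ i) < n
        l = +-monoʳ-< m (proj₁ bi (toℕ i) i<m)
        j : Fin n
        j = fromℕ< l
        toℕj : toℕ j ≡ m + τ (toℕ i)
        toℕj = Fin.toℕ-fromℕ< l
      ... | no i≮m = j , adjℕ⇒edge (matching τ) i j (subst₂ (λ u v → adjℕ (matching τ) u v ≡ true) u≡ (sym toℕj)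
              (trans (adjℕ-sym (matching τ) (m + τ v) v) (matching-adj v v<m))) ,
            λ {y} e → Fin.toℕ-injective (trans toℕj (sym (unique′ y e)))
        where
        m≤i : m ≤ toℕ i
        m≤i = ≮⇒≥ i≮m
        i∸m : toℕ i ∸ m < m
        i∸m = +-cancelˡ-< m _ _ (subst (_< n) (sym (m+[n∸m]≡n m≤i)) (Fin.toℕ<n i))
        pre = surjective bi (toℕ i ∸ m) i∸m
        v : ℕ
        v = proj₁ pre
        v<m : v < m
        v<m = proj₁ (proj₂ pre)
        u≡ : m + τ v ≡ toℕ i
        u≡ = trans (cong (m +_) (proj₂ (proj₂ pre))) (m+[n∸m]≡n m≤i)
        l : v < n
        l = <-≤-trans v<m (m≤m+n m m)
        j : Fin n
        j = fromℕ< l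
        toℕj : toℕ j ≡ v
        toℕj = Fin.toℕ-fromℕ< l
        unique′ : ∀ y → Edge (matching τ) i y → toℕ y ≡ v
        unique′ y e = let y<m , eq = high-edges (toℕ i) (toℕ y) m≤i (Fin.toℕ<n i) (Fin.toℕ<n y) (edge⇒adjℕ (matching τ) i y e)
          in proj₂ bi (toℕ y) v y<m v<m (+-cancelˡ-≡ m _ _ (trans (sym eq) (sym u≡)))

      halves : ℕ → Fin 2
      halves u = if u <ᵇ m then 0F else 1F

      matching-2-colourable : IntervalColourable (matching τ) 2
      matching-2-colourable = (λ i → halves (toℕ i)) , mono , surj , proper
        where
        mono : ∀ i j → i Fin.≤ j → halves (toℕ i) Fin.≤ halves (toℕ j)
        mono i j i≤j with toℕ i <ᵇ m in e₁ | toℕ j <ᵇ m in e₂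
        ... | true  | _     = z≤n
        ... | false | false = ≤-refl
        ... | false | true  = ⊥-elim (true≢false (trans (sym (<ᵇ-true {toℕ i} {m} (≤-<-trans i≤j (<ᵇ-true⁻ {toℕ j} {m} e₂)))) e₁))
        surj : ∀ c → ∃[ i ] halves (toℕ i) ≡ c
        surj 0F = fromℕ< (≤-<-trans z≤n m<n) , cong (λ b → if b then 0F else 1F) (trans (cong (_<ᵇ m) (Fin.toℕ-fromℕ< (≤-<-trans z≤n m<n))) (<ᵇ-true 0<m))
        surj 1F = fromℕ< m<n , cong (λ b → if b then 0F else 1F) (trans (cong (_<ᵇ m) (Fin.toℕ-fromℕ< m<n)) (<ᵇ-false (≤-refl {m})))
        proper : ∀ i j → Edge (matching τ) i j → halves (toℕ i) ≢ halves (toℕ j)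
        proper i j e eq with toℕ i <ᵇ m in e₁ | toℕ j <ᵇ m in e₂
        ... | true  | false with eq
        ...   | ()
        proper i j e eq | false | true with eq
        ...   | ()
        proper i j e eq | true  | true = <⇒≱ (<ᵇ-true⁻ e₂) (subst (m ≤_)
          (sym (low-edges (toℕ i) (toℕ j) (<ᵇ-true⁻ e₁) (Fin.toℕ<n j) (edge⇒adjℕ (matching τ) i j e))) (m≤m+n m _))
        proper i j e eq | false | false = true≢false (trans (sym (<ᵇ-true (proj₁
          (high-edges (toℕ i) (toℕ j) (≮⇒≥ (λ l → true≢false (trans (sym (<ᵇ-true l)) e₁))) (Fin.toℕ<n i) (Fin.toℕ<n j) (edge⇒adjℕ (matching τ) i j e))))) e₂)

      matching-not-1-colourable : ¬ IntervalColourable (matching τ) 1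
      matching-not-1-colourable (f , _ , _ , proper) = proper i j (proj₁ (proj₂ (matching-isMatching i))) (one (f i) (f j))
        where
        i = fromℕ< (≤-<-trans z≤n m<n)
        j = proj₁ (matching-isMatching i)
        one : (a b : Fin 1) → a ≡ b
        one 0F 0F = refl

      matching-χ< : χ< (matching τ) ≡ 2
      matching-χ< with least (intervalColourable? (matching τ)) _ (intervalColourable-id (matching τ))
      ... | zero , c , _ = ⊥-elim (colourable-0 (matching τ) c)
      ... | suc zero , c , _ = ⊥-elim (matching-not-1-colourable c)
      ... | suc (suc zero) , _ , _ = refl
      ... | suc (suc (suc k)) , _ , min = ⊥-elim (<⇒≱ (s≤s (s≤s (s≤s z≤n))) (min 2 matching-2-colourable))

      matching-∈ : matching τ ∈ matchingsWithχ<≡2 n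
      matching-∈ = ∈-filter⁺ (λ G → isMatching? G ×-dec (χ< G ≟ 2)) (∈-orderedGraphs (matching τ)) (matching-isMatching , matching-χ<)

      partner-matching : ∀ i → i < m → partner (matching τ) i ≡ τ i
      partner-matching i i<m =
        let l , e = find-correct m (λ j → adjℕ (matching τ) i (m + j)) (τ i) (proj₁ bi i i<m) (matching-adj i i<m)
        in +-cancelˡ-≡ m _ _ (low-edges i (m + partner (matching τ) i) i<m (+-monoʳ-< m l) e)

    module _ {G : OrderedGraph n} (G∈ : G ∈ matchingsWithχ<≡2 n) where

      properties : IsMatching G × χ< G ≡ 2
      properties = proj₂ (∈-filter⁻ (λ G → isMatching? G ×-dec (χ< G ≟ 2)) {xs = orderedGraphs n} G∈)

      colouring : IntervalColourable G 2
      colouring = subst (IntervalColourable G) (proj₂ properties)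
        (proj₁ (proj₂ (least (intervalColourable? G) _ (intervalColourable-id G))))

      mate : ∀ {u} → u < n → ℕ
      mate u<n = toℕ (proj₁ (proj₁ properties (fromℕ< u<n)))

      q : ℕ → ℕ
      q u with u <? n
      ... | yes u<n = mate u<n
      ... | no _    = 0

      q-edge : ∀ u → u < n → q u < n × adjℕ G u (q u) ≡ true
      q-edge u u<n with u <? n
      ... | no u≮n = ⊥-elim (u≮n u<n)
      ... | yes l  = Fin.toℕ<n _ , trans (cong (λ z → adjℕ G z (mate l)) (sym (Fin.toℕ-fromℕ< l)))
                       (edge⇒adjℕ G (fromℕ< l) _ (proj₁ (proj₂ (proj₁ properties (fromℕ< l)))))

      q-unique : ∀ u v → u < n → v < n → adjℕ G u v ≡ true → q u ≡ v
      q-unique u v u<n v<n e with u <? n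
      ... | no u≮n = ⊥-elim (u≮n u<n)
      ... | yes l  = trans (cong toℕ (proj₂ (proj₂ (proj₁ properties (fromℕ< l)))
          (adjℕ⇒edge G (fromℕ< l) (fromℕ< v<n) (trans (cong₂ (adjℕ G) (Fin.toℕ-fromℕ< l) (Fin.toℕ-fromℕ< v<n)) e)))) (Fin.toℕ-fromℕ< v<n)

      q-bi : BoundedInjective n q
      q-bi = (λ u u<n → proj₁ (q-edge u u<n)) , λ u v u<n v<n e →
        trans (sym (back u u<n)) (trans (cong q e) (back v v<n))
        where
        back : ∀ u → u < n → q (q u) ≡ u
        back u u<n = q-unique (q u) u (proj₁ (q-edge u u<n)) u<n (trans (adjℕ-sym G (q u) u) (proj₂ (q-edge u u<n)))

      isZero : Fin 2 → Bool
      isZero 0F = true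
      isZero 1F = false

      isZero-≢ : ∀ {a b} → a ≢ b → isZero b ≡ not (isZero a)
      isZero-≢ {0F} {0F} h = ⊥-elim (h refl)
      isZero-≢ {0F} {1F} h = refl
      isZero-≢ {1F} {0F} h = refl
      isZero-≢ {1F} {1F} h = ⊥-elim (h refl)

      low : ℕ → Bool
      low u with u <? n
      ... | yes u<n = isZero (proj₁ colouring (fromℕ< u<n))
      ... | no _    = false

      low≡ : ∀ u (u<n : u < n) → low u ≡ isZero (proj₁ colouring (fromℕ< u<n))
      low≡ u u<n with u <? n
      ... | yes l = cong (λ l → isZero (proj₁ colouring (fromℕ< l))) (<-irrelevant l u<n)
      ... | no u≮n = ⊥-elim (u≮n u<n)

      edge-low : ∀ u v → u < n → v < n → adjℕ G u v ≡ true → low v ≡ not (low u)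
      edge-low u v u<n v<n e = trans (low≡ v v<n) (trans (isZero-≢ (proj₂ (proj₂ (proj₂ colouring)) (fromℕ< u<n) (fromℕ< v<n)
          (adjℕ⇒edge G (fromℕ< u<n) (fromℕ< v<n) (trans (cong₂ (adjℕ G) (Fin.toℕ-fromℕ< u<n) (Fin.toℕ-fromℕ< v<n)) e))))
        (cong not (sym (low≡ u u<n))))

      low-down : ∀ u v → u ≤ v → v < n → low v ≡ true → low u ≡ true
      low-down u v u≤v v<n e = trans (low≡ u u<n) (down (proj₁ (proj₂ colouring) (fromℕ< u<n) (fromℕ< v<n)
          (subst₂ _≤_ (sym (Fin.toℕ-fromℕ< u<n)) (sym (Fin.toℕ-fromℕ< v<n)) u≤v)) (trans (sym (low≡ v v<n)) e))
        where
        u<n : u < n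
        u<n = ≤-<-trans u≤v v<n
        down : ∀ {a b : Fin 2} → a Fin.≤ b → isZero b ≡ true → isZero a ≡ true
        down {0F} {_}  _ _ = refl
        down {1F} {0F} () _
        down {1F} {1F} _ ()

      -- The mate function is injective and exchanges the two intervals, so each of them has at most
      -- half of the vertices.
      count-low : count n low ≡ m
      count-low = ≤-antisym (half≤ low (λ u l → edge-low u (q u) l (proj₁ (q-edge u l)) (proj₂ (q-edge u l)))) (+-cancelʳ-≤ (count n (λ u → not (low u))) m (count n low) (≤-trans
          (+-monoʳ-≤ m (half≤ (λ u → not (low u)) (λ u l → cong not (edge-low u (q u) l (proj₁ (q-edge u l)) (proj₂ (q-edge u l))))))
          (≤-reflexive (sym (count-not low n)))))
        where
        half≤ : ∀ P → (∀ u → u < n → P (q u) ≡ not (P u)) → count n P ≤ m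
        half≤ P h = *-cancelˡ-≤ 2 (begin
          2 * count n P ≡⟨ cong (count n P +_) (+-identityʳ (count n P)) ⟩
          count n P + count n P ≤⟨ +-monoʳ-≤ (count n P) (≤-trans (count-injective q-bi P) (≤-reflexive
              (trans (sum<-cong n (λ u l → cong 𝟙[_] (h u l))) (sym (count≡sum (λ u → not (P u)) n))))) ⟩
          count n P + count n (λ u → not (P u)) ≡⟨ count-not P n ⟩
          n ≡⟨ cong (m +_) (sym (+-identityʳ m)) ⟩
          2 * m ∎)
          where open ≤-Reasoning

      low-< : ∀ u → u < n → low u ≡ true → u < m
      low-< u u<n e = subst (u <_) count-low (count-below low n (suc u) u<n (λ v v≤u → low-down v u (s≤s⁻¹ v≤u) u<n e))

      <-low : ∀ u → u < m → low u ≡ true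
      <-low u u<m with low u in eq
      ... | true  = refl
      ... | false = ⊥-elim (<⇒≱ u<m (subst (_≤ u) count-low (count-above low n u (λ v u≤v v<n → off v u≤v v<n))))
        where
        off : ∀ v → u ≤ v → v < n → low v ≡ false
        off v u≤v v<n with low v in e
        ... | false = refl
        ... | true  = ⊥-elim (true≢false (trans (sym (low-down u v u≤v v<n e)) eq))

      crossing : ∀ u v → u < v → v < n → adjℕ G u v ≡ true → u < m × m ≤ v
      crossing u v u<v v<n e = u<m , ≮⇒≥ (λ v<m → true≢false (trans (sym (<-low v v<m)) (trans opposite (cong not (<-low u u<m)))))
        where
        u<n : u < n
        u<n = <-trans u<v v<n
        opposite : low v ≡ not (low u)
        opposite = edge-low u v u<n v<n e
        u<m : u < m
        u<m with low u in eq
        ... | true  = low-< u u<n eq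
        ... | false = ⊥-elim (true≢false (trans (sym (low-down u v (<⇒≤ u<v) v<n (trans opposite (cong not eq)))) eq))

      partner-edge : ∀ i → i < m → partner G i < m × adjℕ G i (m + partner G i) ≡ true
      partner-edge i i<m = find-correct m (λ j → adjℕ G i (m + j)) (q i ∸ m) j<m
          (subst (λ v → adjℕ G i v ≡ true) (sym (m+[n∸m]≡n m≤q)) (proj₂ (q-edge i i<n)))
        where
        i<n : i < n
        i<n = <-≤-trans i<m (m≤m+n m m)
        m≤q : m ≤ q i
        m≤q = ≮⇒≥ (λ l → true≢false (trans (sym (<-low (q i) l)) (trans (edge-low i (q i) i<n (proj₁ (q-edge i i<n)) (proj₂ (q-edge i i<n))) (cong not (<-low i i<m)))))
        j<m : q i ∸ m < m
        j<m = +-cancelˡ-< m _ _ (subst (_< n) (sym (m+[n∸m]≡n m≤q)) (proj₁ (q-edge i i<n)))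

      partner-bi : BoundedInjective m (partner G)
      partner-bi = (λ i i<m → proj₁ (partner-edge i i<m)) , λ i j i<m j<m e →
        let i<n = <-≤-trans i<m (m≤m+n m m)
            j<n = <-≤-trans j<m (m≤m+n m m)
            v<n = +-monoʳ-< m (proj₁ (partner-edge i i<m))
        in trans (sym (q-unique (m + partner G i) i v<n i<n (trans (adjℕ-sym G _ i) (proj₂ (partner-edge i i<m)))))
                 (q-unique (m + partner G i) j v<n j<n (trans (adjℕ-sym G _ j) (trans (cong (λ z → adjℕ G j (m + z)) e) (proj₂ (partner-edge j j<m)))))

      -- A graph in the list is thus determined by `partner`, which gives injectivity in the model.
      adjacency : ∀ u v → u < v → v < n → adjℕ G u v ≡ matchingRelation (partner G) u v
      adjacency u v u<v v<n = bool-iff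
        (λ e → let u<m , _ = crossing u v u<v v<n e
                   u<n = <-trans u<v v<n
               in cong₂ _∧_ (<ᵇ-true u<m) (trans (cong (_≡ᵇ m + partner G u)
                    (trans (sym (q-unique u v u<n v<n e)) (q-unique u (m + partner G u) u<n (+-monoʳ-< m (proj₁ (partner-edge u u<m))) (proj₂ (partner-edge u u<m)))))
                    (≡ᵇ-refl (m + partner G u))))
        (λ e → let a , b = ∧-true e in trans (cong (adjℕ G u) (≡ᵇ-true⁻ {v} b)) (proj₂ (partner-edge u (<ᵇ-true⁻ a))))

    model : PermutationModel (OrderedGraph n) m
    model = record
      { elements = matchingsWithχ<≡2 n
      ; unique = Unique.filter⁺ (λ G → isMatching? G ×-dec (χ< G ≟ 2)) (orderedGraphs-unique n)
      ; π = partner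
      ; realize = matching
      ; realize-∈ = matching-∈
      ; π-realize = partner-matching
      ; π-bi = partner-bi
      ; π-injective = λ {G} {G′} G∈ G′∈ h → graph-ext G G′ λ u v u<v v<n →
          trans (adjacency G∈ u v u<v v<n) (trans (agree {G} {G′} h u v) (sym (adjacency G′∈ u v u<v v<n)))
      }
      where
      agree : ∀ {G G′} → (∀ i → i < m → partner G i ≡ partner G′ i) → ∀ u v → matchingRelation (partner G) u v ≡ matchingRelation (partner G′) u v
      agree {G} {G′} h u v with u <ᵇ m in eq
      ... | false = refl
      ... | true  = cong (λ z → v ≡ᵇ m + z) (h u (<ᵇ-true⁻ eq))

-- Descriptions of embeddings by cells, and the positions they forbid.

module CellCover where
  open Process using (≡ᵇ-refl; ≡ᵇ-true⁻; <ᵇ-true; <ᵇ-true⁻; <ᵇ-false)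
  open ExpectedStep using (count)
  open Sums
  open SubsetPairs using (Increasing; length-cartesianProduct)
  open Matchings using (∧-true; true≢false; count-not)
  open import Data.Bool.Base using (Bool; true; false; if_then_else_; _∧_; not)
  open import Data.Nat.Base
  open import Data.Nat.Properties
  open import Data.Nat.DivMod using (m*n/n≡m; m<n⇒m/n≡0; +-distrib-/-∣ˡ; m/n*n≤m; m%n<n; m≡m%n+[m/n]*n)
  open import Data.Nat.Divisibility using (divides-refl)
  open import Data.Nat.Tactic.RingSolver using (solve-∀)
  open import Data.List.Base using (List; []; _∷_; _++_; length; map; cartesianProduct)
  open import Data.List.Properties using (length-++; length-map)
  open import Data.List.Relation.Unary.Any using (here)
  open import Data.List.Membership.Propositional using (_∈_)
  open import Data.List.Membership.Propositional.Properties using (∈-++⁺ˡ; ∈-++⁺ʳ; ∈-map⁺; ∈-cartesianProduct⁺)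
  open import Data.Empty using (⊥-elim)
  open import Data.Product using (_×_; _,_; proj₁; proj₂; ∃-syntax)
  open import Data.Sum.Base using (inj₁; inj₂)
  open import Relation.Binary.PropositionalEquality hiding ([_])
  open import Relation.Nullary using (yes; no)

  extend : {A : Set} → A → (ℕ → A) → ℕ → A
  extend a α zero    = a
  extend a α (suc i) = α i

  -- Monotone sequences of length q with values in [lo, lo + g).
  monotones : ℕ → ℕ → ℕ → List (ℕ → ℕ)
  monotones zero    lo g       = (λ _ → 0) ∷ []
  monotones (suc q) lo zero    = []
  monotones (suc q) lo (suc g) = map (extend lo) (monotones q lo (suc g)) ++ monotones (suc q) (suc lo) g

  -- The recursion follows lattice paths: emit the current value or move on to the next one. At each
  -- of at most q + g moves there are two possibilities.
  length-monotones : ∀ q lo g → length (monotones q lo g) ≤ 2 ^ (q + g)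
  length-monotones zero    lo g       = m^n>0 2 g
  length-monotones (suc q) lo zero    = z≤n
  length-monotones (suc q) lo (suc g) = begin
    length (map (extend lo) (monotones q lo (suc g)) ++ monotones (suc q) (suc lo) g)
      ≡⟨ trans (length-++ (map (extend lo) (monotones q lo (suc g)))) (cong (_+ length (monotones (suc q) (suc lo) g)) (length-map (extend lo) (monotones q lo (suc g)))) ⟩
    length (monotones q lo (suc g)) + length (monotones (suc q) (suc lo) g)
      ≤⟨ +-mono-≤ (length-monotones q lo (suc g)) (length-monotones (suc q) (suc lo) g) ⟩
    2 ^ (q + suc g) + 2 ^ (suc q + g) ≡⟨ cong (2 ^ (q + suc g) +_) (trans (cong (2 ^_) (sym (+-suc q g))) (sym (+-identityʳ (2 ^ (q + suc g))))) ⟩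
    2 ^ (suc q + suc g) ∎
    where open ≤-Reasoning

  monotones-complete : ∀ q lo g (ψ : ℕ → ℕ) → (∀ i j → i ≤ j → j < q → ψ i ≤ ψ j) →
    (∀ i → i < q → lo ≤ ψ i × ψ i < lo + g) → ∃[ α ] α ∈ monotones q lo g × (∀ i → i < q → α i ≡ ψ i)
  monotones-complete zero    lo g       ψ mono bnd = (λ _ → 0) , here refl , λ _ ()
  monotones-complete (suc q) lo zero    ψ mono bnd =
    ⊥-elim (<⇒≱ (proj₂ (bnd 0 z<s)) (subst (_≤ ψ 0) (sym (+-identityʳ lo)) (proj₁ (bnd 0 z<s))))
  monotones-complete (suc q) lo (suc g) ψ mono bnd with ψ 0 ≟ lo
  ... | yes e =
    let α , α∈ , eq = monotones-complete q lo (suc g) (λ i → ψ (suc i)) (λ i j i≤j j<q → mono (suc i) (suc j) (s≤s i≤j) (s≤s j<q))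
                        (λ i i<q → bnd (suc i) (s≤s i<q))
    in extend lo α , ∈-++⁺ˡ (∈-map⁺ (extend lo) α∈) , λ { zero _ → sym e ; (suc i) (s≤s l) → eq i l }
  ... | no ψ0≢ =
    let α , α∈ , eq = monotones-complete (suc q) (suc lo) g ψ mono (λ i i<q →
                        ≤-trans (≤∧≢⇒< (proj₁ (bnd 0 z<s)) (λ e → ψ0≢ (sym e))) (mono 0 i z≤n i<q) ,
                        subst (ψ i <_) (+-suc lo g) (proj₂ (bnd i i<q)))
    in α , ∈-++⁺ʳ (map (extend lo) (monotones q lo (suc g))) α∈ , eq

  flags : ℕ → List (ℕ → Bool)
  flags zero    = (λ _ → false) ∷ []
  flags (suc q) = map (extend true) (flags q) ++ map (extend false) (flags q)

  length-flags : ∀ q → length (flags q) ≡ 2 ^ q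
  length-flags zero    = refl
  length-flags (suc q) = trans (length-++ (map (extend true) (flags q))) (cong₂ _+_
    (trans (length-map (extend true) (flags q)) (length-flags q))
    (trans (length-map (extend false) (flags q)) (trans (length-flags q) (sym (+-identityʳ _)))))

  flags-complete : ∀ q (P : ℕ → Bool) → ∃[ φ ] φ ∈ flags q × (∀ i → i < q → φ i ≡ P i)
  flags-complete zero    P = (λ _ → false) , here refl , λ _ ()
  flags-complete (suc q) P with P 0 in e | flags-complete q (λ i → P (suc i))
  ... | true  | φ , φ∈ , eq = extend true φ , ∈-++⁺ˡ (∈-map⁺ (extend true) φ∈) , λ { zero _ → sym e ; (suc i) (s≤s l) → eq i l }
  ... | false | φ , φ∈ , eq = extend false φ , ∈-++⁺ʳ (map (extend true) (flags q)) (∈-map⁺ (extend false) φ∈) , λ { zero _ → sym e ; (suc i) (s≤s l) → eq i l }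

  sum-increasing : ∀ (g c : ℕ → ℕ) M Q → Increasing M c → (∀ s → s < M → c s < Q) → sum< M (λ s → g (c s)) ≤ sum< Q g
  sum-increasing g c zero    Q inc bnd = z≤n
  sum-increasing g c (suc M) Q inc bnd = ≤-trans
    (+-monoˡ-≤ (g (c M)) (sum-increasing g c M (c M) (λ i j i<j j<M → inc i j i<j (m<n⇒m<1+n j<M)) (λ s s<M → inc s M s<M ≤-refl)))
    (sum<-extend g (bnd M ≤-refl))

  enumerate : ∀ (P : ℕ → Bool) Q M → M ≤ count Q P → ∃[ c ] Increasing M c × (∀ s → s < M → c s < Q × P (c s) ≡ true)
  enumerate P Q       zero    _ = (λ _ → 0) , (λ _ _ _ ()) , λ _ ()
  enumerate P (suc Q) (suc M) l with P Q in eq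
  ... | false = let c , inc , ok = enumerate P Q (suc M) l in c , inc , λ s s<M → m<n⇒m<1+n (proj₁ (ok s s<M)) , proj₂ (ok s s<M)
  ... | true  = c′ , inc′ , ok′
    where
    rec = enumerate P Q M (s≤s⁻¹ l)
    c = proj₁ rec
    inc = proj₁ (proj₂ rec)
    ok = proj₂ (proj₂ rec)
    c′ : ℕ → ℕ
    c′ s = if s <ᵇ M then c s else Q
    below : ∀ s → s < M → c′ s ≡ c s
    below s s<M rewrite <ᵇ-true s<M = refl
    at : c′ M ≡ Q
    at rewrite <ᵇ-false (≤-refl {M}) = refl
    inc′ : Increasing (suc M) c′
    inc′ i j i<j j≤M with j ≟ M
    ... | yes refl = subst₂ _<_ (sym (below i i<j)) (sym at) (proj₁ (ok i i<j))
    ... | no j≢M = let j<M = ≤∧≢⇒< (s≤s⁻¹ j≤M) j≢M in subst₂ _<_ (sym (below i (<-trans i<j j<M))) (sym (below j j<M)) (inc i j i<j j<M)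
    ok′ : ∀ s → s < suc M → c′ s < suc Q × P (c′ s) ≡ true
    ok′ s s≤M with s ≟ M
    ... | yes refl = subst (λ z → z < suc Q × P z ≡ true) (sym at) (≤-refl , eq)
    ... | no s≢M = subst (λ z → z < suc Q × P z ≡ true) (sym (below s s<M)) (m<n⇒m<1+n (proj₁ (ok s s<M)) , proj₂ (ok s s<M))
      where s<M = ≤∧≢⇒< (s≤s⁻¹ s≤M) s≢M

  increasing-gap : ∀ {M c} → Increasing M c → ∀ s d → s + d < M → c s + d ≤ c (s + d)
  increasing-gap {c = c} inc s zero    l = ≤-reflexive (trans (+-identityʳ (c s)) (cong c (sym (+-identityʳ s))))
  increasing-gap {c = c} inc s (suc d) l = ≤-trans (≤-reflexive (+-suc (c s) d)) (≤-trans
    (s≤s (increasing-gap inc s d (<-trans (+-monoʳ-< s (n<1+n d)) l)))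
    (inc (s + d) (s + suc d) (+-monoʳ-< s (n<1+n d)) l))

  cell-/ : ∀ c o h′ → o < suc h′ → (c * suc h′ + o) / suc h′ ≡ c
  cell-/ c o h′ o<h = trans (+-distrib-/-∣ˡ o (divides-refl c)) (trans (cong₂ _+_ (m*n/n≡m c (suc h′)) (m<n⇒m/n≡0 o<h)) (+-identityʳ c))

  module Cells (T k μ h′ m E₀ : ℕ) (R : ℕ → ℕ → Bool) (kμ≡2T : k * μ ≡ T + T) (μ≤T : μ ≤ T)
    (cells≤ : (T + T + (T + T)) * suc h′ ≤ m)
    (dense : ∀ X Y → Increasing k X → Increasing k Y → (∀ i j → i < k → j < k → X i < Y j) →
             (∀ j → j < k → Y j < T) → E₀ ≤ sum< k (λ j → sum< k (λ i → 𝟙[ R (Y j) (X i) ]))) where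

    h Q : ℕ
    h = suc h′
    Q = T + T + (T + T)

    Side : Set
    Side = (ℕ → ℕ) × (ℕ → Bool)

    Data : Set
    Data = Side × Side

    sides : List Side
    sides = cartesianProduct (monotones Q 0 T) (flags Q)

    descriptions : List Data
    descriptions = cartesianProduct sides sides

    length-descriptions : length descriptions ≤ 2 ^ (Q + T + Q + (Q + T + Q))
    length-descriptions = ≤-trans (≤-reflexive (length-cartesianProduct sides sides))
      (≤-trans (*-mono-≤ side side) (≤-reflexive (sym (^-distribˡ-+-* 2 (Q + T + Q) (Q + T + Q)))))
      where
      side : length sides ≤ 2 ^ (Q + T + Q)
      side = ≤-trans (≤-reflexive (length-cartesianProduct (monotones Q 0 T) (flags Q)))
        (≤-trans (*-mono-≤ (length-monotones Q 0 T) (≤-reflexive (length-flags Q))) (≤-reflexive (sym (^-distribˡ-+-* 2 (Q + T) Q))))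

    -- α and α′ are the images of the first vertices of the cells, φ and φ′ mark the constant cells.
    conflict : Data → ℕ → ℕ → Bool
    conflict ((α , φ) , (α′ , φ′)) c c′ = φ c ∧ (φ′ c′ ∧ R (α′ c′) (α c))

    -- The cells cover an initial stretch of each half; positions past the last cell are never
    -- forbidden.
    forbidden : Data → ℕ → ℕ → Bool
    forbidden d i j = (i / h <ᵇ Q) ∧ ((j / h <ᵇ Q) ∧ conflict d (i / h) (j / h))

    forbidden-area : ∀ d → h * (h * sum< Q (λ c → sum< Q (λ c′ → 𝟙[ conflict d c c′ ]))) ≤ sum< m (λ i → count m (forbidden d i))
    forbidden-area d = begin
      h * (h * sum< Q (λ c → sum< Q (λ c′ → 𝟙[ conflict d c c′ ])))
        ≡⟨ trans (cong (h *_) (trans (sym (sum<-*ˡ h (λ c → sum< Q (λ c′ → 𝟙[ conflict d c c′ ])) Q)) (sum<-cong Q (λ c _ → sym (sum<-*ˡ h (λ c′ → 𝟙[ conflict d c c′ ]) Q)))))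
             (sym (sum<-*ˡ h (λ c → sum< Q (λ c′ → h * 𝟙[ conflict d c c′ ])) Q)) ⟩
      sum< Q (λ c → h * sum< Q (λ c′ → h * 𝟙[ conflict d c c′ ]))
        ≡⟨ sum<-cong Q (λ c c<Q → trans (sym (sum<-const _ h)) (sum<-cong h (λ o o<h → trans
             (sum<-cong Q (λ c′ c′<Q → trans (sym (sum<-const _ h)) (sum<-cong h (λ o′ o′<h → cong 𝟙[_] (inside c o c′ o′ c<Q o<h c′<Q o′<h)))))
             (sym (sum<-grid (λ j → 𝟙[ forbidden d (c * h + o) j ]) Q h))))) ⟩
      sum< Q (λ c → sum< h (λ o → sum< (Q * h) (λ j → 𝟙[ forbidden d (c * h + o) j ])))
        ≡⟨ sym (sum<-grid (λ i → sum< (Q * h) (λ j → 𝟙[ forbidden d i j ])) Q h) ⟩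
      sum< (Q * h) (λ i → sum< (Q * h) (λ j → 𝟙[ forbidden d i j ]))
        ≤⟨ ≤-trans (sum<-mono (Q * h) (λ i _ → ≤-trans (sum<-extend (λ j → 𝟙[ forbidden d i j ]) cells≤) (≤-reflexive (sym (count≡sum (forbidden d i) m)))))
             (sum<-extend (λ i → count m (forbidden d i)) cells≤) ⟩
      sum< m (λ i → count m (forbidden d i)) ∎
      where
      open ≤-Reasoning
      inside : ∀ c o c′ o′ → c < Q → o < h → c′ < Q → o′ < h → conflict d c c′ ≡ forbidden d (c * h + o) (c′ * h + o′)
      inside c o c′ o′ c<Q o<h c′<Q o′<h rewrite cell-/ c o h′ o<h | cell-/ c′ o′ h′ o′<h | <ᵇ-true c<Q | <ᵇ-true c′<Q = refl

    -- What is retained of one half of an embedding after projection to the intervals. `jump`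
    -- expresses that an interval has μ h vertices, so μ h positions further on the image has left
    -- it.
    record Placement (ψ : ℕ → ℕ) : Set where
      field
        mono  : ∀ i j → i ≤ j → j < m → ψ i ≤ ψ j
        bound : ∀ i → i < m → ψ i < T
        jump  : ∀ i j → i + μ * h ≤ j → j < m → ψ i < ψ j

    -- `c * h + h′` is the last position of cell `c`; hence whole cells fit below `m`.
    start : ∀ c → c < Q → c * h + h′ < m
    start c c<Q = ≤-trans (≤-trans (≤-reflexive (trans (sym (+-suc (c * h) h′)) (+-comm (c * h) h))) (*-monoˡ-≤ h c<Q)) cells≤

    module Place {ψ : ℕ → ℕ} (pl : Placement ψ) where
      open Placement pl

      first : ℕ → ℕ
      first c = ψ (c * h)

      -- By monotonicity it suffices to compare the two ends of the cell.
      constant : ℕ → Bool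
      constant c = ψ (c * h) ≡ᵇ ψ (c * h + h′)

      -- Every non-constant cell raises ψ, which stays below T.
      broken-cells : ∀ c → c < Q → count (suc c) (λ x → not (constant x)) ≤ ψ (c * h + h′)
      broken-before : ∀ c → c < Q → count c (λ x → not (constant x)) ≤ ψ (c * h)

      broken-before zero    _   = z≤n
      broken-before (suc c) c<Q = ≤-trans (broken-cells c (<-trans (n<1+n c) c<Q))
        (mono (c * h + h′) (suc c * h) (≤-trans (n≤1+n _) (≤-reflexive (trans (sym (+-suc (c * h) h′)) (+-comm (c * h) h))))
          (≤-<-trans (m≤m+n _ h′) (start (suc c) c<Q)))

      within-cell : ∀ c → c < Q → ψ (c * h) ≤ ψ (c * h + h′)
      within-cell c c<Q = mono (c * h) (c * h + h′) (m≤m+n _ _) (start c c<Q)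

      broken-cells c c<Q with ψ (c * h) ≡ᵇ ψ (c * h + h′) in eq
      ... | true  = ≤-trans (broken-before c c<Q) (within-cell c c<Q)
      ... | false = ≤∧≢⇒< (≤-trans (broken-before c c<Q) (within-cell c c<Q)) (λ e → <⇒≱ strict (subst (_≤ ψ (c * h)) e (broken-before c c<Q)))
        where
        strict : ψ (c * h) < ψ (c * h + h′)
        strict = ≤∧≢⇒< (within-cell c c<Q) (λ e → true≢false (trans (sym (trans (cong (_≡ᵇ ψ (c * h + h′)) e) (≡ᵇ-refl (ψ (c * h + h′))))) eq))

      broken≤T : ∀ q → q ≤ Q → count q (λ x → not (constant x)) ≤ T
      broken≤T zero    _   = z≤n
      broken≤T (suc c) c<Q = <⇒≤ (≤-<-trans (broken-cells c c<Q) (bound _ (start c c<Q)))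

      -- Two of the three `T` make up the k-sets. The third, as μ ≤ T, leaves room for the shift by
      -- μ cells in `first-before`.
      many-constant : T + T + T ≤ count Q constant
      many-constant = +-cancelʳ-≤ T _ _ (begin
        T + T + T + T ≡⟨ +-assoc (T + T) T T ⟩
        Q ≡⟨ sym (count-not constant Q) ⟩
        count Q constant + count Q (λ x → not (constant x)) ≤⟨ +-monoʳ-≤ (count Q constant) (broken≤T Q ≤-refl) ⟩
        count Q constant + T ∎)
        where open ≤-Reasoning

      cells : ∃[ c ] Increasing (T + T + T) c × (∀ s → s < T + T + T → c s < Q × constant (c s) ≡ true)
      cells = enumerate constant Q (T + T + T) many-constant

      cell : ℕ → ℕ
      cell = proj₁ cells

      cell<Q : ∀ s → s < T + T + T → cell s < Q
      cell<Q s l = proj₁ (proj₂ (proj₂ cells) s l)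

      cell-increasing : Increasing (T + T + T) cell
      cell-increasing = proj₁ (proj₂ cells)

      first-jump : ∀ s s′ → s + μ ≤ s′ → s′ < T + T + T → first (cell s) < first (cell s′)
      first-jump s s′ l s′< = jump (cell s * h) (cell s′ * h)
        (≤-trans (≤-reflexive (sym (*-distribʳ-+ h (cell s) μ))) (*-monoˡ-≤ h (≤-trans
          (increasing-gap cell-increasing s μ (≤-<-trans l s′<)) (mono-cell (s + μ) s′ l s′<))))
        (≤-<-trans (m≤m+n _ h′) (start (cell s′) (cell<Q s′ s′<)))
        where
        mono-cell : ∀ a b → a ≤ b → b < T + T + T → cell a ≤ cell b
        mono-cell a b a≤b b< with m≤n⇒m<n∨m≡n a≤b
        ... | inj₁ a<b  = <⇒≤ (cell-increasing a b a<b b<)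
        ... | inj₂ refl = ≤-refl

      constant-value : ∀ i → i < m → i / h < Q → constant (i / h) ≡ true → ψ i ≡ first (i / h)
      constant-value i i<m c<Q e = ≤-antisym
        (≤-trans (mono i (i / h * h + h′) i≤ (start (i / h) c<Q)) (≤-reflexive (sym (≡ᵇ-true⁻ {ψ (i / h * h)} e))))
        (mono (i / h * h) i (m/n*n≤m i h) i<m)
        where
        i≤ : i ≤ i / h * h + h′
        i≤ = ≤-trans (≤-reflexive (m≡m%n+[m/n]*n i h)) (≤-trans (≤-reflexive (+-comm (i % h) (i / h * h))) (+-monoʳ-≤ (i / h * h) (s≤s⁻¹ (m%n<n i h))))

      side : ∃[ d ] d ∈ sides × (∀ c → c < Q → proj₁ d c ≡ first c) × (∀ c → c < Q → proj₂ d c ≡ constant c)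
      side =
        let α , α∈ , α≡ = monotones-complete Q 0 T first
              (λ i j i≤j j<Q → mono (i * h) (j * h) (*-monoˡ-≤ h i≤j) (≤-<-trans (m≤m+n _ h′) (start j j<Q)))
              (λ i i<Q → z≤n , bound (i * h) (≤-<-trans (m≤m+n _ h′) (start i i<Q)))
            φ , φ∈ , φ≡ = flags-complete Q constant
        in (α , φ) , ∈-cartesianProduct⁺ α∈ φ∈ , α≡ , φ≡

    module Both {ψ ψ′ : ℕ → ℕ} (pl : Placement ψ) (pl′ : Placement ψ′) (before : ∀ i j → i < m → j < m → ψ i ≤ ψ′ j) where
      module A = Place pl
      module B = Place pl′

      description : Data
      description = proj₁ A.side , proj₁ B.side

      description-∈ : description ∈ descriptions
      description-∈ = ∈-cartesianProduct⁺ (proj₁ (proj₂ A.side)) (proj₁ (proj₂ B.side))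

      conflict≡ : ∀ c c′ → c < Q → c′ < Q → conflict description c c′ ≡ A.constant c ∧ (B.constant c′ ∧ R (B.first c′) (A.first c))
      conflict≡ c c′ c<Q c′<Q = cong₂ _∧_ (proj₂ (proj₂ (proj₂ A.side)) c c<Q) (cong₂ _∧_ (proj₂ (proj₂ (proj₂ B.side)) c′ c′<Q)
        (cong₂ R (proj₁ (proj₂ (proj₂ B.side)) c′ c′<Q) (proj₁ (proj₂ (proj₂ A.side)) c c<Q)))

      -- On constant cells the recorded image of the first vertex is the image of every vertex, so a
      -- position is forbidden only if its two ends lie in adjacent intervals.
      avoids : ∀ i j → i < m → j < m → R (ψ′ j) (ψ i) ≡ false → forbidden description i j ≡ false
      avoids i j i<m j<m e with forbidden description i j in eq
      ... | false = refl
      ... | true  = ⊥-elim (true≢false (trans (sym (trans (cong₂ R (B.constant-value j j<m c′<Q (proj₁ (∧-true (proj₂ parts))))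
                      (A.constant-value i i<m c<Q (proj₁ parts))) (proj₂ (∧-true (proj₂ parts))))) e))
        where
        outer = ∧-true {i / h <ᵇ Q} eq
        inner = ∧-true {j / h <ᵇ Q} (proj₂ outer)
        c<Q : i / h < Q
        c<Q = <ᵇ-true⁻ (proj₁ outer)
        c′<Q : j / h < Q
        c′<Q = <ᵇ-true⁻ (proj₁ inner)
        parts = ∧-true {A.constant (i / h)} (trans (sym (conflict≡ (i / h) (j / h) c<Q c′<Q)) (proj₂ inner))

      -- The end of the lower half and the beginning of the upper one may share an interval, so
      -- `before` is only weak. Strictness comes from comparing with a constant cell of the lower
      -- half that lies μ places further on.
      first-before : ∀ s s′ → s < T + T → s′ < T + T + T → A.first (A.cell s) < B.first (B.cell s′)
      first-before s s′ s< s′< = <-≤-trans (A.first-jump s (s + μ) ≤-refl s+μ<)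
        (before _ _ (≤-<-trans (m≤m+n _ h′) (start _ (A.cell<Q (s + μ) s+μ<))) (≤-<-trans (m≤m+n _ h′) (start _ (B.cell<Q s′ s′<))))
        where
        s+μ< : s + μ < T + T + T
        s+μ< = +-mono-<-≤ s< μ≤T

      2T≤3T : T + T ≤ T + T + T
      2T≤3T = m≤m+n (T + T) T

      index< : ∀ t r → t < k → r < μ → t * μ + r < T + T
      index< t r t<k r<μ = subst (t * μ + r <_) kμ≡2T (≤-trans (≤-trans (≤-reflexive (sym (+-suc (t * μ) r))) (+-monoʳ-≤ (t * μ) r<μ))
        (≤-trans (≤-reflexive (+-comm (t * μ) μ)) (*-monoˡ-≤ μ t<k)))

      -- Members of one residue class are at least μ cells apart, hence lie in different intervals.
      class-increasing : ∀ {ψ} (pl : Placement ψ) r → r < μ → Increasing k (λ t → Place.first pl (Place.cell pl (t * μ + r)))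
      class-increasing pl r r<μ t t′ t<t′ t′<k = Place.first-jump pl (t * μ + r) (t′ * μ + r)
        (≤-trans (≤-reflexive (lemma (t * μ) r μ)) (+-monoˡ-≤ r (*-monoˡ-≤ μ t<t′))) (<-≤-trans (index< t′ r t′<k r<μ) 2T≤3T)
        where
        lemma : ∀ a r μ → a + r + μ ≡ μ + a + r
        lemma = solve-∀

      weight : ℕ → ℕ → ℕ
      weight s s′ = 𝟙[ R (B.first (B.cell s′)) (A.first (A.cell s)) ]

      class-edges : ∀ r r′ → r < μ → r′ < μ → E₀ ≤ sum< k (λ t′ → sum< k (λ t → weight (t * μ + r) (t′ * μ + r′)))
      class-edges r r′ r<μ r′<μ = dense (λ t → A.first (A.cell (t * μ + r))) (λ t → B.first (B.cell (t * μ + r′)))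
        (class-increasing pl r r<μ) (class-increasing pl′ r′ r′<μ)
        (λ t t′ t<k t′<k → first-before (t * μ + r) (t′ * μ + r′) (index< t r t<k r<μ) (<-≤-trans (index< t′ r′ t′<k r′<μ) 2T≤3T))
        (λ t t<k → Placement.bound pl′ _ (≤-<-trans (m≤m+n _ h′) (start _ (B.cell<Q (t * μ + r′) (<-≤-trans (index< t r′ t<k r′<μ) 2T≤3T)))))

      selected-edges : μ * (μ * E₀) ≤ sum< (T + T) (λ s → sum< (T + T) (λ s′ → weight s s′))
      selected-edges = subst (λ N → μ * (μ * E₀) ≤ sum< N (λ s → sum< N (λ s′ → weight s s′))) kμ≡2T (begin
        μ * (μ * E₀) ≡⟨ sym (trans (sum<-cong μ (λ _ _ → sum<-const E₀ μ)) (sum<-const (μ * E₀) μ)) ⟩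
        sum< μ (λ r → sum< μ (λ r′ → E₀)) ≤⟨ sum<-mono μ (λ r r<μ → sum<-mono μ (λ r′ r′<μ → class-edges r r′ r<μ r′<μ)) ⟩
        sum< μ (λ r → sum< μ (λ r′ → sum< k (λ t′ → sum< k (λ t → weight (t * μ + r) (t′ * μ + r′)))))
          ≡⟨ sum<-cong μ (λ r _ → trans (sum<-cong μ (λ r′ _ → sum<-swap (λ t′ t → weight (t * μ + r) (t′ * μ + r′)) k k))
               (trans (sum<-swap (λ r′ t → sum< k (λ t′ → weight (t * μ + r) (t′ * μ + r′))) μ k)
                 (sum<-cong k (λ t _ → trans (sum<-swap (λ r′ t′ → weight (t * μ + r) (t′ * μ + r′)) μ k)
                   (sym (sum<-grid (λ s′ → weight (t * μ + r) s′) k μ)))))) ⟩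
        sum< μ (λ r → sum< k (λ t → sum< (k * μ) (λ s′ → weight (t * μ + r) s′)))
          ≡⟨ trans (sum<-swap (λ r t → sum< (k * μ) (λ s′ → weight (t * μ + r) s′)) μ k) (sym (sum<-grid (λ s → sum< (k * μ) (λ s′ → weight s s′)) k μ)) ⟩
        sum< (k * μ) (λ s → sum< (k * μ) (λ s′ → weight s s′)) ∎)
        where open ≤-Reasoning

      conflicts-many : μ * (μ * E₀) ≤ sum< Q (λ c → sum< Q (λ c′ → 𝟙[ conflict description c c′ ]))
      conflicts-many = ≤-trans selected-edges (≤-trans
        (sum<-mono (T + T) (λ s s< → ≤-trans (sum<-mono (T + T) (λ s′ s′< → ≤-reflexive (cong 𝟙[_] (sym (value s s′ s< s′<)))))
          (sum-increasing (λ c′ → 𝟙[ conflict description (A.cell s) c′ ]) B.cell (T + T) Q (restrict B.cell-increasing) (λ s′ s′< → B.cell<Q s′ (<-≤-trans s′< 2T≤3T)))))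
        (sum-increasing (λ c → sum< Q (λ c′ → 𝟙[ conflict description c c′ ])) A.cell (T + T) Q (restrict A.cell-increasing) (λ s s< → A.cell<Q s (<-≤-trans s< 2T≤3T))))
        where
        restrict : ∀ {c} → Increasing (T + T + T) c → Increasing (T + T) c
        restrict inc i j i<j j< = inc i j i<j (<-≤-trans j< 2T≤3T)
        value : ∀ s s′ → s < T + T → s′ < T + T → conflict description (A.cell s) (B.cell s′) ≡ R (B.first (B.cell s′)) (A.first (A.cell s))
        value s s′ s< s′< = trans (conflict≡ (A.cell s) (B.cell s′) (A.cell<Q s s<3) (B.cell<Q s′ s′<3))
          (cong₂ (λ a b → a ∧ (b ∧ R (B.first (B.cell s′)) (A.first (A.cell s)))) (proj₂ (proj₂ (proj₂ A.cells) s s<3)) (proj₂ (proj₂ (proj₂ B.cells) s′ s′<3)))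
          where
          s<3 = <-≤-trans s< 2T≤3T
          s′<3 = <-≤-trans s′< 2T≤3T

      area-large : h * (h * (μ * (μ * E₀))) ≤ sum< m (λ i → count m (forbidden description i))
      area-large = ≤-trans (*-monoʳ-≤ h (*-monoʳ-≤ h conflicts-many)) (forbidden-area description)

-- The colouring, and the union bound over descriptions.

module Embeddings where
  open import Defs
  open Sums
  open SequentialGraph using (TriangleFree)
  open SubsetPairs using (Increasing)
  open Switching
  open CellCover
  open Matchings
  open import Data.Bool.Base using (Bool; true; false; if_then_else_; T)
  open import Data.Fin.Base as Fin using (Fin; toℕ; fromℕ<)
  open import Data.Fin.Patterns using (0F; 1F; 2F)
  import Data.Fin.Properties as Fin
  open import Data.Nat.Base
  open import Data.Nat.Properties
  open import Data.Nat.DivMod using (/-monoˡ-≤; m<n*o⇒m/o<n; +-distrib-/-∣ʳ; n/n≡1)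
  open import Data.Nat.Divisibility using (∣-refl)
  open import Data.List.Base using (List; []; _∷_; length; filter)
  open import Data.List.Relation.Unary.Any using (here; there)
  open import Data.List.Membership.Propositional using (_∈_)
  open import Data.Vec.Base as Vec using (Vec; []; _∷_)
  open import Data.Empty using (⊥-elim)
  open import Data.Product using (_,_; proj₁; proj₂)
  open import Data.Sum.Base using (inj₁; inj₂)
  open import Relation.Binary.PropositionalEquality hiding ([_])
  open import Relation.Nullary using (Dec; yes; no; ¬_; does)
  open import Relation.Nullary.Decidable using (dec-true)

  rowℕ : (ℕ → Fin 2) → ∀ n → Vec (Fin 2) n
  rowℕ P zero    = []
  rowℕ P (suc n) = P 0 ∷ rowℕ (λ j → P (suc j)) n

  colouringℕ : (ℕ → ℕ → Fin 2) → ∀ n → Colouring n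
  colouringℕ K zero    = []
  colouringℕ K (suc n) = rowℕ (λ j → K 0 (suc j)) n ∷ colouringℕ (λ i j → K (suc i) (suc j)) n

  colourClassℕ : ∀ K n c → colourClass (colouringℕ K n) c ≡ graphℕ (λ i j → does (K i j Fin.≟ c)) n
  colourClassℕ K zero    c = refl
  colourClassℕ K (suc n) c = cong₂ _∷_ (row (λ j → K 0 (suc j)) n) (colourClassℕ (λ i j → K (suc i) (suc j)) n c)
    where
    row : ∀ P n → Vec.map (λ d → does (d Fin.≟ c)) (rowℕ P n) ≡ tabulateℕ (λ j → does (P j Fin.≟ c)) n
    row P zero    = refl
    row P (suc n) = cong (does (P 0 Fin.≟ c) ∷_) (row (λ j → P (suc j)) n)

  colourClass-edge : ∀ K n c (i j : Fin n) → toℕ i < toℕ j → Edge (colourClass (colouringℕ K n) c) i j →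
                     does (K (toℕ i) (toℕ j) Fin.≟ c) ≡ true
  colourClass-edge K n c i j i<j e = trans
    (sym (adjℕ-graphℕ (λ i j → does (K i j Fin.≟ c)) n (toℕ i) (toℕ j) i<j (Fin.toℕ<n j)))
    (edge⇒adjℕ (graphℕ (λ i j → does (K i j Fin.≟ c)) n) i j (subst (λ G → Edge G i j) (colourClassℕ K n c) e))

  sumList-swap : {A B : Set} (F : A → B → ℕ) (xs : List A) (ys : List B) →
    sumList (λ x → sumList (F x) ys) xs ≡ sumList (λ y → sumList (λ x → F x y) xs) ys
  sumList-swap F []       ys = sym (zeros ys)
    where
    zeros : ∀ ys → sumList (λ _ → 0) ys ≡ 0
    zeros []       = refl
    zeros (y ∷ ys) = zeros ys
  sumList-swap F (x ∷ xs) ys = trans (cong (sumList (F x) ys +_) (sumList-swap F xs ys)) (sym (sumList-+ (F x) (λ y → sumList (λ x → F x y) xs) ys))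

  term≤sumList : {A : Set} (F : A → ℕ) {x : A} {xs : List A} → x ∈ xs → F x ≤ sumList F xs
  term≤sumList F {xs = y ∷ ys} (here refl) = m≤m+n _ _
  term≤sumList F {xs = y ∷ ys} (there p)   = ≤-trans (term≤sumList F p) (m≤n+m _ (F y))

  sumList-const : {A : Set} (c : ℕ) (xs : List A) → sumList (λ _ → c) xs ≡ length xs * c
  sumList-const c []       = refl
  sumList-const c (x ∷ xs) = cong (c +_) (sumList-const c xs)

  length-filter≤sumList : {A : Set} {P : A → Set} (P? : ∀ x → Dec (P x)) (F : A → ℕ) (xs : List A) →
    (∀ {x} → x ∈ xs → P x → 1 ≤ F x) → length (filter P? xs) ≤ sumList F xs
  length-filter≤sumList P? F []       h = z≤n
  length-filter≤sumList P? F (x ∷ xs) h with P? x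
  ... | no _  = ≤-trans (length-filter≤sumList P? F xs (λ p → h (there p))) (m≤n+m _ (F x))
  ... | yes p = +-mono-≤ (h (here refl) p) (length-filter≤sumList P? F xs (λ p → h (there p)))

  module Bad (T k μ h′ m E₀ r : ℕ) (back : ℕ → ℕ → Bool) (free : TriangleFree back)
    (kμ≡2T : k * μ ≡ T + T) (1≤μ : 1 ≤ μ) (μ≤T : μ ≤ T) (cells≤ : (T + T + (T + T)) * suc h′ ≤ m) (0<m : 0 < m)
    (dense : ∀ X Y → Increasing k X → Increasing k Y → (∀ i j → i < k → j < k → X i < Y j) →
             (∀ j → j < k → Y j < T) → E₀ ≤ sum< k (λ j → sum< k (λ i → 𝟙[ back (Y j) (X i) ])))
    (r-bound : (10 * r + 16) * m ≤ suc h′ * (suc h′ * (μ * (μ * E₀)))) where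

    open TriangleFree free
    open MatchingModel m 0<m
    open Cells T k μ h′ m E₀ back kμ≡2T μ≤T cells≤ dense

    -- `β` is the interval length μ h, written as a successor so that division by it is defined.
    β′ β N : ℕ
    β′ = pred (μ * h)
    β  = suc β′
    N  = T * β

    β≡ : β ≡ μ * h
    β≡ = suc-pred (μ * h) {{>-nonZero (*-mono-≤ 1≤μ (s≤s (z≤n {h′})))}}

    K : ℕ → ℕ → Fin 2
    K i j = if back (j / β) (i / β) then 0F else 1F

    first-colour : ∀ b → does ((if b then 0F else 1F) Fin.≟ (Fin.zero {1})) ≡ true → b ≡ true
    first-colour true  _ = refl
    first-colour false ()

    second-colour : ∀ b → does ((if b then 0F else 1F) Fin.≟ (Fin.suc (Fin.zero {0}))) ≡ true → b ≡ false
    second-colour false _ = refl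
    second-colour true  ()

    no-triangle : ∀ N′ → ¬ Contains (colourClass (colouringℕ K N′) 0F) K₃
    no-triangle N′ (φ , mono , hom) = true≢false (trans (sym (edge 0F 1F (s≤s z≤n) _)) (triangle _ _ _ (edge 0F 2F (s≤s z≤n) _) (edge 1F 2F (s≤s (s≤s z≤n)) _)))
      where
      edge : ∀ i j → i Fin.< j → Edge K₃ i j → back (toℕ (φ j) / β) (toℕ (φ i) / β) ≡ true
      edge i j i<j e = first-colour _ (colourClass-edge K N′ 0F (φ i) (φ j) (mono i j i<j) (hom i j e))

    module Embedding {G : OrderedGraph n} (G∈ : G ∈ matchingsWithχ<≡2 n) {N′ : ℕ} (N′≤N : N′ ≤ N)
                     (emb : Contains (colourClass (colouringℕ K N′) 1F) G) where

      φ : ℕ → ℕ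
      φ u with u <? n
      ... | yes u<n = toℕ (proj₁ emb (fromℕ< u<n))
      ... | no _    = 0

      φ≡ : ∀ u (u<n : u < n) → φ u ≡ toℕ (proj₁ emb (fromℕ< u<n))
      φ≡ u u<n with u <? n
      ... | yes l  = cong (λ l → toℕ (proj₁ emb (fromℕ< l))) (<-irrelevant l u<n)
      ... | no u≮n = ⊥-elim (u≮n u<n)

      φ-increasing : Increasing n φ
      φ-increasing u v u<v v<n = subst₂ _<_ (sym (φ≡ u u<n)) (sym (φ≡ v v<n))
        (proj₁ (proj₂ emb) (fromℕ< u<n) (fromℕ< v<n) (subst₂ _<_ (sym (Fin.toℕ-fromℕ< u<n)) (sym (Fin.toℕ-fromℕ< v<n)) u<v))
        where
        u<n = <-trans u<v v<n

      φ-mono : ∀ u v → u ≤ v → v < n → φ u ≤ φ v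
      φ-mono u v u≤v v<n with m≤n⇒m<n∨m≡n u≤v
      ... | inj₁ u<v  = <⇒≤ (φ-increasing u v u<v v<n)
      ... | inj₂ refl = ≤-refl

      ψ : ℕ → ℕ
      ψ u = φ u / β

      ψ-mono : ∀ u v → u ≤ v → v < n → ψ u ≤ ψ v
      ψ-mono u v u≤v v<n = /-monoˡ-≤ β (φ-mono u v u≤v v<n)

      ψ-bound : ∀ u → u < n → ψ u < T
      ψ-bound u u<n = m<n*o⇒m/o<n (<-≤-trans (subst (_< N′) (sym (φ≡ u u<n)) (Fin.toℕ<n _)) N′≤N)

      ψ-jump : ∀ u v → u + β ≤ v → v < n → ψ u < ψ v
      ψ-jump u v l v<n = ≤-trans (≤-reflexive (trans (+-comm 1 (ψ u)) (sym (trans (+-distrib-/-∣ʳ (φ u) (∣-refl {β})) (cong (ψ u +_) (n/n≡1 β))))))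
        (/-monoˡ-≤ β (≤-trans (increasing-gap φ-increasing u β (≤-<-trans l v<n)) (φ-mono (u + β) v l v<n)))

      lower : ∀ {i} → i < m → i < n
      lower i<m = <-≤-trans i<m (m≤m+n m m)

      upper : ∀ {j} → j < m → m + j < n
      upper = +-monoʳ-< m

      placement-A : Placement ψ
      placement-A = record { mono = λ i j i≤j j<m → ψ-mono i j i≤j (lower j<m) ; bound = λ i i<m → ψ-bound i (lower i<m)
        ; jump = λ i j l j<m → ψ-jump i j (≤-trans (≤-reflexive (cong (i +_) β≡)) l) (lower j<m) }

      placement-B : Placement (λ j → ψ (m + j))
      placement-B = record { mono = λ i j i≤j j<m → ψ-mono (m + i) (m + j) (+-monoʳ-≤ m i≤j) (upper j<m) ; bound = λ i i<m → ψ-bound (m + i) (upper i<m)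
        ; jump = λ i j l j<m → ψ-jump (m + i) (m + j) (≤-trans (≤-reflexive (trans (+-assoc m i β) (cong (λ z → m + (i + z)) β≡))) (+-monoʳ-≤ m l)) (upper j<m) }

      open Both placement-A placement-B (λ i j i<m j<m → ψ-mono i (m + j) (≤-trans (<⇒≤ i<m) (m≤m+n m j)) (upper j<m)) public

      non-edge : ∀ i → i < m → back (ψ (m + partner G i)) (ψ i) ≡ false
      non-edge i i<m = subst₂ (λ a b → back (b / β) (a / β) ≡ false) (sym (φ≡ i i<n)) (sym (φ≡ (m + j) j<n))
        (second-colour _ (colourClass-edge K N′ 1F _ _ increasing (proj₂ (proj₂ emb) (fromℕ< i<n) (fromℕ< j<n)
          (adjℕ⇒edge G (fromℕ< i<n) (fromℕ< j<n) (trans (cong₂ (adjℕ G) (Fin.toℕ-fromℕ< i<n) (Fin.toℕ-fromℕ< j<n)) (proj₂ (partner-edge G∈ i i<m)))))))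
        where
        j = partner G i
        i<n = lower i<m
        j<n = upper (proj₁ (partner-edge G∈ i i<m))
        increasing : toℕ (proj₁ emb (fromℕ< i<n)) < toℕ (proj₁ emb (fromℕ< j<n))
        increasing = subst₂ _<_ (φ≡ i i<n) (φ≡ (m + j) j<n) (φ-increasing i (m + j) (<-≤-trans i<m (m≤m+n m j)) j<n)

      no-hits : Switch.hits model (forbidden description) G ≡ 0
      no-hits = trans (count≡sum _ m) (trans (sum<-cong m (λ i i<m → cong 𝟙[_]
        (avoids i (partner G i) i<m (proj₁ (partner-edge G∈ i i<m)) (non-edge i i<m)))) (sum<-zero m))

    large : Data → Bool
    large d = does ((10 * r + 16) * m ≤? Switch.area model (forbidden d))

    -- The factor `large` discards the descriptions with too small a forbidden set: the switching
    -- bound says nothing about them, and no embedding produces them.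
    witness : Data → OrderedGraph n → ℕ
    witness d G = 𝟙[ large d ] * 𝟙[ Switch.hits model (forbidden d) G ≡ᵇ 0 ]

    -- Allowing every N′ ≤ N makes it applicable at the Ramsey number itself, where arrowing holds
    -- by definition; no monotonicity of `Arrows` is involved.
    arrowing⇒witness : ∀ {G} → G ∈ matchingsWithχ<≡2 n → ∀ N′ → N′ ≤ N → Arrows K₃ G N′ → 1 ≤ sumList (λ d → witness d G) descriptions
    arrowing⇒witness {G} G∈ N′ N′≤N arr with arr (colouringℕ K N′)
    ... | inj₁ c = ⊥-elim (no-triangle N′ c)
    ... | inj₂ c = ≤-trans (≤-reflexive (sym (cong₂ _*_
            (cong 𝟙[_] (dec-true ((10 * r + 16) * m ≤? Switch.area model (forbidden E.description)) (≤-trans r-bound E.area-large)))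
            (cong (λ z → 𝟙[ z ≡ᵇ 0 ]) E.no-hits))))
          (term≤sumList (λ d → witness d G) E.description-∈)
      where
      module E = Embedding G∈ N′≤N c

    bad-few : length (filter (λ G → r< K₃ G ≤? N) (matchingsWithχ<≡2 n)) * 2 ^ r
              ≤ 2 ^ (Q + T + Q + (Q + T + Q)) * length (matchingsWithχ<≡2 n)
    bad-few = begin
      length (filter (λ G → r< K₃ G ≤? N) 𝓜) * 2 ^ r ≤⟨ *-monoˡ-≤ (2 ^ r) bad≤ ⟩
      sumList (λ G → sumList (λ d → witness d G) descriptions) 𝓜 * 2 ^ r
        ≡⟨ trans (cong (_* 2 ^ r) (sumList-swap (λ G d → witness d G) 𝓜 descriptions)) (sym (sumList-*ʳ (2 ^ r) (λ d → sumList (witness d) 𝓜) descriptions)) ⟩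
      sumList (λ d → sumList (witness d) 𝓜 * 2 ^ r) descriptions ≤⟨ sumList-mono descriptions (λ {d} _ → each d) ⟩
      sumList (λ d → length 𝓜) descriptions ≡⟨ sumList-const (length 𝓜) descriptions ⟩
      length descriptions * length 𝓜 ≤⟨ *-monoˡ-≤ (length 𝓜) length-descriptions ⟩
      2 ^ (Q + T + Q + (Q + T + Q)) * length 𝓜 ∎
      where
      open ≤-Reasoning
      𝓜 : List (OrderedGraph n)
      𝓜 = matchingsWithχ<≡2 n
      bad≤ : length (filter (λ G → r< K₃ G ≤? N) 𝓜) ≤ sumList (λ G → sumList (λ d → witness d G) descriptions) 𝓜
      bad≤ = length-filter≤sumList (λ G → r< K₃ G ≤? N) _ 𝓜 (λ {G} G∈ l → arrowing⇒witness G∈ (r< K₃ G) l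
               (proj₁ (proj₂ (least (arrows? K₃ G) _ (arrows-ramseyBound K₃ G)))))
      switch : ∀ d (D : Dec ((10 * r + 16) * m ≤ Switch.area model (forbidden d))) →
               sumList (λ G → 𝟙[ does D ] * 𝟙[ Switch.hits model (forbidden d) G ≡ᵇ 0 ]) 𝓜 * 2 ^ r ≤ length 𝓜
      switch d (no _)  = ≤-trans (≤-reflexive (cong (_* 2 ^ r) (trans (sumList-const 0 𝓜) (*-zeroʳ (length 𝓜))))) z≤n
      switch d (yes l) = ≤-trans (*-monoˡ-≤ (2 ^ r) (sumList-mono 𝓜 (λ _ → ≤-reflexive (*-identityˡ _))))
                           (Switch.avoiding-rare model (forbidden d) r 0<m l)
      each : ∀ d → sumList (witness d) 𝓜 * 2 ^ r ≤ length 𝓜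
      each d = switch d ((10 * r + 16) * m ≤? Switch.area model (forbidden d))

-- Choice of f and h, and the inequalities between the parameters.

module Parameters where
  open import Defs
  open Embeddings
  open Matchings
  open import Data.Nat.Base
  open import Data.Nat.Properties
  open import Data.Nat.DivMod using (m≡m%n+[m/n]*n; m%n<n; m/n*n≤m)
  open import Data.Nat.Tactic.RingSolver using (solve-∀)
  open import Data.Integer.Base as ℤ using ()
  import Data.Integer.Properties as ℤ
  open import Data.Rational.Base as ℚ using (ℚ; mkℚ; 0ℚ; 1ℚ; ↧ₙ_)
  import Data.Rational.Properties as ℚ
  open import Algebra.Properties.Group ℚ.+-0-group using (⁻¹-involutive)
  open import Data.Rational.Unnormalised.Base as ℚᵘ using (mkℚᵘ)
  import Data.Rational.Unnormalised.Properties as ℚᵘ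
  open import Data.List.Base using (List; []; _∷_; length; filter)
  open import Data.List.Relation.Unary.Any using (here; there)
  open import Data.List.Membership.Propositional using (_∈_)
  open import Data.Empty using (⊥-elim)
  open import Data.Product using (_×_; _,_; Σ-syntax)
  open import Relation.Binary.PropositionalEquality hiding ([_])
  open import Relation.Nullary using (Dec; yes; no; ¬_)

  n<2^n : ∀ n → n < 2 ^ n
  n<2^n zero    = s≤s z≤n
  n<2^n (suc n) = ≤-trans (+-mono-≤ (≤-trans (s≤s z≤n) (n<2^n n)) (n<2^n n)) (≤-reflexive (cong (2 ^ n +_) (sym (+-identityʳ (2 ^ n)))))

  -- The upward search ends by `m` at the latest, because F f ≥ f.
  largest : (F : ℕ → ℕ) → (∀ f → f ≤ F f) → ∀ m f₀ → F f₀ ≤ m → Σ[ f ∈ ℕ ] f₀ ≤ f × F f ≤ m × m < F (suc f)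
  largest F f≤F m f₀ l₀ = go m f₀ l₀ (s≤s (m≤m+n m f₀))
    where
    go : ∀ d f → F f ≤ m → m < suc d + f → Σ[ f′ ∈ ℕ ] f ≤ f′ × F f′ ≤ m × m < F (suc f′)
    go d f l b with F (suc f) ≤? m
    ... | no ≰ = f , ≤-refl , l , ≰⇒> ≰
    go zero    f l b | yes l′ = ⊥-elim (<⇒≱ b (≤-trans (f≤F (suc f)) l′))
    go (suc d) f l b | yes l′ with go d (suc f) l′ (≤-trans b (≤-reflexive (cong suc (sym (+-suc d f)))))
    ... | f′ , f≤f′ , rest = f′ , ≤-trans (n≤1+n f) f≤f′ , rest

  -- The quotient m / Q loses at most a factor 2, as the remainder is below Q and the quotient is at
  -- least 1.
  floor : ∀ m Q → 1 ≤ Q → Q ≤ m → Σ[ h ∈ ℕ ] Q * suc h ≤ m × m ≤ Q * suc h * 2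
  floor m Q@(suc _) _ Q≤m = pred (m / Q) , lower , upper
    where
    h≡ : suc (pred (m / Q)) ≡ m / Q
    h≡ with m / Q in e
    ... | suc _ = refl
    ... | zero  = ⊥-elim (<⇒≱ (m%n<n m Q) (≤-trans Q≤m (≤-reflexive (trans (m≡m%n+[m/n]*n m Q) (trans (cong (λ z → m % Q + z * Q) e) (+-identityʳ _))))))
    lower : Q * suc (pred (m / Q)) ≤ m
    lower = ≤-trans (≤-reflexive (trans (cong (Q *_) h≡) (*-comm Q (m / Q)))) (m/n*n≤m m Q)
    upper : m ≤ Q * suc (pred (m / Q)) * 2
    upper = begin
      m ≡⟨ m≡m%n+[m/n]*n m Q ⟩
      m % Q + m / Q * Q ≤⟨ +-mono-≤ (<⇒≤ (m%n<n m Q)) (≤-reflexive (trans (cong (_* Q) (sym h≡)) (*-comm (suc (pred (m / Q))) Q))) ⟩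
      Q + Q * suc (pred (m / Q)) ≤⟨ +-monoˡ-≤ _ (m≤m*n Q (suc (pred (m / Q)))) ⟩
      Q * suc (pred (m / Q)) + Q * suc (pred (m / Q)) ≡⟨ double (Q * suc (pred (m / Q))) ⟩
      Q * suc (pred (m / Q)) * 2 ∎
      where
      open ≤-Reasoning
      double : ∀ x → x + x ≡ x * 2
      double = solve-∀

  -- For x = 128 this is f b³ up to a constant: the order of m at which the m / b expected hits
  -- balance the f b² bits of a description.
  threshold : ℕ → ℕ → ℕ
  threshold x f = f * (2 ^ (f * x) * 2 ^ (f * x) * 2 ^ (f * x)) * 131072

  f≤threshold : ∀ x f → f ≤ threshold x f
  f≤threshold x f = ≤-trans (m≤m*n f (b * b * b) {{>-nonZero (*-mono-≤ (*-mono-≤ 1≤b 1≤b) 1≤b)}}) (m≤m*n (f * (b * b * b)) 131072)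
    where
    b : ℕ
    b = 2 ^ (f * x)
    1≤b : 1 ≤ b
    1≤b = m^n>0 2 (f * x)

  -- The constants 131072 = 2^17 = 8 · 16384 in threshold and 16384 below are what area-bound requires.
  gap-bound : ∀ f b m h → 1 ≤ f → 1 ≤ b → f * (b * b * b) * 131072 ≤ m → m ≤ f * b * b * 8 * h → b * 16384 ≤ h
  gap-bound f b m h 1≤f 1≤b l u = *-cancelˡ-≤ (f * b * b * 8) {{>-nonZero (*-mono-≤ (*-mono-≤ (*-mono-≤ 1≤f 1≤b) 1≤b) (s≤s (z≤n {7})))}}
    (≤-trans (≤-reflexive (eq f b 8 16384)) (≤-trans l u))
    where
    eq : ∀ f b x y → f * b * b * x * (b * y) ≡ f * (b * b * b) * (x * y)
    eq = solve-∀

  -- The hypothesis of the switching bound with r = 19 T. The right side is the area guaranteed by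
  -- `area-large` with `E₀` = 128 f k.
  area-bound : ∀ f b μ k m h → 1 ≤ f * b * b → k * μ ≡ f * b * b + f * b * b → b ≡ μ * 2048 → b * 16384 ≤ h → m ≤ f * b * b * 8 * h →
    (10 * (f * b * b * 19) + 16) * m ≤ h * (h * (μ * (μ * (k * (f * 128)))))
  area-bound f b μ k m h 1≤T kμ b≡ b≤h m≤ = begin
    (10 * (T * 19) + 16) * m ≤⟨ *-mono-≤ (+-monoʳ-≤ (10 * (T * 19)) (m≤n*m 16 T {{>-nonZero 1≤T}})) m≤ ⟩
    (10 * (T * 19) + T * 16) * (T * 8 * h) ≡⟨ eq₁ T h 10 19 16 8 ⟩
    T * T * h * ((10 * 19 + 16) * 8) ≤⟨ *-monoʳ-≤ (T * T * h) (≤ᵇ⇒≤ ((10 * 19 + 16) * 8) 2048 _) ⟩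
    T * T * h * 2048 ≡⟨ eq₂ T h f b 2048 ⟩
    T * h * f * b * (b * 2048) ≡⟨ cong (λ z → T * h * f * b * (z * 2048)) b≡ ⟩
    T * h * f * b * (μ * 2048 * 2048) ≡⟨ cong (T * h * f * b *_) (*-assoc μ 2048 2048) ⟩
    -- 2048 · 2048 is split into 16384 for `b * 16384 ≤ h`, 128 for the number of edges, and 2 for k
    -- μ = 2 T.
    T * h * f * b * (μ * (16384 * 128 * 2)) ≡⟨ eq₃ T h f b μ 16384 128 ⟩
    h * (b * 16384) * (T + T) * μ * (f * 128) ≤⟨ *-monoˡ-≤ (f * 128) (*-monoˡ-≤ μ (*-monoˡ-≤ (T + T) (*-monoʳ-≤ h b≤h))) ⟩
    h * h * (T + T) * μ * (f * 128) ≡⟨ cong (λ z → h * h * z * μ * (f * 128)) (sym kμ) ⟩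
    h * h * (k * μ) * μ * (f * 128) ≡⟨ eq₄ h k μ (f * 128) ⟩
    h * (h * (μ * (μ * (k * (f * 128))))) ∎
    where
    open ≤-Reasoning
    T = f * b * b
    eq₁ : ∀ T h x y z w → (x * (T * y) + T * z) * (T * w * h) ≡ T * T * h * ((x * y + z) * w)
    eq₁ = solve-∀
    eq₂ : ∀ T h f b x → T * (f * b * b) * h * x ≡ T * h * f * b * (b * x)
    eq₂ = solve-∀
    eq₃ : ∀ T h f b μ x y → T * h * f * b * (μ * (x * y * 2)) ≡ h * (b * x) * (T + T) * μ * (f * y)
    eq₃ = solve-∀
    eq₄ : ∀ h k μ g → h * h * (k * μ) * μ * g ≡ h * (h * (μ * (μ * (k * g))))
    eq₄ = solve-∀

  -- The source of the exponents: m⁴ ≤ D f b³ m³ = D f (m b)³, and m b is at most a constant times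
  -- N.
  fourth-power-bound : ∀ f b m N D → m ≤ f * (b * b * b) * D → m * b ≤ N * 16384 →
    (m + m) ^ 4 ≤ f * (N ^ 3 * (D * 16 * (16384 * 16384 * 16384)))
  fourth-power-bound f b m N D m≤ mb≤ = begin
    (m + m) ^ 4 ≡⟨ eq₁ m ⟩
    m * (m * m * m * 16) ≤⟨ *-monoˡ-≤ (m * m * m * 16) m≤ ⟩
    f * (b * b * b) * D * (m * m * m * 16) ≡⟨ eq₂ f b m D 16 ⟩
    f * (D * 16 * (m * b * (m * b) * (m * b))) ≤⟨ *-monoʳ-≤ f (*-monoʳ-≤ (D * 16) (*-mono-≤ (*-mono-≤ mb≤ mb≤) mb≤)) ⟩
    f * (D * 16 * (N * 16384 * (N * 16384) * (N * 16384))) ≡⟨ eq₃ f (D * 16) N 16384 ⟩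
    f * (N ^ 3 * (D * 16 * (16384 * 16384 * 16384))) ∎
    where
    open ≤-Reasoning
    eq₁ : ∀ m → (m + m) * ((m + m) * ((m + m) * ((m + m) * 1))) ≡ m * (m * m * m * 16)
    eq₁ = solve-∀
    eq₂ : ∀ f b m D x → f * (b * b * b) * D * (m * m * m * x) ≡ f * (D * x * (m * b * (m * b) * (m * b)))
    eq₂ = solve-∀
    eq₃ : ∀ f D N x → f * (D * (N * x * (N * x) * (N * x))) ≡ f * ((N * (N * (N * 1))) * (D * (x * x * x)))
    eq₃ = solve-∀

  -- The exponent x stays a variable so that no power with a numeral exponent gets unfolded.
  threshold-suc : ∀ x f → 1 ≤ f → threshold x (suc f) ≤ f * (2 ^ (f * x) * 2 ^ (f * x) * 2 ^ (f * x)) * (2 ^ x * 2 ^ x * 2 ^ x * 262144)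
  threshold-suc x f 1≤f = begin
    suc f * (2 ^ (suc f * x) * 2 ^ (suc f * x) * 2 ^ (suc f * x)) * 131072 ≡⟨ cong (λ z → suc f * (z * z * z) * 131072) 2^-suc ⟩
    suc f * (b * W * (b * W) * (b * W)) * 131072 ≤⟨ *-monoˡ-≤ 131072 (*-monoˡ-≤ (b * W * (b * W) * (b * W)) (+-monoˡ-≤ f 1≤f)) ⟩
    (f + f) * (b * W * (b * W) * (b * W)) * 131072 ≡⟨ eq f b W 131072 ⟩
    f * (b * b * b) * (W * W * W * 262144) ∎
    where
    open ≤-Reasoning
    b W : ℕ
    b = 2 ^ (f * x)
    W = 2 ^ x
    2^-suc : 2 ^ (suc f * x) ≡ b * W
    2^-suc = trans (cong (2 ^_) (+-comm x (f * x))) (^-distribˡ-+-* 2 (f * x) x)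
    eq : ∀ f b W y → (f + f) * (b * W * (b * W) * (b * W)) * y ≡ f * (b * b * b) * (W * W * W * (y * 2))
    eq = solve-∀

  -- The proportion of failures is at most bad / (l + 1), which is below 1 / ↧ₙ ε, and this is at
  -- most ε as the numerator of ε is at least 1.
  ∣-∣<ε : ∀ (ε : ℚ) g l bad → 0ℚ ℚ.< ε → g ≤ suc l → suc l ≤ g + bad → bad * ↧ₙ ε < suc l →
          ℚ.∣ ratio g (suc l) ℚ.- 1ℚ ∣ ℚ.< ε
  ∣-∣<ε ε@(mkℚ (ℤ.+ suc p) d-1 _) g l bad 0<ε g≤ ≤g bad< = subst (ℚ._< ε) (sym abs) small
    where
    x = ratio g (suc l)
    x≃ : ℚ.toℚᵘ x ℚᵘ.≃ mkℚᵘ (ℤ.+ g) l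
    x≃ = ℚ.toℚᵘ-fromℚᵘ (mkℚᵘ (ℤ.+ g) l)
    x≤1 : x ℚ.≤ 1ℚ
    x≤1 = ℚ.toℚᵘ-cancel-≤ (ℚᵘ.≤-respˡ-≃ (ℚᵘ.≃-sym x≃) (ℚᵘ.*≤* (subst₂ ℤ._≤_ (sym (ℤ.*-identityʳ (ℤ.+ g))) (sym (ℤ.*-identityˡ (ℤ.+ suc l))) (ℤ.+≤+ g≤))))
    abs : ℚ.∣ x ℚ.- 1ℚ ∣ ≡ 1ℚ ℚ.- x
    abs = trans (cong ℚ.∣_∣ (sym flip)) (trans (ℚ.∣-p∣≡∣p∣ (1ℚ ℚ.- x)) (ℚ.0≤p⇒∣p∣≡p 0≤1-x))
      where
      flip : ℚ.- (1ℚ ℚ.- x) ≡ x ℚ.- 1ℚ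
      flip = trans (ℚ.neg-distrib-+ 1ℚ (ℚ.- x)) (trans (ℚ.+-comm (ℚ.- 1ℚ) (ℚ.- (ℚ.- x))) (cong (ℚ._- 1ℚ) (⁻¹-involutive x)))
      0≤1-x : 0ℚ ℚ.≤ 1ℚ ℚ.- x
      0≤1-x = subst (ℚ._≤ 1ℚ ℚ.- x) (ℚ.+-inverseʳ x) (ℚ.+-monoˡ-≤ (ℚ.- x) x≤1)
    cross : suc d-1 * suc l < suc p * suc l + g * suc d-1
    cross = begin-strict
      suc d-1 * suc l ≤⟨ *-monoʳ-≤ (suc d-1) ≤g ⟩
      suc d-1 * (g + bad) ≡⟨ trans (*-comm (suc d-1) (g + bad)) (trans (*-distribʳ-+ (suc d-1) g bad) (+-comm _ (bad * suc d-1))) ⟩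
      bad * suc d-1 + g * suc d-1 <⟨ +-monoˡ-< (g * suc d-1) (≤-trans bad< (m≤m+n (suc l) (p * suc l))) ⟩
      suc p * suc l + g * suc d-1 ∎
      where open ≤-Reasoning
    1<ε+x : 1ℚ ℚ.< ε ℚ.+ x
    1<ε+x = ℚ.toℚᵘ-cancel-< (ℚᵘ.<-respʳ-≃ (ℚᵘ.≃-trans (ℚᵘ.+-congʳ (ℚ.toℚᵘ ε) (ℚᵘ.≃-sym x≃)) (ℚᵘ.≃-sym (ℚ.toℚᵘ-homo-+ ε x)))
      (ℚᵘ.*<* (subst₂ ℤ._<_ (sym (ℤ.*-identityˡ (ℤ.+ (suc d-1 * suc l)))) (sym (ℤ.*-identityʳ (ℤ.+ suc p ℤ.* ℤ.+ suc l ℤ.+ ℤ.+ g ℤ.* ℤ.+ suc d-1)))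
        (subst (ℤ.+ (suc d-1 * suc l) ℤ.<_) (cong₂ ℤ._+_ (ℤ.pos-* (suc p) (suc l)) (ℤ.pos-* g (suc d-1))) (ℤ.+<+ cross)))))
    small : 1ℚ ℚ.- x ℚ.< ε
    small = subst (1ℚ ℚ.- x ℚ.<_) (trans (ℚ.+-assoc ε x (ℚ.- x)) (trans (cong (ε ℚ.+_) (ℚ.+-inverseʳ x)) (ℚ.+-identityʳ ε)))
      (ℚ.+-monoˡ-< (ℚ.- x) 1<ε+x)
  ∣-∣<ε (mkℚ (ℤ.+ zero) _ _) _ _ _ (ℚ.*<* (ℤ.+<+ ()))
  ∣-∣<ε (mkℚ (ℤ.-[1+ _ ]) _ _) _ _ _ (ℚ.*<* ())

  length≤filter+filter : {A : Set} {P R : A → Set} (P? : ∀ x → Dec (P x)) (R? : ∀ x → Dec (R x)) (xs : List A) →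
    (∀ {x} → x ∈ xs → ¬ P x → R x) → length xs ≤ length (filter P? xs) + length (filter R? xs)
  length≤filter+filter P? R? []       h = z≤n
  length≤filter+filter P? R? (x ∷ xs) h with ih ← length≤filter+filter P? R? xs (λ p → h (there p)) | P? x | R? x
  ... | yes _ | yes _ = s≤s (≤-trans ih (+-monoʳ-≤ (length (filter P? xs)) (n≤1+n _)))
  ... | yes _ | no _  = s≤s ih
  ... | no _  | yes _ = ≤-trans (s≤s ih) (≤-reflexive (sym (+-suc (length (filter P? xs)) (length (filter R? xs)))))
  ... | no ¬p | no ¬r = ⊥-elim (¬r (h (here refl) ¬p))

-- From the parameters to the asymptotic statement.

module Conclusion where
  open Parameters
  open import Defs
  open DenseGraph using (module Scale; dense-triangle-free)
  open Switching using (module PermutationModel)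
  open Embeddings
  open Matchings
  open import Data.Nat.Base
  open import Data.Nat.Properties
  open import Data.Nat.Tactic.RingSolver using (solve-∀)
  open import Data.Integer.Base as ℤ using ()
  import Data.Integer.Properties as ℤ
  open import Data.Nat.Coprimality using (1-coprimeTo)
  open import Data.Nat.Divisibility using (_∣_; divides)
  open import Data.Rational.Base as ℚ using (ℚ; mkℚ; 0ℚ; 1ℚ; ↧ₙ_)
  import Data.Rational.Properties as ℚ
  open import Data.List.Base using (length; filter)
  open import Data.List.Properties using (length-filter)
  open import Data.List.Relation.Unary.Any using (here; there)
  open import Data.List.Membership.Propositional using (_∈_)
  open import Data.Empty using (⊥-elim)
  open import Data.Product using (_×_; _,_; proj₁; proj₂; Σ-syntax; ∃-syntax)
  open import Relation.Binary.PropositionalEquality hiding ([_])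

  C₀ : ℕ
  C₀ = 2 ^ 128 * 2 ^ 128 * 2 ^ 128 * 262144 * 16 * (16384 * 16384 * 16384)

  module Regime (f m : ℕ) (16≤f : 16 ≤ f) (below : threshold 128 f ≤ m)
                (above : m < threshold 128 (suc f)) where
    open Scale f using (b; T; k; E₀)

    1≤f : 1 ≤ f
    1≤f = ≤-trans (s≤s z≤n) 16≤f

    1≤b : 1 ≤ b
    1≤b = m^n>0 2 (f * 128)

    1≤T : 1 ≤ T
    1≤T = *-mono-≤ (*-mono-≤ 1≤f 1≤b) 1≤b

    -- μ is b / 2048, which makes k μ = 4096 f b · b / 2048 equal to 2 T.
    μ Q : ℕ
    μ = 2 ^ (f * 128 ∸ 11)
    Q = T + T + (T + T)

    b≡ : b ≡ μ * 2048
    b≡ = trans (cong (2 ^_) (sym (m∸n+n≡m (≤-trans (≤ᵇ⇒≤ 11 128 _) (m≤n*m 128 f {{>-nonZero 1≤f}}))))) (^-distribˡ-+-* 2 (f * 128 ∸ 11) 11)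

    1≤μ : 1 ≤ μ
    1≤μ = m^n>0 2 (f * 128 ∸ 11)

    kμ≡2T : k * μ ≡ T + T
    kμ≡2T = trans (eq f b μ 2048) (trans (cong (λ z → f * b * z + f * b * z) (sym b≡)) refl)
      where
      eq : ∀ f b μ x → f * (x + x) * b * μ ≡ f * b * (μ * x) + f * b * (μ * x)
      eq = solve-∀

    b≤T : b ≤ T
    b≤T = m≤n*m b (f * b) {{>-nonZero (*-mono-≤ 1≤f 1≤b)}}

    μ≤T : μ ≤ T
    μ≤T = ≤-trans (≤-trans (m≤m*n μ 2048) (≤-reflexive (sym b≡))) b≤T

    Q≤m : Q ≤ m
    Q≤m = ≤-trans (≤-trans (≤-reflexive (eq f b)) (*-monoʳ-≤ (f * (b * b)) (≤-trans (≤ᵇ⇒≤ 4 131072 _) (m≤n*m 131072 b {{>-nonZero 1≤b}})))) (≤-trans (≤-reflexive (eq′ f b 131072)) below)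
      where
      eq : ∀ f b → f * b * b + f * b * b + (f * b * b + f * b * b) ≡ f * (b * b) * 4
      eq = solve-∀
      eq′ : ∀ f b x → f * (b * b) * (b * x) ≡ f * (b * b * b) * x
      eq′ = solve-∀

    h-bounds : Σ[ h ∈ ℕ ] Q * suc h ≤ m × m ≤ Q * suc h * 2
    h-bounds = floor m Q (≤-trans 1≤T (≤-trans (m≤m+n T T) (m≤m+n (T + T) (T + T)))) Q≤m

    h′ h : ℕ
    h′ = proj₁ h-bounds
    h  = suc h′

    m≤8Th : m ≤ T * 8 * h
    m≤8Th = ≤-trans (proj₂ (proj₂ h-bounds)) (≤-reflexive (eq T h))
      where
      eq : ∀ T h → (T + T + (T + T)) * h * 2 ≡ T * 8 * h
      eq = solve-∀

    0<m : 0 < m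
    0<m = ≤-trans 1≤T (≤-trans (≤-trans (m≤m+n T T) (m≤m+n (T + T) (T + T))) Q≤m)

    graph = dense-triangle-free f 16≤f

    module B = Bad T k μ h′ m E₀ (T * 19) (proj₁ graph) (proj₁ (proj₂ graph)) kμ≡2T 1≤μ μ≤T (proj₁ (proj₂ h-bounds)) 0<m
      (proj₂ (proj₂ graph)) (area-bound f b μ k m h 1≤T kμ≡2T b≡ (gap-bound f b m h 1≤f 1≤b below m≤8Th) m≤8Th)
    open B using (N) public
    open MatchingModel m 0<m using (model)

    bad-few : length (filter (λ G → r< K₃ G ≤? N) (matchingsWithχ<≡2 (m + m))) * 2 ^ T ≤ length (matchingsWithχ<≡2 (m + m))
    bad-few = *-cancelʳ-≤ _ _ (2 ^ (T * 18)) {{m^n≢0 2 (T * 18)}} (begin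
      x * 2 ^ T * 2 ^ (T * 18) ≡⟨ *-assoc x (2 ^ T) (2 ^ (T * 18)) ⟩
      x * (2 ^ T * 2 ^ (T * 18)) ≡⟨ cong (x *_) (trans (sym (^-distribˡ-+-* 2 T (T * 18))) (cong (2 ^_) (sym (*-suc T 18)))) ⟩
      x * 2 ^ (T * 19) ≤⟨ B.bad-few ⟩
      2 ^ (Q + T + Q + (Q + T + Q)) * total ≡⟨ trans (cong (λ z → 2 ^ z * total) (eq T)) (*-comm (2 ^ (T * 18)) total) ⟩
      total * 2 ^ (T * 18) ∎)
      where
      open ≤-Reasoning
      x total : ℕ
      x     = length (filter (λ G → r< K₃ G ≤? N) (matchingsWithχ<≡2 (m + m)))
      total = length (matchingsWithχ<≡2 (m + m))
      eq : ∀ T → T + T + (T + T) + T + (T + T + (T + T)) + (T + T + (T + T) + T + (T + T + (T + T))) ≡ T * 18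
      eq = solve-∀

    nonempty : 1 ≤ length (matchingsWithχ<≡2 (m + m))
    nonempty = inhabited (PermutationModel.realize-∈ model (λ i → i) ((λ i i<m → i<m) , λ i j _ _ e → e))
      where
      inhabited : ∀ {A : Set} {x : A} {xs} → x ∈ xs → 1 ≤ length xs
      inhabited (here _)  = s≤s z≤n
      inhabited (there _) = s≤s z≤n

    fourth-power : (m + m) ^ 4 ≤ f * (N ^ 3 * C₀)
    fourth-power = fourth-power-bound f b m N (2 ^ 128 * 2 ^ 128 * 2 ^ 128 * 262144)
      (≤-trans (<⇒≤ above) (threshold-suc 128 f 1≤f))
      (begin
        m * b ≤⟨ *-monoˡ-≤ b m≤8Th ⟩
        T * 8 * h * b ≡⟨ cong (T * 8 * h *_) b≡ ⟩
        T * 8 * h * (μ * 2048) ≡⟨ eq T h μ 8 2048 ⟩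
        T * (μ * h) * 16384 ≡⟨ cong (λ z → T * z * 16384) (sym B.β≡) ⟩
        N * 16384 ∎)
      where
      open ≤-Reasoning
      eq : ∀ T h μ x y → T * x * h * (μ * y) ≡ T * (μ * h) * (x * y)
      eq = solve-∀

    -- Lets `f` stand in for log₂ n, which it does not exceed.
    2^f≤n : 2 ^ f ≤ m + m
    2^f≤n = begin
      2 ^ f ≤⟨ ^-monoʳ-≤ 2 (m≤m*n f 128) ⟩
      b ≤⟨ b≤T ⟩
      T ≤⟨ ≤-trans (m≤m+n T T) (m≤m+n (T + T) (T + T)) ⟩
      Q ≤⟨ Q≤m ⟩
      m ≤⟨ m≤m+n m m ⟩
      m + m ∎
      where open ≤-Reasoning

    f≤T : f ≤ T
    f≤T = ≤-trans (m≤m*n f b {{>-nonZero 1≤b}}) (m≤m*n (f * b) b {{>-nonZero 1≤b}})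

  -- The proportion of bad matchings is at most 2^(-T), and the denominator of ε is at most T < 2^T.
  probability-close : (c ε : ℚ) → 0ℚ ℚ.< ε → ∀ n N T → ↧ₙ ε ≤ T → 1 ≤ length (matchingsWithχ<≡2 n) →
    length (filter (λ G → r< K₃ G ≤? N) (matchingsWithχ<≡2 n)) * 2 ^ T ≤ length (matchingsWithχ<≡2 n) →
    (∀ r → N < r → LowerBound c n r) →
    ℚ.∣ probability (matchingsWithχ<≡2 n) (λ G → lowerBound? c n (r< K₃ G)) ℚ.- 1ℚ ∣ ℚ.< ε
  probability-close c ε 0<ε n N T d≤T 1≤total few lower = go (length 𝓜) refl
    where
    𝓜 = matchingsWithχ<≡2 n
    good bad : ℕ
    good = length (filter (λ G → lowerBound? c n (r< K₃ G)) 𝓜)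
    bad  = length (filter (λ G → r< K₃ G ≤? N) 𝓜)
    strict : ∀ x y d t → 1 ≤ y → d < t → x * t ≤ y → x * d < y
    strict zero    y d t 1≤y d<t l = 1≤y
    strict (suc x) y d t 1≤y d<t l = <-≤-trans (*-monoʳ-< (suc x) d<t) l
    go : ∀ total → length 𝓜 ≡ total → ℚ.∣ ratio good total ℚ.- 1ℚ ∣ ℚ.< ε
    go zero    e = ⊥-elim (<⇒≱ 1≤total (≤-reflexive e))
    go (suc l) e = ∣-∣<ε ε good l bad 0<ε
      (≤-trans (length-filter (λ G → lowerBound? c n (r< K₃ G)) 𝓜) (≤-reflexive e))
      (≤-trans (≤-reflexive (sym e)) (length≤filter+filter (λ G → lowerBound? c n (r< K₃ G)) (λ G → r< K₃ G ≤? N) 𝓜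
        (λ {G} _ ¬lower → ≮⇒≥ (λ N<r → ¬lower (lower (r< K₃ G) N<r)))))
      (subst (bad * ↧ₙ ε <_) e (strict bad (length 𝓜) (↧ₙ ε) (2 ^ T) 1≤total (≤-<-trans d≤T (n<2^n T)) few))

  -- In exponents: n⁴ ≤ f N³ C ≤ f r³ q³ with q = q′ + 1; then 2^f is replaced by the larger `n`.
  lowerBound : ∀ (q′ f n N r C : ℕ) → C ≤ suc q′ ^ 3 → n ^ 4 ≤ f * (N ^ 3 * C) → 2 ^ f ≤ n → N < r →
               LowerBound (mkℚ (ℤ.+ 1) q′ (1-coprimeTo (suc q′))) n r
  lowerBound q′ f n N r C C≤ n⁴≤ 2^f≤n N<r = begin
    2 ^ (1 * n ^ 4) ≤⟨ ^-monoʳ-≤ 2 (≤-trans (≤-reflexive (*-identityˡ (n ^ 4))) n⁴≤) ⟩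
    2 ^ (f * (N ^ 3 * C)) ≤⟨ ^-monoʳ-≤ 2 (*-monoʳ-≤ f (≤-trans (*-mono-≤ (^-monoˡ-≤ 3 (<⇒≤ N<r)) C≤) (≤-reflexive (*-comm (r ^ 3) (suc q′ ^ 3))))) ⟩
    2 ^ (f * (suc q′ ^ 3 * r ^ 3)) ≡⟨ ^-*-assoc 2 f (suc q′ ^ 3 * r ^ 3) ⟨
    (2 ^ f) ^ (suc q′ ^ 3 * r ^ 3) ≤⟨ ^-monoˡ-≤ (suc q′ ^ 3 * r ^ 3) 2^f≤n ⟩
    n ^ (suc q′ ^ 3 * r ^ 3) ∎
    where open ≤-Reasoning

  -- `C₀` is 2^448, below (2^150)³; hence c = 2^(-150).
  constant : Σ[ q′ ∈ ℕ ] C₀ ≤ suc q′ ^ 3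
  constant = pred (2 ^ 150) , ≤ᵇ⇒≤ C₀ (suc (pred (2 ^ 150)) ^ 3) _

  eventually : ∀ q′ → C₀ ≤ suc q′ ^ 3 → ∀ ε → 0ℚ ℚ.< ε → ∀ f₀ → 16 ≤ f₀ → ↧ₙ ε ≤ f₀ → ∀ m → threshold 128 f₀ ≤ m →
    ℚ.∣ probability (matchingsWithχ<≡2 (m + m)) (λ G → lowerBound? (mkℚ (ℤ.+ 1) q′ (1-coprimeTo (suc q′))) (m + m) (r< K₃ G)) ℚ.- 1ℚ ∣ ℚ.< ε
  eventually q′ C₀≤ ε 0<ε f₀ 16≤f₀ d≤f₀ m F≤m = go (largest (threshold 128) (f≤threshold 128) m f₀ F≤m)
    where
    go : Σ[ f ∈ ℕ ] f₀ ≤ f × threshold 128 f ≤ m × m < threshold 128 (suc f) → _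
    go (f , f₀≤f , below , above) =
      probability-close (mkℚ (ℤ.+ 1) q′ (1-coprimeTo (suc q′))) ε 0<ε (m + m) N (Scale.T f) (≤-trans d≤f₀ (≤-trans f₀≤f f≤T)) nonempty bad-few
        (λ r N<r → lowerBound q′ f (m + m) N r C₀ C₀≤ fourth-power 2^f≤n N<r)
      where open Regime f m (≤-trans 16≤f₀ f₀≤f) below above

  evens : (P : ℕ → Set) (t : ℕ) → (∀ m → t ≤ m → P (m + m)) → ∃[ n₀ ] ∀ n → n₀ ≤ n → 2 ∣ n → P n
  evens P t h = t + t , λ n t+t≤n (divides m n≡) →
    let n≡m+m = trans n≡ (trans (*-comm m 2) (cong (m +_) (+-identityʳ m)))
    in subst P (sym n≡m+m) (h m (≮⇒≥ λ m<t → <⇒≱ (+-mono-< m<t m<t) (subst (t + t ≤_) n≡m+m t+t≤n)))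

  asymptotically-almost-surely : ∀ q′ → C₀ ≤ suc q′ ^ 3 → Σ[ c ∈ ℚ ] 0ℚ ℚ.< c ×
    (∀ (ε : ℚ) → 0ℚ ℚ.< ε → ∃[ n₀ ] ∀ (n : ℕ) → n₀ ≤ n → 2 ∣ n →
     ℚ.∣ probability (matchingsWithχ<≡2 n) (λ M → lowerBound? c n (r< K₃ M)) ℚ.- 1ℚ ∣ ℚ.< ε)
  asymptotically-almost-surely q′ C₀≤ = c , ℚ.positive⁻¹ c , λ ε 0<ε →
    evens (λ n → ℚ.∣ probability (matchingsWithχ<≡2 n) (λ M → lowerBound? c n (r< K₃ M)) ℚ.- 1ℚ ∣ ℚ.< ε) _
      (eventually q′ C₀≤ ε 0<ε (16 + ↧ₙ ε) (m≤m+n 16 (↧ₙ ε)) (m≤n+m (↧ₙ ε) 16))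
    where
    c : ℚ
    c = mkℚ (ℤ.+ 1) q′ (1-coprimeTo (suc q′))

open import Defs
open import Data.Nat.Base using (ℕ; _≤_)
open import Data.Nat.Divisibility using (_∣_)
open import Data.Product using (Σ-syntax; ∃-syntax; _×_; proj₁; proj₂)
open import Data.Rational.Base using (ℚ; 0ℚ; 1ℚ; _-_; ∣_∣; _<_)

theorem1p4 : Σ[ c ∈ ℚ ] 0ℚ < c ×
    (∀ (ε : ℚ) → 0ℚ < ε →
    ∃[ n₀ ] ∀ (n : ℕ) → n₀ ≤ n → 2 ∣ n →
    ∣ probability (matchingsWithχ<≡2 n) (λ M → lowerBound? c n (r< K₃ M)) - 1ℚ ∣ < ε)
theorem1p4 = Conclusion.asymptotically-almost-surely (proj₁ Conclusion.constant) (proj₂ Conclusion.constant)
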